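{- Let $d^*$ denote the unique real solution (a triple root) of the equation $(2-x)^3=27x$. Let $F$ be a $3$-graph on $f$ vertices with the following property $(\spadesuit)$: there exist an ordering $(v_1,\dots,v_f)$ of $V(F)$, an integer $i^\star\in[f]$, and a $6$-coloring $\chi:\partial F\to\{\text{red},\text{blue},\text{green},\text{violet},\text{cyan},\text{black}\}$ such that every edge $\{v_i,v_j,v_k\}$ of $F$ with $i<j<k$ satisfies exactly one of the following: (a) $(\chi(v_i,v_j),\chi(v_j,v_k),\chi(v_i,v_k))=(\text{blue},\text{violet},\text{red})$; (b) $(\chi(v_i,v_j),\chi(v_j,v_k),\chi(v_i,v_k))=(\text{green},\text{cyan},\text{blue})$ and $i<j<k\le i^\star$; (c) $(\chi(v_i,v_j),\chi(v_j,v_k),\chi(v_i,v_k))=(\text{green},\text{black},\text{red})$ and $1\le i<j<i^\star<k\le f$. Suppose moreover that $F$ does not satisfy the following property $(\spadesuit^*)$: there exist an ordering $(v_1,\dots,v_f)$ of $V(F)$, an integer $i^\star\in[f]$ and a $6$-coloring $\chi$ of $\partial F$ with the same six colors such that $E(F)$ can be partitioned into three non-empty sets $E_1,E_2,E_3$, where every edge $\{v_i,v_j,v_k\}\in E_1$ ($i<j<k$) satisfies (a), every edge in $E_2$ satisfies (b), and every edge in $E_3$ satisfies (c). Then $\pi_{\therefore}(F)\le d^*$.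
   Context: All hypergraphs are $3$-uniform ($3$-graphs). For a $3$-graph $F$, its shadow is $\partial F=\{e\setminus\{x\}: x\in e\in E(F)\}$, the set of pairs contained in some edge. A $3$-graph $H=(V,E)$ is $(d,\mu)$-dense if $|\binom{U}{3}\cap E|\ge d\binom{|U|}{3}-\mu|V|^3$ for every $U\subseteq V$. The uniform Turán density $\pi_{\therefore}(F)$ is the supremum of all $d\in[0,1]$ such that for every $\mu>0$ and $n_0\in\mathbb N$ there exists an $F$-free $(d,\mu)$-dense $3$-graph $H$ with $|V(H)|\ge n_0$. -}

module Defs where

open import Data.Bool using (Bool; true; false; _∧_; if_then_else_)
open import Data.Nat as ℕ using (ℕ; zero; suc)
open import Data.Nat.Combinatorics using (_C_)
open import Data.Integer using (+_)
open import Data.Rational as ℚ using (ℚ; _/_; 0ℚ)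
open import Data.Fin using (Fin; toℕ; _<_)
open import Data.Fin.Permutation using (Permutation′; _⟨$⟩ʳ_)
open import Data.List using (List; map; allFin)
open import Data.Nat.ListAction using (sum)
open import Data.Product using (Σ; ∃; _×_; _,_)
open import Data.Sum using (_⊎_)
open import Data.Empty using (⊥)
open import Relation.Nullary using (¬_)
open import Relation.Nullary.Decidable using (⌊_⌋)
open import Relation.Binary.PropositionalEquality using (_≡_)
open import Function.Definitions using (Injective)

-- 3-graphs on the vertex set Fin n.
-- A 3-graph is given by a Boolean function H; for i < j < k the value
-- H i j k says whether {i,j,k} is an edge.  Values on non-increasing
-- triples are ignored (they never enter any definition below).

Graph3 : ℕ → Set
Graph3 n = Fin n → Fin n → Fin n → Bool

IsEdge : ∀ {n} → Graph3 n → Fin n → Fin n → Fin n → Set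
IsEdge H a b c =
    (a < b × b < c × H a b c ≡ true)
  ⊎ (a < c × c < b × H a c b ≡ true)
  ⊎ (b < a × a < c × H b a c ≡ true)
  ⊎ (b < c × c < a × H b c a ≡ true)
  ⊎ (c < a × a < b × H c a b ≡ true)
  ⊎ (c < b × b < a × H c b a ≡ true)

Contains : ∀ {f n} → Graph3 n → Graph3 f → Set
Contains {f} {n} H F =
  Σ (Fin f → Fin n) λ φ → Injective _≡_ _≡_ φ ×
    (∀ a b c → IsEdge F a b c → IsEdge H (φ a) (φ b) (φ c))

FFree : ∀ {f n} → Graph3 f → Graph3 n → Set
FFree F H = ¬ Contains H F

Σfin : ∀ {n} → (Fin n → ℕ) → ℕ
Σfin {n} g = sum (map g (allFin n))

size : ∀ {n} → (Fin n → Bool) → ℕ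
size U = Σfin λ i → if U i then 1 else 0

lt : ∀ {n} → Fin n → Fin n → Bool
lt i j = ⌊ toℕ i ℕ.<? toℕ j ⌋

edgesIn : ∀ {n} → Graph3 n → (Fin n → Bool) → ℕ
edgesIn H U = Σfin λ i → Σfin λ j → Σfin λ k →
  if lt i j ∧ lt j k ∧ U i ∧ U j ∧ U k ∧ H i j k then 1 else 0

toℚ : ℕ → ℚ
toℚ m = (+ m) / 1

Dense : ∀ {n} → ℚ → ℚ → Graph3 n → Set
Dense {n} d μ H = ∀ (U : Fin n → Bool) →
  d ℚ.* toℚ (size U C 3) ℚ.- μ ℚ.* toℚ (n ℕ.^ 3) ℚ.≤ toℚ (edgesIn H U)

-- The defining property of π_∴(F) ≥ d, i.e. d lies in the set whose
-- supremum is π_∴(F) (μ ranges over positive rationals).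
Admissible : ∀ {f} → Graph3 f → ℚ → Set
Admissible F d = ∀ (μ : ℚ) → 0ℚ ℚ.< μ → ∀ (n₀ : ℕ) →
  Σ ℕ λ n → n₀ ℕ.≤ n × Σ (Graph3 n) λ H → FFree F H × Dense d μ H

data Colour : Set where
  red blue green violet cyan black : Colour

-- Data of an ordering (v_1,…,v_f) (v_{p+1} = ord ⟨$⟩ʳ p), an integer
-- i* (1-indexed) and a colouring χ of pairs of vertices. χ is only ever
-- evaluated at pairs of the shadow, each pair in the order (v_i, v_j)
-- with i < j.
module _ {f : ℕ} (ord : Permutation′ f) (istar : ℕ) (χ : Fin f → Fin f → Colour) where
  private
    v : Fin f → Fin f
    v p = ord ⟨$⟩ʳ p

  -- positions i < j < k (0-indexed; paper index = toℕ + 1)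
  CondA : Fin f → Fin f → Fin f → Set
  CondA i j k = χ (v i) (v j) ≡ blue × χ (v j) (v k) ≡ violet × χ (v i) (v k) ≡ red

  CondB : Fin f → Fin f → Fin f → Set
  CondB i j k = (χ (v i) (v j) ≡ green × χ (v j) (v k) ≡ cyan × χ (v i) (v k) ≡ blue)
              × suc (toℕ k) ℕ.≤ istar

  CondC : Fin f → Fin f → Fin f → Set
  CondC i j k = (χ (v i) (v j) ≡ green × χ (v j) (v k) ≡ black × χ (v i) (v k) ≡ red)
              × suc (toℕ j) ℕ.< istar × istar ℕ.< suc (toℕ k)

  Cond : Fin 3 → Fin f → Fin f → Fin f → Set
  Cond Fin.zero = CondA
  Cond (Fin.suc Fin.zero) = CondB
  Cond (Fin.suc (Fin.suc Fin.zero)) = CondC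

ExactlyOne : Set → Set → Set → Set
ExactlyOne P Q R = (P × ¬ Q × ¬ R) ⊎ (¬ P × Q × ¬ R) ⊎ (¬ P × ¬ Q × R)

Spade : ∀ {f} → Graph3 f → Set
Spade {f} F =
  Σ (Permutation′ f) λ ord → Σ ℕ λ istar → 1 ℕ.≤ istar × istar ℕ.≤ f ×
  Σ (Fin f → Fin f → Colour) λ χ →
    ∀ (i j k : Fin f) → i < j → j < k →
      IsEdge F (ord ⟨$⟩ʳ i) (ord ⟨$⟩ʳ j) (ord ⟨$⟩ʳ k) →
      ExactlyOne (CondA ord istar χ i j k) (CondB ord istar χ i j k) (CondC ord istar χ i j k)

-- (♠*): E(F) partitioned into three nonempty classes E_1, E_2, E_3,
-- encoded by a class assignment cls of each edge (given by its positions
-- i<j<k); edges of class t satisfy condition t, and each class is nonempty.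
SpadeStar : ∀ {f} → Graph3 f → Set
SpadeStar {f} F =
  Σ (Permutation′ f) λ ord → Σ ℕ λ istar → 1 ℕ.≤ istar × istar ℕ.≤ f ×
  Σ (Fin f → Fin f → Colour) λ χ →
  Σ (Fin f → Fin f → Fin f → Fin 3) λ cls →
    (∀ (i j k : Fin f) → i < j → j < k →
      IsEdge F (ord ⟨$⟩ʳ i) (ord ⟨$⟩ʳ j) (ord ⟨$⟩ʳ k) →
      Cond ord istar χ (cls i j k) i j k)
  × (∀ (t : Fin 3) → Σ (Fin f) λ i → Σ (Fin f) λ j → Σ (Fin f) λ k →
      i < j × j < k × IsEdge F (ord ⟨$⟩ʳ i) (ord ⟨$⟩ʳ j) (ord ⟨$⟩ʳ k) × cls i j k ≡ t)

-- d > d*, where d* is the unique real root of (2-x)^3 = 27x.  Since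
-- x ↦ (2-x)^3 - 27x is strictly decreasing, d > d* ⇔ (2-d)^3 < 27 d.

AboveDStar : ℚ → Set
AboveDStar d = let e = toℚ 2 ℚ.- d in e ℚ.* e ℚ.* e ℚ.< toℚ 27 ℚ.* d

{-# OPTIONS --safe #-}

-- If F does not satisfy (♠*), then some colouring witnessing (♠) misses one of the classes (a), (b), (c), and merging
-- colours gives the pairs roles β, ν, ρ, κ, γ such that every edge follows the pattern (β,ν,ρ) or (γ,κ,β).  As d* > 1/5,
-- it suffices to find such an F in every large hypergraph H that is (d,μ)-dense for some d ≥ 1/5 and small μ.
--
-- Energy increment produces colourings of the pairs and of the vertices of H after which a random M-tuple of vertices
-- looks like a reduced structure: independent random colours on the pairs of indices, and a weight W on triples of colours,
-- the conditional edge density.  If H is F-free, then a copy of F has small expected weight in it.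
--
-- In a reduced structure Ramsey's theorem leaves three cases.  If all triples of indices have density below 0.198, then
-- spreading weight over the corresponding vertex types contradicts the density of H.  If no colours of a pair are at the
-- same time frequent as last colour of a triple and frequent as first (or, in the other case, as middle) colour, then a
-- lower bound x for the probability t of frequent last colours improves to 0.198 / (1 + τ − x)²; as 0.198 > 4/27, iterating
-- this leads to t > 1.  Otherwise F can be embedded in increasing or in decreasing order of the indices: the colours of
-- role β are common to both patterns, and the roles β, ν, ρ, κ, γ are filled one after the other by the pigeonhole principle.
module Submission where

open import Defs
open import Data.Nat using (ℕ)
open import Data.Rational using (ℚ; _≤_; 0ℚ; 1ℚ)
open import Relation.Nullary using (¬_)
open import Data.Bool using (Bool; _∧_; _∨_; false; if_then_else_; not; true)
open import Data.Empty using (⊥; ⊥-elim)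
open import Data.Fin using (Fin; cast; combine; finToFun; funToFin; remQuot; suc; toℕ; zero)
open import Data.Fin.Permutation using (Permutation′; _⟨$⟩ʳ_; _⟨$⟩ˡ_; inverseʳ)
open import Data.List using (List; []; _++_; _∷_; allFin; cartesianProduct; length; map; reverse; tabulate; take)
open import Data.List.Membership.Propositional using (_∈_; _∉_)
open import Data.List.Membership.Propositional.Properties using (∈-++⁺ʳ; ∈-++⁺ˡ; ∈-++⁻; ∈-allFin; ∈-cartesianProduct⁺; ∈-lookup; ∈-map⁺; ∈-map⁻)
open import Data.List.Properties using (length-++; length-map; length-reverse; length-tabulate; length-take; unfold-reverse)
open import Data.List.Relation.Binary.Sublist.Propositional using ([]; _∷_; _∷ʳ_; minimum; ⊆-refl; ⊆-trans)
open import Data.List.Relation.Binary.Sublist.Propositional.Properties using (++⁺; map⁺; reverse⁺; take-⊆)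
open import Data.List.Relation.Unary.All using (All; []; _∷_)
open import Data.List.Relation.Unary.AllPairs using (AllPairs; []; _∷_)
open import Data.List.Relation.Unary.Any using (any?; here; there)
open import Data.Maybe using (Maybe; just; nothing)
open import Data.Nat using (_⊔_; suc; s≤s; zero; z≤n)
open import Data.Nat.Combinatorics using (nC1≡n; nCk+nC[k+1]≡[n+1]C[k+1])
open import Data.Nat.ListAction using (sum)
open import Data.Nat.Properties using (+-suc; m≤m⊔n; m≤n⊔m)
open import Data.Product using (_,_; _×_; proj₁; proj₂; Σ)
open import Data.Product.Properties using (≡-dec)
open import Data.Rational using (NonNegative; Positive; _<_; mkℚ; nonNegative; positive; toℚᵘ; ½)
open import Data.Rational.Properties using (<-cmp; <-irrefl; <-≤-trans; <⇒≤; _<?_; _≟_; _≤?_; ≤-<-trans; ≤-antisym; ≤-refl; ≤-total; ≤-trans; ≮⇒≥; ≰⇒>)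
open import Data.Rational.Unnormalised using (*≡*; *≤*; mkℚᵘ)
open import Data.Sum using (_⊎_; inj₁; inj₂)
open import Data.Unit using (tt; ⊤)
open import Data.Vec using (Vec; []; _[_]≔_; _∷_)
open import Data.Vec.Properties using (lookup∘update; lookup∘update′)
open import Function.Definitions using (Injective)
open import Level using (0ℓ)
open import Relation.Binary.Definitions using (DecidableEquality; tri<; tri>; tri≈)
open import Relation.Binary.PropositionalEquality using (_≡_; _≢_; cong; cong₂; module ≡-Reasoning; refl; subst; subst₂; sym; trans)
open import Relation.Nullary using (Dec; does; no; yes)
open import Relation.Nullary.Decidable using (_×-dec_; _⊎-dec_; dec-true; dec⇒maybe; from-yes)
open import Tactic.RingSolver using (solve-∀)
import Tactic.RingSolver.Core.AlmostCommutativeRing as ACR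
import Data.List.Relation.Unary.All as All
import Data.List.Relation.Unary.AllPairs.Properties as AllPairsP
import Data.Bool.Properties as BoolP
import Data.Fin as Fin
import Data.Fin.Properties as FinP
import Data.Rational as Q
import Data.Rational.Properties as QP
import Data.Rational.Unnormalised as U
import Data.Rational.Unnormalised.Properties as UP
import Data.Nat as ℕ
import Data.Nat.Properties as ℕP
import Data.Integer as ℤ
import Data.Integer.Properties as ℤP

module Expectation where

  infixl 6 _+_ _-_
  infixl 7 _*_
  infix 8 -_

  -- Opaque copies of the field operations: unlike the originals they are injective for unification.

  opaque
    _+_ : ℚ → ℚ → ℚ
    _+_ = Q._+_

  opaque
    unfolding _+_
    _*_ : ℚ → ℚ → ℚ
    _*_ = Q._*_

  opaque
    unfolding _*_
    -_ : ℚ → ℚ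
    -_ = Q.-_

  _-_ : ℚ → ℚ → ℚ
  a - b = a + - b

  ℚ-ring : ACR.AlmostCommutativeRing 0ℓ 0ℓ
  ℚ-ring = ACR.fromCommutativeRing QP.+-*-commutativeRing (λ x → dec⇒maybe (0ℚ ≟ x))

  opaque
    unfolding -_

    +-comm : ∀ a b → a + b ≡ b + a
    +-comm = QP.+-comm
    +-assoc : ∀ a b c → (a + b) + c ≡ a + (b + c)
    +-assoc = QP.+-assoc
    +-identityˡ : ∀ a → 0ℚ + a ≡ a
    +-identityˡ = QP.+-identityˡ
    +-identityʳ : ∀ a → a + 0ℚ ≡ a
    +-identityʳ = QP.+-identityʳ
    *-comm : ∀ a b → a * b ≡ b * a
    *-comm = QP.*-comm
    *-assoc : ∀ a b c → (a * b) * c ≡ a * (b * c)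
    *-assoc = QP.*-assoc
    *-identityˡ : ∀ a → 1ℚ * a ≡ a
    *-identityˡ = QP.*-identityˡ
    *-identityʳ : ∀ a → a * 1ℚ ≡ a
    *-identityʳ = QP.*-identityʳ
    *-zeroˡ : ∀ a → 0ℚ * a ≡ 0ℚ
    *-zeroˡ = QP.*-zeroˡ
    *-zeroʳ : ∀ a → a * 0ℚ ≡ 0ℚ
    *-zeroʳ = QP.*-zeroʳ
    *-distribˡ-+ : ∀ a b c → a * (b + c) ≡ a * b + a * c
    *-distribˡ-+ = QP.*-distribˡ-+
    *-distribʳ-+ : ∀ a b c → (b + c) * a ≡ b * a + c * a
    *-distribʳ-+ = QP.*-distribʳ-+
    +-mono-≤ : ∀ {a b c d} → a ≤ b → c ≤ d → a + c ≤ b + d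
    +-mono-≤ = QP.+-mono-≤
    +-mono-<-≤ : ∀ {a b c d} → a < b → c ≤ d → a + c < b + d
    +-mono-<-≤ = QP.+-mono-<-≤
    +-mono-≤-< : ∀ {a b c d} → a ≤ b → c < d → a + c < b + d
    +-mono-≤-< = QP.+-mono-≤-<
    +-monoˡ-≤ : ∀ c {a b} → a ≤ b → a + c ≤ b + c
    +-monoˡ-≤ = QP.+-monoˡ-≤
    +-monoʳ-≤ : ∀ c {a b} → a ≤ b → c + a ≤ c + b
    +-monoʳ-≤ = QP.+-monoʳ-≤
    +-monoˡ-< : ∀ c {a b} → a < b → a + c < b + c
    +-monoˡ-< = QP.+-monoˡ-<
    *-monoʳ-≤-nonNeg : ∀ r .{{_ : NonNegative r}} {a b} → a ≤ b → a * r ≤ b * r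
    *-monoʳ-≤-nonNeg r = QP.*-monoʳ-≤-nonNeg r
    *-monoˡ-<-pos : ∀ r .{{_ : Positive r}} {a b} → a < b → a * r < b * r
    *-monoˡ-<-pos r = QP.*-monoˡ-<-pos r
    *-cancelˡ-≤-pos : ∀ r .{{_ : Positive r}} {a b} → r * a ≤ r * b → a ≤ b
    *-cancelˡ-≤-pos r = QP.*-cancelˡ-≤-pos r
    neg-antimono-≤ : ∀ {a b} → a ≤ b → - b ≤ - a
    neg-antimono-≤ = QP.neg-antimono-≤
    1/-inverseʳ : ∀ a .{{_ : Q.NonZero a}} → a * (Q.1/ a) ≡ 1ℚ
    1/-inverseʳ a = QP.*-inverseʳ a

  private opaque
    unfolding -_
    a+-a : ∀ a → a + - a ≡ 0ℚ
    a+-a = solve-∀ ℚ-ring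
    b-a+a : ∀ a b → (b - a) + a ≡ b
    b-a+a = solve-∀ ℚ-ring
    sq0 : ∀ a → (- a) * (- a) ≡ a * a
    sq0 = solve-∀ ℚ-ring
    neg0 : - 0ℚ ≡ 0ℚ
    neg0 = refl
    neg1 : ∀ a → - a ≡ (- 1ℚ) * a
    neg1 = solve-∀ ℚ-ring
    +-interchange : ∀ a b c d → (a + b) + (c + d) ≡ (a + c) + (b + d)
    +-interchange = solve-∀ ℚ-ring
    b+ab : ∀ a b → b + a * b ≡ (1ℚ + a) * b
    b+ab = solve-∀ ℚ-ring
    *-left-comm : ∀ i c s → i * (c * s) ≡ c * (i * s)
    *-left-comm = solve-∀ ℚ-ring

  ≡⇒≤ : ∀ {a b} → a ≡ b → a ≤ b
  ≡⇒≤ refl = ≤-refl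

  0≤1 : 0ℚ ≤ 1ℚ
  0≤1 = QP.nonNegative⁻¹ 1ℚ

  0<1 : 0ℚ < 1ℚ
  0<1 = QP.positive⁻¹ 1ℚ

  *-monoʳ : ∀ {c a b} → 0ℚ ≤ c → a ≤ b → a * c ≤ b * c
  *-monoʳ {c} 0≤c = *-monoʳ-≤-nonNeg c {{nonNegative 0≤c}}

  *-monoˡ : ∀ {c a b} → 0ℚ ≤ c → a ≤ b → c * a ≤ c * b
  *-monoˡ {c} {a} {b} 0≤c p = subst₂ _≤_ (*-comm a c) (*-comm b c) (*-monoʳ 0≤c p)

  *-mono-≤ : ∀ {a b c d} → 0ℚ ≤ a → a ≤ b → 0ℚ ≤ c → c ≤ d → a * c ≤ b * d
  *-mono-≤ 0≤a a≤b 0≤c c≤d = ≤-trans (*-monoʳ 0≤c a≤b) (*-monoˡ (≤-trans 0≤a a≤b) c≤d)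

  0≤* : ∀ {a b} → 0ℚ ≤ a → 0ℚ ≤ b → 0ℚ ≤ a * b
  0≤* {a} {b} 0≤a 0≤b = subst (_≤ a * b) (*-zeroˡ b) (*-monoʳ 0≤b 0≤a)

  0<* : ∀ {a b} → 0ℚ < a → 0ℚ < b → 0ℚ < a * b
  0<* {a} {b} 0<a 0<b = subst (_< a * b) (*-zeroˡ b) (*-monoˡ-<-pos b {{positive 0<b}} 0<a)

  0≤+ : ∀ {a b} → 0ℚ ≤ a → 0ℚ ≤ b → 0ℚ ≤ a + b
  0≤+ {a} {b} p q = subst (_≤ a + b) (+-identityˡ 0ℚ) (+-mono-≤ p q)

  ≤⇒0≤- : ∀ {a b} → a ≤ b → 0ℚ ≤ b - a
  ≤⇒0≤- {a} {b} p = subst (_≤ b - a) (a+-a a) (+-monoˡ-≤ (- a) p)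

  0≤-⇒≤ : ∀ {a b} → 0ℚ ≤ b - a → a ≤ b
  0≤-⇒≤ {a} {b} p = subst₂ _≤_ (+-identityˡ a) (b-a+a a b) (+-monoˡ-≤ a p)

  ≤-cert : ∀ {a b} c → 0ℚ ≤ c → b - a ≡ c → a ≤ b
  ≤-cert c 0≤c eq = 0≤-⇒≤ (subst (0ℚ ≤_) (sym eq) 0≤c)

  0≤² : ∀ a → 0ℚ ≤ a * a
  0≤² a with ≤-total 0ℚ a
  ... | inj₁ p = 0≤* p p
  ... | inj₂ p = subst (0ℚ ≤_) (sq0 a) (0≤* q q)
    where q = subst (_≤ - a) neg0 (neg-antimono-≤ p)

  *-cancel : ∀ {a b c} → 0ℚ < c → c * a ≤ c * b → a ≤ b
  *-cancel {c = c} 0<c = *-cancelˡ-≤-pos c {{positive 0<c}}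

  inv : ∀ a → 0ℚ < a → ℚ
  inv a p = Q.1/_ a {{Q.>-nonZero p}}

  inv-r : ∀ a (p : 0ℚ < a) → a * inv a p ≡ 1ℚ
  inv-r a p = 1/-inverseʳ a {{Q.>-nonZero p}}

  inv-pos : ∀ a (p : 0ℚ < a) → 0ℚ < inv a p
  inv-pos a p = QP.positive⁻¹ (inv a p) {{QP.1/pos⇒pos a {{positive p}}}}

  0≤∧≢⇒0< : ∀ {a} → 0ℚ ≤ a → a ≢ 0ℚ → 0ℚ < a
  0≤∧≢⇒0< {a} le ne with <-cmp 0ℚ a
  ... | tri< l _ _ = l
  ... | tri≈ _ e _ = ⊥-elim (ne (sym e))
  ... | tri> _ _ g = ⊥-elim (<-irrefl refl (<-≤-trans g le))

  does-true : ∀ {P : Set} (d : Dec P) → does d ≡ true → P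
  does-true (yes p) _ = p

  does-false : ∀ {P : Set} (d : Dec P) → does d ≡ false → ¬ P
  does-false (no n) _ = n

  opaque
    leqᵇ : ℚ → ℚ → Bool
    leqᵇ a b = does (a ≤? b)

    leqᵇ-sound : ∀ {a b} → leqᵇ a b ≡ true → a ≤ b
    leqᵇ-sound {a} {b} = does-true (a ≤? b)

    leqᵇ-complete : ∀ {a b} → a ≤ b → leqᵇ a b ≡ true
    leqᵇ-complete {a} {b} = dec-true (a ≤? b)

    leqᵇ-false : ∀ {a b} → leqᵇ a b ≡ false → b < a
    leqᵇ-false {a} {b} e = ≰⇒> (does-false (a ≤? b) e)

  𝟙 : Bool → ℚ
  𝟙 b = if b then 1ℚ else 0ℚ

  0≤𝟙 : ∀ b → 0ℚ ≤ 𝟙 b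
  0≤𝟙 true = 0≤1
  0≤𝟙 false = ≤-refl

  𝟙≤1 : ∀ b → 𝟙 b ≤ 1ℚ
  𝟙≤1 true = ≤-refl
  𝟙≤1 false = 0≤1

  fromℕ : ℕ → ℚ
  fromℕ zero = 0ℚ
  fromℕ (suc n) = 1ℚ + fromℕ n

  0≤fromℕ : ∀ n → 0ℚ ≤ fromℕ n
  0≤fromℕ zero = ≤-refl
  0≤fromℕ (suc n) = 0≤+ 0≤1 (0≤fromℕ n)

  0<fromℕ : ∀ n → 0ℚ < fromℕ (suc n)
  0<fromℕ n = subst (_< fromℕ (suc n)) (+-identityˡ 0ℚ) (+-mono-<-≤ 0<1 (0≤fromℕ n))

  fromℕ-mono : ∀ {m n} → m ℕ.≤ n → fromℕ m ≤ fromℕ n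
  fromℕ-mono {n = n} ℕ.z≤n = 0≤fromℕ n
  fromℕ-mono (ℕ.s≤s p) = +-monoʳ-≤ 1ℚ (fromℕ-mono p)

  fromℕ-+ : ∀ m n → fromℕ (m ℕ.+ n) ≡ fromℕ m + fromℕ n
  fromℕ-+ zero n = sym (+-identityˡ _)
  fromℕ-+ (suc m) n = trans (cong (1ℚ +_) (fromℕ-+ m n)) (sym (+-assoc 1ℚ _ _))

  fromℕ-* : ∀ m n → fromℕ (m ℕ.* n) ≡ fromℕ m * fromℕ n
  fromℕ-* zero n = sym (*-zeroˡ _)
  fromℕ-* (suc m) n = trans (fromℕ-+ n _) (trans (cong (fromℕ n +_) (fromℕ-* m n)) (b+ab (fromℕ m) (fromℕ n)))

  opaque
    ∑ : ∀ {n} → (Fin n → ℚ) → ℚ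
    ∑ {zero} f = 0ℚ
    ∑ {suc n} f = f zero + ∑ (λ i → f (suc i))

    ∑-zero : ∀ (f : Fin 0 → ℚ) → ∑ f ≡ 0ℚ
    ∑-zero f = refl

    ∑-suc : ∀ {n} (f : Fin (suc n) → ℚ) → ∑ f ≡ f zero + ∑ (λ i → f (suc i))
    ∑-suc f = refl

    ∑-mono : ∀ {n} {f g : Fin n → ℚ} → (∀ i → f i ≤ g i) → ∑ f ≤ ∑ g
    ∑-mono {zero} e = ≤-refl
    ∑-mono {suc n} e = +-mono-≤ (e zero) (∑-mono (λ i → e (suc i)))

    ∑-cong : ∀ {n} {f g : Fin n → ℚ} → (∀ i → f i ≡ g i) → ∑ f ≡ ∑ g
    ∑-cong e = ≤-antisym (∑-mono (λ i → ≡⇒≤ (e i))) (∑-mono (λ i → ≡⇒≤ (sym (e i))))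

    ∑-+ : ∀ {n} (f g : Fin n → ℚ) → ∑ (λ i → f i + g i) ≡ ∑ f + ∑ g
    ∑-+ {zero} f g = sym (+-identityˡ 0ℚ)
    ∑-+ {suc n} f g = trans (cong₂ _+_ refl (∑-+ (λ i → f (suc i)) (λ i → g (suc i)))) (+-interchange _ _ _ _)

    ∑-* : ∀ {n} c (f : Fin n → ℚ) → ∑ (λ i → c * f i) ≡ c * ∑ f
    ∑-* {zero} c f = sym (*-zeroʳ c)
    ∑-* {suc n} c f = trans (cong₂ _+_ refl (∑-* c (λ i → f (suc i)))) (sym (*-distribˡ-+ c _ _))

    ∑-const : ∀ n c → ∑ {n} (λ _ → c) ≡ fromℕ n * c
    ∑-const zero c = sym (*-zeroˡ c)
    ∑-const (suc n) c = trans (cong (c +_) (∑-const n c)) (b+ab (fromℕ n) c)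

  ∑-neg : ∀ {n} (f : Fin n → ℚ) → ∑ (λ i → - f i) ≡ - ∑ f
  ∑-neg f = trans (∑-cong (λ i → neg1 (f i))) (trans (∑-* (- 1ℚ) f) (sym (neg1 (∑ f))))

  ∑-- : ∀ {n} (f g : Fin n → ℚ) → ∑ (λ i → f i - g i) ≡ ∑ f - ∑ g
  ∑-- f g = trans (∑-+ f (λ i → - g i)) (cong (∑ f +_) (∑-neg g))

  ∑-0 : ∀ n → ∑ {n} (λ _ → 0ℚ) ≡ 0ℚ
  ∑-0 n = trans (∑-const n 0ℚ) (*-zeroʳ _)

  0≤∑ : ∀ {n} {f : Fin n → ℚ} → (∀ i → 0ℚ ≤ f i) → 0ℚ ≤ ∑ f
  0≤∑ {n} {f} p = subst (_≤ ∑ f) (∑-0 n) (∑-mono p)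

  opaque
    unfolding ∑

    ∑-term : ∀ {n} {f : Fin n → ℚ} → (∀ i → 0ℚ ≤ f i) → ∀ i → f i ≤ ∑ f
    ∑-term {suc n} {f} p zero = subst (_≤ ∑ f) (+-identityʳ _) (+-mono-≤ ≤-refl (0≤∑ (λ i → p (suc i))))
    ∑-term {suc n} {f} p (suc i) = subst (_≤ ∑ f) (+-identityˡ _) (+-mono-≤ (p zero) (∑-term (λ i → p (suc i)) i))

    ∑-swap : ∀ {m n} (f : Fin m → Fin n → ℚ) → ∑ (λ i → ∑ (f i)) ≡ ∑ (λ j → ∑ (λ i → f i j))
    ∑-swap {zero} {n} f = sym (∑-0 n)
    ∑-swap {suc m} f = trans (cong₂ _+_ refl (∑-swap (λ i → f (suc i)))) (sym (∑-+ (f zero) (λ j → ∑ (λ i → f (suc i) j))))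

  eqᵇ : ∀ {n} → Fin n → Fin n → Bool
  eqᵇ i j = does (i FinP.≟ j)

  eqᵇ-refl : ∀ {n} (i : Fin n) → eqᵇ i i ≡ true
  eqᵇ-refl i with i FinP.≟ i
  ... | yes _ = refl
  ... | no ne = ⊥-elim (ne refl)

  eqᵇ-sound : ∀ {n} (i j : Fin n) → eqᵇ i j ≡ true → i ≡ j
  eqᵇ-sound i j e with i FinP.≟ j
  ... | yes p = p

  eqᵇ-≢ : ∀ {n} {i j : Fin n} → i ≢ j → eqᵇ i j ≡ false
  eqᵇ-≢ {i = i} {j} ne with i FinP.≟ j
  ... | yes p = ⊥-elim (ne p)
  ... | no _ = refl

  opaque
    unfolding ∑

    ∑-δ : ∀ {n} (f : Fin n → ℚ) (j : Fin n) → ∑ (λ i → f i * 𝟙 (eqᵇ j i)) ≡ f j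
    ∑-δ {suc n} f zero = trans (cong₂ _+_ (*-identityʳ _) (trans (∑-cong (λ i → *-zeroʳ (f (suc i)))) (∑-0 n))) (+-identityʳ _)
    ∑-δ {suc n} f (suc j) = trans (cong₂ _+_ (*-zeroʳ (f zero)) (∑-δ (λ i → f (suc i)) j)) (+-identityˡ _)

  -- Normalised positive linear functionals: the expectations of finite probability spaces.

  record Ex (X : Set) : Set where
    field
      𝔼 : (X → ℚ) → ℚ
      𝔼-mono : ∀ {f g} → (∀ x → f x ≤ g x) → 𝔼 f ≤ 𝔼 g
      𝔼-+ : ∀ f g → 𝔼 (λ x → f x + g x) ≡ 𝔼 f + 𝔼 g
      𝔼-* : ∀ c f → 𝔼 (λ x → c * f x) ≡ c * 𝔼 f
      𝔼-1 : 𝔼 (λ _ → 1ℚ) ≡ 1ℚ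

    𝔼-cong : ∀ {f g} → (∀ x → f x ≡ g x) → 𝔼 f ≡ 𝔼 g
    𝔼-cong e = ≤-antisym (𝔼-mono (λ x → ≡⇒≤ (e x))) (𝔼-mono (λ x → ≡⇒≤ (sym (e x))))

    𝔼-const : ∀ c → 𝔼 (λ _ → c) ≡ c
    𝔼-const c = trans (𝔼-cong (λ _ → sym (*-identityʳ c))) (trans (𝔼-* c _) (trans (cong (c *_) 𝔼-1) (*-identityʳ c)))

    𝔼-*ʳ : ∀ c f → 𝔼 (λ x → f x * c) ≡ 𝔼 f * c
    𝔼-*ʳ c f = trans (𝔼-cong (λ x → *-comm (f x) c)) (trans (𝔼-* c f) (*-comm c _))

    𝔼-neg : ∀ f → 𝔼 (λ x → - f x) ≡ - 𝔼 f
    𝔼-neg f = trans (𝔼-cong (λ x → neg1 (f x))) (trans (𝔼-* (- 1ℚ) f) (sym (neg1 (𝔼 f))))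

    𝔼-- : ∀ f g → 𝔼 (λ x → f x - g x) ≡ 𝔼 f - 𝔼 g
    𝔼-- f g = trans (𝔼-+ f _) (cong (𝔼 f +_) (𝔼-neg g))

    0≤𝔼 : ∀ {f} → (∀ x → 0ℚ ≤ f x) → 0ℚ ≤ 𝔼 f
    0≤𝔼 {f} p = subst (_≤ 𝔼 f) (𝔼-const 0ℚ) (𝔼-mono p)

    𝔼≤ : ∀ {f c} → (∀ x → f x ≤ c) → 𝔼 f ≤ c
    𝔼≤ {f} {c} p = subst (𝔼 f ≤_) (𝔼-const c) (𝔼-mono p)

    𝔼-∑ : ∀ {n} (f : Fin n → X → ℚ) → 𝔼 (λ x → ∑ (λ i → f i x)) ≡ ∑ (λ i → 𝔼 (f i))
    𝔼-∑ {zero} f = trans (𝔼-cong (λ x → ∑-zero _)) (trans (𝔼-const 0ℚ) (sym (∑-zero _)))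
    𝔼-∑ {suc n} f = trans (𝔼-cong (λ x → ∑-suc (λ i → f i x)))
      (trans (𝔼-+ (f zero) (λ x → ∑ (λ i → f (suc i) x)))
      (trans (cong (𝔼 (f zero) +_) (𝔼-∑ (λ i → f (suc i)))) (sym (∑-suc (λ i → 𝔼 (f i))))))

  open Ex public

  -- On a finite type every functional is a finite sum, hence commutes with any other one.

  𝔼-fin : ∀ {n} (E : Ex (Fin n)) f → 𝔼 E f ≡ ∑ (λ i → f i * 𝔼 E (λ j → 𝟙 (eqᵇ j i)))
  𝔼-fin E f = trans (𝔼-cong E (λ j → sym (∑-δ f j))) (trans (𝔼-∑ E (λ i j → f i * 𝟙 (eqᵇ j i))) (∑-cong (λ i → 𝔼-* E (f i) (λ j → 𝟙 (eqᵇ j i)))))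

  𝔼-swap : ∀ {n} {Y : Set} (E : Ex (Fin n)) (E' : Ex Y) (f : Fin n → Y → ℚ) →
    𝔼 E' (λ y → 𝔼 E (λ x → f x y)) ≡ 𝔼 E (λ x → 𝔼 E' (λ y → f x y))
  𝔼-swap E E' f = begin
    𝔼 E' (λ y → 𝔼 E (λ x → f x y))          ≡⟨ 𝔼-cong E' (λ y → 𝔼-fin E _) ⟩
    𝔼 E' (λ y → ∑ (λ i → f i y * w i))      ≡⟨ 𝔼-∑ E' (λ i y → f i y * w i) ⟩
    ∑ (λ i → 𝔼 E' (λ y → f i y * w i))      ≡⟨ ∑-cong (λ i → 𝔼-*ʳ E' (w i) (f i)) ⟩
    ∑ (λ i → 𝔼 E' (f i) * w i)              ≡⟨ sym (𝔼-fin E _) ⟩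
    𝔼 E (λ x → 𝔼 E' (f x)) ∎
    where
    open ≡-Reasoning
    w : Fin _ → ℚ
    w i = 𝔼 E (λ j → 𝟙 (eqᵇ j i))

  map-Ex : ∀ {X Y : Set} → (X → Y) → Ex X → Ex Y
  map-Ex φ E = record
    { 𝔼 = λ f → 𝔼 E (λ x → f (φ x))
    ; 𝔼-mono = λ p → 𝔼-mono E (λ x → p (φ x))
    ; 𝔼-+ = λ f g → 𝔼-+ E _ _
    ; 𝔼-* = λ c f → 𝔼-* E c _
    ; 𝔼-1 = 𝔼-1 E }

  _⊗_ : ∀ {X Y : Set} → Ex X → Ex Y → Ex (X × Y)
  E ⊗ E' = record
    { 𝔼 = λ f → 𝔼 E (λ x → 𝔼 E' (λ y → f (x , y)))
    ; 𝔼-mono = λ p → 𝔼-mono E (λ x → 𝔼-mono E' (λ y → p _))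
    ; 𝔼-+ = λ f g → trans (𝔼-cong E (λ x → 𝔼-+ E' _ _)) (𝔼-+ E _ _)
    ; 𝔼-* = λ c f → trans (𝔼-cong E (λ x → 𝔼-* E' c _)) (𝔼-* E c _)
    ; 𝔼-1 = trans (𝔼-cong E (λ _ → 𝔼-1 E')) (𝔼-1 E) }

  opaque
    uniform : ∀ n → Ex (Fin (suc n))
    uniform n = record
      { 𝔼 = λ f → ι * ∑ f
      ; 𝔼-mono = λ p → *-monoˡ (<⇒≤ (inv-pos (fromℕ (suc n)) (0<fromℕ n))) (∑-mono p)
      ; 𝔼-+ = λ f g → trans (cong (ι *_) (∑-+ f g)) (*-distribˡ-+ ι _ _)
      ; 𝔼-* = λ c f → trans (cong (ι *_) (∑-* c f)) (*-left-comm ι c (∑ f))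
      ; 𝔼-1 = trans (cong (ι *_) (trans (∑-const (suc n) 1ℚ) (*-identityʳ _))) (trans (*-comm ι _) (inv-r _ (0<fromℕ n))) }
      where
      ι : ℚ
      ι = inv (fromℕ (suc n)) (0<fromℕ n)

    𝔼-uniform : ∀ n f → 𝔼 (uniform n) f ≡ inv (fromℕ (suc n)) (0<fromℕ n) * ∑ f
    𝔼-uniform n f = refl

  -- Conditioning on B; when B is null the result is the point mass at x₀.

  cond : ∀ {X : Set} → Ex X → (X → Bool) → X → Ex X
  cond {X} E B x₀ with 𝔼 E (λ x → 𝟙 (B x)) ≟ 0ℚ
  ... | yes _ = record
    { 𝔼 = λ f → f x₀ ; 𝔼-mono = λ p → p x₀ ; 𝔼-+ = λ f g → refl ; 𝔼-* = λ c f → refl ; 𝔼-1 = refl }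
  ... | no ne = record
    { 𝔼 = λ f → ι * 𝔼 E (λ x → 𝟙 (B x) * f x)
    ; 𝔼-mono = λ p → *-monoˡ (<⇒≤ (inv-pos m 0<m)) (𝔼-mono E (λ x → *-monoˡ (0≤𝟙 (B x)) (p x)))
    ; 𝔼-+ = λ f g → trans (cong (ι *_) (trans (𝔼-cong E (λ x → *-distribˡ-+ (𝟙 (B x)) _ _)) (𝔼-+ E _ _))) (*-distribˡ-+ ι _ _)
    ; 𝔼-* = λ c f → trans (cong (ι *_) (trans (𝔼-cong E (λ x → *-left-comm (𝟙 (B x)) c (f x))) (𝔼-* E c _))) (*-left-comm ι c _)
    ; 𝔼-1 = trans (cong (ι *_) (𝔼-cong E (λ x → *-identityʳ _))) (trans (*-comm ι m) (inv-r m 0<m)) }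
    where
    m = 𝔼 E (λ x → 𝟙 (B x))
    0<m = 0≤∧≢⇒0< (0≤𝔼 E (λ x → 0≤𝟙 (B x))) ne
    ι = inv m 0<m

  private
    null : ∀ {X : Set} (E : Ex X) (B : X → Bool) (f : X → ℚ) c → (∀ x → 0ℚ ≤ f x) → (∀ x → f x ≤ c) →
      𝔼 E (λ x → 𝟙 (B x)) ≡ 0ℚ → 𝔼 E (λ x → 𝟙 (B x) * f x) ≡ 0ℚ
    null E B f c 0≤f f≤c z = ≤-antisym
      (≤-trans (𝔼-mono E (λ x → *-monoˡ (0≤𝟙 (B x)) (f≤c x)))
        (≡⇒≤ (trans (𝔼-*ʳ E c _) (trans (cong (_* c) z) (*-zeroˡ c)))))
      (0≤𝔼 E (λ x → 0≤* (0≤𝟙 (B x)) (0≤f x)))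

  cond-mul : ∀ {X : Set} (E : Ex X) (B : X → Bool) (x₀ : X) (f : X → ℚ) → (∀ x → 0ℚ ≤ f x) → (∀ x → f x ≤ 1ℚ) →
    𝔼 E (λ x → 𝟙 (B x) * f x) ≡ 𝔼 E (λ x → 𝟙 (B x)) * 𝔼 (cond E B x₀) f
  cond-mul E B x₀ f 0≤f f≤1 with 𝔼 E (λ x → 𝟙 (B x)) ≟ 0ℚ
  ... | yes z = trans (null E B f 1ℚ 0≤f f≤1 z) (sym (trans (cong (_* f x₀) z) (*-zeroˡ _)))
  ... | no ne = sym (trans (sym (*-assoc m _ _)) (trans (cong₂ _*_ (inv-r m (0≤∧≢⇒0< (0≤𝔼 E (λ x → 0≤𝟙 (B x))) ne)) refl) (*-identityˡ _)))
    where m = 𝔼 E (λ x → 𝟙 (B x))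

open Expectation

module Conditioning where

  In01 : ∀ {X : Set} → (X → ℚ) → Set
  In01 f = ∀ x → 0ℚ ≤ f x × f x ≤ 1ℚ

  Faithful : ∀ {X : Set} → Ex X → Set
  Faithful {X} E = ∀ x → Σ ℚ λ ε → 0ℚ < ε × (∀ f → (∀ y → 0ℚ ≤ f y) → ε * f x ≤ 𝔼 E f)

  Faithful-⊗ : ∀ {X Y : Set} (E : Ex X) (E' : Ex Y) → Faithful E → Faithful E' → Faithful (E ⊗ E')
  Faithful-⊗ E E' F F' (x , y) with F x | F' y
  ... | ε , p , q | ε' , p' , q' = ε * ε' , 0<* p p' , λ f 0≤f →
    ≤-trans (≡⇒≤ (*-assoc ε ε' _))
      (≤-trans (*-monoˡ (<⇒≤ p) (q' (λ y → f (x , y)) (λ y → 0≤f _)))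
               (q (λ x → 𝔼 E' (λ y → f (x , y))) (λ x → 0≤𝔼 E' (λ y → 0≤f _))))

  Faithful-uniform : ∀ n → Faithful (uniform n)
  Faithful-uniform n x = _ , inv-pos (fromℕ (suc n)) (0<fromℕ n) ,
    λ f 0≤f → ≤-trans (*-monoˡ (<⇒≤ (inv-pos (fromℕ (suc n)) (0<fromℕ n))) (∑-term 0≤f x)) (≡⇒≤ (sym (𝔼-uniform n f)))

  Refines : ∀ {X : Set} {k k' : ℕ} → (X → Fin k') → (X → Fin k) → Set
  Refines C' C = ∀ x y → C' x ≡ C' y → C x ≡ C y

  Measurable : ∀ {X : Set} {k : ℕ} → (X → Fin k) → (X → ℚ) → Set
  Measurable C φ = ∀ x y → C x ≡ C y → φ x ≡ φ y

  private opaque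
    unfolding -_
    square-completion : ∀ κ K α t φ →
      κ * ((α + K * (t * φ)) * (α + K * (t * φ))) + K * (t * t) * (1ℚ - φ * φ)
        ≡ (κ * K) * ((α + α) * (t * φ)) + α * α * κ + K * (t * t) + (κ * K - 1ℚ) * (K * (t * t) * (φ * φ))
    square-completion = solve-∀ ℚ-ring
    drop-zero : ∀ x y a b → 1ℚ * x + a + b + (1ℚ - 1ℚ) * y ≡ x + a + b
    drop-zero = solve-∀ ℚ-ring
    sq-diff : ∀ a b → (a - b) * (a - b) ≡ a * a + b * b - (a * b + a * b)
    sq-diff = solve-∀ ℚ-ring
    tφ-split : ∀ α a b φ → (α + α) * ((a - b) * φ) ≡ (α + α) * (a * φ - b * φ)
    tφ-split = solve-∀ ℚ-ring
    cancel-sq : ∀ a b → a + b - (b + b) ≡ a - b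
    cancel-sq = solve-∀ ℚ-ring
    assemble : ∀ α κ K a b c d → (α + α) * (a - b) + K * (α * α * κ) + K * (c - d)
        + (K * (α * α * κ) - K * (c - d)) ≡ (α + α) * ((a - b) + α * (κ * K))
    assemble = solve-∀ ℚ-ring
    K-bound : ∀ α κ K c d → K * (α * α * κ) - K * (c - d) ≡ K * (d + α * α * κ - c)
    K-bound = solve-∀ ℚ-ring
    final-form : ∀ a b α → a - (b - α) ≡ (a - b) + α * 1ℚ
    final-form = solve-∀ ℚ-ring
    rearr : ∀ a b c → a * (b * c) ≡ b * (a * c)
    rearr = solve-∀ ℚ-ring
    0≡z*2α : ∀ α → 0ℚ ≡ (α + α) * 0ℚ
    0≡z*2α = solve-∀ ℚ-ring
    neg-form : ∀ A B α → (- α + - α) * (A - B + - α * 1ℚ) ≡ (α + α) * (B + α - A)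
    neg-form = solve-∀ ℚ-ring
    neg-sq : ∀ α → α * α ≡ (- α) * (- α)
    neg-sq = solve-∀ ℚ-ring
    *-zero-one : ∀ a → 1ℚ - a * a ≡ (1ℚ - a) * (1ℚ + a)
    *-zero-one = solve-∀ ℚ-ring

  module _ {X : Set} (E : Ex X) (x₀ : X) (faithful : Faithful E) where

    mass : ∀ {k} → (X → Fin k) → Fin k → ℚ
    mass C κ = 𝔼 E (λ x → 𝟙 (eqᵇ (C x) κ))

    mass-pos : ∀ {k} (C : X → Fin k) x → 0ℚ < mass C (C x)
    mass-pos C x with faithful x
    ... | ε , p , q = <-≤-trans p (≤-trans (≡⇒≤ (trans (sym (*-identityʳ ε)) (cong (λ b → ε * 𝟙 b) (sym (eqᵇ-refl (C x))))))
                         (q _ (λ y → 0≤𝟙 (eqᵇ (C y) (C x)))))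

    cexp : ∀ {k} → (X → Fin k) → (X → ℚ) → Fin k → ℚ
    cexp C h κ = 𝔼 (cond E (λ x → eqᵇ (C x) κ) x₀) h

    cexp-01 : ∀ {k} (C : X → Fin k) {h} → In01 h → In01 (cexp C h)
    cexp-01 C p κ = 0≤𝔼 (cond E _ x₀) (λ x → proj₁ (p x)) , 𝔼≤ (cond E _ x₀) (λ x → proj₂ (p x))

    cexp-mul : ∀ {k} (C : X → Fin k) {h} → In01 h → ∀ κ → 𝔼 E (λ x → 𝟙 (eqᵇ (C x) κ) * h x) ≡ mass C κ * cexp C h κ
    cexp-mul C {h} p κ = cond-mul E (λ x → eqᵇ (C x) κ) x₀ h (λ x → proj₁ (p x)) (λ x → proj₂ (p x))

    𝔼-partition : ∀ {k} (C : X → Fin k) f → 𝔼 E f ≡ ∑ (λ κ → 𝔼 E (λ x → 𝟙 (eqᵇ (C x) κ) * f x))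
    𝔼-partition C f = trans
      (𝔼-cong E (λ x → trans (sym (∑-δ (λ _ → f x) (C x))) (∑-cong (λ κ → *-comm (f x) _))))
      (𝔼-∑ E (λ κ x → 𝟙 (eqᵇ (C x) κ) * f x))

    on-class : ∀ {k} (i j : Fin k) (ψ : Fin k → ℚ) → 𝟙 (eqᵇ i j) * ψ i ≡ 𝟙 (eqᵇ i j) * ψ j
    on-class i j ψ with eqᵇ i j in e
    ... | true = cong (λ z → 1ℚ * ψ z) (eqᵇ-sound i j e)
    ... | false = trans (*-zeroˡ _) (sym (*-zeroˡ _))

    tower : ∀ {k} (C : X → Fin k) {h} → In01 h → (ψ : Fin k → ℚ) →
      𝔼 E (λ x → h x * ψ (C x)) ≡ ∑ (λ κ → mass C κ * (cexp C h κ * ψ κ))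
    tower C {h} p ψ = trans (𝔼-partition C _) (∑-cong (λ κ → begin
      𝔼 E (λ x → 𝟙 (eqᵇ (C x) κ) * (h x * ψ (C x)))   ≡⟨ 𝔼-cong E (λ x → rearr _ _ _) ⟩
      𝔼 E (λ x → h x * (𝟙 (eqᵇ (C x) κ) * ψ (C x)))   ≡⟨ 𝔼-cong E (λ x → cong (h x *_) (on-class (C x) κ ψ)) ⟩
      𝔼 E (λ x → h x * (𝟙 (eqᵇ (C x) κ) * ψ κ))       ≡⟨ 𝔼-cong E (λ x → trans (sym (*-assoc (h x) _ _)) (cong (_* ψ κ) (*-comm (h x) _))) ⟩
      𝔼 E (λ x → 𝟙 (eqᵇ (C x) κ) * h x * ψ κ)         ≡⟨ 𝔼-*ʳ E (ψ κ) _ ⟩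
      𝔼 E (λ x → 𝟙 (eqᵇ (C x) κ) * h x) * ψ κ         ≡⟨ cong (_* ψ κ) (cexp-mul C p κ) ⟩
      mass C κ * cexp C h κ * ψ κ                      ≡⟨ *-assoc _ _ _ ⟩
      mass C κ * (cexp C h κ * ψ κ) ∎))
      where open ≡-Reasoning

    tower-self : ∀ {k} (C : X → Fin k) (g ψ : Fin k → ℚ) →
      𝔼 E (λ x → g (C x) * ψ (C x)) ≡ ∑ (λ κ → mass C κ * (g κ * ψ κ))
    tower-self C g ψ = trans (𝔼-partition C _) (∑-cong (λ κ →
      trans (𝔼-cong E (λ x → on-class (C x) κ (λ κ → g κ * ψ κ))) (𝔼-*ʳ E (g κ * ψ κ) _)))

    measurable-factor : ∀ {k} (C : X → Fin k) {φ} → In01 φ → Measurable C φ → ∀ x → φ x ≡ cexp C φ (C x)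
    measurable-factor C {φ} p m x = ≤-antisym
        (*-cancel (mass-pos C x) (≡⇒≤ eq)) (*-cancel (mass-pos C x) (≡⇒≤ (sym eq)))
      where
      const-on : ∀ y → 𝟙 (eqᵇ (C y) (C x)) * φ y ≡ 𝟙 (eqᵇ (C y) (C x)) * φ x
      const-on y with eqᵇ (C y) (C x) in e
      ... | true = cong (1ℚ *_) (m y x (eqᵇ-sound _ _ e))
      ... | false = trans (*-zeroˡ _) (sym (*-zeroˡ _))
      eq : mass C (C x) * φ x ≡ mass C (C x) * cexp C φ (C x)
      eq = trans (sym (trans (𝔼-cong E const-on) (𝔼-*ʳ E (φ x) _))) (cexp-mul C p (C x))

    cexp-test : ∀ {k} (C : X → Fin k) {h φ} → In01 h → In01 φ → Measurable C φ →
      𝔼 E (λ x → h x * φ x) ≡ 𝔼 E (λ x → cexp C h (C x) * φ x)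
    cexp-test C {h} {φ} p q m = trans (𝔼-cong E (λ x → cong (h x *_) (f x)))
        (trans (tower C p _) (trans (sym (tower-self C (cexp C h) (cexp C φ))) (𝔼-cong E (λ x → cong (cexp C h (C x) *_) (sym (f x))))))
      where f = measurable-factor C q m

    energy₁ : ∀ {k} → (X → Fin k) → (X → ℚ) → ℚ
    energy₁ C h = 𝔼 E (λ x → cexp C h (C x) * cexp C h (C x))

    energy-diff : ∀ {k k'} (C : X → Fin k) (C' : X → Fin k') {h} → In01 h → Refines C' C →
      𝔼 E (λ x → (cexp C' h (C' x) - cexp C h (C x)) * (cexp C' h (C' x) - cexp C h (C x))) ≡ energy₁ C' h - energy₁ C h
    energy-diff C C' {h} p r = begin
      𝔼 E (λ x → (g' x - g x) * (g' x - g x))                          ≡⟨ 𝔼-cong E (λ x → sq-diff (g' x) (g x)) ⟩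
      𝔼 E (λ x → g' x * g' x + g x * g x - (g' x * g x + g' x * g x))  ≡⟨ 𝔼-- E _ _ ⟩
      𝔼 E (λ x → g' x * g' x + g x * g x) - 𝔼 E (λ x → g' x * g x + g' x * g x)
        ≡⟨ cong₂ _-_ (𝔼-+ E _ _) (trans (𝔼-+ E _ _) (cong₂ _+_ cross cross)) ⟩
      energy₁ C' h + energy₁ C h - (energy₁ C h + energy₁ C h)         ≡⟨ cancel-sq _ _ ⟩
      energy₁ C' h - energy₁ C h ∎
      where
      open ≡-Reasoning
      g g' : X → ℚ
      g x = cexp C h (C x)
      g' x = cexp C' h (C' x)
      cross : 𝔼 E (λ x → g' x * g x) ≡ energy₁ C h
      cross = trans (sym (cexp-test C' p (λ x → cexp-01 C p (C x)) (λ x y e → cong (cexp C h) (r x y e))))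
                    (cexp-test C p (λ x → cexp-01 C p (C x)) (λ x y e → cong (cexp C h) e))

    -- Completing the square gives  2α t φ ≥ − α²κ − K t²  for κ K = 1 and 0 ≤ φ ≤ 1.
    pointwise : ∀ κ K α t φ → 0ℚ ≤ κ → 0ℚ ≤ K → κ * K ≡ 1ℚ → 0ℚ ≤ φ → φ ≤ 1ℚ →
      0ℚ ≤ (α + α) * (t * φ) + α * α * κ + K * (t * t)
    pointwise κ K α t φ 0≤κ 0≤K κK 0≤φ φ≤1 = subst (0ℚ ≤_)
      (trans (square-completion κ K α t φ)
        (trans (cong (λ z → z * ((α + α) * (t * φ)) + α * α * κ + K * (t * t) + (z - 1ℚ) * (K * (t * t) * (φ * φ))) κK)
               (drop-zero _ _ _ _)))
      (0≤+ (0≤* 0≤κ (0≤² (α + K * (t * φ))))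
           (0≤* (0≤* 0≤K (0≤² t)) (subst (0ℚ ≤_) (sym (*-zero-one φ)) (0≤* (≤⇒0≤- φ≤1) (0≤+ 0≤1 0≤φ)))))

    decouple-square : ∀ {K k k'} (h : Fin K → X → ℚ) → (∀ γ → In01 (h γ)) → (C : X → Fin k) (C' : X → Fin k') → Refines C' C →
      ∀ α κ → 0ℚ ≤ κ → κ * fromℕ K ≡ 1ℚ →
      ∑ (λ γ → energy₁ C' (h γ)) ≤ ∑ (λ γ → energy₁ C (h γ)) + α * α * κ →
      (φ : Fin K → X → ℚ) → (∀ γ → In01 (φ γ)) → (∀ γ → Measurable C' (φ γ)) →
      0ℚ ≤ (α + α) * (∑ (λ γ → 𝔼 E (λ x → h γ x * φ γ x)) - ∑ (λ γ → 𝔼 E (λ x → cexp C (h γ) (C x) * φ γ x)) + α * 1ℚ)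
    decouple-square {K} h h01 C C' r α κ 0≤κ κK en φ φ01 φm =
        subst (0ℚ ≤_) (trans (assemble α κ K' A B en' en₀) (cong (λ z → (α + α) * (A - B + α * z)) κK))
          (0≤+ total (subst (0ℚ ≤_) (sym (K-bound α κ K' en' en₀)) (0≤* (0≤fromℕ K) (≤⇒0≤- en))))
      where
      K' = fromℕ K
      A = ∑ (λ γ → 𝔼 E (λ x → h γ x * φ γ x))
      B = ∑ (λ γ → 𝔼 E (λ x → cexp C (h γ) (C x) * φ γ x))
      en' = ∑ (λ γ → energy₁ C' (h γ))
      en₀ = ∑ (λ γ → energy₁ C (h γ))
      g g' : Fin K → X → ℚ
      g γ x = cexp C (h γ) (C x)
      g' γ x = cexp C' (h γ) (C' x)
      term : ∀ γ → 0ℚ ≤ (α + α) * (𝔼 E (λ x → h γ x * φ γ x) - 𝔼 E (λ x → g γ x * φ γ x)) + α * α * κ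
                        + K' * (energy₁ C' (h γ) - energy₁ C (h γ))
      term γ = subst (0ℚ ≤_) eq (0≤𝔼 E (λ x → pointwise κ K' α (g' γ x - g γ x) (φ γ x) 0≤κ (0≤fromℕ K) κK (proj₁ (φ01 γ x)) (proj₂ (φ01 γ x))))
        where
        open ≡-Reasoning
        eq : 𝔼 E (λ x → (α + α) * ((g' γ x - g γ x) * φ γ x) + α * α * κ + K' * ((g' γ x - g γ x) * (g' γ x - g γ x)))
             ≡ (α + α) * (𝔼 E (λ x → h γ x * φ γ x) - 𝔼 E (λ x → g γ x * φ γ x)) + α * α * κ
                        + K' * (energy₁ C' (h γ) - energy₁ C (h γ))
        eq = trans (𝔼-+ E _ _) (cong₂ _+_
          (trans (𝔼-+ E _ _) (cong₂ _+_
            (trans (𝔼-cong E (λ x → tφ-split α (g' γ x) (g γ x) (φ γ x)))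
              (trans (𝔼-* E (α + α) _) (cong ((α + α) *_)
                (trans (𝔼-- E _ _) (cong (_- 𝔼 E (λ x → g γ x * φ γ x)) (sym (cexp-test C' (h01 γ) (φ01 γ) (φm γ))))))))
            (𝔼-const E _)))
          (trans (𝔼-* E K' _) (cong (K' *_) (energy-diff C C' (h01 γ) r))))
      total : 0ℚ ≤ (α + α) * (A - B) + K' * (α * α * κ) + K' * (en' - en₀)
      total = subst (0ℚ ≤_) (trans (∑-+ _ _) (cong₂ _+_
          (trans (∑-+ _ _) (cong₂ _+_ (trans (∑-* (α + α) _) (cong ((α + α) *_) (∑-- _ _))) (∑-const K _)))
          (trans (∑-* K' _) (cong (K' *_) (∑-- _ _)))))
        (0≤∑ term)

    module _ {K k k' : ℕ} (h : Fin K → X → ℚ) (h01 : ∀ γ → In01 (h γ)) (C : X → Fin k) (C' : X → Fin k') (r : Refines C' C)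
      (α κ : ℚ) (0<α : 0ℚ < α) (0≤κ : 0ℚ ≤ κ) (κK : κ * fromℕ K ≡ 1ℚ)
      (en : ∑ (λ γ → energy₁ C' (h γ)) ≤ ∑ (λ γ → energy₁ C (h γ)) + α * α * κ)
      (φ : Fin K → X → ℚ) (φ01 : ∀ γ → In01 (φ γ)) (φm : ∀ γ → Measurable C' (φ γ)) where

      private
        A = ∑ (λ γ → 𝔼 E (λ x → h γ x * φ γ x))
        B = ∑ (λ γ → 𝔼 E (λ x → cexp C (h γ) (C x) * φ γ x))
        0<2α : 0ℚ < α + α
        0<2α = subst (_< α + α) (+-identityˡ 0ℚ) (+-mono-<-≤ 0<α (<⇒≤ 0<α))

      decouple-lower : B - α ≤ A
      decouple-lower = 0≤-⇒≤ (subst (0ℚ ≤_) (sym (final-form A B α))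
        (*-cancel 0<2α (≤-trans (≡⇒≤ (sym (0≡z*2α α))) (decouple-square h h01 C C' r α κ 0≤κ κK en φ φ01 φm))))

      decouple-upper : A ≤ B + α
      decouple-upper = 0≤-⇒≤ (*-cancel 0<2α (≤-trans (≡⇒≤ (sym (0≡z*2α α))) (subst (0ℚ ≤_) (neg-form A B α)
        (decouple-square h h01 C C' r (- α) κ 0≤κ κK (subst (λ z → ∑ (λ γ → energy₁ C' (h γ)) ≤ ∑ (λ γ → energy₁ C (h γ)) + z * κ) (neg-sq α) en) φ φ01 φm))))

module Tuples where

  open Conditioning using (In01)
  open import Data.Vec using (lookup)

  opaque
    ∏ : ∀ {n} → (Fin n → ℚ) → ℚ
    ∏ {zero} f = 1ℚ
    ∏ {suc n} f = f zero * ∏ (λ i → f (suc i))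

    ∏-cong : ∀ {n} {f g : Fin n → ℚ} → (∀ i → f i ≡ g i) → ∏ f ≡ ∏ g
    ∏-cong {zero} e = refl
    ∏-cong {suc n} e = cong₂ _*_ (e zero) (∏-cong (λ i → e (suc i)))

    ∏-01 : ∀ {n} {f : Fin n → ℚ} → In01 f → 0ℚ ≤ ∏ f × ∏ f ≤ 1ℚ
    ∏-01 {zero} p = 0≤1 , ≤-refl
    ∏-01 {suc n} {f} p with p zero | ∏-01 (λ i → p (suc i))
    ... | a , b | c , d = 0≤* a c , ≤-trans (*-mono-≤ a b c d) (≡⇒≤ (*-identityˡ 1ℚ))

    ∏-pull : ∀ {n} (f : Fin n → ℚ) j → ∏ f ≡ f j * ∏ (λ i → if eqᵇ j i then 1ℚ else f i)
    ∏-pull {suc n} f zero = cong (f zero *_) (sym (*-identityˡ _))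
    ∏-pull {suc n} f (suc j) = trans (cong (f zero *_) (∏-pull (λ i → f (suc i)) j)) (swap _ _ _)
      where swap : ∀ a b c → a * (b * c) ≡ b * (a * c)
            swap a b c = trans (sym (*-assoc a b c)) (trans (cong (_* c) (*-comm a b)) (*-assoc b a c))

    pw : ℚ → ℕ → ℚ
    pw η zero = 1ℚ
    pw η (suc n) = η * pw η n

    pw-pos : ∀ {η} n → 0ℚ < η → 0ℚ < pw η n
    pw-pos zero p = 0<1
    pw-pos (suc n) p = 0<* p (pw-pos n p)

    pw-suc : ∀ η n → pw η (suc n) ≡ η * pw η n
    pw-suc η n = refl

    pw-0 : ∀ η → pw η 0 ≡ 1ℚ
    pw-0 η = refl

    ∏-lower : ∀ {n} {f : Fin n → ℚ} {η} → 0ℚ ≤ η → (∀ i → η ≤ f i) → pw η n ≤ ∏ f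
    ∏-lower {zero} p q = ≤-refl
    ∏-lower {suc n} {η = η} p q = *-mono-≤ p (q zero) (0≤pw n) (∏-lower p (λ i → q (suc i)))
      where 0≤pw : ∀ n → 0ℚ ≤ pw η n
            0≤pw zero = 0≤1
            0≤pw (suc n) = 0≤* p (0≤pw n)

    ∏≤ : ∀ {n} {f : Fin n → ℚ} → In01 f → ∀ j → ∏ f ≤ f j
    ∏≤ {f = f} p j = ≤-trans (≡⇒≤ (∏-pull f j)) (≤-trans (*-monoˡ (proj₁ (p j)) (proj₂ (∏-01 q))) (≡⇒≤ (*-identityʳ _)))
      where q : In01 (λ i → if eqᵇ j i then 1ℚ else f i)
            q i with eqᵇ j i
            ... | true = 0≤1 , ≤-refl
            ... | false = p i

  pow : ∀ {V : Set} → Ex V → ∀ M → Ex (Vec V M)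
  pow E zero = record { 𝔼 = λ f → f [] ; 𝔼-mono = λ p → p [] ; 𝔼-+ = λ f g → refl ; 𝔼-* = λ c f → refl ; 𝔼-1 = refl }
  pow E (suc M) = map-Ex (λ (v , x) → v ∷ x) (E ⊗ pow E M)

  resample : ∀ {n M} (E : Ex (Fin n)) (i : Fin M) (φ : Vec (Fin n) M → ℚ) →
    𝔼 (pow E M) φ ≡ 𝔼 (pow E M) (λ x → 𝔼 E (λ a → φ (x [ i ]≔ a)))
  resample {M = suc M} E zero φ = sym (trans (𝔼-const E _) (𝔼-swap E (pow E M) (λ a x → φ (a ∷ x))))
  resample {M = suc M} E (suc i) φ = 𝔼-cong E (λ v → resample E i (λ x → φ (v ∷ x)))

  opaque
    upd : ∀ {V : Set} {M} → (Fin M → V) → Fin M → V → Fin M → V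
    upd f i a v = if eqᵇ i v then a else f v

    upd-same : ∀ {V : Set} {M} (f : Fin M → V) i a → upd f i a i ≡ a
    upd-same f i a rewrite eqᵇ-refl i = refl

    upd-other : ∀ {V : Set} {M} (f : Fin M → V) {i v} a → i ≢ v → upd f i a v ≡ f v
    upd-other f a ne rewrite eqᵇ-≢ ne = refl

    upd-at : ∀ {V : Set} {M} {f g : Fin M → V} i a v → f v ≡ g v → upd f i a v ≡ upd g i a v
    upd-at i a v e with eqᵇ i v
    ... | true = refl
    ... | false = e

    lookup-upd : ∀ {V : Set} {M} (x : Vec V M) i a v → lookup (x [ i ]≔ a) v ≡ upd (lookup x) i a v
    lookup-upd x i a v with eqᵇ i v in e
    ... | true = trans (cong (lookup (x [ i ]≔ a)) (sym (eqᵇ-sound i v e))) (lookup∘update i x a)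
    ... | false = lookup∘update′ (λ v≡i → contra v≡i e) x a
      where contra : v ≡ i → eqᵇ i v ≡ false → ⊥
            contra refl e' with trans (sym (eqᵇ-refl i)) e'
            ... | ()

  upd-cong : ∀ {V : Set} {M} {f g : Fin M → V} i a → (∀ v → f v ≡ g v) → ∀ v → upd f i a v ≡ upd g i a v
  upd-cong i a e v = upd-at i a v (e v)

  Respects : ∀ {V : Set} {M} → ((Fin M → V) → ℚ) → Set
  Respects φ = ∀ {f g} → (∀ v → f v ≡ g v) → φ f ≡ φ g

  module _ {n M : ℕ} (E : Ex (Fin n)) (φ : (Fin M → Fin n) → ℚ) (φ-resp : Respects φ) where

    resample₂ : ∀ i j → 𝔼 (pow E M) (λ x → φ (lookup x)) ≡
      𝔼 (pow E M) (λ x → 𝔼 E (λ a → 𝔼 E (λ b → φ (upd (upd (lookup x) i a) j b))))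
    resample₂ i j = trans (resample E j _) (trans (resample E i _) (𝔼-cong (pow E M) (λ x → 𝔼-cong E (λ a → 𝔼-cong E (λ b →
      φ-resp (λ v → trans (lookup-upd (x [ i ]≔ a) j b v) (upd-cong j b (lookup-upd x i a) v)))))))

    resample₃ : ∀ i j k → 𝔼 (pow E M) (λ x → φ (lookup x)) ≡
      𝔼 (pow E M) (λ x → 𝔼 E (λ a → 𝔼 E (λ b → 𝔼 E (λ c → φ (upd (upd (upd (lookup x) i a) j b) k c)))))
    resample₃ i j k = trans (resample E k _) (trans (resample E j _) (trans (resample E i _)
      (𝔼-cong (pow E M) (λ x → 𝔼-cong E (λ a → 𝔼-cong E (λ b → 𝔼-cong E (λ c →
      φ-resp (λ v → trans (lookup-upd (x [ i ]≔ a [ j ]≔ b) k c v) (upd-cong k c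
        (λ v → trans (lookup-upd (x [ i ]≔ a) j b v) (upd-cong j b (lookup-upd x i a) v)) v)))))))))

  opaque
    #triples : ℕ → ℕ
    #triples M = M ℕ.* (M ℕ.* M)

    tri-index : ∀ {M} → Fin M → Fin M → Fin M → Fin (#triples M)
    tri-index a b c = combine a (combine b c)

    tri₁ tri₂ tri₃ : ∀ {M} → Fin (#triples M) → Fin M
    tri₁ {M} t = proj₁ (remQuot {M} (M ℕ.* M) t)
    tri₂ {M} t = proj₁ (remQuot {M} M (proj₂ (remQuot {M} (M ℕ.* M) t)))
    tri₃ {M} t = proj₂ (remQuot {M} M (proj₂ (remQuot {M} (M ℕ.* M) t)))

    tri₁-index : ∀ {M} (a b c : Fin M) → tri₁ (tri-index a b c) ≡ a
    tri₁-index a b c = cong proj₁ (FinP.remQuot-combine a (combine b c))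

    tri₂-index : ∀ {M} (a b c : Fin M) → tri₂ (tri-index a b c) ≡ b
    tri₂-index {M} a b c = trans (cong (λ z → proj₁ (remQuot {M} M (proj₂ z))) (FinP.remQuot-combine a (combine b c)))
                                 (cong proj₁ (FinP.remQuot-combine b c))

    tri₃-index : ∀ {M} (a b c : Fin M) → tri₃ (tri-index a b c) ≡ c
    tri₃-index {M} a b c = trans (cong (λ z → proj₂ (remQuot {M} M (proj₂ z))) (FinP.remQuot-combine a (combine b c)))
                                 (cong proj₂ (FinP.remQuot-combine b c))

    tri-η : ∀ {M} (t : Fin (#triples M)) → tri-index (tri₁ t) (tri₂ t) (tri₃ t) ≡ t
    tri-η {M} t = trans (cong (combine (tri₁ {M} t)) (FinP.combine-remQuot {M} M _)) (FinP.combine-remQuot {M} (M ℕ.* M) t)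

  funToFin-injective : ∀ {m n} (f g : Fin m → Fin n) → funToFin f ≡ funToFin g → ∀ i → f i ≡ g i
  funToFin-injective f g e i = trans (sym (FinP.finToFun-funToFin f i)) (trans (cong (λ z → finToFun z i) e) (FinP.finToFun-funToFin g i))

  bit : Bool → Fin 2
  bit true = suc zero
  bit false = zero

  bit-injective : ∀ a b → bit a ≡ bit b → a ≡ b
  bit-injective true true _ = refl
  bit-injective false false _ = refl

module Archimedean where

  open import Data.Integer using (ℤ; +_; -[1+_]; ∣_∣)
  open import Data.Rational using (_/_)

  private
    toℚᵘ-int : ∀ n → toℚᵘ ((+ n) / 1) U.≃ mkℚᵘ (+ n) 0
    toℚᵘ-int n = QP.toℚᵘ-fromℚᵘ (mkℚᵘ (+ n) 0)

    toℚᵘ-+-int : ∀ m n → toℚᵘ ((+ m) / 1 Q.+ (+ n) / 1) U.≃ mkℚᵘ (+ m) 0 U.+ mkℚᵘ (+ n) 0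
    toℚᵘ-+-int m n = UP.≃-trans (QP.toℚᵘ-homo-+ ((+ m) / 1) ((+ n) / 1)) (UP.+-cong (toℚᵘ-int m) (toℚᵘ-int n))

    int-+ : ∀ m n → (+ m) / 1 Q.+ (+ n) / 1 ≡ (+ (m ℕ.+ n)) / 1
    int-+ m n = QP.toℚᵘ-injective (UP.≃-trans (toℚᵘ-+-int m n) (UP.≃-trans
      (*≡* (cong (ℤ._* + 1) (cong₂ ℤ._+_ (ℤP.*-identityʳ (+ m)) (ℤP.*-identityʳ (+ n)))))
      (UP.≃-sym (toℚᵘ-int (m ℕ.+ n)))))

  opaque
    unfolding _+_

    fromℕ-/ : ∀ n → fromℕ n ≡ (+ n) / 1
    fromℕ-/ zero = refl
    fromℕ-/ (suc n) = trans (cong (λ z → 1ℚ + z) (fromℕ-/ n)) (int-+ 1 n)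

  ≤-numerator : ∀ q → q ≤ fromℕ ∣ Q.↥ q ∣
  ≤-numerator q@(mkℚ n d-1 _) = subst (q ≤_) (sym (fromℕ-/ ∣ n ∣))
    (QP.toℚᵘ-cancel-≤ (UP.≤-respʳ-≃ (UP.≃-sym (toℚᵘ-int ∣ n ∣)) (*≤* (le n))))
    where
    le : ∀ n → n ℤ.* + 1 ℤ.≤ + ∣ n ∣ ℤ.* + suc d-1
    le (+ n) = subst₂ ℤ._≤_ (sym (ℤP.*-identityʳ (+ n))) (ℤP.pos-* n (suc d-1)) (ℤ.+≤+ (ℕP.m≤m*n n (suc d-1)))
    le -[1+ n ] = ℤP.≤-trans (subst (ℤ._≤ + 0) (sym (ℤP.*-identityʳ -[1+ n ])) ℤ.-≤+) (subst (+ 0 ℤ.≤_) (ℤP.pos-* (suc n) (suc d-1)) (ℤ.+≤+ ℕ.z≤n))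

  archimedean : ∀ c {τ} → 0ℚ < τ → Σ ℕ λ R → c ≤ fromℕ R * τ
  archimedean c {τ} 0<τ = ∣ Q.↥ (c * inv τ 0<τ) ∣ , ≤-trans (≡⇒≤ eq) (*-monoʳ (<⇒≤ 0<τ) (≤-numerator (c * inv τ 0<τ)))
    where eq : c ≡ c * inv τ 0<τ * τ
          eq = sym (trans (*-assoc c _ τ) (trans (cong (c *_) (trans (*-comm _ τ) (inv-r τ 0<τ))) (*-identityʳ c)))

module EdgeWeights where

  open Conditioning
  open Tuples
  open import Data.Vec using (lookup)

  -- the factor of a triple: none, the edge indicator or its conditional expectation
  data Factor : Set where
    one edge weight : Factor

  to-weight : Factor → Factor
  to-weight one = one
  to-weight edge = weight
  to-weight weight = weight

  to-weight-idem : ∀ s → to-weight (to-weight s) ≡ to-weight s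
  to-weight-idem one = refl
  to-weight-idem edge = refl
  to-weight-idem weight = refl

  replace : ∀ {N} → Fin N → (Fin N → Factor) → Fin N → Factor
  replace t s u = if eqᵇ t u then to-weight (s u) else s u

  replaceAll : ∀ {N} → List (Fin N) → (Fin N → Factor) → Fin N → Factor
  replaceAll [] s = s
  replaceAll (t ∷ L) s = replaceAll L (replace t s)

  replace-done : ∀ {N} (t : Fin N) s u → to-weight (replace t s u) ≡ to-weight (s u)
  replace-done t s u with eqᵇ t u
  ... | true = to-weight-idem (s u)
  ... | false = refl

  replaceAll-done : ∀ {N} (L : List (Fin N)) s u → (u ∈ L) ⊎ (s u ≡ to-weight (s u)) → replaceAll L s u ≡ to-weight (s u)
  replaceAll-done [] s u (inj₂ e) = e
  replaceAll-done (t ∷ L) s u (inj₁ (there p)) = trans (replaceAll-done L (replace t s) u (inj₁ p)) (replace-done t s u)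
  replaceAll-done (t ∷ L) s u (inj₂ e) = trans (replaceAll-done L (replace t s) u (inj₂ lem)) (replace-done t s u)
    where lem : replace t s u ≡ to-weight (replace t s u)
          lem with eqᵇ t u
          ... | true = sym (to-weight-idem (s u))
          ... | false = e
  replaceAll-done (t ∷ L) s .t (inj₁ (here refl)) = trans (replaceAll-done L (replace t s) t (inj₂ lem)) (replace-done t s t)
    where lem : replace t s t ≡ to-weight (replace t s t)
          lem rewrite eqᵇ-refl t = sym (to-weight-idem (s t))

  Ref₂ : ∀ {V : Set} {K K'} → (V → V → Fin K') → (V → V → Fin K) → Set
  Ref₂ c' c = ∀ a b a' b' → c' a b ≡ c' a' b' → c a b ≡ c a' b'

  missing : ∀ {M} (i j k u₁ u₂ u₃ : Fin M) → i Fin.< j → j Fin.< k → u₁ Fin.< u₂ → u₂ Fin.< u₃ →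
    ¬ (u₁ ≡ i × u₂ ≡ j × u₃ ≡ k) →
    Σ (Fin M) λ l → (l ≡ i ⊎ l ≡ j ⊎ l ≡ k) × l ≢ u₁ × l ≢ u₂ × l ≢ u₃
  missing i j k u₁ u₂ u₃ i<j j<k p q ne with i FinP.≟ u₁ | j FinP.≟ u₂ | k FinP.≟ u₃
  ... | yes refl | yes refl | yes refl = ⊥-elim (ne (refl , refl , refl))
  ... | yes refl | yes refl | no k≢ = k , inj₂ (inj₂ refl) ,
          (λ { refl → ℕP.<-asym i<j j<k }) , (λ { refl → ℕP.<-irrefl refl j<k }) , k≢
  ... | yes refl | no j≢ | _ with j FinP.≟ u₃
  ...   | no j≢₃ = j , inj₂ (inj₁ refl) , (λ { refl → ℕP.<-irrefl refl i<j }) , j≢ , j≢₃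
  ...   | yes refl = k , inj₂ (inj₂ refl) , (λ { refl → ℕP.<-asym i<j j<k }) , (λ { refl → ℕP.<-asym j<k q }) , (λ { refl → ℕP.<-irrefl refl j<k })
  missing i j k u₁ u₂ u₃ i<j j<k p q ne | no i≢ | _ | _ with i FinP.≟ u₂ | i FinP.≟ u₃
  ... | no i≢₂ | no i≢₃ = i , inj₁ refl , i≢ , i≢₂ , i≢₃
  ... | _ | yes refl = j , inj₂ (inj₁ refl) , (λ { refl → ℕP.<-asym i<j (ℕP.<-trans p q) }) , (λ { refl → ℕP.<-asym i<j q }) , (λ { refl → ℕP.<-irrefl refl i<j })
  ... | yes refl | no _ with k FinP.≟ u₃
  ...   | no k≢ = k , inj₂ (inj₂ refl) , (λ { refl → ℕP.<-asym p (ℕP.<-trans i<j j<k) }) , (λ { refl → ℕP.<-asym i<j j<k }) , k≢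
  ...   | yes refl = j , inj₂ (inj₁ refl) , (λ { refl → ℕP.<-asym p i<j }) , (λ { refl → ℕP.<-irrefl refl i<j }) , (λ { refl → ℕP.<-irrefl refl j<k })

  private opaque
    unfolding -_
    shift : ∀ w e α → e - (w - α) ≡ e + α - w
    shift = solve-∀ ℚ-ring
    regroup : ∀ p α l → p + α + l * α ≡ p + (1ℚ + l) * α
    regroup = solve-∀ ℚ-ring

  module Edge-level {n : ℕ} (E : Ex (Fin n)) (x₀ : Fin n) (faithful : Faithful E) (h : Fin n → Fin n → Fin n → Bool) where

    private V = Fin n

    E₃ : Ex (V × V × V)
    E₃ = E ⊗ (E ⊗ E)

    faithful₃ : Faithful E₃
    faithful₃ = Faithful-⊗ E (E ⊗ E) faithful (Faithful-⊗ E E faithful faithful)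

    hℚ : V × V × V → ℚ
    hℚ (a , b , c) = 𝟙 (h a b c)

    h01 : In01 hℚ
    h01 _ = 0≤𝟙 _ , 𝟙≤1 _

    C₃ : ∀ {K} → (V → V → Fin K) → V × V × V → Fin (K ℕ.* (K ℕ.* K))
    C₃ c (x , y , z) = combine (c x y) (combine (c y z) (c x z))

    C₃-injective : ∀ {K} (c : V → V → Fin K) {x y z x' y' z'} → C₃ c (x , y , z) ≡ C₃ c (x' , y' , z') →
      c x y ≡ c x' y' × c y z ≡ c y' z' × c x z ≡ c x' z'
    C₃-injective c e with FinP.combine-injective _ _ _ _ e
    ... | p , q with FinP.combine-injective _ _ _ _ q
    ... | q₁ , q₂ = p , q₁ , q₂

    C₃-refines : ∀ {K K'} {c : V → V → Fin K} {c' : V → V → Fin K'} → Ref₂ c' c → Refines (C₃ c') (C₃ c)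
    C₃-refines {c' = c'} r _ _ e with C₃-injective c' e
    ... | p , q , s = cong₂ combine (r _ _ _ _ p) (cong₂ combine (r _ _ _ _ q) (r _ _ _ _ s))

    W : ∀ {K} → (V → V → Fin K) → Fin K → Fin K → Fin K → ℚ
    W c γ₁ γ₂ γ₃ = cexp E₃ (x₀ , x₀ , x₀) faithful₃ (C₃ c) hℚ (combine γ₁ (combine γ₂ γ₃))

    W-01 : ∀ {K} (c : V → V → Fin K) γ₁ γ₂ γ₃ → 0ℚ ≤ W c γ₁ γ₂ γ₃ × W c γ₁ γ₂ γ₃ ≤ 1ℚ
    W-01 c γ₁ γ₂ γ₃ = cexp-01 E₃ (x₀ , x₀ , x₀) faithful₃ (C₃ c) h01 _

    energy : ∀ {K} → (V → V → Fin K) → ℚ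
    energy c = energy₁ E₃ (x₀ , x₀ , x₀) faithful₃ (C₃ c) hℚ

    NoGain : ∀ {K K'} → ℚ → (V → V → Fin K) → (V → V → Fin K') → Set
    NoGain α c c' = energy c' ≤ energy c + α * α

    module Test {K K' : ℕ} (c : V → V → Fin K) (c' : V → V → Fin K') (r : Ref₂ c' c) (α : ℚ) (0<α : 0ℚ < α) (ng : NoGain α c c')
      (φ : V → V → V → ℚ) (φ01 : ∀ a b d → 0ℚ ≤ φ a b d × φ a b d ≤ 1ℚ)
      (φm : ∀ a b d a' b' d' → c' a b ≡ c' a' b' → c' b d ≡ c' b' d' → c' a d ≡ c' a' d' → φ a b d ≡ φ a' b' d') where

      private
        ∑₁ : ∀ (f : Fin 1 → ℚ) → ∑ f ≡ f zero
        ∑₁ f = trans (∑-suc f) (trans (cong (f zero +_) (∑-zero _)) (+-identityʳ _))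
        one-one : 1ℚ * fromℕ 1 ≡ 1ℚ
        one-one = trans (*-identityˡ _) (+-identityʳ 1ℚ)
        en : ∑ (λ (γ : Fin 1) → energy c') ≤ ∑ (λ (γ : Fin 1) → energy c) + α * α * 1ℚ
        en = subst₂ _≤_ (sym (∑₁ _)) (cong₂ _+_ (sym (∑₁ _)) (sym (*-identityʳ _))) ng
        φ' : V × V × V → ℚ
        φ' (a , b , d) = φ a b d
        φm' : Measurable (C₃ c') φ'
        φm' _ _ e with C₃-injective c' e
        ... | p , q , s = φm _ _ _ _ _ _ p q s

      lower : 𝔼 E (λ a → 𝔼 E (λ b → 𝔼 E (λ d → W c (c a b) (c b d) (c a d) * φ a b d))) - α
        ≤ 𝔼 E (λ a → 𝔼 E (λ b → 𝔼 E (λ d → 𝟙 (h a b d) * φ a b d)))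
      lower = subst₂ _≤_ (cong (_- α) (∑₁ _)) (∑₁ _)
        (decouple-lower E₃ (x₀ , x₀ , x₀) faithful₃ {1} (λ _ → hℚ) (λ _ → h01) (C₃ c) (C₃ c') (C₃-refines r)
          α 1ℚ 0<α 0≤1 one-one en (λ _ → φ') (λ _ _ → φ01 _ _ _) (λ _ → φm'))

      upper : 𝔼 E (λ a → 𝔼 E (λ b → 𝔼 E (λ d → 𝟙 (h a b d) * φ a b d)))
        ≤ 𝔼 E (λ a → 𝔼 E (λ b → 𝔼 E (λ d → W c (c a b) (c b d) (c a d) * φ a b d))) + α
      upper = subst₂ _≤_ (∑₁ _) (cong (_+ α) (∑₁ _))
        (decouple-upper E₃ (x₀ , x₀ , x₀) faithful₃ {1} (λ _ → hℚ) (λ _ → h01) (C₃ c) (C₃ c') (C₃-refines r)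
          α 1ℚ 0<α 0≤1 one-one en (λ _ → φ') (λ _ _ → φ01 _ _ _) (λ _ → φm'))

    module Replacement (M K : ℕ) (c : V → V → Fin K) where

      N = #triples M
      L = (2 ℕ.* K) ℕ.^ N

      table : (Fin M → V) → Fin N → Fin (2 ℕ.* K)
      table f t = combine (bit (h (f (tri₁ t)) (f (tri₂ t)) (f (tri₃ t)))) (c (f (tri₁ t)) (f (tri₂ t)))

      code : (Fin M → V) → Fin L
      code f = funToFin (table f)

      table-at : ∀ f a b d → table f (tri-index a b d) ≡ combine (bit (h (f a) (f b) (f d))) (c (f a) (f b))
      table-at f a b d rewrite tri₁-index a b d | tri₂-index a b d | tri₃-index a b d = refl

      code-sound : ∀ f g → code f ≡ code g → ∀ a b d → h (f a) (f b) (f d) ≡ h (g a) (g b) (g d) × c (f a) (f b) ≡ c (g a) (g b)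
      code-sound f g e a b d with FinP.combine-injective _ _ _ _
          (trans (sym (table-at f a b d)) (trans (funToFin-injective (table f) (table g) e (tri-index a b d)) (table-at g a b d)))
      ... | p , q = bit-injective _ _ p , q

      value : Factor → (Fin M → V) → Fin M → Fin M → Fin M → ℚ
      value one f a b d = 1ℚ
      value edge f a b d = 𝟙 (h (f a) (f b) (f d))
      value weight f a b d = W c (c (f a) (f b)) (c (f b) (f d)) (c (f a) (f d))

      value-01 : ∀ s f a b d → 0ℚ ≤ value s f a b d × value s f a b d ≤ 1ℚ
      value-01 one f a b d = 0≤1 , ≤-refl
      value-01 edge f a b d = 0≤𝟙 _ , 𝟙≤1 _
      value-01 weight f a b d = W-01 c _ _ _

      value-resp : ∀ s {f g} a b d → f a ≡ g a → f b ≡ g b → f d ≡ g d → value s f a b d ≡ value s g a b d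
      value-resp one a b d _ _ _ = refl
      value-resp edge a b d p q r rewrite p | q | r = refl
      value-resp weight a b d p q r rewrite p | q | r = refl

      value-code : ∀ s {f g} a b d → code f ≡ code g → value s f a b d ≡ value s g a b d
      value-code one a b d e = refl
      value-code edge {f} {g} a b d e = cong 𝟙 (proj₁ (code-sound f g e a b d))
      value-code weight {f} {g} a b d e
        rewrite proj₂ (code-sound f g e a b d) | proj₂ (code-sound f g e b d d) | proj₂ (code-sound f g e a d d) = refl

      P : (Fin N → Factor) → (Fin M → V) → ℚ
      P s f = ∏ (λ t → value (s t) f (tri₁ t) (tri₂ t) (tri₃ t))

      P-01 : ∀ s f → 0ℚ ≤ P s f × P s f ≤ 1ℚ
      P-01 s f = ∏-01 (λ t → value-01 (s t) f _ _ _)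

      P-resp : ∀ s → Respects (P s)
      P-resp s e = ∏-cong (λ t → value-resp (s t) _ _ _ (e _) (e _) (e _))

      Increasing : (Fin N → Factor) → Set
      Increasing s = ∀ t → s t ≢ one → tri₁ t Fin.< tri₂ t × tri₂ t Fin.< tri₃ t

      without : Fin N → (Fin N → Factor) → Fin N → Factor
      without t s u = if eqᵇ t u then one else s u

      P-pull : ∀ s t f → P s f ≡ value (s t) f (tri₁ t) (tri₂ t) (tri₃ t) * P (without t s) f
      P-pull s t f = trans (∏-pull _ t) (cong (value (s t) f _ _ _ *_) (∏-cong lem))
        where lem : ∀ u → (if eqᵇ t u then 1ℚ else value (s u) f (tri₁ u) (tri₂ u) (tri₃ u)) ≡ value (without t s u) f (tri₁ u) (tri₂ u) (tri₃ u)
              lem u with eqᵇ t u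
              ... | true = refl
              ... | false = refl

      P-cong-s : ∀ {s s'} → (∀ t → s t ≡ s' t) → ∀ f → P s f ≡ P s' f
      P-cong-s e f = ∏-cong (λ t → cong (λ z → value z f (tri₁ t) (tri₂ t) (tri₃ t)) (e t))

      K⁺ = L ℕ.* (L ℕ.* L)

      upd₃ : (Fin M → V) → Fin M → Fin M → Fin M → V → V → V → Fin M → V
      upd₃ f i j k a b d = upd (upd (upd f i a) j b) k d

      fine : (Fin M → V) → Fin M → Fin M → Fin M → V → V → Fin K⁺
      fine f i j k a b = combine (code (upd (upd f i a) j b)) (combine (code (upd (upd f j a) k b)) (code (upd (upd f i a) k b)))

      fine-sound : ∀ f i j k a b a' b' → fine f i j k a b ≡ fine f i j k a' b' →
        code (upd (upd f i a) j b) ≡ code (upd (upd f i a') j b')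
        × code (upd (upd f j a) k b) ≡ code (upd (upd f j a') k b')
        × code (upd (upd f i a) k b) ≡ code (upd (upd f i a') k b')
      fine-sound f i j k a b a' b' e with FinP.combine-injective _ _ _ _ e
      ... | p , q with FinP.combine-injective _ _ _ _ q
      ... | q₁ , q₂ = p , q₁ , q₂

      fine-refines : ∀ f i j k → i ≢ j → Ref₂ (fine f i j k) c
      fine-refines f i j k i≢j a b a' b' e = subst₂ _≡_ (lem a b) (lem a' b')
          (proj₂ (code-sound (upd (upd f i a) j b) (upd (upd f i a') j b') (proj₁ (fine-sound f i j k a b a' b' e)) i j j))
        where lem : ∀ a b → c (upd (upd f i a) j b i) (upd (upd f i a) j b j) ≡ c a b
              lem a b = cong₂ c (trans (upd-other _ b (λ z → i≢j (sym z))) (upd-same f i a)) (upd-same _ j b)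

      upd₃-k : ∀ f i j k a b d v → k ≢ v → upd₃ f i j k a b d v ≡ upd (upd f i a) j b v
      upd₃-k f i j k a b d v ne = upd-other _ d ne

      upd₃-j : ∀ f i j k a b d v → j ≢ v → upd₃ f i j k a b d v ≡ upd (upd f i a) k d v
      upd₃-j f i j k a b d v ne = upd-at k d v (upd-other _ b ne)

      upd₃-i : ∀ f i j k a b d v → i ≢ v → upd₃ f i j k a b d v ≡ upd (upd f j b) k d v
      upd₃-i f i j k a b d v ne = upd-at k d v (upd-at j b v (upd-other f a ne))

      rest-measurable : ∀ s → Increasing s → ∀ t → tri₁ t Fin.< tri₂ t → tri₂ t Fin.< tri₃ t → ∀ f →
        let i = tri₁ t ; j = tri₂ t ; k = tri₃ t ; c' = fine f i j k ; φ = λ a b d → P (without t s) (upd₃ f i j k a b d) in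
        ∀ a b d a' b' d' → c' a b ≡ c' a' b' → c' b d ≡ c' b' d' → c' a d ≡ c' a' d' → φ a b d ≡ φ a' b' d'
      rest-measurable s inc t i<j j<k f a b d a' b' d' e₁ e₂ e₃ = ∏-cong go
        where
        i = tri₁ t
        j = tri₂ t
        k = tri₃ t
        g = upd₃ f i j k a b d
        g' = upd₃ f i j k a' b' d'
        via : ∀ s {g₁ g₁'} u₁ u₂ u₃ → (∀ v → v ≡ u₁ ⊎ v ≡ u₂ ⊎ v ≡ u₃ → g v ≡ g₁ v × g' v ≡ g₁' v) →
          code g₁ ≡ code g₁' → value s g u₁ u₂ u₃ ≡ value s g' u₁ u₂ u₃
        via s u₁ u₂ u₃ e ce = trans (value-resp s u₁ u₂ u₃ (proj₁ (e _ (inj₁ refl))) (proj₁ (e _ (inj₂ (inj₁ refl)))) (proj₁ (e _ (inj₂ (inj₂ refl)))))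
          (trans (value-code s u₁ u₂ u₃ ce)
            (sym (value-resp s u₁ u₂ u₃ (proj₂ (e _ (inj₁ refl))) (proj₂ (e _ (inj₂ (inj₁ refl)))) (proj₂ (e _ (inj₂ (inj₂ refl)))))))
        ne-all : ∀ {l u₁ u₂ u₃ : Fin M} → l ≢ u₁ → l ≢ u₂ → l ≢ u₃ → ∀ v → v ≡ u₁ ⊎ v ≡ u₂ ⊎ v ≡ u₃ → l ≢ v
        ne-all p q r v (inj₁ refl) = p
        ne-all p q r v (inj₂ (inj₁ refl)) = q
        ne-all p q r v (inj₂ (inj₂ refl)) = r
        case : ∀ u → eqᵇ t u ≡ false → ∀ F → tri₁ u Fin.< tri₂ u × tri₂ u Fin.< tri₃ u →
          value F g (tri₁ u) (tri₂ u) (tri₃ u) ≡ value F g' (tri₁ u) (tri₂ u) (tri₃ u)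
        case u eq F (p , q) with missing i j k (tri₁ u) (tri₂ u) (tri₃ u) i<j j<k p q
              (λ { (a₁ , a₂ , a₃) → t≢u (trans (sym (tri-η t)) (trans (index-cong (sym a₁) (sym a₂) (sym a₃)) (tri-η u))) })
            where t≢u : t ≢ u
                  t≢u refl with trans (sym (eqᵇ-refl t)) eq
                  ... | ()
                  index-cong : ∀ {a a' b b' d d' : Fin M} → a ≡ a' → b ≡ b' → d ≡ d' → tri-index a b d ≡ tri-index a' b' d'
                  index-cong refl refl refl = refl
        ... | l , inj₁ refl , n₁ , n₂ , n₃ = via F _ _ _
                (λ v m → upd₃-i f i j k a b d v (ne-all n₁ n₂ n₃ v m) , upd₃-i f i j k a' b' d' v (ne-all n₁ n₂ n₃ v m))
                (proj₁ (proj₂ (fine-sound f i j k b d b' d' e₂)))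
        ... | l , inj₂ (inj₁ refl) , n₁ , n₂ , n₃ = via F _ _ _
                (λ v m → upd₃-j f i j k a b d v (ne-all n₁ n₂ n₃ v m) , upd₃-j f i j k a' b' d' v (ne-all n₁ n₂ n₃ v m))
                (proj₂ (proj₂ (fine-sound f i j k a d a' d' e₃)))
        ... | l , inj₂ (inj₂ refl) , n₁ , n₂ , n₃ = via F _ _ _
                (λ v m → upd₃-k f i j k a b d v (ne-all n₁ n₂ n₃ v m) , upd₃-k f i j k a' b' d' v (ne-all n₁ n₂ n₃ v m))
                (proj₁ (fine-sound f i j k a b a' b' e₁))
        active : ∀ u → eqᵇ t u ≡ false → ∀ F → (F ≢ one → tri₁ u Fin.< tri₂ u × tri₂ u Fin.< tri₃ u) →
          value F g (tri₁ u) (tri₂ u) (tri₃ u) ≡ value F g' (tri₁ u) (tri₂ u) (tri₃ u)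
        active u eq one iu = refl
        active u eq edge iu = case u eq edge (iu (λ ()))
        active u eq weight iu = case u eq weight (iu (λ ()))
        go : ∀ u → value (without t s u) g (tri₁ u) (tri₂ u) (tri₃ u) ≡ value (without t s u) g' (tri₁ u) (tri₂ u) (tri₃ u)
        go u with eqᵇ t u in eq
        ... | true = refl
        ... | false = active u eq (s u) (inc u)

      module _ (α : ℚ) (0<α : 0ℚ < α)
        (regular : ∀ (c' : V → V → Fin K⁺) → Ref₂ c' c → NoGain α c c') where

        replace-edge : ∀ s → Increasing s → ∀ t → s t ≡ edge →
          𝔼 (pow E M) (λ x → P (replace t s) (lookup x)) ≤ 𝔼 (pow E M) (λ x → P s (lookup x)) + α
        replace-edge s inc t st = subst₂ _≤_
            (sym (resample₃ E (P (replace t s)) (P-resp (replace t s)) i j k))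
            (trans (𝔼-+ (pow E M) _ _) (cong₂ _+_ (sym (resample₃ E (P s) (P-resp s) i j k)) (𝔼-const (pow E M) α)))
            (𝔼-mono (pow E M) (λ x → at (lookup x)))
          where
          i = tri₁ t
          j = tri₂ t
          k = tri₃ t
          i<j = proj₁ (inc t (λ e → case trans (sym st) e of-absurd))
            where case_of-absurd : edge ≡ one → ⊥
                  case () of-absurd
          j<k = proj₂ (inc t (λ e → case trans (sym st) e of-absurd))
            where case_of-absurd : edge ≡ one → ⊥
                  case () of-absurd
          i≢j : i ≢ j
          i≢j e = ℕP.<-irrefl (cong toℕ e) i<j
          j≢k : j ≢ k
          j≢k e = ℕP.<-irrefl (cong toℕ e) j<k
          i≢k : i ≢ k
          i≢k e = ℕP.<-irrefl (cong toℕ e) (ℕP.<-trans i<j j<k)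
          without-same : ∀ u → without t (replace t s) u ≡ without t s u
          without-same u with eqᵇ t u
          ... | true = refl
          ... | false = refl
          replaced : replace t s t ≡ weight
          replaced = trans (cong (λ z → if z then to-weight (s t) else s t) (eqᵇ-refl t)) (cong to-weight st)
          at : ∀ f → 𝔼 E (λ a → 𝔼 E (λ b → 𝔼 E (λ d → P (replace t s) (upd₃ f i j k a b d))))
            ≤ 𝔼 E (λ a → 𝔼 E (λ b → 𝔼 E (λ d → P s (upd₃ f i j k a b d)))) + α
          at f = 0≤-⇒≤ (subst (0ℚ ≤_) (shift _ _ α) (≤⇒0≤- (subst₂ (λ y z → y - α ≤ z)
              (𝔼-cong E (λ a → 𝔼-cong E (λ b → 𝔼-cong E (λ d → sym (w-eq a b d)))))
              (𝔼-cong E (λ a → 𝔼-cong E (λ b → 𝔼-cong E (λ d → sym (h-eq a b d)))))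
              (Test.lower c (fine f i j k) (fine-refines f i j k i≢j) α 0<α (regular _ (fine-refines f i j k i≢j))
                (λ a b d → P (without t s) (upd₃ f i j k a b d)) (λ a b d → P-01 (without t s) _)
                (rest-measurable s inc t i<j j<k f)))))
            where
            at-i : ∀ a b d → upd₃ f i j k a b d i ≡ a
            at-i a b d = trans (upd-other _ d (λ e → i≢k (sym e))) (trans (upd-other _ b (λ e → i≢j (sym e))) (upd-same f i a))
            at-j : ∀ a b d → upd₃ f i j k a b d j ≡ b
            at-j a b d = trans (upd-other _ d (λ e → j≢k (sym e))) (upd-same _ j b)
            at-k : ∀ a b d → upd₃ f i j k a b d k ≡ d
            at-k a b d = upd-same _ k d
            h-eq : ∀ a b d → P s (upd₃ f i j k a b d) ≡ 𝟙 (h a b d) * P (without t s) (upd₃ f i j k a b d)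
            h-eq a b d = trans (P-pull s t _) (cong (_* P (without t s) (upd₃ f i j k a b d))
              (trans (cong (λ z → value z (upd₃ f i j k a b d) i j k) st)
                     (cong 𝟙 (cong₃ h (at-i a b d) (at-j a b d) (at-k a b d)))))
              where cong₃ : ∀ {A B : Set} (f : A → A → A → B) {x x' y y' z z'} → x ≡ x' → y ≡ y' → z ≡ z' → f x y z ≡ f x' y' z'
                    cong₃ f refl refl refl = refl
            w-eq : ∀ a b d → P (replace t s) (upd₃ f i j k a b d) ≡ W c (c a b) (c b d) (c a d) * P (without t s) (upd₃ f i j k a b d)
            w-eq a b d = trans (P-pull (replace t s) t _) (cong₂ _*_
              (trans (cong (λ z → value z (upd₃ f i j k a b d) i j k) replaced)
                     (cong₃ (λ x y z → W c (c x y) (c y z) (c x z)) (at-i a b d) (at-j a b d) (at-k a b d)))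
              (P-cong-s without-same _))
              where cong₃ : ∀ {A B : Set} (f : A → A → A → B) {x x' y y' z z'} → x ≡ x' → y ≡ y' → z ≡ z' → f x y z ≡ f x' y' z'
                    cong₃ f refl refl refl = refl

        replace-any : ∀ s → Increasing s → ∀ t →
          𝔼 (pow E M) (λ x → P (replace t s) (lookup x)) ≤ 𝔼 (pow E M) (λ x → P s (lookup x)) + α
        replace-any s inc t = by (s t) refl
          where
          trivial : to-weight (s t) ≡ s t → 𝔼 (pow E M) (λ x → P (replace t s) (lookup x)) ≤ 𝔼 (pow E M) (λ x → P s (lookup x)) + α
          trivial e = ≤-trans (≡⇒≤ (trans (𝔼-cong (pow E M) (λ x → P-cong-s same (lookup x))) (sym (+-identityʳ _)))) (+-monoʳ-≤ _ (<⇒≤ 0<α))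
            where same : ∀ u → replace t s u ≡ s u
                  same u with eqᵇ t u in eq
                  ... | true = subst (λ z → to-weight (s z) ≡ s z) (eqᵇ-sound t u eq) e
                  ... | false = refl
          by : ∀ F → s t ≡ F → 𝔼 (pow E M) (λ x → P (replace t s) (lookup x)) ≤ 𝔼 (pow E M) (λ x → P s (lookup x)) + α
          by one e = trivial (trans (cong to-weight e) (sym e))
          by edge e = replace-edge s inc t e
          by weight e = trivial (trans (cong to-weight e) (sym e))

        increasing-replace : ∀ s t → Increasing s → Increasing (replace t s)
        increasing-replace s t inc u ne = inc u (λ e → ne (lem e))
          where lem : s u ≡ one → replace t s u ≡ one
                lem e with eqᵇ t u
                ... | true = cong to-weight e
                ... | false = e

        replace-list : ∀ Ts s → Increasing s →
          𝔼 (pow E M) (λ x → P (replaceAll Ts s) (lookup x)) ≤ 𝔼 (pow E M) (λ x → P s (lookup x)) + fromℕ (length Ts) * α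
        replace-list [] s inc = ≡⇒≤ (sym (trans (cong (_ +_) (*-zeroˡ α)) (+-identityʳ _)))
        replace-list (t ∷ Ts) s inc = ≤-trans (replace-list Ts (replace t s) (increasing-replace s t inc))
          (≤-trans (+-monoˡ-≤ _ (replace-any s inc t)) (≡⇒≤ (regroup _ α (fromℕ (length Ts)))))

        edges-to-weights : ∀ s → Increasing s →
          𝔼 (pow E M) (λ x → P (λ t → to-weight (s t)) (lookup x)) ≤ 𝔼 (pow E M) (λ x → P s (lookup x)) + fromℕ N * α
        edges-to-weights s inc = subst₂ _≤_
          (𝔼-cong (pow E M) (λ x → P-cong-s (λ t → replaceAll-done (allFin N) s t (inj₁ (∈-allFin t))) (lookup x)))
          (cong (λ z → 𝔼 (pow E M) (λ x → P s (lookup x)) + fromℕ z * α) (length-tabulate {n = N} (λ i → i)))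
          (replace-list (allFin N) s inc)

module IndependentColours where

  open Conditioning
  open Tuples
  open import Data.Vec using (lookup)

  private opaque
    unfolding -_
    shift : ∀ w e α → e - (w - α) ≡ e + α - w
    shift = solve-∀ ℚ-ring
    regroup : ∀ p α l → p + l * α + α ≡ p + (1ℚ + l) * α
    regroup = solve-∀ ℚ-ring

  missing₂ : ∀ {M} (i j l m : Fin M) → i Fin.< j → l Fin.< m → ¬ (l ≡ i × m ≡ j) → (j ≢ l × j ≢ m) ⊎ (i ≢ l × i ≢ m)
  missing₂ i j l m i<j l<m ne with j FinP.≟ l | j FinP.≟ m
  ... | no p | no q = inj₁ (p , q)
  ... | yes refl | _ = inj₂ ((λ { refl → ℕP.<-irrefl refl i<j }) , (λ { refl → ℕP.<-asym i<j l<m }))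
  ... | no _ | yes refl = inj₂ ((λ { refl → ne (refl , refl) }) , (λ { refl → ℕP.<-irrefl refl i<j }))

  module _ {I : Set} (_≟I_ : DecidableEquality I) where

    opaque
      set : ∀ {Γ : Set} → (I → Γ) → I → Γ → I → Γ
      set g ι γ κ with ι ≟I κ
      ... | yes _ = γ
      ... | no _ = g κ

      set-same : ∀ {Γ : Set} (g : I → Γ) ι γ → set g ι γ ι ≡ γ
      set-same g ι γ with ι ≟I ι
      ... | yes _ = refl
      ... | no ne = ⊥-elim (ne refl)

      set-other : ∀ {Γ : Set} (g : I → Γ) {ι κ} γ → ι ≢ κ → set g ι γ κ ≡ g κ
      set-other g {ι} {κ} γ ne with ι ≟I κ
      ... | yes e = ⊥-elim (ne e)
      ... | no _ = refl

      set-at : ∀ {Γ : Set} {g g' : I → Γ} ι γ κ → g κ ≡ g' κ → set g ι γ κ ≡ set g' ι γ κ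
      set-at ι γ κ e with ι ≟I κ
      ... | yes _ = refl
      ... | no _ = e

    -- independent resampling of the variables in a list
    EL : ∀ {Γ : Set} → (I → Ex Γ) → List I → ((I → Γ) → ℚ) → (I → Γ) → ℚ
    EL p [] Φ g = Φ g
    EL p (ι ∷ is) Φ g = 𝔼 (p ι) (λ γ → EL p is Φ (set g ι γ))

  module Colour-level {n K : ℕ} (E : Ex (Fin n)) (x₀ : Fin n) (faithful : Faithful E) (c : Fin n → Fin n → Fin K) where

    private V = Fin n

    E₂ : Ex (V × V)
    E₂ = E ⊗ E

    faithful₂ : Faithful E₂
    faithful₂ = Faithful-⊗ E E faithful faithful

    colour : Fin K → V × V → ℚ
    colour γ (a , b) = 𝟙 (eqᵇ (c a b) γ)

    colour-01 : ∀ γ → In01 (colour γ)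
    colour-01 γ _ = 0≤𝟙 _ , 𝟙≤1 _

    C₂ : ∀ {k} → (V → Fin k) → V × V → Fin (k ℕ.* k)
    C₂ d (a , b) = combine (d a) (d b)

    -- the distribution of the colour of a random pair of vertices of given types
    p : ∀ {k} → (V → Fin k) → Fin k → Fin k → Ex (Fin K)
    p d δ δ' = map-Ex (λ (a , b) → c a b) (cond E₂ (λ ab → eqᵇ (C₂ d ab) (combine δ δ')) (x₀ , x₀))

    energy : ∀ {k} → (V → Fin k) → ℚ
    energy d = ∑ (λ γ → energy₁ E₂ (x₀ , x₀) faithful₂ (C₂ d) (colour γ))

    NoGain : ∀ {k k'} → ℚ → (V → Fin k) → (V → Fin k') → Set
    NoGain η d d' = energy d' ≤ energy d + η

    module Test {k k' : ℕ} (d : V → Fin k) (d' : V → Fin k') (r : ∀ a b → d' a ≡ d' b → d a ≡ d b)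
      (α κ : ℚ) (0<α : 0ℚ < α) (0≤κ : 0ℚ ≤ κ) (κK : κ * fromℕ K ≡ 1ℚ) (ng : NoGain (α * α * κ) d d')
      (φ : Fin K → V → V → ℚ) (φ01 : ∀ γ a b → 0ℚ ≤ φ γ a b × φ γ a b ≤ 1ℚ)
      (φm : ∀ γ a b a' b' → d' a ≡ d' a' → d' b ≡ d' b' → φ γ a b ≡ φ γ a' b') where

      private
        r' : Refines (C₂ d') (C₂ d)
        r' (a , b) (a' , b') e with FinP.combine-injective _ _ _ _ e
        ... | e₁ , e₂ = cong₂ combine (r a a' e₁) (r b b' e₂)

      lower : 𝔼 E (λ a → 𝔼 E (λ b → 𝔼 (p d (d a) (d b)) (λ γ → φ γ a b))) - α ≤ 𝔼 E (λ a → 𝔼 E (λ b → φ (c a b) a b))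
      lower = subst₂ (λ y z → y - α ≤ z)
        (trans (sym (𝔼-∑ E₂ (λ γ x → cexp E₂ (x₀ , x₀) faithful₂ (C₂ d) (colour γ) (C₂ d x) * φ γ (proj₁ x) (proj₂ x))))
          (𝔼-cong E₂ (λ (a , b) → trans (∑-cong (λ γ → *-comm _ (φ γ a b))) (sym (𝔼-fin (p d (d a) (d b)) (λ γ → φ γ a b))))))
        (trans (sym (𝔼-∑ E₂ (λ γ x → colour γ x * φ γ (proj₁ x) (proj₂ x))))
          (𝔼-cong E₂ (λ (a , b) → trans (∑-cong (λ γ → *-comm _ (φ γ a b))) (∑-δ (λ γ → φ γ a b) (c a b)))))
        (decouple-lower E₂ (x₀ , x₀) faithful₂ colour colour-01 (C₂ d) (C₂ d') r' α κ 0<α 0≤κ κK ng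
          (λ γ x → φ γ (proj₁ x) (proj₂ x)) (λ γ _ → φ01 γ _ _)
          (λ γ x y e → let (e₁ , e₂) = FinP.combine-injective _ _ _ _ e in φm γ _ _ _ _ e₁ e₂))

    module Resampling (M : ℕ) {k : ℕ} (d : V → Fin k)
      {I : Set} (_≟I_ : DecidableEquality I) (src tgt : I → Fin M)
      (sel : Fin M → Fin M → I) (src-sel : ∀ i j → src (sel i j) ≡ i) (tgt-sel : ∀ i j → tgt (sel i j) ≡ j)
      (Ψ : (I → Fin K) → (Fin M → Fin k) → ℚ)
      (Ψ01 : ∀ g δ → 0ℚ ≤ Ψ g δ × Ψ g δ ≤ 1ℚ)
      (Ψ-cong : ∀ {g g' δ δ'} → (∀ i j → i Fin.< j → g (sel i j) ≡ g' (sel i j)) → (∀ v → δ v ≡ δ' v) → Ψ g δ ≡ Ψ g' δ') where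

      true-colours : (Fin M → V) → I → Fin K
      true-colours f ι = c (f (src ι)) (f (tgt ι))

      law : (Fin M → V) → I → Ex (Fin K)
      law f ι = p d (d (f (src ι))) (d (f (tgt ι)))

      Φ : List I → (I → Fin K) → (Fin M → V) → ℚ
      Φ is g f = EL _≟I_ (law f) is (λ g → Ψ g (λ v → d (f v))) g

      Φ01 : ∀ is g f → 0ℚ ≤ Φ is g f × Φ is g f ≤ 1ℚ
      Φ01 [] g f = Ψ01 g _
      Φ01 (ι ∷ is) g f = 0≤𝔼 (law f ι) (λ γ → proj₁ (Φ01 is (set _≟I_ g ι γ) f)) , 𝔼≤ (law f ι) (λ γ → proj₂ (Φ01 is (set _≟I_ g ι γ) f))

      Φ-cong : ∀ is {g g' f f'} → (∀ i j → i Fin.< j → g (sel i j) ≡ g' (sel i j)) → (∀ v → d (f v) ≡ d (f' v)) → Φ is g f ≡ Φ is g' f'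
      Φ-cong [] e e' = Ψ-cong e e'
      Φ-cong (ι ∷ is) {g} {g'} {f} {f'} e e' = trans
        (𝔼-cong (law f ι) (λ γ → Φ-cong is {set _≟I_ g ι γ} {set _≟I_ g' ι γ} {f} {f'} (λ i j i<j → set-at _≟I_ ι γ (sel i j) (e i j i<j)) e'))
        (cong₂ (λ δ δ' → 𝔼 (p d δ δ') (λ γ → Φ is (set _≟I_ g' ι γ) f')) (e' (src ι)) (e' (tgt ι)))

      Φ-true-resp : ∀ is → Respects (λ f → Φ is (true-colours f) f)
      Φ-true-resp is e = Φ-cong is (λ i j _ → cong₂ c (e _) (e _)) (λ v → cong d (e v))

      L = K ℕ.^ #triples M

      code : (Fin M → V) → Fin L
      code f = funToFin (λ t → c (f (tri₁ t)) (f (tri₂ t)))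

      code-sound : ∀ f g → code f ≡ code g → ∀ a b → c (f a) (f b) ≡ c (g a) (g b)
      code-sound f g e a b = subst₂ (λ x y → c (f x) (f y) ≡ c (g x) (g y)) (tri₁-index a b b) (tri₂-index a b b)
        (funToFin-injective _ _ e (tri-index a b b))

      k⁺ = k ℕ.* (L ℕ.* L)

      fine : (Fin M → V) → Fin M → Fin M → V → Fin k⁺
      fine f i j u = combine (d u) (combine (code (upd f i u)) (code (upd f j u)))

      fine-sound : ∀ f i j u v → fine f i j u ≡ fine f i j v →
        d u ≡ d v × code (upd f i u) ≡ code (upd f i v) × code (upd f j u) ≡ code (upd f j v)
      fine-sound f i j u v e with FinP.combine-injective _ _ _ _ e
      ... | e₁ , e₂ with FinP.combine-injective _ _ _ _ e₂
      ... | e₃ , e₄ = e₁ , e₃ , e₄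

      module _ (α κ : ℚ) (0<α : 0ℚ < α) (0≤κ : 0ℚ ≤ κ) (κK : κ * fromℕ K ≡ 1ℚ)
        (regular : ∀ (d' : V → Fin k⁺) → (∀ a b → d' a ≡ d' b → d a ≡ d b) → NoGain (α * α * κ) d d') where

        step-active : ∀ ι is → src ι Fin.< tgt ι → sel (src ι) (tgt ι) ≡ ι →
          𝔼 (pow E M) (λ x → Φ (ι ∷ is) (true-colours (lookup x)) (lookup x))
            ≤ 𝔼 (pow E M) (λ x → Φ is (true-colours (lookup x)) (lookup x)) + α
        step-active ι is i<j sel-ι = subst₂ _≤_
            (sym (resample₂ E _ (Φ-true-resp (ι ∷ is)) i j))
            (trans (𝔼-+ (pow E M) _ _) (cong₂ _+_ (sym (resample₂ E _ (Φ-true-resp is) i j)) (𝔼-const (pow E M) α)))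
            (𝔼-mono (pow E M) (λ x → at (lookup x)))
          where
          i = src ι
          j = tgt ι
          i≢j : i ≢ j
          i≢j e = ℕP.<-irrefl (cong toℕ e) i<j
          upd₂ : (Fin M → V) → V → V → Fin M → V
          upd₂ f a b = upd (upd f i a) j b
          at-i : ∀ f a b → upd₂ f a b i ≡ a
          at-i f a b = trans (upd-other _ b (λ e → i≢j (sym e))) (upd-same f i a)
          at-j : ∀ f a b → upd₂ f a b j ≡ b
          at-j f a b = upd-same _ j b
          φ : (Fin M → V) → Fin K → V → V → ℚ
          φ f γ a b = Φ is (set _≟I_ (true-colours (upd₂ f a b)) ι γ) (upd₂ f a b)
          measurable : ∀ f γ a b a' b' → fine f i j a ≡ fine f i j a' → fine f i j b ≡ fine f i j b' → φ f γ a b ≡ φ f γ a' b'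
          measurable f γ a b a' b' e₁ e₂ = Φ-cong is entry types
            where
            sa = fine-sound f i j a a' e₁
            sb = fine-sound f i j b b' e₂
            types : ∀ v → d (upd₂ f a b v) ≡ d (upd₂ f a' b' v)
            types v with j FinP.≟ v
            ... | yes refl = trans (cong d (at-j f a b)) (trans (proj₁ sb) (cong d (sym (at-j f a' b'))))
            ... | no j≢v with i FinP.≟ v
            ...   | yes refl = trans (cong d (at-i f a b)) (trans (proj₁ sa) (cong d (sym (at-i f a' b'))))
            ...   | no i≢v = cong d (trans (upd-other _ b j≢v) (trans (upd-other f a i≢v) (sym (trans (upd-other _ b' j≢v) (upd-other f a' i≢v)))))
            entry : ∀ l m → l Fin.< m → set _≟I_ (true-colours (upd₂ f a b)) ι γ (sel l m) ≡ set _≟I_ (true-colours (upd₂ f a' b')) ι γ (sel l m)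
            entry l m l<m with ι ≟I sel l m
            ... | yes e = subst (λ z → set _≟I_ (true-colours (upd₂ f a b)) ι γ z ≡ set _≟I_ (true-colours (upd₂ f a' b')) ι γ z) e
                            (trans (set-same _≟I_ _ ι γ) (sym (set-same _≟I_ _ ι γ)))
            ... | no ne = set-at _≟I_ ι γ (sel l m)
                    (subst₂ (λ y z → c (upd₂ f a b y) (upd₂ f a b z) ≡ c (upd₂ f a' b' y) (upd₂ f a' b' z)) (sym (src-sel l m)) (sym (tgt-sel l m))
                      (agree (missing₂ i j l m i<j l<m (λ { (e , e') → ne (trans (sym sel-ι) (cong₂ sel (sym e) (sym e'))) }))))
              where
              agree : (j ≢ l × j ≢ m) ⊎ (i ≢ l × i ≢ m) → c (upd₂ f a b l) (upd₂ f a b m) ≡ c (upd₂ f a' b' l) (upd₂ f a' b' m)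
              agree (inj₁ (jl , jm)) = trans (cong₂ c (upd-other _ b jl) (upd-other _ b jm))
                (trans (code-sound (upd f i a) (upd f i a') (proj₁ (proj₂ sa)) l m) (sym (cong₂ c (upd-other _ b' jl) (upd-other _ b' jm))))
              agree (inj₂ (il , im)) = trans (cong₂ c (upd-at j b l (upd-other f a il)) (upd-at j b m (upd-other f a im)))
                (trans (code-sound (upd f j b) (upd f j b') (proj₂ (proj₂ sb)) l m) (sym (cong₂ c (upd-at j b' l (upd-other f a' il)) (upd-at j b' m (upd-other f a' im)))))
          at : ∀ f → 𝔼 E (λ a → 𝔼 E (λ b → Φ (ι ∷ is) (true-colours (upd₂ f a b)) (upd₂ f a b)))
                    ≤ 𝔼 E (λ a → 𝔼 E (λ b → Φ is (true-colours (upd₂ f a b)) (upd₂ f a b))) + α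
          at f = 0≤-⇒≤ (subst (0ℚ ≤_) (shift _ _ α) (≤⇒0≤- (subst₂ (λ y z → y - α ≤ z)
              (𝔼-cong E (λ a → 𝔼-cong E (λ b → cong₂ (λ y z → 𝔼 (p d (d y) (d z)) (λ γ → φ f γ a b)) (sym (at-i f a b)) (sym (at-j f a b)))))
              (𝔼-cong E (λ a → 𝔼-cong E (λ b → Φ-cong is (true-entry a b) (λ v → refl))))
              (Test.lower d (fine f i j) (λ a b e → proj₁ (fine-sound f i j a b e)) α κ 0<α 0≤κ κK
                (regular _ (λ a b e → proj₁ (fine-sound f i j a b e))) (φ f) (λ γ a b → Φ01 is _ _) (measurable f)))))
            where
            true-entry : ∀ a b l m → l Fin.< m →
              set _≟I_ (true-colours (upd₂ f a b)) ι (c a b) (sel l m) ≡ true-colours (upd₂ f a b) (sel l m)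
            true-entry a b l m _ with ι ≟I sel l m
            ... | yes e = subst (λ z → set _≟I_ (true-colours (upd₂ f a b)) ι (c a b) z ≡ true-colours (upd₂ f a b) z) e
                            (trans (set-same _≟I_ _ ι (c a b)) (cong₂ c (sym (at-i f a b)) (sym (at-j f a b))))
            ... | no ne = set-other _≟I_ _ (c a b) ne

        step-inactive : ∀ ι is → ¬ (src ι Fin.< tgt ι × sel (src ι) (tgt ι) ≡ ι) → ∀ g f → Φ (ι ∷ is) g f ≡ Φ is g f
        step-inactive ι is na g f = trans
          (𝔼-cong (law f ι) (λ γ → Φ-cong is {set _≟I_ g ι γ} {g} {f} {f} (λ l m l<m → set-other _≟I_ g γ (λ { refl → na
            (subst₂ Fin._<_ (sym (src-sel l m)) (sym (tgt-sel l m)) l<m , cong₂ sel (src-sel l m) (tgt-sel l m)) })) (λ _ → refl)))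
          (𝔼-const (law f ι) _)

        step : ∀ ι is → 𝔼 (pow E M) (λ x → Φ (ι ∷ is) (true-colours (lookup x)) (lookup x))
            ≤ 𝔼 (pow E M) (λ x → Φ is (true-colours (lookup x)) (lookup x)) + α
        step ι is with src ι FinP.<? tgt ι | sel (src ι) (tgt ι) ≟I ι
        ... | yes l< | yes e = step-active ι is l< e
        ... | no nlt | _ = ≤-trans (≡⇒≤ (trans (𝔼-cong (pow E M) (λ x → step-inactive ι is (λ q → nlt (proj₁ q)) _ (lookup x))) (sym (+-identityʳ _)))) (+-monoʳ-≤ _ (<⇒≤ 0<α))
        ... | _ | no ne = ≤-trans (≡⇒≤ (trans (𝔼-cong (pow E M) (λ x → step-inactive ι is (λ q → ne (proj₂ q)) _ (lookup x))) (sym (+-identityʳ _)))) (+-monoʳ-≤ _ (<⇒≤ 0<α))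

        decorrelate : ∀ is → 𝔼 (pow E M) (λ x → Φ is (true-colours (lookup x)) (lookup x))
          ≤ 𝔼 (pow E M) (λ x → Ψ (true-colours (lookup x)) (λ v → d (lookup x v))) + fromℕ (length is) * α
        decorrelate [] = ≡⇒≤ (sym (trans (cong (_ +_) (*-zeroˡ α)) (+-identityʳ _)))
        decorrelate (ι ∷ is) = ≤-trans (step ι is) (≤-trans (+-monoˡ-≤ α (decorrelate is)) (≡⇒≤ (regroup _ α (fromℕ (length is)))))

module RamseyTheory where

  open import Data.List.Relation.Binary.Sublist.Propositional using (_⊆_)

  shorten : ∀ {A : Set} m (xs : List A) → m ℕ.≤ length xs → Σ (List A) λ ys → ys ⊆ xs × length ys ≡ m
  shorten zero xs _ = [] , minimum xs , refl
  shorten (suc m) (x ∷ xs) (s≤s p) with shorten m xs p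
  ... | ys , q , e = x ∷ ys , refl ∷ q , cong suc e

  Hom : ∀ {A : Set} → ℕ → (List A → Set) → List A → Set
  Hom r P ys = ∀ {zs} → zs ⊆ ys → length zs ≡ r → P zs

  Decided : ∀ {A : Set} → ℕ → (List A → Set) → List A → Set
  Decided r P ys = Hom r P ys ⊎ Hom r (λ zs → ¬ P zs) ys

  Hom-⊆ : ∀ {A : Set} {r} {P : List A → Set} {xs ys} → xs ⊆ ys → Hom r P ys → Hom r P xs
  Hom-⊆ s H t = H (⊆-trans t s)

  Decided-⊆ : ∀ {A : Set} {r} {P : List A → Set} {xs ys} → xs ⊆ ys → Decided r P ys → Decided r P xs
  Decided-⊆ s (inj₁ H) = inj₁ (Hom-⊆ s H)
  Decided-⊆ s (inj₂ H) = inj₂ (Hom-⊆ s H)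

  -- the property of an (r+1)-element sublist depends on its first element only
  data EndHom {A : Set} (r : ℕ) (P : List A → Set) : List A → Set where
    []  : EndHom r P []
    _∷_ : ∀ {y ys} → Decided r (λ zs → P (y ∷ zs)) ys → EndHom r P ys → EndHom r P (y ∷ ys)

  pigeonhole : ∀ {A : Set} {r} {P : List A → Set} a b ys → EndHom r P ys → a ℕ.+ b ℕ.≤ length ys →
    (Σ (List A) λ zs → zs ⊆ ys × length zs ≡ a × Hom (suc r) P zs) ⊎
    (Σ (List A) λ zs → zs ⊆ ys × length zs ≡ b × Hom (suc r) (λ zs → ¬ P zs) zs)
  pigeonhole zero b ys H le = inj₁ ([] , minimum ys , refl , λ { [] () })
  pigeonhole (suc a) zero ys H le = inj₂ ([] , minimum ys , refl , λ { [] () })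
  pigeonhole (suc a) (suc b) (y ∷ ys) (inj₁ p ∷ H) (s≤s le) with pigeonhole a (suc b) ys H le
  ... | inj₂ (zs , s , l , h) = inj₂ (zs , y ∷ʳ s , l , h)
  ... | inj₁ (zs , s , l , h) = inj₁ (y ∷ zs , refl ∷ s , cong suc l ,
          λ { (.y ∷ʳ t) e → h t e ; (refl ∷ t) e → p (⊆-trans t s) (ℕP.suc-injective e) })
  pigeonhole (suc a) (suc b) (y ∷ ys) (inj₂ p ∷ H) (s≤s le) with pigeonhole (suc a) b ys H (subst (ℕ._≤ length ys) (+-suc a b) le)
  ... | inj₁ (zs , s , l , h) = inj₁ (zs , y ∷ʳ s , l , h)
  ... | inj₂ (zs , s , l , h) = inj₂ (y ∷ zs , refl ∷ s , cong suc l ,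
          λ { (.y ∷ʳ t) e → h t e ; (refl ∷ t) e → p (⊆-trans t s) (ℕP.suc-injective e) })

  Ramsey : ℕ → ℕ → ℕ → Set₁
  Ramsey r m N = ∀ {A : Set} (P : List A → Set) → (∀ zs → Dec (P zs)) → ∀ xs → N ℕ.≤ length xs →
    Σ (List A) λ ys → ys ⊆ xs × length ys ≡ m × Decided r P ys

  end-homogeneous : ∀ r → (∀ m → Σ ℕ (Ramsey r m)) → ∀ q → Σ ℕ λ N → ∀ {A : Set} (P : List A → Set) → (∀ zs → Dec (P zs)) →
    ∀ xs → N ℕ.≤ length xs → Σ (List A) λ ys → ys ⊆ xs × length ys ≡ q × EndHom r P ys
  end-homogeneous r R zero = 0 , λ P P? xs _ → [] , minimum xs , refl , []
  end-homogeneous r R (suc q) with end-homogeneous r R q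
  ... | N , eh with R N
  ... | N' , ram = suc N' , λ { P P? (x ∷ xs) (s≤s le) → go P P? x xs (ram (λ zs → P (x ∷ zs)) (λ zs → P? (x ∷ zs)) xs le) }
    where
    go : ∀ {A : Set} (P : List A → Set) → (∀ zs → Dec (P zs)) → ∀ x xs →
      (Σ (List A) λ ys → ys ⊆ xs × length ys ≡ N × Decided r (λ zs → P (x ∷ zs)) ys) →
      Σ (List A) λ ys → ys ⊆ x ∷ xs × length ys ≡ suc q × EndHom r P ys
    go P P? x xs (ys , s , l , h) with eh P P? ys (ℕP.≤-reflexive (sym l))
    ... | zs , t , l' , H = x ∷ zs , refl ∷ ⊆-trans t s , cong suc l' , Decided-⊆ t h ∷ H

  ramsey : ∀ r m → Σ ℕ (Ramsey r m)
  ramsey zero m = m , go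
    where
    go : Ramsey zero m m
    go P P? xs le with shorten m xs le | P? []
    ... | ys , s , l | yes p = ys , s , l , inj₁ (λ { {[]} _ _ → p })
    ... | ys , s , l | no ¬p = ys , s , l , inj₂ (λ { {[]} _ _ → ¬p })
  ramsey (suc r) m with end-homogeneous r (ramsey r) (m ℕ.+ m)
  ... | N , eh = N , go
    where
    go : Ramsey (suc r) m N
    go P P? xs le with eh P P? xs le
    ... | ys , s , l , H with pigeonhole m m ys H (ℕP.≤-reflexive (sym l))
    ... | inj₁ (zs , t , l' , h) = zs , ⊆-trans t s , l' , inj₁ h
    ... | inj₂ (zs , t , l' , h) = zs , ⊆-trans t s , l' , inj₂ h

  opaque
    ramsey-bound : ℕ → ℕ → ℕ
    ramsey-bound r m = proj₁ (ramsey r m)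

    ramsey-property : ∀ r m → Ramsey r m (ramsey-bound r m)
    ramsey-property r m = proj₂ (ramsey r m)

  Unavoidable : ∀ {A : Set} → (List A → Set) → ℕ → ℕ → (List A → Set) → Set
  Unavoidable {A} Cl m L P = ∀ xs → Cl xs → L ℕ.≤ length xs → Σ (List A) λ ys → ys ⊆ xs × length ys ≡ m × P ys

  both-bound : ℕ → ℕ → ℕ → ℕ
  both-bound m L₁ L₂ = ramsey-bound m (L₁ ⊔ L₂)

  -- On a list homogeneous for the first property, all m-element sublists have it.
  unavoidable-both : ∀ {A : Set} (Cl : List A → Set) → (∀ {xs ys} → xs ⊆ ys → Cl ys → Cl xs) → ∀ m L₁ L₂ (P Q : List A → Set) →
    (∀ zs → Dec (P zs)) → Unavoidable Cl m L₁ P → Unavoidable Cl m L₂ Q →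
    Unavoidable Cl m (both-bound m L₁ L₂) (λ zs → P zs × Q zs)
  unavoidable-both Cl her m L₁ L₂ P Q P? UP UQ xs cl le with ramsey-property m (L₁ ⊔ L₂) P P? xs le
  ... | ys , s , l , inj₂ H with UP ys (her s cl) (subst (L₁ ℕ.≤_) (sym l) (m≤m⊔n L₁ L₂))
  ...   | zs , t , l' , p = ⊥-elim (H t l' p)
  unavoidable-both Cl her m L₁ L₂ P Q P? UP UQ xs cl le | ys , s , l , inj₁ H
    with UQ ys (her s cl) (subst (L₂ ℕ.≤_) (sym l) (m≤n⊔m L₁ L₂))
  ... | zs , t , l' , q = zs , ⊆-trans t s , l' , H t l' , q

  all-bound : ℕ → ℕ → ℕ → ℕ
  all-bound m L zero = m
  all-bound m L (suc n) = both-bound m L (all-bound m L n)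

  unavoidable-all : ∀ {A : Set} (Cl : List A → Set) → (∀ {xs ys} → xs ⊆ ys → Cl ys → Cl xs) → ∀ m L n (P : ℕ → List A → Set) →
    (∀ i zs → Dec (P i zs)) → (∀ i → i ℕ.< n → Unavoidable Cl m L (P i)) →
    Unavoidable Cl m (all-bound m L n) (λ zs → ∀ i → i ℕ.< n → P i zs)
  unavoidable-all Cl her m L zero P P? U xs cl le with shorten m xs le
  ... | ys , s , l = ys , s , l , λ i ()
  unavoidable-all Cl her m L (suc n) P P? U xs cl le
    with unavoidable-both Cl her m L (all-bound m L n) (P n) (λ zs → ∀ i → i ℕ.< n → P i zs) (P? n) (U n ℕP.≤-refl)
           (unavoidable-all Cl her m L n P P? (λ i l< → U i (ℕP.m≤n⇒m≤1+n l<))) xs cl le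
  ... | ys , s , l , p , q = ys , s , l , all
    where
    all : ∀ i → i ℕ.< suc n → P i ys
    all i l< with i ℕP.≟ n
    ... | yes refl = p
    ... | no ne = q i (ℕP.≤∧≢⇒< (ℕP.≤-pred l<) ne)

  AllPairs-⊆ : ∀ {A : Set} {R : A → A → Set} {xs ys} → xs ⊆ ys → AllPairs R ys → AllPairs R xs
  AllPairs-⊆ [] [] = []
  AllPairs-⊆ (y ∷ʳ s) (_ ∷ p) = AllPairs-⊆ s p
  AllPairs-⊆ (refl ∷ s) (a ∷ p) = All-⊆ s a ∷ AllPairs-⊆ s p
    where
    All-⊆ : ∀ {A : Set} {P : A → Set} {xs ys} → xs ⊆ ys → All P ys → All P xs
    All-⊆ [] [] = []
    All-⊆ (y ∷ʳ s) (_ ∷ q) = All-⊆ s q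
    All-⊆ (refl ∷ s) (a ∷ q) = a ∷ All-⊆ s q

  ∈-⊆ : ∀ {A : Set} {x : A} {xs ys} → xs ⊆ ys → x ∈ xs → x ∈ ys
  ∈-⊆ (y ∷ʳ s) p = there (∈-⊆ s p)
  ∈-⊆ (refl ∷ s) (here e) = here e
  ∈-⊆ (refl ∷ s) (there p) = there (∈-⊆ s p)

  increasing-⊆ : ∀ {A : Set} {_≺_ : A → A → Set} → (∀ {x} → ¬ (x ≺ x)) → (∀ {x y z} → x ≺ y → y ≺ z → x ≺ z) →
    ∀ {zs ys} → AllPairs _≺_ zs → AllPairs _≺_ ys → All (_∈ ys) zs → zs ⊆ ys
  increasing-⊆ {A} {_≺_} irr tr {[]} {ys} _ _ _ = minimum ys
  increasing-⊆ {A} {_≺_} irr tr {z ∷ zs} {y ∷ ys} (a ∷ p) (b ∷ q) (z∈ ∷ m) = go z∈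
    where
    later : ∀ {ws} → All (y ≺_) ws → All (_∈ (y ∷ ys)) ws → All (_∈ ys) ws
    later [] [] = []
    later (l ∷ ls) (here refl ∷ ms) = ⊥-elim (irr l)
    later (l ∷ ls) (there i ∷ ms) = i ∷ later ls ms
    go : z ∈ y ∷ ys → z ∷ zs ⊆ y ∷ ys
    go (here refl) = refl ∷ increasing-⊆ irr tr p q (later a m)
    go (there i) = y ∷ʳ increasing-⊆ irr tr (a ∷ p) q (i ∷ later (All.map (tr (All.lookup b i)) a) m)

module Selection where

  open Archimedean
  open RamseyTheory
  open import Data.Bool.ListAction using (all)
  open import Data.List.Relation.Binary.Sublist.Propositional using (_⊆_)

  lsum : ∀ {X : Set} → (X → ℚ) → List X → ℚ
  lsum f [] = 0ℚ
  lsum f (x ∷ xs) = f x + lsum f xs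

  lsum-++ : ∀ {X : Set} (f : X → ℚ) xs ys → lsum f (xs ++ ys) ≡ lsum f xs + lsum f ys
  lsum-++ f [] ys = sym (+-identityˡ _)
  lsum-++ f (x ∷ xs) ys = trans (cong (f x +_) (lsum-++ f xs ys)) (sym (+-assoc _ _ _))

  lsum-map : ∀ {X Y : Set} (f : Y → ℚ) (φ : X → Y) xs → lsum f (map φ xs) ≡ lsum (λ x → f (φ x)) xs
  lsum-map f φ [] = refl
  lsum-map f φ (x ∷ xs) = cong (f (φ x) +_) (lsum-map f φ xs)

  0≤lsum : ∀ {X : Set} {f : X → ℚ} → (∀ x → 0ℚ ≤ f x) → ∀ xs → 0ℚ ≤ lsum f xs
  0≤lsum p [] = ≤-refl
  0≤lsum p (x ∷ xs) = 0≤+ (p x) (0≤lsum p xs)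

  𝔼-lsum : ∀ {X Y : Set} (E : Ex Y) (f : X → Y → ℚ) xs → 𝔼 E (λ y → lsum (λ x → f x y) xs) ≡ lsum (λ x → 𝔼 E (f x)) xs
  𝔼-lsum E f [] = 𝔼-const E 0ℚ
  𝔼-lsum E f (x ∷ xs) = trans (𝔼-+ E _ _) (cong (𝔼 E (f x) +_) (𝔼-lsum E f xs))

  lsum-search : ∀ {X : Set} (f : X → ℚ) θ xs → (Σ X λ x → θ ≤ f x) ⊎ (lsum f xs ≤ fromℕ (length xs) * θ)
  lsum-search f θ [] = inj₂ (≡⇒≤ (sym (*-zeroˡ θ)))
  lsum-search f θ (x ∷ xs) with θ ≤? f x | lsum-search f θ xs
  ... | yes p | _ = inj₁ (x , p)
  ... | no _ | inj₁ r = inj₁ r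
  ... | no q | inj₂ r = inj₂ (≤-trans (+-mono-≤ (<⇒≤ (≰⇒> q)) r)
          (≡⇒≤ (sym (trans (*-distribʳ-+ θ 1ℚ _) (cong₂ _+_ (*-identityˡ θ) refl)))))

  lsum-lower : ∀ {X : Set} (f : X → ℚ) τ xs → (∀ {x} → x ∈ xs → τ ≤ f x) → fromℕ (length xs) * τ ≤ lsum f xs
  lsum-lower f τ [] p = ≡⇒≤ (*-zeroˡ τ)
  lsum-lower f τ (x ∷ xs) p = ≤-trans (≡⇒≤ (trans (*-distribʳ-+ τ 1ℚ _) (cong₂ _+_ (*-identityˡ τ) refl)))
    (+-mono-≤ (p (here refl)) (lsum-lower f τ xs (λ i → p (there i))))

  Sub : ∀ {T : Set} → ℕ → List T → Set
  Sub {T} m ts = Σ (List T) λ zs → zs ⊆ ts × length zs ≡ m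

  add : ∀ {T : Set} {m} {ts : List T} t → Sub m ts → Sub (suc m) (t ∷ ts)
  add t (zs , s , l) = t ∷ zs , refl ∷ s , cong suc l

  skip : ∀ {T : Set} {m} {ts : List T} t → Sub m ts → Sub m (t ∷ ts)
  skip t (zs , s , l) = zs , t ∷ʳ s , l

  subs : ∀ {T : Set} m (ts : List T) → List (Sub m ts)
  subs zero ts = ([] , minimum ts , refl) ∷ []
  subs (suc m) [] = []
  subs (suc m) (t ∷ ts) = map (add t) (subs m ts) ++ map (skip t) (subs (suc m) ts)

  #subs : ℕ → ℕ → ℕ
  #subs zero n = 1
  #subs (suc m) zero = 0
  #subs (suc m) (suc n) = #subs m n ℕ.+ #subs (suc m) n

  length-subs : ∀ {T : Set} m (ts : List T) → length (subs m ts) ≡ #subs m (length ts)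
  length-subs zero ts = refl
  length-subs (suc m) [] = refl
  length-subs (suc m) (t ∷ ts) = trans (length-++ (map (add t) (subs m ts)))
    (cong₂ ℕ._+_ (trans (length-map (add t) (subs m ts)) (length-subs m ts)) (trans (length-map (skip t) (subs (suc m) ts)) (length-subs (suc m) ts)))

  count : ∀ {T : Set} → (T → Bool) → List T → ℕ
  count e [] = 0
  count e (t ∷ ts) = if e t then suc (count e ts) else count e ts

  count≤ : ∀ {T : Set} (e : T → Bool) ts → count e ts ℕ.≤ length ts
  count≤ e [] = z≤n
  count≤ e (t ∷ ts) with e t
  ... | true = s≤s (count≤ e ts)
  ... | false = ℕP.m≤n⇒m≤1+n (count≤ e ts)

  count-lsum : ∀ {T : Set} (e : T → Bool) ts → lsum (λ t → 𝟙 (e t)) ts ≡ fromℕ (count e ts)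
  count-lsum e [] = refl
  count-lsum e (t ∷ ts) with e t
  ... | true = cong (1ℚ +_) (count-lsum e ts)
  ... | false = trans (+-identityˡ _) (count-lsum e ts)

  all-subs : ∀ {T : Set} (e : T → Bool) m ts → m ℕ.≤ count e ts → 1ℚ ≤ lsum (λ z → 𝟙 (all e (proj₁ z))) (subs m ts)
  all-subs e zero ts _ = ≡⇒≤ (sym (+-identityʳ 1ℚ))
  all-subs e (suc m) (t ∷ ts) le = ≤-trans (split le) (≡⇒≤ (sym (trans (lsum-++ _ (map (add t) (subs m ts)) _)
      (cong₂ _+_ (lsum-map _ (add t) (subs m ts)) (lsum-map _ (skip t) (subs (suc m) ts))))))
    where
    split : suc m ℕ.≤ count e (t ∷ ts) →
      1ℚ ≤ lsum (λ z → 𝟙 (e t ∧ all e (proj₁ z))) (subs m ts) + lsum (λ z → 𝟙 (all e (proj₁ z))) (subs (suc m) ts)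
    split le with e t
    ... | true = ≤-trans (all-subs e m ts (ℕP.≤-pred le)) (≤-trans (≡⇒≤ (sym (+-identityʳ _))) (+-monoʳ-≤ _ (0≤lsum (λ _ → 0≤𝟙 _) (subs (suc m) ts))))
    ... | false = ≤-trans (all-subs e (suc m) ts le) (≤-trans (≡⇒≤ (sym (+-identityˡ _))) (+-monoˡ-≤ _ (0≤lsum (λ z → 0≤𝟙 (false ∧ all e (proj₁ z))) (subs m ts))))

  count-bound : ∀ {T : Set} (e : T → Bool) m ts →
    lsum (λ t → 𝟙 (e t)) ts ≤ fromℕ m + fromℕ (length ts) * lsum (λ z → 𝟙 (all e (proj₁ z))) (subs m ts)
  count-bound e m ts with m ℕP.≤? count e ts
  ... | yes le = ≤-trans (≡⇒≤ (count-lsum e ts)) (≤-trans (fromℕ-mono (count≤ e ts))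
         (≤-trans (≡⇒≤ (sym (*-identityʳ _))) (≤-trans (*-monoˡ (0≤fromℕ (length ts)) (all-subs e m ts le))
           (≤-trans (≡⇒≤ (sym (+-identityˡ _))) (+-monoˡ-≤ _ (0≤fromℕ m))))))
  ... | no nle = ≤-trans (≡⇒≤ (count-lsum e ts)) (≤-trans (fromℕ-mono (ℕP.<⇒≤ (ℕP.≰⇒> nle)))
         (≤-trans (≡⇒≤ (sym (+-identityʳ _))) (+-monoʳ-≤ _ (0≤* (0≤fromℕ (length ts)) (0≤lsum (λ _ → 0≤𝟙 _) (subs m ts))))))

  measure-pigeonhole : ∀ τ → 0ℚ < τ → ∀ m → Σ ℕ λ R → Σ ℚ λ θ → 0ℚ < θ × θ ≤ 1ℚ × (∀ {Γ T : Set} (E : Ex Γ) (ev : T → Γ → Bool) ts →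
    length ts ≡ R → (∀ {t} → t ∈ ts → τ ≤ 𝔼 E (λ γ → 𝟙 (ev t γ))) →
    Σ (List T) λ zs → zs ⊆ ts × length zs ≡ m × θ ≤ 𝔼 E (λ γ → 𝟙 (all (λ t → ev t γ) zs)))
  measure-pigeonhole τ 0<τ m = R , θ , inv-pos _ (0<fromℕ N) , θ≤1 , go
    where
    R = proj₁ (archimedean (fromℕ (suc (suc m))) 0<τ)
    R-big : fromℕ (suc (suc m)) ≤ fromℕ R * τ
    R-big = proj₂ (archimedean (fromℕ (suc (suc m))) 0<τ)
    N = R ℕ.* #subs m R
    θ = inv (fromℕ (suc N)) (0<fromℕ N)
    θ≤1 : θ ≤ 1ℚ
    θ≤1 = ≤-trans (≡⇒≤ (sym (*-identityˡ θ))) (≤-trans (*-monoʳ (<⇒≤ (inv-pos _ (0<fromℕ N)))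
      (≤-trans (≡⇒≤ (sym (+-identityʳ 1ℚ))) (+-monoʳ-≤ 1ℚ (0≤fromℕ N)))) (≡⇒≤ (inv-r _ (0<fromℕ N))))
    Nθ≤1 : fromℕ N * θ ≤ 1ℚ
    Nθ≤1 = ≤-trans (*-monoʳ (<⇒≤ (inv-pos _ (0<fromℕ N))) (fromℕ-mono (ℕP.n≤1+n N))) (≡⇒≤ (inv-r _ (0<fromℕ N)))
    go : ∀ {Γ T : Set} (E : Ex Γ) (ev : T → Γ → Bool) ts →
      length ts ≡ R → (∀ {t} → t ∈ ts → τ ≤ 𝔼 E (λ γ → 𝟙 (ev t γ))) →
      Σ (List T) λ zs → zs ⊆ ts × length zs ≡ m × θ ≤ 𝔼 E (λ γ → 𝟙 (all (λ t → ev t γ) zs))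
    go E ev ts lR p with lsum-search (λ z → 𝔼 E (λ γ → 𝟙 (all (λ t → ev t γ) (proj₁ z)))) θ (subs m ts)
    ... | inj₁ ((zs , s , l) , q) = zs , s , l , q
    ... | inj₂ few = ⊥-elim (<-irrefl refl (≤-<-trans chain gap))
      where
      open QP.≤-Reasoning
      n = length ts
      S = lsum (λ z → 𝔼 E (λ γ → 𝟙 (all (λ t → ev t γ) (proj₁ z)))) (subs m ts)
      chain : fromℕ (suc (suc m)) ≤ fromℕ (suc m)
      chain = begin
        fromℕ (suc (suc m))                          ≤⟨ R-big ⟩
        fromℕ R * τ                                  ≡⟨ cong (λ z → fromℕ z * τ) (sym lR) ⟩
        fromℕ n * τ                                  ≤⟨ lsum-lower _ τ ts p ⟩
        lsum (λ t → 𝔼 E (λ γ → 𝟙 (ev t γ))) ts       ≡⟨ sym (𝔼-lsum E _ ts) ⟩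
        𝔼 E (λ γ → lsum (λ t → 𝟙 (ev t γ)) ts)       ≤⟨ 𝔼-mono E (λ γ → count-bound (λ t → ev t γ) m ts) ⟩
        𝔼 E (λ γ → fromℕ m + fromℕ n * lsum (λ z → 𝟙 (all (λ t → ev t γ) (proj₁ z))) (subs m ts))
          ≡⟨ trans (𝔼-+ E _ _) (cong₂ _+_ (𝔼-const E _) (trans (𝔼-* E _ _) (cong (fromℕ n *_) (𝔼-lsum E _ (subs m ts))))) ⟩
        fromℕ m + fromℕ n * S                        ≤⟨ +-monoʳ-≤ _ (*-monoˡ (0≤fromℕ n) few) ⟩
        fromℕ m + fromℕ n * (fromℕ (length (subs m ts)) * θ)
          ≡⟨ cong (fromℕ m +_) (trans (sym (*-assoc _ _ θ)) (cong (_* θ) (trans (cong₂ (λ y z → fromℕ y * fromℕ z) lR (trans (length-subs m ts) (cong (#subs m) lR))) (sym (fromℕ-* R (#subs m R)))))) ⟩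
        fromℕ m + fromℕ N * θ                        ≤⟨ +-monoʳ-≤ _ Nθ≤1 ⟩
        fromℕ m + 1ℚ                                 ≡⟨ +-comm _ 1ℚ ⟩
        fromℕ (suc m) ∎
      gap : fromℕ (suc m) < fromℕ (suc (suc m))
      gap = subst (_< fromℕ (suc (suc m))) (+-identityˡ _) (+-monoˡ-< (fromℕ (suc m)) 0<1)

  nth : ∀ {A : Set} → List A → ℕ → Maybe A
  nth [] _ = nothing
  nth (x ∷ xs) zero = just x
  nth (x ∷ xs) (suc i) = nth xs i

  nth-++ : ∀ {A : Set} (as : List A) x bs → nth (as ++ x ∷ bs) (length as) ≡ just x
  nth-++ [] x bs = refl
  nth-++ (a ∷ as) x bs = nth-++ as x bs

  nth-++² : ∀ {A : Set} (as : List A) x bs y cs → nth (as ++ x ∷ bs ++ y ∷ cs) (suc (length as ℕ.+ length bs)) ≡ just y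
  nth-++² [] x bs y cs = nth-++ bs y cs
  nth-++² (a ∷ as) x bs y cs = nth-++² as x bs y cs

  nth-beyond : ∀ {A : Set} (xs : List A) i → length xs ℕ.≤ i → nth xs i ≡ nothing
  nth-beyond [] i _ = refl
  nth-beyond (x ∷ xs) (suc i) (s≤s le) = nth-beyond xs i le

  cut : ∀ {A : Set} R L (xs : List A) → R ℕ.+ L ℕ.≤ length xs →
    Σ (List A) λ as → Σ (List A) λ bs → xs ≡ as ++ bs × length as ≡ R × L ℕ.≤ length bs
  cut zero L xs le = [] , xs , refl , refl , le
  cut (suc R) L (x ∷ xs) (s≤s le) with cut R L xs le
  ... | as , bs , e , l , le' = x ∷ as , bs , cong (x ∷_) e , cong suc l , le'

  decompose : ∀ {A : Set} R (xs : List A) → R ℕ.+ suc (R ℕ.+ suc (R ℕ.+ 0)) ℕ.≤ length xs →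
    Σ (List A) λ as → Σ A λ p → Σ (List A) λ bs → Σ A λ q → Σ (List A) λ cs → Σ (List A) λ ds →
    xs ≡ as ++ p ∷ bs ++ q ∷ cs ++ ds × length as ≡ R × length bs ≡ R × length cs ≡ R
  decompose R xs le with cut R _ xs le
  ... | as , p ∷ xs₁ , refl , l₁ , s≤s le₁ with cut R _ xs₁ le₁
  ... | bs , q ∷ xs₂ , refl , l₂ , s≤s le₂ with cut R 0 xs₂ le₂
  ... | cs , ds , refl , l₃ , _ = as , p , bs , q , cs , ds , refl , l₁ , l₂ , l₃

  zip₃ : ∀ {A : Set} → List A → List A → List A → List (A × A × A)
  zip₃ (a ∷ as) (b ∷ bs) (c ∷ cs) = (a , b , c) ∷ zip₃ as bs cs
  zip₃ _ _ _ = []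

  zip₃-props : ∀ {A : Set} R (as bs cs : List A) → length as ≡ R → length bs ≡ R → length cs ≡ R →
    length (zip₃ as bs cs) ≡ R × map proj₁ (zip₃ as bs cs) ≡ as × map (λ t → proj₁ (proj₂ t)) (zip₃ as bs cs) ≡ bs
      × map (λ t → proj₂ (proj₂ t)) (zip₃ as bs cs) ≡ cs
  zip₃-props zero [] [] [] _ _ _ = refl , refl , refl , refl
  zip₃-props (suc R) (a ∷ as) (b ∷ bs) (c ∷ cs) p q r
    with zip₃-props R as bs cs (ℕP.suc-injective p) (ℕP.suc-injective q) (ℕP.suc-injective r)
  ... | l , e₁ , e₂ , e₃ = cong suc l , cong (a ∷_) e₁ , cong (b ∷_) e₂ , cong (c ∷_) e₃

  AllPairs-++ : ∀ {A : Set} {R : A → A → Set} (xs : List A) {ys} → AllPairs R (xs ++ ys) → ∀ {x y} → x ∈ xs → y ∈ ys → R x y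
  AllPairs-++ (x ∷ xs) (a ∷ p) (here refl) j = All.lookup a (∈-++⁺ʳ xs j)
  AllPairs-++ (x ∷ xs) (a ∷ p) (there i) j = AllPairs-++ xs p i j

  AllPairs-tail : ∀ {A : Set} {R : A → A → Set} (xs : List A) {ys} → AllPairs R (xs ++ ys) → AllPairs R ys
  AllPairs-tail [] p = p
  AllPairs-tail (x ∷ xs) (_ ∷ p) = AllPairs-tail xs p

  all-true : ∀ {T : Set} (e : T → Bool) ts → (∀ {t} → t ∈ ts → e t ≡ true) → all e ts ≡ true
  all-true e [] p = refl
  all-true e (t ∷ ts) p = cong₂ _∧_ (p (here refl)) (all-true e ts (λ i → p (there i)))

  all-at : ∀ {T : Set} (e : T → Bool) ts → all e ts ≡ true → ∀ {t} → t ∈ ts → e t ≡ true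
  all-at e (t ∷ ts) h (here refl) with e t
  ... | true = refl
  all-at e (t ∷ ts) h (there i) with e t
  ... | true = all-at e ts h i

  𝟙-mono : ∀ a b → (a ≡ true → b ≡ true) → 𝟙 a ≤ 𝟙 b
  𝟙-mono false b _ = 0≤𝟙 b
  𝟙-mono true b p = ≡⇒≤ (sym (cong 𝟙 (p refl)))

  ∧-true : ∀ a b → a ∧ b ≡ true → a ≡ true × b ≡ true
  ∧-true true b e = refl , e

  position : ∀ {A : Set} (ys : List A) {q} → q ∈ ys → Σ ℕ λ w → nth ys w ≡ just q
  position (y ∷ ys) (here refl) = 0 , refl
  position (y ∷ ys) (there j) with position ys j
  ... | w , e = suc w , e

  module Order {A : Set} (_≺_ : A → A → Set) (irr : ∀ {x} → ¬ (x ≺ x)) (tr : ∀ {x y z} → x ≺ y → y ≺ z → x ≺ z)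
    (_≺?_ : ∀ x y → Dec (x ≺ y)) where

    Inc : List A → Set
    Inc = AllPairs _≺_

    locate : ∀ ys → Inc ys → ∀ {p q} → p ∈ ys → q ∈ ys → p ≺ q →
      Σ ℕ λ u → Σ ℕ λ w → nth ys u ≡ just p × nth ys (suc (u ℕ.+ w)) ≡ just q
    locate (y ∷ ys) (a ∷ s) (here refl) (here refl) l = ⊥-elim (irr l)
    locate (y ∷ ys) (a ∷ s) (here refl) (there j) l with position ys j
    ... | w , e = 0 , w , refl , e
    locate (y ∷ ys) (a ∷ s) (there i) (here refl) l = ⊥-elim (irr (tr l (All.lookup a i)))
    locate (y ∷ ys) (a ∷ s) (there i) (there j) l with locate ys s i j l
    ... | u , w , e , e' = suc u , w , e , e'

    module Events {Γ : Set} (P : A → A → Ex Γ) (D₁ D₂ D₃ : A → A → A → Γ → Bool) where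

      -- the event that γ suits the pair p ≺ q together with a third index a, lying below, between or above
      ok : A → A → Γ → A → Bool
      ok p q γ a = (not (does (a ≺? p)) ∨ D₁ p q a γ) ∧ ((not (does (p ≺? a) ∧ does (a ≺? q)) ∨ D₂ p q a γ) ∧ (not (does (q ≺? a)) ∨ D₃ p q a γ))

      good : List A → A → A → Γ → Bool
      good zs p q γ = all (ok p q γ) zs

      ok-intro : ∀ p q γ a → (a ≺ p → D₁ p q a γ ≡ true) → (p ≺ a → a ≺ q → D₂ p q a γ ≡ true) → (q ≺ a → D₃ p q a γ ≡ true) →
        ok p q γ a ≡ true
      ok-intro p q γ a h₁ h₂ h₃ = cong₂ _∧_ c₁ (cong₂ _∧_ c₂ c₃)
        where
        c₁ : not (does (a ≺? p)) ∨ D₁ p q a γ ≡ true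
        c₁ with a ≺? p
        ... | yes l = h₁ l
        ... | no _ = refl
        c₂ : not (does (p ≺? a) ∧ does (a ≺? q)) ∨ D₂ p q a γ ≡ true
        c₂ with p ≺? a | a ≺? q
        ... | yes l | yes l' = h₂ l l'
        ... | yes l | no _ = refl
        ... | no _ | _ = refl
        c₃ : not (does (q ≺? a)) ∨ D₃ p q a γ ≡ true
        c₃ with q ≺? a
        ... | yes l = h₃ l
        ... | no _ = refl

      ok₁ : ∀ p q γ a → ok p q γ a ≡ true → a ≺ p → D₁ p q a γ ≡ true
      ok₁ p q γ a h l with a ≺? p | proj₁ (∧-true (not (does (a ≺? p)) ∨ D₁ p q a γ) _ h)
      ... | yes _ | e = e
      ... | no n | _ = ⊥-elim (n l)

      ok₂ : ∀ p q γ a → ok p q γ a ≡ true → p ≺ a → a ≺ q → D₂ p q a γ ≡ true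
      ok₂ p q γ a h l l' with p ≺? a | a ≺? q | proj₁ (∧-true _ (not (does (q ≺? a)) ∨ D₃ p q a γ) (proj₂ (∧-true (not (does (a ≺? p)) ∨ D₁ p q a γ) _ h)))
      ... | yes _ | yes _ | e = e
      ... | no n | _ | _ = ⊥-elim (n l)
      ... | yes _ | no n | _ = ⊥-elim (n l')

      ok₃ : ∀ p q γ a → ok p q γ a ≡ true → q ≺ a → D₃ p q a γ ≡ true
      ok₃ p q γ a h l with q ≺? a | proj₂ (∧-true (not (does (p ≺? a) ∧ does (a ≺? q)) ∨ D₂ p q a γ) (not (does (q ≺? a)) ∨ D₃ p q a γ)
                                     (proj₂ (∧-true (not (does (a ≺? p)) ∨ D₁ p q a γ) _ h)))
      ... | yes _ | e = e
      ... | no n | _ = ⊥-elim (n l)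

      module _ (θ : ℚ) where

        At : Maybe A → Maybe A → List A → Set
        At (just p) (just q) zs = θ ≤ 𝔼 (P p q) (λ γ → 𝟙 (good zs p q γ))
        At _ _ zs = ⊤

        at? : ∀ x y zs → Dec (At x y zs)
        at? (just p) (just q) zs = θ ≤? _
        at? (just p) nothing zs = yes tt
        at? nothing y zs = yes tt

        At-nothing : ∀ x zs → At x nothing zs
        At-nothing (just p) zs = tt
        At-nothing nothing zs = tt

        -- the elements of zs number u and u+1+w form a pair suited by many γ
        Suited : ℕ → ℕ → List A → Set
        Suited u w zs = At (nth zs u) (nth zs (suc (u ℕ.+ w))) zs

        module _ (τ : ℚ) (m R : ℕ)
          (choose : ∀ {T : Set} (E : Ex Γ) (ev : T → Γ → Bool) ts → length ts ≡ R → (∀ {t} → t ∈ ts → τ ≤ 𝔼 E (λ γ → 𝟙 (ev t γ))) →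
            Σ (List T) λ zs → zs ⊆ ts × length zs ≡ m × θ ≤ 𝔼 E (λ γ → 𝟙 (all (λ t → ev t γ) zs)))
          (xs₀ : List A)
          (hyp : ∀ {a p b q c} → a ∈ xs₀ → p ∈ xs₀ → b ∈ xs₀ → q ∈ xs₀ → c ∈ xs₀ → a ≺ p → p ≺ b → b ≺ q → q ≺ c →
            τ ≤ 𝔼 (P p q) (λ γ → 𝟙 (D₁ p q a γ ∧ (D₂ p q b γ ∧ D₃ p q c γ)))) where

          Class : List A → Set
          Class xs = xs ⊆ xs₀ × Inc xs

          Class-⊆ : ∀ {xs ys} → xs ⊆ ys → Class ys → Class xs
          Class-⊆ s (t , i) = ⊆-trans s t , AllPairs-⊆ s i

          L₀ = m ℕ.+ (R ℕ.+ suc (R ℕ.+ suc (R ℕ.+ 0)))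

          suited-unavoidable : ∀ u w → Unavoidable Class m L₀ (Suited u w)
          suited-unavoidable u w xs cl le with suc (u ℕ.+ w) ℕP.<? m
          ... | no nlt with shorten m xs (ℕP.≤-trans (ℕP.m≤m+n m _) le)
          ...   | ys , s , l = ys , s , l , subst (λ z → At (nth ys u) z ys)
                    (sym (nth-beyond ys _ (ℕP.≤-trans (ℕP.≤-reflexive l) (ℕP.≮⇒≥ nlt)))) (At-nothing (nth ys u) ys)
          suited-unavoidable u w xs (s₀ , inc) le | yes l< with decompose R xs (ℕP.≤-trans (ℕP.m≤n+m _ m) le)
          ... | as , p , bs , q , cs , ds , refl , las , lbs , lcs = result
            where
            zp = zip₃-props R as bs cs las lbs lcs
            ts = zip₃ as bs cs
            ev : A × A × A → Γ → Bool
            ev (a , b , c) γ = D₁ p q a γ ∧ (D₂ p q b γ ∧ D₃ p q c γ)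
            in-as : ∀ {t} → t ∈ ts → proj₁ t ∈ as
            in-as i = subst (_ ∈_) (proj₁ (proj₂ zp)) (∈-map⁺ proj₁ i)
            in-bs : ∀ {t} → t ∈ ts → proj₁ (proj₂ t) ∈ bs
            in-bs i = subst (_ ∈_) (proj₁ (proj₂ (proj₂ zp))) (∈-map⁺ (λ t → proj₁ (proj₂ t)) i)
            in-cs : ∀ {t} → t ∈ ts → proj₂ (proj₂ t) ∈ cs
            in-cs i = subst (_ ∈_) (proj₂ (proj₂ (proj₂ zp))) (∈-map⁺ (λ t → proj₂ (proj₂ t)) i)
            inc₁ : Inc (p ∷ bs ++ q ∷ cs ++ ds)
            inc₁ = AllPairs-tail as inc
            inc₂ : Inc (bs ++ q ∷ cs ++ ds)
            inc₂ = AllPairs-tail (p ∷ []) inc₁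
            a≺p : ∀ {a} → a ∈ as → a ≺ p
            a≺p i = AllPairs-++ as inc i (here refl)
            p≺b : ∀ {b} → b ∈ bs → p ≺ b
            p≺b i = AllPairs-++ (p ∷ []) inc₁ (here refl) (∈-++⁺ˡ i)
            b≺q : ∀ {b} → b ∈ bs → b ≺ q
            b≺q i = AllPairs-++ bs inc₂ i (here refl)
            p≺q : p ≺ q
            p≺q = AllPairs-++ (p ∷ []) inc₁ (here refl) (∈-++⁺ʳ bs (here refl))
            q≺c : ∀ {c} → c ∈ cs → q ≺ c
            q≺c i = AllPairs-++ (q ∷ []) (AllPairs-tail bs inc₂) (here refl) (∈-++⁺ˡ i)
            up : ∀ {x} → x ∈ as ++ p ∷ bs ++ q ∷ cs ++ ds → x ∈ xs₀
            up = ∈-⊆ s₀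
            chosen = choose (P p q) ev ts (proj₁ zp) (λ {t} i → hyp (up (∈-++⁺ˡ (in-as i))) (up (∈-++⁺ʳ as (here refl)))
              (up (∈-++⁺ʳ as (there (∈-++⁺ˡ (in-bs i))))) (up (∈-++⁺ʳ as (there (∈-++⁺ʳ bs (here refl)))))
              (up (∈-++⁺ʳ as (there (∈-++⁺ʳ bs (there (∈-++⁺ˡ (in-cs i)))))))
              (a≺p (in-as i)) (p≺b (in-bs i)) (b≺q (in-bs i)) (q≺c (in-cs i)))
            zs = proj₁ chosen
            zs⊆ts : zs ⊆ ts
            zs⊆ts = proj₁ (proj₂ chosen)
            len-zs : length zs ≡ m
            len-zs = proj₁ (proj₂ (proj₂ chosen))
            v = m ℕ.∸ suc (suc (u ℕ.+ w))
            as' = take u (map proj₁ zs)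
            bs' = take w (map (λ t → proj₁ (proj₂ t)) zs)
            cs' = take v (map (λ t → proj₂ (proj₂ t)) zs)
            as'⊆ : as' ⊆ as
            as'⊆ = ⊆-trans (take-⊆ u _) (subst (map proj₁ zs ⊆_) (proj₁ (proj₂ zp)) (map⁺ proj₁ zs⊆ts))
            bs'⊆ : bs' ⊆ bs
            bs'⊆ = ⊆-trans (take-⊆ w _) (subst (map (λ t → proj₁ (proj₂ t)) zs ⊆_) (proj₁ (proj₂ (proj₂ zp))) (map⁺ (λ t → proj₁ (proj₂ t)) zs⊆ts))
            cs'⊆ : cs' ⊆ cs
            cs'⊆ = ⊆-trans (take-⊆ v _) (subst (map (λ t → proj₂ (proj₂ t)) zs ⊆_) (proj₂ (proj₂ (proj₂ zp))) (map⁺ (λ t → proj₂ (proj₂ t)) zs⊆ts))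
            len : ∀ n (f : A × A × A → A) → n ℕ.≤ m → length (take n (map f zs)) ≡ n
            len n f le = trans (length-take n (map f zs)) (ℕP.m≤n⇒m⊓n≡m (ℕP.≤-trans le (ℕP.≤-reflexive (sym (trans (length-map f zs) len-zs)))))
            u≤m : u ℕ.≤ m
            u≤m = ℕP.≤-trans (ℕP.m≤m+n u w) (ℕP.≤-trans (ℕP.n≤1+n _) (ℕP.<⇒≤ l<))
            w≤m : w ℕ.≤ m
            w≤m = ℕP.≤-trans (ℕP.m≤n+m w u) (ℕP.≤-trans (ℕP.n≤1+n _) (ℕP.<⇒≤ l<))
            las' = len u proj₁ u≤m
            lbs' = len w (λ t → proj₁ (proj₂ t)) w≤m
            lcs' = len v (λ t → proj₂ (proj₂ t)) (ℕP.m∸n≤m m (suc (suc (u ℕ.+ w))))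
            ys = as' ++ p ∷ bs' ++ q ∷ cs'
            ys⊆ : ys ⊆ as ++ p ∷ bs ++ q ∷ cs ++ ds
            ys⊆ = ++⁺ as'⊆ (refl ∷ ++⁺ bs'⊆ (refl ∷ subst (_⊆ cs ++ ds) (++-[] cs') (++⁺ cs'⊆ (minimum ds))))
              where ++-[] : ∀ (xs : List A) → xs ++ [] ≡ xs
                    ++-[] [] = refl
                    ++-[] (x ∷ xs) = cong (x ∷_) (++-[] xs)
            len-ys : length ys ≡ m
            len-ys = begin
              length ys                                          ≡⟨ length-++ as' ⟩
              length as' ℕ.+ suc (length (bs' ++ q ∷ cs'))       ≡⟨ cong (λ z → length as' ℕ.+ suc z) (length-++ bs') ⟩
              length as' ℕ.+ suc (length bs' ℕ.+ suc (length cs')) ≡⟨ cong₂ (λ x y → x ℕ.+ suc y) las' (cong₂ (λ x y → x ℕ.+ suc y) lbs' lcs') ⟩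
              u ℕ.+ suc (w ℕ.+ suc v)                            ≡⟨ ℕP.+-suc u _ ⟩
              suc (u ℕ.+ (w ℕ.+ suc v))                          ≡⟨ cong suc (sym (ℕP.+-assoc u w (suc v))) ⟩
              suc (u ℕ.+ w ℕ.+ suc v)                            ≡⟨ cong suc (ℕP.+-suc (u ℕ.+ w) v) ⟩
              suc (suc (u ℕ.+ w)) ℕ.+ v                          ≡⟨ ℕP.m+[n∸m]≡n l< ⟩
              m ∎
              where open ≡-Reasoning
            from-take : ∀ n (f : A × A × A → A) {x} → x ∈ take n (map f zs) → Σ (A × A × A) λ t → t ∈ zs × x ≡ f t
            from-take n f i with ∈-map⁻ f (∈-⊆ (take-⊆ n _) i)
            ... | t , j , e = t , j , e
            good-ys : ∀ γ → all (λ t → ev t γ) zs ≡ true → good ys p q γ ≡ true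
            good-ys γ h = all-true (ok p q γ) ys each
              where
              each : ∀ {a} → a ∈ ys → ok p q γ a ≡ true
              each {a} i with ∈-++⁻ as' i
              ... | inj₁ j with from-take u proj₁ j
              ...   | t , k , refl = ok-intro p q γ a (λ _ → proj₁ (∧-true _ _ (all-at _ zs h k)))
                        (λ l _ → ⊥-elim (irr (tr l (a≺p (∈-⊆ as'⊆ j))))) (λ l → ⊥-elim (irr (tr p≺q (tr l (a≺p (∈-⊆ as'⊆ j))))))
              each {a} i | inj₂ (here refl) = ok-intro p q γ p (λ l → ⊥-elim (irr l)) (λ l _ → ⊥-elim (irr l)) (λ l → ⊥-elim (irr (tr l p≺q)))
              each {a} i | inj₂ (there j) with ∈-++⁻ bs' j
              ... | inj₁ j' with from-take w (λ t → proj₁ (proj₂ t)) j'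
              ...   | t , k , refl = ok-intro p q γ a (λ l → ⊥-elim (irr (tr l (p≺b (∈-⊆ bs'⊆ j')))))
                        (λ _ _ → proj₁ (∧-true _ _ (proj₂ (∧-true (D₁ p q (proj₁ t) γ) _ (all-at _ zs h k)))))
                        (λ l → ⊥-elim (irr (tr l (b≺q (∈-⊆ bs'⊆ j')))))
              each {a} i | inj₂ (there j) | inj₂ (here refl) = ok-intro p q γ q (λ l → ⊥-elim (irr (tr l p≺q))) (λ _ l → ⊥-elim (irr l)) (λ l → ⊥-elim (irr l))
              each {a} i | inj₂ (there j) | inj₂ (there j') with from-take v (λ t → proj₂ (proj₂ t)) j'
              ...   | t , k , refl = ok-intro p q γ a (λ l → ⊥-elim (irr (tr l (tr p≺q (q≺c (∈-⊆ cs'⊆ j')))))) (λ _ l → ⊥-elim (irr (tr l (q≺c (∈-⊆ cs'⊆ j')))))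
                        (λ _ → proj₂ (∧-true (D₂ p q (proj₁ (proj₂ t)) γ) _ (proj₂ (∧-true (D₁ p q (proj₁ t) γ) _ (all-at _ zs h k)))))
            suited : Suited u w ys
            suited = subst₂ (λ x y → At x y ys)
              (sym (trans (cong (nth ys) (sym las')) (nth-++ as' p _)))
              (sym (trans (cong₂ (λ x y → nth ys (suc (x ℕ.+ y))) (sym las') (sym lbs')) (nth-++² as' p bs' q cs')))
              (≤-trans (proj₂ (proj₂ (proj₂ chosen))) (𝔼-mono (P p q) (λ γ → 𝟙-mono _ _ (good-ys γ))))
            result : Σ (List A) λ ys → ys ⊆ (as ++ p ∷ bs ++ q ∷ cs ++ ds) × length ys ≡ m × Suited u w ys
            result = ys , ys⊆ , len-ys , suited

module ReducedStructures where

  open Tuples using (pw; pw-pos; pw-suc; pw-0)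
  open IndependentColours using (set; set-same; set-other; EL)
  open RamseyTheory
  open Selection
  open import Data.List.Relation.Binary.Sublist.Propositional using (_⊆_)
  open import Data.Bool.ListAction using (all)

  all-below? : ∀ {P : ℕ → Set} → (∀ i → Dec (P i)) → ∀ n → Dec (∀ i → i ℕ.< n → P i)
  all-below? P? zero = yes (λ i ())
  all-below? P? (suc n) with P? n | all-below? P? n
  ... | no q | _ = no (λ h → q (h n ℕP.≤-refl))
  ... | _ | no q = no (λ h → q (λ i l → h i (ℕP.m≤n⇒m≤1+n l)))
  ... | yes p | yes q = yes go
    where go : ∀ i → i ℕ.< suc n → _
          go i l with i ℕP.≟ n
          ... | yes refl = p
          ... | no ne = q i (ℕP.≤∧≢⇒< (ℕP.≤-pred l) ne)

  module Constants (τ : ℚ) (0<τ : 0ℚ < τ) (m : ℕ) where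
    opaque
      R : ℕ
      R = proj₁ (measure-pigeonhole τ 0<τ m)
      θ : ℚ
      θ = proj₁ (proj₂ (measure-pigeonhole τ 0<τ m))
      0<θ : 0ℚ < θ
      0<θ = proj₁ (proj₂ (proj₂ (measure-pigeonhole τ 0<τ m)))
      θ≤1 : θ ≤ 1ℚ
      θ≤1 = proj₁ (proj₂ (proj₂ (proj₂ (measure-pigeonhole τ 0<τ m))))
      choose : ∀ {Γ T : Set} (E : Ex Γ) (ev : T → Γ → Bool) ts →
        length ts ≡ R → (∀ {t} → t ∈ ts → τ ≤ 𝔼 E (λ γ → 𝟙 (ev t γ))) →
        Σ (List T) λ zs → zs ⊆ ts × length zs ≡ m × θ ≤ 𝔼 E (λ γ → 𝟙 (all (λ t → ev t γ) zs))
      choose = proj₂ (proj₂ (proj₂ (proj₂ (measure-pigeonhole τ 0<τ m))))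
      bound : ℕ
      bound = all-bound m (all-bound m (m ℕ.+ (R ℕ.+ suc (R ℕ.+ suc (R ℕ.+ 0)))) m) m
      bound-def : bound ≡ all-bound m (all-bound m (m ℕ.+ (R ℕ.+ suc (R ℕ.+ suc (R ℕ.+ 0)))) m) m
      bound-def = refl

  module Common {A : Set} (_≺_ : A → A → Set) (irr : ∀ {x} → ¬ (x ≺ x)) (tr : ∀ {x y z} → x ≺ y → y ≺ z → x ≺ z)
    (_≺?_ : ∀ x y → Dec (x ≺ y)) {Γ : Set} (P : A → A → Ex Γ) (D₁ D₂ D₃ : A → A → A → Γ → Bool)
    (τ : ℚ) (0<τ : 0ℚ < τ) (m : ℕ) where

    open Order _≺_ irr tr _≺?_
    open Events P D₁ D₂ D₃
    open Constants τ 0<τ m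

    common-events : ∀ xs → Inc xs → bound ℕ.≤ length xs →
      (∀ {a p b q c} → a ∈ xs → p ∈ xs → b ∈ xs → q ∈ xs → c ∈ xs → a ≺ p → p ≺ b → b ≺ q → q ≺ c →
        τ ≤ 𝔼 (P p q) (λ γ → 𝟙 (D₁ p q a γ ∧ (D₂ p q b γ ∧ D₃ p q c γ)))) →
      Σ (List A) λ ys → ys ⊆ xs × length ys ≡ m × (∀ {p q} → p ∈ ys → q ∈ ys → p ≺ q → θ ≤ 𝔼 (P p q) (λ γ → 𝟙 (good ys p q γ)))
    common-events xs inc le hyp
      with unavoidable-all (Class θ τ m R choose xs hyp) (Class-⊆ θ τ m R choose xs hyp) m _ m
             (λ u zs → ∀ w → w ℕ.< m → Suited θ u w zs) (λ u zs → all-below? (λ w → at? θ _ _ zs) m)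
             (λ u _ → unavoidable-all (Class θ τ m R choose xs hyp) (Class-⊆ θ τ m R choose xs hyp) m _ m
               (λ w zs → Suited θ u w zs) (λ w zs → at? θ _ _ zs) (λ w _ → suited-unavoidable θ τ m R choose xs hyp u w))
             xs (⊆-refl , inc) (subst (ℕ._≤ length xs) bound-def le)
    ... | ys , s , l , h = ys , s , l , pairs
      where
      pairs : ∀ {p q} → p ∈ ys → q ∈ ys → p ≺ q → θ ≤ 𝔼 (P p q) (λ γ → 𝟙 (good ys p q γ))
      pairs {p} {q} i j l< with locate ys (AllPairs-⊆ s inc) i j l<
      ... | u , w , e , e' = subst₂ (λ x y → At θ x y ys) e e' (h u (ℕP.≤-trans (s≤s (ℕP.m≤m+n u w)) (ℕP.≤-trans (ℕP.n≤1+n _) small))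
                               w (ℕP.≤-trans (s≤s (ℕP.m≤n+m w u)) (ℕP.≤-trans (ℕP.n≤1+n _) small)))
        where
        small : suc (suc (u ℕ.+ w)) ℕ.≤ m
        small with suc (u ℕ.+ w) ℕP.<? m
        ... | yes l< = l<
        ... | no nlt with trans (sym (nth-beyond ys _ (subst (ℕ._≤ suc (u ℕ.+ w)) (sym l) (ℕP.≮⇒≥ nlt)))) e'
        ...   | ()

  EL-++ : ∀ {I Γ : Set} (_≟I_ : DecidableEquality I) (p : I → Ex Γ) is js (Φ : (I → Γ) → ℚ) g →
    EL _≟I_ p (is ++ js) Φ g ≡ EL _≟I_ p is (EL _≟I_ p js Φ) g
  EL-++ _≟I_ p [] js Φ g = refl
  EL-++ _≟I_ p (ι ∷ is) js Φ g = 𝔼-cong (p ι) (λ γ → EL-++ _≟I_ p is js Φ (set _≟I_ g ι γ))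

  0≤EL : ∀ {I Γ : Set} (_≟I_ : DecidableEquality I) (p : I → Ex Γ) is (Φ : (I → Γ) → ℚ) → (∀ g → 0ℚ ≤ Φ g) → ∀ g → 0ℚ ≤ EL _≟I_ p is Φ g
  0≤EL _≟I_ p [] Φ h g = h g
  0≤EL _≟I_ p (ι ∷ is) Φ h g = 0≤𝔼 (p ι) (λ γ → 0≤EL _≟I_ p is Φ h (set _≟I_ g ι γ))

  EL-lower : ∀ {I Γ : Set} (_≟I_ : DecidableEquality I) (p : I → Ex Γ) (G : I → Γ → Bool) θ η → 0ℚ ≤ θ → 0ℚ ≤ η → ∀ is →
    (∀ {ι} → ι ∈ is → θ ≤ 𝔼 (p ι) (λ γ → 𝟙 (G ι γ))) → (Φ : (I → Γ) → ℚ) → (∀ g → 0ℚ ≤ Φ g) → ∀ g →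
    (∀ g' → (∀ {ι} → ι ∈ is → G ι (g' ι) ≡ true) → (∀ {ι} → ι ∉ is → g' ι ≡ g ι) → η ≤ Φ g') →
    pw θ (length is) * η ≤ EL _≟I_ p is Φ g
  EL-lower _≟I_ p G θ η 0≤θ 0≤η [] hθ Φ 0≤Φ g H = ≤-trans (≡⇒≤ (trans (cong (_* η) (pw-0 θ)) (*-identityˡ η))) (H g (λ ()) (λ _ → refl))
  EL-lower {I} {Γ} _≟I_ p G θ η 0≤θ 0≤η (ι ∷ is) hθ Φ 0≤Φ g H = ≤-trans
      (≡⇒≤ (trans (cong (_* η) (pw-suc θ (length is))) (*-assoc θ _ η)))
      (≤-trans (*-monoʳ (0≤* (0≤pw (length is)) 0≤η) (hθ (here refl)))
        (≤-trans (≡⇒≤ (sym (𝔼-*ʳ (p ι) _ _))) (𝔼-mono (p ι) each)))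
    where
    0≤pw : ∀ n → 0ℚ ≤ pw θ n
    0≤pw zero = ≤-trans 0≤1 (≡⇒≤ (sym (pw-0 θ)))
    0≤pw (suc n) = ≤-trans (0≤* 0≤θ (0≤pw n)) (≡⇒≤ (sym (pw-suc θ n)))
    each : ∀ γ → 𝟙 (G ι γ) * (pw θ (length is) * η) ≤ EL _≟I_ p is Φ (set _≟I_ g ι γ)
    each γ with G ι γ in eq
    ... | false = ≤-trans (≡⇒≤ (*-zeroˡ _)) (0≤EL _≟I_ p is Φ 0≤Φ _)
    ... | true = ≤-trans (≡⇒≤ (*-identityˡ _)) (EL-lower _≟I_ p G θ η 0≤θ 0≤η is (λ i → hθ (there i)) Φ 0≤Φ (set _≟I_ g ι γ)
        (λ g' h h' → H g' (λ { (here refl) → at-ι g' h h' ; (there i) → h i })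
          (λ {κ} n → trans (h' (λ i → n (there i))) (set-other _≟I_ g γ (λ { refl → n (here refl) })))))
      where
      at-ι : ∀ g' → (∀ {κ} → κ ∈ is → G κ (g' κ) ≡ true) → (∀ {κ} → κ ∉ is → g' κ ≡ set _≟I_ g ι γ κ) → G ι (g' ι) ≡ true
      at-ι g' h h' with any? (ι ≟I_) is
      ... | yes i = h i
      ... | no n = trans (cong (G ι) (trans (h' n) (set-same _≟I_ g ι γ))) eq

  data Role : Set where
    rβ rν rρ rκ rγ : Role

  _≟R_ : DecidableEquality Role
  rβ ≟R rβ = yes refl
  rβ ≟R rν = no (λ ())
  rβ ≟R rρ = no (λ ())
  rβ ≟R rκ = no (λ ())
  rβ ≟R rγ = no (λ ())
  rν ≟R rβ = no (λ ())
  rν ≟R rν = yes refl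
  rν ≟R rρ = no (λ ())
  rν ≟R rκ = no (λ ())
  rν ≟R rγ = no (λ ())
  rρ ≟R rβ = no (λ ())
  rρ ≟R rν = no (λ ())
  rρ ≟R rρ = yes refl
  rρ ≟R rκ = no (λ ())
  rρ ≟R rγ = no (λ ())
  rκ ≟R rβ = no (λ ())
  rκ ≟R rν = no (λ ())
  rκ ≟R rρ = no (λ ())
  rκ ≟R rκ = yes refl
  rκ ≟R rγ = no (λ ())
  rγ ≟R rβ = no (λ ())
  rγ ≟R rν = no (λ ())
  rγ ≟R rρ = no (λ ())
  rγ ≟R rκ = no (λ ())
  rγ ≟R rγ = yes refl

  Index : ℕ → Set
  Index M = Role × Fin M × Fin M

  _≟ᴵ_ : ∀ {M} → DecidableEquality (Index M)
  _≟ᴵ_ = ≡-dec _≟R_ (≡-dec FinP._≟_ FinP._≟_)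

  items : ∀ M → Role → List (Index M)
  items M r = map (r ,_) (cartesianProduct (allFin M) (allFin M))

  items-complete : ∀ {M} r (a b : Fin M) → (r , a , b) ∈ items M r
  items-complete r a b = ∈-map⁺ (r ,_) (∈-cartesianProduct⁺ (∈-allFin a) (∈-allFin b))

  items-role : ∀ {M r r'} {a b : Fin M} → r' ≢ r → (r' , a , b) ∉ items M r
  items-role ne i with ∈-map⁻ _ i
  ... | _ , _ , refl = ne refl

  all-items : ∀ M → List (Index M)
  all-items M = items M rβ ++ items M rν ++ items M rρ ++ items M rκ ++ items M rγ

  2* : ℚ → ℚ
  2* x = x + x

  module Chain (M f : ℕ) (τ δ : ℚ) (0<τ : 0ℚ < τ) (0<δ : 0ℚ < δ) where
    -- δ is a quarter of the richness threshold
    module C₅ = Constants δ 0<δ f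
    0<2δ : 0ℚ < 2* δ
    0<2δ = subst (_< 2* δ) (+-identityˡ 0ℚ) (+-mono-<-≤ 0<δ (<⇒≤ 0<δ))
    module C₄ = Constants (2* δ) 0<2δ C₅.bound
    module C₃ = Constants δ 0<δ C₄.bound
    module C₂ = Constants (2* δ) 0<2δ C₃.bound
    module C₁ = Constants τ 0<τ C₂.bound

    steps = λ r → length (items M r)
    c₅ = λ (η : ℚ) → pw C₅.θ (steps rγ) * η
    c₄ = λ (η : ℚ) → pw C₄.θ (steps rκ) * c₅ η
    c₃ = λ (η : ℚ) → pw C₃.θ (steps rρ) * c₄ η
    c₂ = λ (η : ℚ) → pw C₂.θ (steps rν) * c₃ η
    c₁ = λ (η : ℚ) → pw C₁.θ (steps rβ) * c₂ η

    0<c₅ : ∀ {η} → 0ℚ < η → 0ℚ < c₅ η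
    0<c₅ p = 0<* (pw-pos (steps rγ) C₅.0<θ) p
    0<c₄ : ∀ {η} → 0ℚ < η → 0ℚ < c₄ η
    0<c₄ p = 0<* (pw-pos (steps rκ) C₄.0<θ) (0<c₅ p)
    0<c₃ : ∀ {η} → 0ℚ < η → 0ℚ < c₃ η
    0<c₃ p = 0<* (pw-pos (steps rρ) C₃.0<θ) (0<c₄ p)
    0<c₂ : ∀ {η} → 0ℚ < η → 0ℚ < c₂ η
    0<c₂ p = 0<* (pw-pos (steps rν) C₂.0<θ) (0<c₃ p)
    0<c₁ : ∀ {η} → 0ℚ < η → 0ℚ < c₁ η
    0<c₁ p = 0<* (pw-pos (steps rβ) C₁.0<θ) (0<c₂ p)

  private opaque
    unfolding -_
    drop-one : ∀ δ x → x + δ - (δ + δ) ≡ x - δ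
    drop-one = solve-∀ ℚ-ring

  markov : ∀ {Γ : Set} (E : Ex Γ) (X : Γ → ℚ) δ → 0ℚ ≤ δ → (∀ γ → X γ ≤ 1ℚ) → 2* δ ≤ 𝔼 E X → δ ≤ 𝔼 E (λ γ → 𝟙 (leqᵇ δ (X γ)))
  markov E X δ 0≤δ X≤1 h = 0≤-⇒≤ (subst (0ℚ ≤_) (drop-one δ _) (≤⇒0≤- (≤-trans h (≤-trans (𝔼-mono E each) (≡⇒≤ (trans (𝔼-+ E _ _) (cong₂ _+_ refl (𝔼-const E δ))))))))
    where
    each : ∀ γ → X γ ≤ 𝟙 (leqᵇ δ (X γ)) + δ
    each γ with leqᵇ δ (X γ) in eq
    ... | true = ≤-trans (X≤1 γ) (≤-trans (≡⇒≤ (sym (+-identityʳ 1ℚ))) (+-monoʳ-≤ 1ℚ 0≤δ))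
    ... | false = ≤-trans (<⇒≤ (leqᵇ-false eq)) (≡⇒≤ (sym (+-identityˡ δ)))

  module Degrees {M K : ℕ} (P : Fin M → Fin M → Ex (Fin K)) (W : Fin K → Fin K → Fin K → ℚ) where

    density : Fin M → Fin M → Fin M → ℚ
    density i j l = 𝔼 (P i j) (λ a → 𝔼 (P j l) (λ b → 𝔼 (P i l) (λ r → W a b r)))

    deg-first deg-mid deg-last : Fin M → Fin M → Fin M → Fin K → ℚ
    deg-first i j l a = 𝔼 (P j l) (λ b → 𝔼 (P i l) (λ r → W a b r))
    deg-mid j l i b = 𝔼 (P i j) (λ a → 𝔼 (P i l) (λ r → W a b r))
    deg-last i l j r = 𝔼 (P j l) (λ b → 𝔼 (P i j) (λ a → W a b r))

    Rich : ℚ → ℚ → Fin M → Fin M → Fin M → Fin M → Set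
    Rich τ δ i m j l = τ ≤ 𝔼 (P i j) (λ b → 𝟙 (leqᵇ δ (deg-last i j m b) ∧ leqᵇ δ (deg-first i j l b)))

  -- The reduced structure: independent colours for the pairs of indices, a weight for triples of colours.
  module Reduced (M : ℕ) (_≺_ : Fin M → Fin M → Set) (irr : ∀ {x} → ¬ (x ≺ x)) (tr : ∀ {x y z} → x ≺ y → y ≺ z → x ≺ z)
    (_≺?_ : ∀ x y → Dec (x ≺ y)) {K : ℕ} (P : Fin M → Fin M → Ex (Fin K))
    (W : Fin K → Fin K → Fin K → ℚ) (W01 : ∀ a b c → 0ℚ ≤ W a b c × W a b c ≤ 1ℚ) where

    private
      A = Fin M
      Γ = Fin K

    open Order _≺_ irr tr _≺?_

    open Degrees P W

    module Embedding (f : ℕ) (τ δ : ℚ) (0<τ : 0ℚ < τ) (0<δ : 0ℚ < δ) where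

      open Chain M f τ δ 0<τ 0<δ
      δ₂ = 2* δ
      δ₄ = 2* δ₂

      Colouring = Index M → Γ

      law : Index M → Ex Γ
      law (_ , a , b) = P a b

      S₁ S₂ S₃ S₄ S₅ : List A → Colouring → Set
      S₁ ys g = ∀ {p b q} → p ∈ ys → b ∈ ys → q ∈ ys → p ≺ b → b ≺ q →
        δ₄ ≤ deg-last p q b (g (rβ , p , q)) × δ₄ ≤ deg-first p b q (g (rβ , p , b))
      S₂ ys g = ∀ {a p q} → a ∈ ys → p ∈ ys → q ∈ ys → a ≺ p → p ≺ q →
        δ₂ ≤ 𝔼 (P a q) (λ r → W (g (rβ , a , p)) (g (rν , p , q)) r)
      S₃ ys g = ∀ {p b q} → p ∈ ys → b ∈ ys → q ∈ ys → p ≺ b → b ≺ q →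
        δ ≤ W (g (rβ , p , b)) (g (rν , b , q)) (g (rρ , p , q))
      S₄ ys g = ∀ {a p q} → a ∈ ys → p ∈ ys → q ∈ ys → a ≺ p → p ≺ q →
        δ₂ ≤ 𝔼 (P a p) (λ x → W x (g (rκ , p , q)) (g (rβ , a , q)))
      S₅ ys g = ∀ {p q c} → p ∈ ys → q ∈ ys → c ∈ ys → p ≺ q → q ≺ c →
        δ ≤ W (g (rγ , p , q)) (g (rκ , q , c)) (g (rβ , p , c))

      Success : List A → Colouring → Set
      Success ys g = S₃ ys g × S₅ ys g

      in-list : List A → A → A → Bool
      in-list ys p q = does (any? (p FinP.≟_) ys) ∧ (does (any? (q FinP.≟_) ys) ∧ does (p ≺? q))

      in-list-true : ∀ {ys p q} → p ∈ ys → q ∈ ys → p ≺ q → in-list ys p q ≡ true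
      in-list-true {ys} {p} {q} i j l with any? (p FinP.≟_) ys | any? (q FinP.≟_) ys | p ≺? q
      ... | yes _ | yes _ | yes _ = refl
      ... | no n | _ | _ = ⊥-elim (n i)
      ... | yes _ | no n | _ = ⊥-elim (n j)
      ... | yes _ | yes _ | no n = ⊥-elim (n l)

      in-list-sound : ∀ {ys p q} → in-list ys p q ≡ true → p ∈ ys × q ∈ ys × p ≺ q
      in-list-sound {ys} {p} {q} e with any? (p FinP.≟_) ys | any? (q FinP.≟_) ys | p ≺? q
      ... | yes i | yes j | yes l = i , j , l

      stage : ∀ r t (0<t : 0ℚ < t) m (D₁ D₂ D₃ : A → A → A → Γ → Bool) η → 0ℚ ≤ η → ∀ xs → Inc xs →
        Constants.bound t 0<t m ℕ.≤ length xs →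
        (∀ {a p b q c} → a ∈ xs → p ∈ xs → b ∈ xs → q ∈ xs → c ∈ xs → a ≺ p → p ≺ b → b ≺ q → q ≺ c →
          t ≤ 𝔼 (P p q) (λ x → 𝟙 (D₁ p q a x ∧ (D₂ p q b x ∧ D₃ p q c x)))) →
        (Φ : Colouring → ℚ) → (∀ g → 0ℚ ≤ Φ g) → ∀ g →
        (∀ ys g' → ys ⊆ xs → length ys ≡ m →
          (∀ {p q a} → p ∈ ys → q ∈ ys → a ∈ ys → p ≺ q →
            (a ≺ p → D₁ p q a (g' (r , p , q)) ≡ true) × (p ≺ a → a ≺ q → D₂ p q a (g' (r , p , q)) ≡ true) × (q ≺ a → D₃ p q a (g' (r , p , q)) ≡ true)) →
          (∀ {r' p q} → r' ≢ r → g' (r' , p , q) ≡ g (r' , p , q)) → η ≤ Φ g') →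
        pw (Constants.θ t 0<t m) (steps r) * η ≤ EL _≟ᴵ_ law (items M r) Φ g
      stage r t 0<t m D₁ D₂ D₃ η 0≤η xs inc le hyp Φ 0≤Φ g H
        with Common.common-events _≺_ irr tr _≺?_ P D₁ D₂ D₃ t 0<t m xs inc le hyp
      ... | ys , s , l , h = EL-lower _≟ᴵ_ law G θ η (<⇒≤ (Constants.0<θ t 0<t m)) 0≤η (items M r) G-likely Φ 0≤Φ g
          (λ g' on off → H ys g' s l (facts g' on) (λ ne → off (items-role ne)))
        where
        open Events P D₁ D₂ D₃
        θ = Constants.θ t 0<t m
        G : Index M → Γ → Bool
        G (_ , p , q) x = not (in-list ys p q) ∨ good ys p q x
        G-likely : ∀ {ι} → ι ∈ items M r → θ ≤ 𝔼 (law ι) (λ x → 𝟙 (G ι x))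
        G-likely {_ , p , q} _ with in-list ys p q in eq
        ... | true with in-list-sound {ys} eq
        ...   | i , j , l< = h i j l<
        G-likely {_ , p , q} _ | false = ≤-trans (Constants.θ≤1 t 0<t m) (≡⇒≤ (sym (𝔼-1 (P p q))))
        facts : ∀ g' → (∀ {ι} → ι ∈ items M r → G ι (g' ι) ≡ true) → ∀ {p q a} → p ∈ ys → q ∈ ys → a ∈ ys → p ≺ q →
            (a ≺ p → D₁ p q a (g' (r , p , q)) ≡ true) × (p ≺ a → a ≺ q → D₂ p q a (g' (r , p , q)) ≡ true) × (q ≺ a → D₃ p q a (g' (r , p , q)) ≡ true)
        facts g' on {p} {q} {a} i j k l< = ok₁ p q x a o , ok₂ p q x a o , ok₃ p q x a o
          where
          x = g' (r , p , q)
          gd : good ys p q x ≡ true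
          gd = subst (λ z → not z ∨ good ys p q x ≡ true) (in-list-true {ys} i j l<) (on (items-complete r p q))
          o : ok p q x a ≡ true
          o = all-at (ok p q x) ys gd k

      true₃ : A → A → A → Γ → Bool
      true₃ _ _ _ _ = true

      S₁-to : ∀ {xs ys} g g' → ys ⊆ xs → (∀ p q → g' (rβ , p , q) ≡ g (rβ , p , q)) → S₁ xs g → S₁ ys g'
      S₁-to g g' s e h {p} {b} {q} i j k l l' rewrite e p q | e p b = h (∈-⊆ s i) (∈-⊆ s j) (∈-⊆ s k) l l'

      S₃-to : ∀ {xs ys} g g' → ys ⊆ xs → (∀ p q → g' (rβ , p , q) ≡ g (rβ , p , q)) → (∀ p q → g' (rν , p , q) ≡ g (rν , p , q)) →
        (∀ p q → g' (rρ , p , q) ≡ g (rρ , p , q)) → S₃ xs g → S₃ ys g'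
      S₃-to g g' s e e' e'' h {p} {b} {q} i j k l l' rewrite e p b | e' b q | e'' p q = h (∈-⊆ s i) (∈-⊆ s j) (∈-⊆ s k) l l'

      module _ (xs₀ : List A) (Φ : Colouring → ℚ) (0≤Φ : ∀ g → 0ℚ ≤ Φ g) (η : ℚ) (0<η : 0ℚ < η)
        (win : ∀ ys g → ys ⊆ xs₀ → length ys ≡ f → Success ys g → η ≤ Φ g) where

        long : ∀ {n} (ys : List A) → length ys ≡ n → n ℕ.≤ length ys
        long ys e = ℕP.≤-reflexive (sym e)

        choose-γ : ∀ xs → Inc xs → xs ⊆ xs₀ → C₅.bound ℕ.≤ length xs → ∀ g → S₁ xs g → S₃ xs g → S₄ xs g →
          c₅ η ≤ EL _≟ᴵ_ law (items M rγ) Φ g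
        choose-γ xs inc sub le g s₁ s₃ s₄ = stage rγ δ 0<δ f true₃ true₃ D η (<⇒≤ 0<η) xs inc le
          (λ {a} {p} {b} {q} {c} _ i _ j k _ l l' l'' → markov (P p q) (λ x → W x (g (rκ , q , c)) (g (rβ , p , c))) δ (<⇒≤ 0<δ) (λ _ → proj₂ (W01 _ _ _))
            (s₄ i j k (tr l l') l''))
          Φ 0≤Φ g
          (λ ys g' s len facts off → win ys g' (⊆-trans s sub) len
            ( S₃-to g g' s (λ p q → off (λ ())) (λ p q → off (λ ())) (λ p q → off (λ ())) s₃
            , λ {p} {q} {c} i j k l l' → subst₂ (λ y z → δ ≤ W (g' (rγ , p , q)) y z) (sym (off (λ ()))) (sym (off (λ ())))
                (leqᵇ-sound (proj₂ (proj₂ (facts i j k l)) l'))))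
          where
          D : A → A → A → Γ → Bool
          D p q c x = leqᵇ δ (W x (g (rκ , q , c)) (g (rβ , p , c)))

        choose-κ : ∀ xs → Inc xs → xs ⊆ xs₀ → C₄.bound ℕ.≤ length xs → ∀ g → S₁ xs g → S₃ xs g →
          c₄ η ≤ EL _≟ᴵ_ law (items M rκ ++ items M rγ) Φ g
        choose-κ xs inc sub le g s₁ s₃ = ≤-trans (stage rκ δ₂ 0<2δ C₅.bound D true₃ true₃ (c₅ η) (<⇒≤ (0<c₅ 0<η)) xs inc le
          (λ {a} {p} {b} {q} {c} i j _ k _ l l' l'' _ → ≤-trans
            (markov (P p q) (λ y → 𝔼 (P a p) (λ x → W x y (g (rβ , a , q)))) δ₂ (<⇒≤ 0<2δ) (λ y → 𝔼≤ (P a p) (λ _ → proj₂ (W01 _ _ _)))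
              (proj₁ (s₁ i j k l (tr l' l''))))
            (𝔼-mono (P p q) (λ x → 𝟙-mono (D p q a x) (D p q a x ∧ true) (λ e → trans (BoolP.∧-identityʳ _) e))))
          (EL _≟ᴵ_ law (items M rγ) Φ) (0≤EL _≟ᴵ_ law (items M rγ) Φ 0≤Φ) g
          (λ ys g' s len facts off → choose-γ ys (AllPairs-⊆ s inc) (⊆-trans s sub) (long ys len) g'
            (S₁-to g g' s (λ p q → off (λ ())) s₁) (S₃-to g g' s (λ p q → off (λ ())) (λ p q → off (λ ())) (λ p q → off (λ ())) s₃)
            (λ {a} {p} {q} i j k l l' → subst (λ z → δ₂ ≤ 𝔼 (P a p) (λ x → W x (g' (rκ , p , q)) z)) (sym (off (λ ())))
              (leqᵇ-sound (proj₁ (facts j k i l') l)))))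
          (≡⇒≤ (sym (EL-++ _≟ᴵ_ law (items M rκ) (items M rγ) Φ g)))
          where
          D : A → A → A → Γ → Bool
          D p q a y = leqᵇ δ₂ (𝔼 (P a p) (λ x → W x y (g (rβ , a , q))))

        rest₃ = items M rκ ++ items M rγ
        rest₂ = items M rρ ++ rest₃
        rest₁ = items M rν ++ rest₂

        choose-ρ : ∀ xs → Inc xs → xs ⊆ xs₀ → C₃.bound ℕ.≤ length xs → ∀ g → S₁ xs g → S₂ xs g →
          c₃ η ≤ EL _≟ᴵ_ law rest₂ Φ g
        choose-ρ xs inc sub le g s₁ s₂ = ≤-trans (stage rρ δ 0<δ C₄.bound true₃ D true₃ (c₄ η) (<⇒≤ (0<c₄ 0<η)) xs inc le
          (λ {a} {p} {b} {q} {c} _ i j k _ _ l l' _ → ≤-trans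
            (markov (P p q) (λ x → W (g (rβ , p , b)) (g (rν , b , q)) x) δ (<⇒≤ 0<δ) (λ _ → proj₂ (W01 _ _ _)) (s₂ i j k l l'))
            (𝔼-mono (P p q) (λ x → 𝟙-mono (D p q b x) (D p q b x ∧ true) (λ e → trans (BoolP.∧-identityʳ _) e))))
          (EL _≟ᴵ_ law rest₃ Φ) (0≤EL _≟ᴵ_ law rest₃ Φ 0≤Φ) g
          (λ ys g' s len facts off → choose-κ ys (AllPairs-⊆ s inc) (⊆-trans s sub) (long ys len) g'
            (S₁-to g g' s (λ p q → off (λ ())) s₁)
            (λ {p} {b} {q} i j k l l' → subst₂ (λ y z → δ ≤ W y z (g' (rρ , p , q))) (sym (off (λ ()))) (sym (off (λ ())))
              (leqᵇ-sound (proj₁ (proj₂ (facts i k j (tr l l'))) l l')))))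
          (≡⇒≤ (sym (EL-++ _≟ᴵ_ law (items M rρ) rest₃ Φ g)))
          where
          D : A → A → A → Γ → Bool
          D p q b x = leqᵇ δ (W (g (rβ , p , b)) (g (rν , b , q)) x)

        choose-ν : ∀ xs → Inc xs → xs ⊆ xs₀ → C₂.bound ℕ.≤ length xs → ∀ g → S₁ xs g → c₂ η ≤ EL _≟ᴵ_ law rest₁ Φ g
        choose-ν xs inc sub le g s₁ = ≤-trans (stage rν δ₂ 0<2δ C₃.bound D true₃ true₃ (c₃ η) (<⇒≤ (0<c₃ 0<η)) xs inc le
          (λ {a} {p} {b} {q} {c} i j _ k _ l l' l'' _ → ≤-trans
            (markov (P p q) (λ y → 𝔼 (P a q) (λ x → W (g (rβ , a , p)) y x)) δ₂ (<⇒≤ 0<2δ) (λ y → 𝔼≤ (P a q) (λ _ → proj₂ (W01 _ _ _)))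
              (proj₂ (s₁ i j k l (tr l' l''))))
            (𝔼-mono (P p q) (λ x → 𝟙-mono (D p q a x) (D p q a x ∧ true) (λ e → trans (BoolP.∧-identityʳ _) e))))
          (EL _≟ᴵ_ law rest₂ Φ) (0≤EL _≟ᴵ_ law rest₂ Φ 0≤Φ) g
          (λ ys g' s len facts off → choose-ρ ys (AllPairs-⊆ s inc) (⊆-trans s sub) (long ys len) g'
            (S₁-to g g' s (λ p q → off (λ ())) s₁)
            (λ {a} {p} {q} i j k l l' → subst (λ z → δ₂ ≤ 𝔼 (P a q) (λ x → W z (g' (rν , p , q)) x)) (sym (off (λ ())))
              (leqᵇ-sound (proj₁ (facts j k i l') l)))))
          (≡⇒≤ (sym (EL-++ _≟ᴵ_ law (items M rν) rest₂ Φ g)))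
          where
          D : A → A → A → Γ → Bool
          D p q a y = leqᵇ δ₂ (𝔼 (P a q) (λ x → W (g (rβ , a , p)) y x))

        embed : Inc xs₀ → C₁.bound ℕ.≤ length xs₀ →
          (∀ {i m j l} → i ∈ xs₀ → m ∈ xs₀ → j ∈ xs₀ → l ∈ xs₀ → i ≺ m → m ≺ j → j ≺ l → Rich τ δ₄ i m j l) →
          ∀ g → c₁ η ≤ EL _≟ᴵ_ law (all-items M) Φ g
        embed inc le rich g = ≤-trans (stage rβ τ 0<τ C₂.bound true₃ D₂ D₃ (c₂ η) (<⇒≤ (0<c₂ 0<η)) xs₀ inc le
          (λ _ i j k l' _ l₁ l₂ l₃ → rich i j k l' l₁ l₂ l₃)
          (EL _≟ᴵ_ law rest₁ Φ) (0≤EL _≟ᴵ_ law rest₁ Φ 0≤Φ) g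
          (λ ys g' s len facts off → choose-ν ys (AllPairs-⊆ s inc) s (long ys len) g'
            (λ {p} {b} {q} i j k l l' → leqᵇ-sound (proj₁ (proj₂ (facts i k j (tr l l'))) l l') , leqᵇ-sound (proj₂ (proj₂ (facts i j k l)) l'))))
          (≡⇒≤ (sym (EL-++ _≟ᴵ_ law (items M rβ) rest₁ Φ g)))
          where
          D₂ D₃ : A → A → A → Γ → Bool
          D₂ p q b x = leqᵇ δ₄ (deg-last p q b x)
          D₃ p q c x = leqᵇ δ₄ (deg-first p q c x)

module PoorStructures where

  open ReducedStructures using (module Degrees; 2*)
  open import Data.Integer using (+_)

  opaque
    unfolding -_

    τ₀ δ₀ w₀ ε₀ : ℚ
    τ₀ = (+ 1) Q./ 1000
    δ₀ = (+ 1) Q./ 4000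
    w₀ = (+ 198) Q./ 1000
    ε₀ = (+ 1) Q./ 1000

    0<τ₀ : 0ℚ < τ₀
    0<τ₀ = from-yes (0ℚ Q.<? τ₀)

    0<δ₀ : 0ℚ < δ₀
    0<δ₀ = from-yes (0ℚ Q.<? δ₀)

    0<ε₀ : 0ℚ < ε₀
    0<ε₀ = from-yes (0ℚ Q.<? ε₀)

    0<w₀ : 0ℚ < w₀
    0<w₀ = from-yes (0ℚ Q.<? w₀)

    fifth slack : ℚ
    fifth = (+ 1) Q./ 5
    slack = (+ 1) Q./ 2000

    0<slack : 0ℚ < slack
    0<slack = from-yes (0ℚ Q.<? slack)

    fifth-splits : fifth ≡ (w₀ + ε₀) + (slack + slack)
    fifth-splits = refl

    Δ : ℚ
    Δ = 2* (2* δ₀)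

    -- The lower bounds for the density of frequent last colours, obtained by iterating x ↦ w / (1 + τ − x)².
    levels : ℕ → ℚ
    levels 0 = 0ℚ
    levels 1 = (+ 19) Q./ 100
    levels 2 = (+ 29) Q./ 100
    levels 3 = (+ 38) Q./ 100
    levels 4 = (+ 1) Q./ 2
    levels 5 = (+ 3) Q./ 4
    levels _ = (+ 2) Q./ 1

    levels-0 : levels 0 ≡ 0ℚ
    levels-0 = refl

    1<levels-6 : 1ℚ < levels 6
    1<levels-6 = from-yes (1ℚ Q.<? levels 6)

    co-level : ℕ → ℚ
    co-level r = 1ℚ + τ₀ - levels r

    co-level-def : ∀ r → co-level r ≡ 1ℚ + τ₀ - levels r
    co-level-def r = refl

    0<co-level : ∀ r → r ℕ.< 6 → 0ℚ < co-level r
    0<co-level 0 _ = from-yes (0ℚ Q.<? co-level 0)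
    0<co-level 1 _ = from-yes (0ℚ Q.<? co-level 1)
    0<co-level 2 _ = from-yes (0ℚ Q.<? co-level 2)
    0<co-level 3 _ = from-yes (0ℚ Q.<? co-level 3)
    0<co-level 4 _ = from-yes (0ℚ Q.<? co-level 4)
    0<co-level 5 _ = from-yes (0ℚ Q.<? co-level 5)
    0<co-level (suc (suc (suc (suc (suc (suc _)))))) (ℕ.s≤s (ℕ.s≤s (ℕ.s≤s (ℕ.s≤s (ℕ.s≤s (ℕ.s≤s ()))))))

    level-step : ∀ r → r ℕ.< 6 → co-level r * co-level r * levels (suc r) ≤ w₀ - (Δ + Δ + Δ)
    level-step 0 _ = from-yes (co-level 0 * co-level 0 * levels 1 Q.≤? w₀ - (Δ + Δ + Δ))
    level-step 1 _ = from-yes (co-level 1 * co-level 1 * levels 2 Q.≤? w₀ - (Δ + Δ + Δ))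
    level-step 2 _ = from-yes (co-level 2 * co-level 2 * levels 3 Q.≤? w₀ - (Δ + Δ + Δ))
    level-step 3 _ = from-yes (co-level 3 * co-level 3 * levels 4 Q.≤? w₀ - (Δ + Δ + Δ))
    level-step 4 _ = from-yes (co-level 4 * co-level 4 * levels 5 Q.≤? w₀ - (Δ + Δ + Δ))
    level-step 5 _ = from-yes (co-level 5 * co-level 5 * levels 6 Q.≤? w₀ - (Δ + Δ + Δ))
    level-step (suc (suc (suc (suc (suc (suc _)))))) (ℕ.s≤s (ℕ.s≤s (ℕ.s≤s (ℕ.s≤s (ℕ.s≤s (ℕ.s≤s ()))))))

    δ₀≤1 : δ₀ ≤ 1ℚ
    δ₀≤1 = from-yes (δ₀ Q.≤? 1ℚ)

    Δ-def : Δ ≡ 2* (2* δ₀)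
    Δ-def = refl

    0≤Δ : 0ℚ ≤ Δ
    0≤Δ = from-yes (0ℚ Q.≤? Δ)

  private opaque
    unfolding -_
    complement-bound : ∀ τ f t x → (1ℚ + τ - x) - f ≡ (1ℚ + τ - (f + t)) + (t - x)
    complement-bound = solve-∀ ℚ-ring
    sub-shift : ∀ w d p → p - (w - d) ≡ p + d - w
    sub-shift = solve-∀ ℚ-ring
    triple-prod : ∀ f s t → f * (s * t) ≡ (f * s) * t
    triple-prod = solve-∀ ℚ-ring

  module _ {M K : ℕ} (P : Fin M → Fin M → Ex (Fin K)) (W : Fin K → Fin K → Fin K → ℚ)
    (W01 : ∀ a b r → 0ℚ ≤ W a b r × W a b r ≤ 1ℚ) where

    open Degrees P W

    freq-first freq-mid freq-last : Fin M → Fin M → Fin M → ℚ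
    freq-first i j l = 𝔼 (P i j) (λ a → 𝟙 (leqᵇ Δ (deg-first i j l a)))
    freq-mid j l i = 𝔼 (P j l) (λ b → 𝟙 (leqᵇ Δ (deg-mid j l i b)))
    freq-last i l j = 𝔼 (P i l) (λ r → 𝟙 (leqᵇ Δ (deg-last i l j r)))

    0≤freq : ∀ (E : Ex (Fin K)) (B : Fin K → Bool) → 0ℚ ≤ 𝔼 E (λ a → 𝟙 (B a))
    0≤freq E B = 0≤𝔼 E (λ a → 0≤𝟙 (B a))

    rare : Bool → ℚ
    rare true = 0ℚ
    rare false = 1ℚ

    0≤rare : ∀ b → 0ℚ ≤ rare b
    0≤rare true = ≤-refl
    0≤rare false = 0≤1

    rare-bound : ∀ x → x * rare (leqᵇ Δ x) ≤ Δ
    rare-bound x with leqᵇ Δ x in e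
    ... | true = ≤-trans (≡⇒≤ (*-zeroʳ x)) 0≤Δ
    ... | false = ≤-trans (≡⇒≤ (*-identityʳ x)) (<⇒≤ (leqᵇ-false e))

    split-weight : ∀ x y z w → 0ℚ ≤ w → w ≤ 1ℚ → w ≤ 𝟙 x * (𝟙 y * 𝟙 z) + (w * rare x + w * rare y + w * rare z)
    split-weight true true true w p q = ≤-trans q (≤-trans (≡⇒≤ (sym (trans (+-identityʳ _) (trans (*-identityˡ _) (*-identityˡ _)))))
       (+-mono-≤ ≤-refl (0≤+ (0≤+ (0≤* p ≤-refl) (0≤* p ≤-refl)) (0≤* p ≤-refl))))
    split-weight false y z w p q = ≤-trans (≡⇒≤ (sym (trans (+-identityˡ _) (trans (+-identityʳ _) (trans (+-identityʳ _) (*-identityʳ w))))))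
       (+-mono-≤ (0≤* ≤-refl (0≤* (0≤𝟙 y) (0≤𝟙 z))) (+-mono-≤ (+-mono-≤ ≤-refl (0≤* p (0≤rare y))) (0≤* p (0≤rare z))))
    split-weight true false z w p q = ≤-trans (≡⇒≤ (sym (trans (+-identityˡ _) (trans (+-identityʳ _) (trans (+-identityˡ _) (*-identityʳ w))))))
       (+-mono-≤ (0≤* 0≤1 (0≤* ≤-refl (0≤𝟙 z))) (+-mono-≤ (+-mono-≤ (0≤* p ≤-refl) ≤-refl) (0≤* p (0≤rare z))))
    split-weight true true false w p q = ≤-trans (≡⇒≤ (sym (trans (+-identityˡ _) (trans (+-identityˡ _) (*-identityʳ w)))))
       (+-mono-≤ (0≤* 0≤1 (0≤* 0≤1 ≤-refl)) (+-mono-≤ (0≤+ (0≤* p ≤-refl) (0≤* p ≤-refl)) ≤-refl))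

    density-bound : ∀ i j l → density i j l ≤ freq-first i j l * (freq-mid j l i * freq-last i l j) + (Δ + Δ + Δ)
    density-bound i j l = ≤-trans (𝔼-mono E₁ (λ a → 𝔼-mono E₂ (λ b → 𝔼-mono E₃ (λ r →
        split-weight (F a) (S b) (T r) (W a b r) (proj₁ (W01 a b r)) (proj₂ (W01 a b r))))))
      (≤-trans (≡⇒≤ expand) (+-mono-≤ (≡⇒≤ main) (+-mono-≤ (+-mono-≤ first mid) last)))
      where
      E₁ = P i j
      E₂ = P j l
      E₃ = P i l
      F S T : Fin K → Bool
      F a = leqᵇ Δ (deg-first i j l a)
      S b = leqᵇ Δ (deg-mid j l i b)
      T r = leqᵇ Δ (deg-last i l j r)
      E : (Fin K → Fin K → Fin K → ℚ) → ℚ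
      E X = 𝔼 E₁ (λ a → 𝔼 E₂ (λ b → 𝔼 E₃ (λ r → X a b r)))
      E-+ : ∀ X Y → E (λ a b r → X a b r + Y a b r) ≡ E X + E Y
      E-+ X Y = trans (𝔼-cong E₁ (λ a → trans (𝔼-cong E₂ (λ b → 𝔼-+ E₃ _ _)) (𝔼-+ E₂ _ _))) (𝔼-+ E₁ _ _)
      expand : E (λ a b r → 𝟙 (F a) * (𝟙 (S b) * 𝟙 (T r)) + (W a b r * rare (F a) + W a b r * rare (S b) + W a b r * rare (T r)))
        ≡ E (λ a b r → 𝟙 (F a) * (𝟙 (S b) * 𝟙 (T r)))
          + (E (λ a b r → W a b r * rare (F a)) + E (λ a b r → W a b r * rare (S b)) + E (λ a b r → W a b r * rare (T r)))
      expand = trans (E-+ _ _) (cong₂ _+_ refl (trans (E-+ _ _) (cong₂ _+_ (E-+ _ _) refl)))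
      main : E (λ a b r → 𝟙 (F a) * (𝟙 (S b) * 𝟙 (T r))) ≡ freq-first i j l * (freq-mid j l i * freq-last i l j)
      main = trans (𝔼-cong E₁ (λ a → trans (𝔼-cong E₂ (λ b → trans (𝔼-* E₃ (𝟙 (F a)) _) (cong (𝟙 (F a) *_) (𝔼-* E₃ (𝟙 (S b)) _))))
               (trans (𝔼-* E₂ (𝟙 (F a)) _) (cong (𝟙 (F a) *_) (𝔼-*ʳ E₂ (freq-last i l j) _)))))
               (𝔼-*ʳ E₁ (freq-mid j l i * freq-last i l j) _)
      first : E (λ a b r → W a b r * rare (F a)) ≤ Δ
      first = ≤-trans (≡⇒≤ (𝔼-cong E₁ (λ a → trans (𝔼-cong E₂ (λ b → 𝔼-*ʳ E₃ (rare (F a)) _)) (𝔼-*ʳ E₂ (rare (F a)) _))))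
        (𝔼≤ E₁ (λ a → rare-bound (deg-first i j l a)))
      mid : E (λ a b r → W a b r * rare (S b)) ≤ Δ
      mid = ≤-trans (≡⇒≤ (trans (𝔼-swap E₂ E₁ (λ b a → 𝔼 E₃ (λ r → W a b r * rare (S b))))
          (𝔼-cong E₂ (λ b → trans (𝔼-cong E₁ (λ a → 𝔼-*ʳ E₃ (rare (S b)) _)) (𝔼-*ʳ E₁ (rare (S b)) _)))))
        (𝔼≤ E₂ (λ b → rare-bound (deg-mid j l i b)))
      last : E (λ a b r → W a b r * rare (T r)) ≤ Δ
      last = ≤-trans (≡⇒≤ (trans (𝔼-swap E₂ E₁ (λ b a → 𝔼 E₃ (λ r → W a b r * rare (T r))))
          (trans (𝔼-cong E₂ (λ b → 𝔼-swap E₃ E₁ (λ r a → W a b r * rare (T r))))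
          (trans (𝔼-swap E₃ E₂ (λ r b → 𝔼 E₁ (λ a → W a b r * rare (T r))))
            (𝔼-cong E₃ (λ r → trans (𝔼-cong E₂ (λ b → 𝔼-*ʳ E₁ (rare (T r)) _)) (𝔼-*ʳ E₂ (rare (T r)) _)))))))
        (𝔼≤ E₃ (λ r → rare-bound (deg-last i l j r)))

    inclusion-exclusion : ∀ (E : Ex (Fin K)) (A B : Fin K → Bool) τ → 𝔼 E (λ a → 𝟙 (A a ∧ B a)) ≤ τ →
      𝔼 E (λ a → 𝟙 (B a)) + 𝔼 E (λ a → 𝟙 (A a)) ≤ 1ℚ + τ
    inclusion-exclusion E A B τ h = ≤-trans (≡⇒≤ (sym (𝔼-+ E _ _))) (≤-trans (𝔼-mono E (λ a → pt (A a) (B a)))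
        (≤-trans (≡⇒≤ (trans (𝔼-+ E _ _) (cong₂ _+_ (𝔼-1 E) refl))) (+-monoʳ-≤ 1ℚ h)))
      where
      pt : ∀ a b → 𝟙 b + 𝟙 a ≤ 1ℚ + 𝟙 (a ∧ b)
      pt true true = ≤-refl
      pt true false = ≡⇒≤ (+-comm 0ℚ 1ℚ)
      pt false b = +-mono-≤ (𝟙≤1 b) ≤-refl

    RichRev : ℚ → ℚ → Fin M → Fin M → Fin M → Fin M → Set
    RichRev τ δ h i m j = τ ≤ 𝔼 (P i j) (λ b → 𝟙 (leqᵇ δ (deg-last i j m b) ∧ leqᵇ δ (deg-mid i j h b)))

    private
      gap : ℕ → ℕ
      gap zero = 1
      gap (suc r) = gap r ℕ.+ gap r

      1≤gap : ∀ r → 1 ℕ.≤ gap r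
      1≤gap zero = ℕP.≤-refl
      1≤gap (suc r) = ℕP.≤-trans (1≤gap r) (ℕP.m≤m+n _ _)

    -- Without rich configurations the frequent first and middle colours of a pair are almost disjoint from its
    -- frequent last colours, so a lower bound x for the latter bounds the former by 1 + τ − x,
    -- and the density condition improves x.
    poor-contradiction : ∀ L → 128 ℕ.< L → (q : ℕ → Fin M) →
      (∀ {i j k} → i ℕ.< j → j ℕ.< k → k ℕ.< L → w₀ ≤ density (q i) (q j) (q k)) →
      (∀ {i m j l} → i ℕ.< m → m ℕ.< j → j ℕ.< l → l ℕ.< L → ¬ Rich τ₀ Δ (q i) (q m) (q j) (q l)) →
      (∀ {h i m j} → h ℕ.< i → i ℕ.< m → m ℕ.< j → j ℕ.< L → ¬ RichRev τ₀ Δ (q h) (q i) (q m) (q j)) → ⊥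
    poor-contradiction L long q dense poor poor' = final (level 6 ℕP.≤-refl {0} {64} {128} ℕP.≤-refl ℕP.≤-refl long)
      where
      level : ∀ r → r ℕ.≤ 6 → ∀ {i j k} → i ℕ.+ gap r ℕ.≤ j → j ℕ.+ gap r ℕ.≤ k → k ℕ.< L → levels r ≤ freq-last (q i) (q k) (q j)
      level zero _ {i} {j} {k} _ _ _ = ≤-trans (≡⇒≤ levels-0) (0≤freq (P (q i) (q k)) _)
      level (suc r) r<6 {i} {j} {k} ij jk kL = *-cancel (0<* pos pos) (≤-trans (level-step r r<6) (≤-trans bound₁
          (≤-trans (≡⇒≤ (triple-prod _ _ _)) (*-monoʳ (0≤freq (P (q i) (q k)) _) (*-mono-≤ (0≤freq (P (q i) (q j)) _) f≤ (0≤freq (P (q j) (q k)) _) s≤)))))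
        where
        pos = 0<co-level r r<6
        r≤6 = ℕP.<⇒≤ r<6
        m = i ℕ.+ gap r
        m' = j ℕ.+ gap r
        g+ : ∀ {x y} → x ℕ.+ (gap r ℕ.+ gap r) ℕ.≤ y → x ℕ.+ gap r ℕ.+ gap r ℕ.≤ y
        g+ {x} {y} = subst (ℕ._≤ y) (sym (ℕP.+-assoc x (gap r) (gap r)))
        l< : ∀ x → x ℕ.< x ℕ.+ gap r
        l< x = subst (ℕ._≤ x ℕ.+ gap r) (ℕP.+-comm x 1) (ℕP.+-monoʳ-≤ x (1≤gap r))
        m<j : m ℕ.< j
        m<j = ℕP.≤-trans (l< m) (g+ {i} ij)
        m'<k : m' ℕ.< k
        m'<k = ℕP.≤-trans (l< m') (g+ {j} jk)
        j<k : j ℕ.< k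
        j<k = ℕP.<-trans (l< j) m'<k
        i<j : i ℕ.< j
        i<j = ℕP.<-trans (l< i) m<j
        t≥ : levels r ≤ freq-last (q i) (q j) (q m)
        t≥ = level r r≤6 ℕP.≤-refl (g+ {i} ij) (ℕP.<-trans j<k kL)
        t'≥ : levels r ≤ freq-last (q j) (q k) (q m')
        t'≥ = level r r≤6 ℕP.≤-refl (g+ {j} jk) kL
        below : ∀ {x y} → ¬ (x ≤ y) → y ≤ x
        below n = <⇒≤ (QP.≰⇒> n)
        f≤ : freq-first (q i) (q j) (q k) ≤ co-level r
        f≤ = ≤-trans (0≤-⇒≤ (subst (0ℚ ≤_) (sym (complement-bound τ₀ _ _ (levels r)))
              (0≤+ (≤⇒0≤- (inclusion-exclusion (P (q i) (q j)) (λ b → leqᵇ Δ (deg-last (q i) (q j) (q m) b)) (λ b → leqᵇ Δ (deg-first (q i) (q j) (q k) b)) τ₀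
                 (below (poor (l< i) m<j j<k kL)))) (≤⇒0≤- t≥)))) (≡⇒≤ (sym (co-level-def r)))
        s≤ : freq-mid (q j) (q k) (q i) ≤ co-level r
        s≤ = ≤-trans (0≤-⇒≤ (subst (0ℚ ≤_) (sym (complement-bound τ₀ _ _ (levels r)))
              (0≤+ (≤⇒0≤- (inclusion-exclusion (P (q j) (q k)) (λ b → leqᵇ Δ (deg-last (q j) (q k) (q m') b)) (λ b → leqᵇ Δ (deg-mid (q j) (q k) (q i) b)) τ₀
                 (below (poor' i<j (l< j) m'<k kL)))) (≤⇒0≤- t'≥)))) (≡⇒≤ (sym (co-level-def r)))
        bound₁ : w₀ - (Δ + Δ + Δ) ≤ freq-first (q i) (q j) (q k) * (freq-mid (q j) (q k) (q i) * freq-last (q i) (q k) (q j))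
        bound₁ = 0≤-⇒≤ (subst (0ℚ ≤_) (sym (sub-shift w₀ (Δ + Δ + Δ) _)) (≤⇒0≤- (≤-trans (dense i<j j<k kL) (density-bound (q i) (q j) (q k)))))
      final : ∀ {i j k} → levels 6 ≤ freq-last (q i) (q k) (q j) → ⊥
      final {i} {j} {k} h = <-irrefl refl (<-≤-trans 1<levels-6 (≤-trans h (𝔼≤ (P (q i) (q k)) (λ r → 𝟙≤1 _))))

module WeightedDensity where

  open Conditioning using (In01)
  open Tuples using (upd; upd-same; upd-other)
  open Archimedean
  open Selection using (lsum)
  open import Data.Nat.Tactic.RingSolver renaming (solve-∀ to solveℕ-∀)
  open import Data.Nat.Combinatorics using (_C_)

  isEdge? : ∀ {n} (H : Graph3 n) a b c → Dec (IsEdge H a b c)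
  isEdge? H a b c = sorted a b c ⊎-dec sorted a c b ⊎-dec sorted b a c ⊎-dec sorted b c a ⊎-dec sorted c a b ⊎-dec sorted c b a
    where sorted : ∀ x y z → Dec (x Fin.< y × y Fin.< z × H x y z ≡ true)
          sorted x y z = x FinP.<? y ×-dec y FinP.<? z ×-dec (H x y z BoolP.≟ true)

  opaque
    edgeᵇ : ∀ {n} → Graph3 n → Fin n → Fin n → Fin n → Bool
    edgeᵇ H a b c = does (isEdge? H a b c)

    edgeᵇ-sound : ∀ {n} (H : Graph3 n) a b c → edgeᵇ H a b c ≡ true → IsEdge H a b c
    edgeᵇ-sound H a b c = does-true (isEdge? H a b c)

    edgeᵇ-false : ∀ {n} (H : Graph3 n) a b c → edgeᵇ H a b c ≡ false → ¬ IsEdge H a b c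
    edgeᵇ-false H a b c = does-false (isEdge? H a b c)

  IsEdge-swap₁ : ∀ {n} (H : Graph3 n) {a b c} → IsEdge H a b c → IsEdge H b a c
  IsEdge-swap₁ H (inj₁ x) = inj₂ (inj₂ (inj₁ x))
  IsEdge-swap₁ H (inj₂ (inj₁ x)) = inj₂ (inj₂ (inj₂ (inj₁ x)))
  IsEdge-swap₁ H (inj₂ (inj₂ (inj₁ x))) = inj₁ x
  IsEdge-swap₁ H (inj₂ (inj₂ (inj₂ (inj₁ x)))) = inj₂ (inj₁ x)
  IsEdge-swap₁ H (inj₂ (inj₂ (inj₂ (inj₂ (inj₁ x))))) = inj₂ (inj₂ (inj₂ (inj₂ (inj₂ x))))
  IsEdge-swap₁ H (inj₂ (inj₂ (inj₂ (inj₂ (inj₂ x))))) = inj₂ (inj₂ (inj₂ (inj₂ (inj₁ x))))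

  IsEdge-swap₂ : ∀ {n} (H : Graph3 n) {a b c} → IsEdge H a b c → IsEdge H a c b
  IsEdge-swap₂ H (inj₁ x) = inj₂ (inj₁ x)
  IsEdge-swap₂ H (inj₂ (inj₁ x)) = inj₁ x
  IsEdge-swap₂ H (inj₂ (inj₂ (inj₁ x))) = inj₂ (inj₂ (inj₂ (inj₂ (inj₁ x))))
  IsEdge-swap₂ H (inj₂ (inj₂ (inj₂ (inj₁ x)))) = inj₂ (inj₂ (inj₂ (inj₂ (inj₂ x))))
  IsEdge-swap₂ H (inj₂ (inj₂ (inj₂ (inj₂ (inj₁ x))))) = inj₂ (inj₂ (inj₁ x))
  IsEdge-swap₂ H (inj₂ (inj₂ (inj₂ (inj₂ (inj₂ x))))) = inj₂ (inj₂ (inj₂ (inj₁ x)))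

  bool-ext : ∀ {a b} → (a ≡ true → b ≡ true) → (b ≡ true → a ≡ true) → a ≡ b
  bool-ext {true} {b} f g = sym (f refl)
  bool-ext {false} {true} f g = g refl
  bool-ext {false} {false} f g = refl

  edgeᵇ-complete : ∀ {n} (H : Graph3 n) a b c → IsEdge H a b c → edgeᵇ H a b c ≡ true
  edgeᵇ-complete H a b c e with edgeᵇ H a b c in eq
  ... | true = refl
  ... | false = ⊥-elim (edgeᵇ-false H a b c eq e)

  edgeᵇ-swap₁ : ∀ {n} (H : Graph3 n) a b c → edgeᵇ H a b c ≡ edgeᵇ H b a c
  edgeᵇ-swap₁ H a b c = bool-ext (λ e → edgeᵇ-complete H b a c (IsEdge-swap₁ H (edgeᵇ-sound H a b c e)))
    (λ e → edgeᵇ-complete H a b c (IsEdge-swap₁ H (edgeᵇ-sound H b a c e)))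

  edgeᵇ-swap₂ : ∀ {n} (H : Graph3 n) a b c → edgeᵇ H a b c ≡ edgeᵇ H a c b
  edgeᵇ-swap₂ H a b c = bool-ext (λ e → edgeᵇ-complete H a c b (IsEdge-swap₂ H (edgeᵇ-sound H a b c e)))
    (λ e → edgeᵇ-complete H a b c (IsEdge-swap₂ H (edgeᵇ-sound H a c b e)))

  IsEdge-distinct : ∀ {n} (H : Graph3 n) {a b c} → IsEdge H a b c → a ≢ b × b ≢ c × a ≢ c
  IsEdge-distinct H e = lem e
    where
    ne : ∀ {n} {x y : Fin n} → x Fin.< y → x ≢ y
    ne l refl = ℕP.<-irrefl refl l
    ne' : ∀ {n} {x y : Fin n} → x Fin.< y → y ≢ x
    ne' l refl = ℕP.<-irrefl refl l
    lem : ∀ {a b c} → IsEdge H a b c → a ≢ b × b ≢ c × a ≢ c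
    lem (inj₁ (p , q , _)) = ne p , ne q , ne (ℕP.<-trans p q)
    lem (inj₂ (inj₁ (p , q , _))) = ne (ℕP.<-trans p q) , ne' q , ne p
    lem (inj₂ (inj₂ (inj₁ (p , q , _)))) = ne' p , ne (ℕP.<-trans p q) , ne q
    lem (inj₂ (inj₂ (inj₂ (inj₁ (p , q , _))))) = ne' (ℕP.<-trans p q) , ne p , ne' q
    lem (inj₂ (inj₂ (inj₂ (inj₂ (inj₁ (p , q , _)))))) = ne q , ne' (ℕP.<-trans p q) , ne' p
    lem (inj₂ (inj₂ (inj₂ (inj₂ (inj₂ (p , q , _)))))) = ne' q , ne' p , ne' (ℕP.<-trans p q)

  -- increasing triples: the six orderings of an edge are mutually exclusive

  sortedᵇ : ∀ {n} → Graph3 n → Fin n → Fin n → Fin n → Bool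
  sortedᵇ H a b c = lt a b ∧ lt b c ∧ H a b c

  lt-sound : ∀ {n} (i j : Fin n) → lt i j ≡ true → i Fin.< j
  lt-sound i j e with toℕ i ℕ.<? toℕ j
  ... | yes p = p

  sortedᵇ-sound : ∀ {n} (H : Graph3 n) a b c → sortedᵇ H a b c ≡ true → a Fin.< b × b Fin.< c × H a b c ≡ true
  sortedᵇ-sound H a b c e with lt a b in p | lt b c in q
  ... | true | true = lt-sound a b p , lt-sound b c q , e

  exclusive-sum : ∀ bs → AllPairs (λ a b → a ≡ true → b ≡ true → ⊥) bs → lsum 𝟙 bs ≤ 1ℚ
  exclusive-sum [] [] = 0≤1
  exclusive-sum (false ∷ bs) (_ ∷ p) = ≤-trans (≡⇒≤ (+-identityˡ _)) (exclusive-sum bs p)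
  exclusive-sum (true ∷ bs) (a ∷ p) = ≡⇒≤ (trans (cong (1ℚ +_) (zero-sum bs a)) (+-identityʳ 1ℚ))
    where
    zero-sum : ∀ bs → All (λ b → true ≡ true → b ≡ true → ⊥) bs → lsum 𝟙 bs ≡ 0ℚ
    zero-sum [] [] = refl
    zero-sum (true ∷ bs) (f ∷ _) = ⊥-elim (f refl refl)
    zero-sum (false ∷ bs) (_ ∷ q) = trans (+-identityˡ _) (zero-sum bs q)

  none-sum : ∀ bs → (∀ {b} → b ∈ bs → b ≡ true → ⊥) → lsum 𝟙 bs ≤ 0ℚ
  none-sum [] h = ≤-refl
  none-sum (true ∷ bs) h = ⊥-elim (h (here refl) refl)
  none-sum (false ∷ bs) h = ≤-trans (≡⇒≤ (+-identityˡ _)) (none-sum bs (λ i → h (there i)))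

  module _ {n : ℕ} (H : Graph3 n) where

    private
      s = sortedᵇ H

    six : Fin n → Fin n → Fin n → List Bool
    six a b c = s a b c ∷ s a c b ∷ s b a c ∷ s b c a ∷ s c a b ∷ s c b a ∷ []

    six≤ : ∀ a b c → lsum 𝟙 (six a b c) ≤ 𝟙 (edgeᵇ H a b c)
    six≤ a b c with edgeᵇ H a b c in eq
    ... | false = none-sum (six a b c) (λ
            { (here refl) e → no-edge (inj₁ (sortedᵇ-sound H a b c e))
            ; (there (here refl)) e → no-edge (inj₂ (inj₁ (sortedᵇ-sound H a c b e)))
            ; (there (there (here refl))) e → no-edge (inj₂ (inj₂ (inj₁ (sortedᵇ-sound H b a c e))))
            ; (there (there (there (here refl)))) e → no-edge (inj₂ (inj₂ (inj₂ (inj₁ (sortedᵇ-sound H b c a e)))))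
            ; (there (there (there (there (here refl))))) e → no-edge (inj₂ (inj₂ (inj₂ (inj₂ (inj₁ (sortedᵇ-sound H c a b e))))))
            ; (there (there (there (there (there (here refl)))))) e → no-edge (inj₂ (inj₂ (inj₂ (inj₂ (inj₂ (sortedᵇ-sound H c b a e)))))) })
      where no-edge = edgeᵇ-false H a b c eq
    ... | true = exclusive-sum (six a b c)
        ((x₁ ∷ x₂ ∷ x₃ ∷ x₄ ∷ x₅ ∷ []) ∷ (x₆ ∷ x₇ ∷ x₈ ∷ x₉ ∷ []) ∷ (x₁₀ ∷ x₁₁ ∷ x₁₂ ∷ []) ∷ (x₁₃ ∷ x₁₄ ∷ []) ∷ (x₁₅ ∷ []) ∷ [] ∷ [])
      where
      open ℕP using (<-asym; <-trans)
      fst : ∀ x y z → s x y z ≡ true → x Fin.< y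
      fst x y z e = proj₁ (sortedᵇ-sound H x y z e)
      snd : ∀ x y z → s x y z ≡ true → y Fin.< z
      snd x y z e = proj₁ (proj₂ (sortedᵇ-sound H x y z e))
      out : ∀ x y z → s x y z ≡ true → x Fin.< z
      out x y z e = <-trans (fst x y z e) (snd x y z e)
      x₁ : s a b c ≡ true → s a c b ≡ true → ⊥
      x₁ e e' = <-asym (snd a b c e) (snd a c b e')
      x₂ : s a b c ≡ true → s b a c ≡ true → ⊥
      x₂ e e' = <-asym (fst a b c e) (fst b a c e')
      x₃ : s a b c ≡ true → s b c a ≡ true → ⊥
      x₃ e e' = <-asym (fst a b c e) (out b c a e')
      x₄ : s a b c ≡ true → s c a b ≡ true → ⊥
      x₄ e e' = <-asym (snd a b c e) (out c a b e')
      x₅ : s a b c ≡ true → s c b a ≡ true → ⊥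
      x₅ e e' = <-asym (fst a b c e) (snd c b a e')
      x₆ : s a c b ≡ true → s b a c ≡ true → ⊥
      x₆ e e' = <-asym (out a c b e) (fst b a c e')
      x₇ : s a c b ≡ true → s b c a ≡ true → ⊥
      x₇ e e' = <-asym (snd a c b e) (fst b c a e')
      x₈ : s a c b ≡ true → s c a b ≡ true → ⊥
      x₈ e e' = <-asym (fst a c b e) (fst c a b e')
      x₉ : s a c b ≡ true → s c b a ≡ true → ⊥
      x₉ e e' = <-asym (fst a c b e) (out c b a e')
      x₁₀ : s b a c ≡ true → s b c a ≡ true → ⊥
      x₁₀ e e' = <-asym (snd b a c e) (snd b c a e')
      x₁₁ : s b a c ≡ true → s c a b ≡ true → ⊥
      x₁₁ e e' = <-asym (snd b a c e) (fst c a b e')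
      x₁₂ : s b a c ≡ true → s c b a ≡ true → ⊥
      x₁₂ e e' = <-asym (snd b a c e) (out c b a e')
      x₁₃ : s b c a ≡ true → s c a b ≡ true → ⊥
      x₁₃ e e' = <-asym (fst b c a e) (out c a b e')
      x₁₄ : s b c a ≡ true → s c b a ≡ true → ⊥
      x₁₄ e e' = <-asym (fst b c a e) (fst c b a e')
      x₁₅ : s c a b ≡ true → s c b a ≡ true → ⊥
      x₁₅ e e' = <-asym (snd c a b e) (snd c b a e')

  toℚ-fromℕ : ∀ m → toℚ m ≡ fromℕ m
  toℚ-fromℕ m = sym (fromℕ-/ m)

  Σfin-∑ : ∀ {n} (g : Fin n → ℕ) → fromℕ (Σfin g) ≡ ∑ (λ i → fromℕ (g i))
  Σfin-∑ {n} g = go n (λ i → i)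
    where
    go : ∀ k (f : Fin k → Fin n) → fromℕ (sum (map g (tabulate f))) ≡ ∑ (λ i → fromℕ (g (f i)))
    go zero f = sym (∑-zero _)
    go (suc k) f = trans (fromℕ-+ (g (f zero)) _) (trans (cong (λ z → fromℕ (g (f zero)) + z) (go k (λ i → f (suc i)))) (sym (∑-suc _)))

  fromℕ-if : ∀ b → fromℕ (if b then 1 else 0) ≡ 𝟙 b
  fromℕ-if true = +-identityʳ 1ℚ
  fromℕ-if false = refl

  choose₂ : ∀ s → s ℕ.* s ℕ.≤ 2 ℕ.* (s C 2) ℕ.+ s
  choose₂ zero = ℕ.z≤n
  choose₂ (suc s) = subst₂ ℕ._≤_ (e₁ s) (trans (e₂ s (s C 2)) (cong (λ z → 2 ℕ.* z ℕ.+ suc s) (trans (cong (ℕ._+ s C 2) (sym (nC1≡n s))) (nCk+nC[k+1]≡[n+1]C[k+1] s 1))))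
    (ℕP.+-monoˡ-≤ (2 ℕ.* s ℕ.+ 1) (choose₂ s))
    where
    e₁ : ∀ s → s ℕ.* s ℕ.+ (2 ℕ.* s ℕ.+ 1) ≡ suc s ℕ.* suc s
    e₁ = solveℕ-∀
    e₂ : ∀ s c → 2 ℕ.* c ℕ.+ s ℕ.+ (2 ℕ.* s ℕ.+ 1) ≡ 2 ℕ.* (s ℕ.+ c) ℕ.+ suc s
    e₂ = solveℕ-∀

  choose₃ : ∀ s → s ℕ.* (s ℕ.* s) ℕ.≤ 6 ℕ.* (s C 3) ℕ.+ 3 ℕ.* (s ℕ.* s)
  choose₃ zero = ℕ.z≤n
  choose₃ (suc s) = ℕP.≤-trans (subst₂ ℕ._≤_ (e₁ s) refl (ℕP.+-mono-≤ (choose₃ s) (ℕP.+-monoˡ-≤ (3 ℕ.* s ℕ.+ 1) (ℕP.*-monoʳ-≤ 3 (choose₂ s)))))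
    (ℕP.≤-trans (ℕP.m≤m+n _ 2) (ℕP.≤-reflexive (trans (e₂ s (s C 2) (s C 3))
      (cong (λ z → 6 ℕ.* z ℕ.+ 3 ℕ.* (suc s ℕ.* suc s)) (nCk+nC[k+1]≡[n+1]C[k+1] s 2)))))
    where
    e₁ : ∀ s → s ℕ.* (s ℕ.* s) ℕ.+ (3 ℕ.* (s ℕ.* s) ℕ.+ (3 ℕ.* s ℕ.+ 1)) ≡ suc s ℕ.* (suc s ℕ.* suc s)
    e₁ = solveℕ-∀
    e₂ : ∀ s c₂ c₃ → 6 ℕ.* c₃ ℕ.+ 3 ℕ.* (s ℕ.* s) ℕ.+ (3 ℕ.* (2 ℕ.* c₂ ℕ.+ s) ℕ.+ (3 ℕ.* s ℕ.+ 1)) ℕ.+ 2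
      ≡ 6 ℕ.* (c₂ ℕ.+ c₃) ℕ.+ 3 ℕ.* (suc s ℕ.* suc s)
    e₂ = solveℕ-∀

  private opaque
    unfolding -_
    six-split : ∀ a b c d e f u → (a + (b + (c + (d + (e + (f + 0ℚ)))))) * u ≡ a * u + (b * u + (c * u + (d * u + (e * u + f * u))))
    six-split = solve-∀ ℚ-ring
    six-total : ∀ x → x + (x + (x + (x + (x + x)))) ≡ (1ℚ + (1ℚ + (1ℚ + (1ℚ + (1ℚ + (1ℚ + 0ℚ)))))) * x
    six-total = solve-∀ ℚ-ring
    prod-swap₂ : ∀ x y z → x * (y * z) ≡ x * (z * y)
    prod-swap₂ = solve-∀ ℚ-ring
    prod-swap₁ : ∀ x y z → x * (y * z) ≡ y * (x * z)
    prod-swap₁ = solve-∀ ℚ-ring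

  ∑³ : ∀ {n} → (Fin n → Fin n → Fin n → ℚ) → ℚ
  ∑³ f = ∑ (λ a → ∑ (λ b → ∑ (λ c → f a b c)))

  ∑³-cong : ∀ {n} {f g : Fin n → Fin n → Fin n → ℚ} → (∀ a b c → f a b c ≡ g a b c) → ∑³ f ≡ ∑³ g
  ∑³-cong e = ∑-cong (λ a → ∑-cong (λ b → ∑-cong (λ c → e a b c)))

  ∑³-+ : ∀ {n} (f g : Fin n → Fin n → Fin n → ℚ) → ∑³ (λ a b c → f a b c + g a b c) ≡ ∑³ f + ∑³ g
  ∑³-+ f g = trans (∑-cong (λ a → trans (∑-cong (λ b → ∑-+ (f a b) (g a b))) (∑-+ _ _))) (∑-+ _ _)

  ∑³-swap₁ : ∀ {n} (f : Fin n → Fin n → Fin n → ℚ) → ∑³ (λ a b c → f b a c) ≡ ∑³ f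
  ∑³-swap₁ f = ∑-swap (λ a b → ∑ (f b a))

  ∑³-swap₂ : ∀ {n} (f : Fin n → Fin n → Fin n → ℚ) → ∑³ (λ a b c → f a c b) ≡ ∑³ f
  ∑³-swap₂ f = ∑-cong (λ a → ∑-swap (λ b c → f a c b))

  module _ {n : ℕ} (H : Graph3 n) (U : Fin n → Bool) where

    private
      u : Fin n → ℚ
      u i = 𝟙 (U i)
      uuu : Fin n → Fin n → Fin n → ℚ
      uuu a b c = u a * (u b * u c)
      t : Fin n → Fin n → Fin n → ℚ
      t a b c = 𝟙 (sortedᵇ H a b c) * uuu a b c

    edgesIn-∑ : fromℕ (edgesIn H U) ≡ ∑³ t
    edgesIn-∑ = trans (Σfin-∑ _) (∑-cong (λ i → trans (Σfin-∑ _) (∑-cong (λ j → trans (Σfin-∑ _) (∑-cong (λ k →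
        trans (fromℕ-if _) (bools (lt i j) (lt j k) (U i) (U j) (U k) (H i j k))))))))
      where
      bools : ∀ l m x y z h → 𝟙 (l ∧ m ∧ x ∧ y ∧ z ∧ h) ≡ 𝟙 (l ∧ m ∧ h) * (𝟙 x * (𝟙 y * 𝟙 z))
      bools false m x y z h = sym (*-zeroˡ _)
      bools true false x y z h = sym (*-zeroˡ _)
      bools true true false y z h = sym (trans (cong (𝟙 h *_) (*-zeroˡ _)) (*-zeroʳ _))
      bools true true true false z h = sym (trans (cong (𝟙 h *_) (trans (*-identityˡ _) (*-zeroˡ _))) (*-zeroʳ _))
      bools true true true true false h = sym (trans (cong (𝟙 h *_) (trans (*-identityˡ _) (*-identityˡ _))) (*-zeroʳ _))
      bools true true true true true h = sym (trans (cong (𝟙 h *_) (trans (*-identityˡ _) (*-identityˡ _))) (*-identityʳ _))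

    six-edges : fromℕ 6 * fromℕ (edgesIn H U) ≤ ∑³ (λ a b c → 𝟙 (edgeᵇ H a b c) * uuu a b c)
    six-edges = ≤-trans (≡⇒≤ (sym (trans expand (trans (cong₂ _+_ refl (cong₂ _+_ p₂ (cong₂ _+_ p₃ (cong₂ _+_ p₄ (cong₂ _+_ p₅ p₆)))))
        (trans (six-total (∑³ t)) (cong (fromℕ 6 *_) (sym edgesIn-∑)))))))
      (∑-mono (λ a → ∑-mono (λ b → ∑-mono (λ c → *-monoʳ (0≤uuu a b c) (six≤ H a b c)))))
      where
      0≤uuu : ∀ a b c → 0ℚ ≤ uuu a b c
      0≤uuu a b c = 0≤* (0≤𝟙 (U a)) (0≤* (0≤𝟙 (U b)) (0≤𝟙 (U c)))
      s = sortedᵇ H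
      tm : Bool → Fin n → Fin n → Fin n → ℚ
      tm x a b c = 𝟙 x * uuu a b c
      expand : ∑³ (λ a b c → lsum 𝟙 (six H a b c) * uuu a b c)
        ≡ ∑³ t + (∑³ (λ a b c → tm (s a c b) a b c) + (∑³ (λ a b c → tm (s b a c) a b c) + (∑³ (λ a b c → tm (s b c a) a b c)
          + (∑³ (λ a b c → tm (s c a b) a b c) + ∑³ (λ a b c → tm (s c b a) a b c)))))
      expand = trans (∑³-cong (λ a b c → six-split _ _ _ _ _ _ (uuu a b c)))
        (trans (∑³-+ t _) (cong₂ _+_ refl (trans (∑³-+ (λ a b c → tm (s a c b) a b c) _) (cong₂ _+_ refl (trans (∑³-+ (λ a b c → tm (s b a c) a b c) _)
        (cong₂ _+_ refl (trans (∑³-+ (λ a b c → tm (s b c a) a b c) _) (cong₂ _+_ refl (∑³-+ (λ a b c → tm (s c a b) a b c) (λ a b c → tm (s c b a) a b c))))))))))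
      p₂ : ∑³ (λ a b c → tm (s a c b) a b c) ≡ ∑³ t
      p₂ = trans (∑³-cong (λ a b c → cong (𝟙 (s a c b) *_) (prod-swap₂ (u a) (u b) (u c)))) (∑³-swap₂ t)
      p₃ : ∑³ (λ a b c → tm (s b a c) a b c) ≡ ∑³ t
      p₃ = trans (∑³-cong (λ a b c → cong (𝟙 (s b a c) *_) (prod-swap₁ (u a) (u b) (u c)))) (∑³-swap₁ t)
      p₄ : ∑³ (λ a b c → tm (s b c a) a b c) ≡ ∑³ t
      p₄ = trans (sym (∑³-swap₁ (λ a b c → tm (s b c a) a b c))) (trans (∑³-cong (λ a b c → cong (𝟙 (s a c b) *_) (prod-swap₁ (u b) (u a) (u c)))) p₂)
      p₅ : ∑³ (λ a b c → tm (s c a b) a b c) ≡ ∑³ t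
      p₅ = trans (sym (∑³-swap₂ (λ a b c → tm (s c a b) a b c))) (trans (∑³-cong (λ a b c → cong (𝟙 (s b a c) *_) (prod-swap₂ (u a) (u c) (u b)))) p₃)
      p₆ : ∑³ (λ a b c → tm (s c b a) a b c) ≡ ∑³ t
      p₆ = trans (sym (∑³-swap₁ (λ a b c → tm (s c b a) a b c))) (trans (∑³-cong (λ a b c → cong (𝟙 (s c a b) *_) (prod-swap₁ (u b) (u a) (u c)))) p₅)

    size-∑ : fromℕ (size U) ≡ ∑ u
    size-∑ = trans (Σfin-∑ _) (∑-cong (λ i → fromℕ-if (U i)))

  cube : ℚ → ℚ
  cube x = x * (x * x)

  opaque
    unfolding -_
    dense-at : ∀ {n d μ} {H : Graph3 n} → Dense d μ H → ∀ U → d * toℚ (size U C 3) - μ * toℚ (n ℕ.^ 3) ≤ toℚ (edgesIn H U)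
    dense-at D U = D U

  private opaque
    unfolding -_
    chain₁ : ∀ d s6c q → d * (s6c + q) ≡ d * s6c + d * q
    chain₁ = solve-∀ ℚ-ring
    six-factor : ∀ k d c m n e → k * (e - (d * c - m * n)) ≡ k * e + k * (m * n) - d * (k * c)
    six-factor = solve-∀ ℚ-ring
    move : ∀ X m a b → (X + m + a) - b ≡ (X + m - b) + a
    move = solve-∀ ℚ-ring
    scale : ∀ ι X k μ N q → ι * (ι * (ι * (X + k * (μ * (N * (N * (N * 1ℚ)))) + q * (N * N))))
      ≡ ι * (ι * (ι * X)) + k * (μ * ((N * ι) * ((N * ι) * (N * ι)))) + q * (ι * ((N * ι) * (N * ι)))
    scale = solve-∀ ℚ-ring
    cube-scale : ∀ ι d s → ι * (ι * (ι * (d * (s * (s * s))))) ≡ d * ((ι * s) * ((ι * s) * (ι * s)))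
    cube-scale = solve-∀ ℚ-ring
    ones : ∀ x k μ q ι → x + k * (μ * (1ℚ * (1ℚ * 1ℚ))) + q * (ι * (1ℚ * 1ℚ)) ≡ x + (k * μ + q * ι)
    ones = solve-∀ ℚ-ring
    convex-diff : ∀ t s e → ((1ℚ - t) * (s * (s * s)) + t * ((s + e) * ((s + e) * (s + e)))) - (s + t * e) * ((s + t * e) * (s + t * e))
      ≡ t * ((1ℚ - t) * ((s * (e * e) + s * (e * e) + s * (e * e)) + e * (e * e) * (1ℚ + t)))
    convex-diff = solve-∀ ℚ-ring
    mix-diff : ∀ t s r → (1ℚ - t) * s + t * r ≡ s + t * (r - s)
    mix-diff = solve-∀ ℚ-ring
    s+r-s : ∀ s r → s + (r - s) ≡ r
    s+r-s = solve-∀ ℚ-ring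
    mix-same : ∀ t x → x ≡ (1ℚ - t) * x + t * x
    mix-same = solve-∀ ℚ-ring
    mix-01 : ∀ t → t ≡ (1ℚ - t) * 0ℚ + t * 1ℚ
    mix-01 = solve-∀ ℚ-ring
    mixA : ∀ h t y z → h * (t * (y * z)) ≡ (1ℚ - t) * (h * (0ℚ * (y * z))) + t * (h * (1ℚ * (y * z)))
    mixA = solve-∀ ℚ-ring
    mixB : ∀ h t x z → h * (x * (t * z)) ≡ (1ℚ - t) * (h * (x * (0ℚ * z))) + t * (h * (x * (1ℚ * z)))
    mixB = solve-∀ ℚ-ring
    mixC : ∀ h t x y → h * (x * (y * t)) ≡ (1ℚ - t) * (h * (x * (y * 0ℚ))) + t * (h * (x * (y * 1ℚ)))
    mixC = solve-∀ ℚ-ring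
    mix0 : ∀ t x y → 0ℚ * x ≡ (1ℚ - t) * (0ℚ * y) + t * (0ℚ * y)
    mix0 = solve-∀ ℚ-ring
    mix-bound : ∀ t x y B → (1ℚ - t) * (x + B) + t * (y + B) ≡ ((1ℚ - t) * x + t * y) + B
    mix-bound = solve-∀ ℚ-ring
    mix-d : ∀ t d x y → d * ((1ℚ - t) * x + t * y) ≡ (1ℚ - t) * (d * x) + t * (d * y)
    mix-d = solve-∀ ℚ-ring

  cube-convex : ∀ t s r → 0ℚ ≤ t → t ≤ 1ℚ → 0ℚ ≤ s → s ≤ r → cube ((1ℚ - t) * s + t * r) ≤ (1ℚ - t) * cube s + t * cube r
  cube-convex t s r 0≤t t≤1 0≤s s≤r = subst₂ _≤_ (cong cube (sym (mix-diff t s r)))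
      (cong (λ z → (1ℚ - t) * cube s + t * cube z) (s+r-s s r))
      (≤-cert _ (0≤* 0≤t (0≤* (≤⇒0≤- t≤1) (0≤+ (0≤+ (0≤+ see see) see) (0≤* (0≤* 0≤e (0≤* 0≤e 0≤e)) (0≤+ 0≤1 0≤t))))) (convex-diff t s (r - s)))
    where
    0≤e = ≤⇒0≤- s≤r
    see = 0≤* 0≤s (0≤* 0≤e 0≤e)

  module Rounding {n : ℕ} (E : Ex (Fin n)) (H : Graph3 n) (d : ℚ) (0≤d : 0ℚ ≤ d) (error : ℚ) where

    private
      V = Fin n

    count : (V → ℚ) → ℚ
    count ω = 𝔼 E (λ a → 𝔼 E (λ b → 𝔼 E (λ c → 𝟙 (edgeᵇ H a b c) * (ω a * (ω b * ω c)))))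

    -- The defect is concave in every single coordinate, so it is minimised by an honest set.
    dense-weights : (∀ (U : V → Bool) → d * cube (𝔼 E (λ v → 𝟙 (U v))) ≤ count (λ v → 𝟙 (U v)) + error) →
      ∀ ω → In01 ω → d * cube (𝔼 E ω) ≤ count ω + error
    dense-weights dense-sets ω ω01 = round (allFin n) ω ω01 (λ v nv → ⊥-elim (nv (∈-allFin v)))
      where
      round : ∀ L ω → In01 ω → (∀ v → v ∉ L → ω v ≡ 0ℚ ⊎ ω v ≡ 1ℚ) → d * cube (𝔼 E ω) ≤ count ω + error
      round [] ω ω01 h = subst₂ (λ x y → d * cube x ≤ y + error) (𝔼-cong E (λ v → sym (is-𝟙 v)))
          (𝔼-cong E (λ a → 𝔼-cong E (λ b → 𝔼-cong E (λ c → cong₂ (λ x y → 𝟙 (edgeᵇ H a b c) * (x * y)) (sym (is-𝟙 a)) (cong₂ _*_ (sym (is-𝟙 b)) (sym (is-𝟙 c)))))))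
          (dense-sets U)
        where
        U : V → Bool
        U v = leqᵇ 1ℚ (ω v)
        is-𝟙 : ∀ v → ω v ≡ 𝟙 (U v)
        is-𝟙 v with h v (λ ())
        ... | inj₂ e = trans e (sym (cong 𝟙 (leqᵇ-complete (≡⇒≤ (sym e)))))
        ... | inj₁ e with leqᵇ 1ℚ (ω v) in q
        ...   | false = e
        ...   | true = ⊥-elim (QP.<-irrefl refl (QP.<-≤-trans 0<1 (≤-trans (leqᵇ-sound q) (≡⇒≤ e))))
      round (v ∷ L) ω ω01 h = ≤-trans (*-monoˡ 0≤d (≤-trans (≡⇒≤ (cong cube mean)) (cube-convex t _ _ 0≤t t≤1 0≤m₀ m₀≤m₁)))
          (≤-trans (≡⇒≤ (mix-d t d _ _)) (≤-trans (+-mono-≤ (*-monoˡ (≤⇒0≤- t≤1) ih₀) (*-monoˡ 0≤t ih₁))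
            (≡⇒≤ (trans (mix-bound t _ _ error) (cong (_+ error) (sym counts))))))
        where
        t = ω v
        0≤t = proj₁ (ω01 v)
        t≤1 = proj₂ (ω01 v)
        ω₀ ω₁ : V → ℚ
        ω₀ = upd ω v 0ℚ
        ω₁ = upd ω v 1ℚ
        in01 : ∀ x → 0ℚ ≤ x → x ≤ 1ℚ → In01 (upd ω v x)
        in01 x p q u with v FinP.≟ u
        ... | yes refl = subst (λ z → 0ℚ ≤ z × z ≤ 1ℚ) (sym (upd-same ω v x)) (p , q)
        ... | no ne = subst (λ z → 0ℚ ≤ z × z ≤ 1ℚ) (sym (upd-other ω x ne)) (ω01 u)
        off : ∀ x → x ≡ 0ℚ ⊎ x ≡ 1ℚ → ∀ u → u ∉ L → upd ω v x u ≡ 0ℚ ⊎ upd ω v x u ≡ 1ℚ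
        off x e u nu with v FinP.≟ u
        ... | yes refl = subst (λ z → z ≡ 0ℚ ⊎ z ≡ 1ℚ) (sym (upd-same ω v x)) e
        ... | no ne = subst (λ z → z ≡ 0ℚ ⊎ z ≡ 1ℚ) (sym (upd-other ω x ne)) (h u (λ { (here refl) → ne refl ; (there i) → nu i }))
        ih₀ = round L ω₀ (in01 0ℚ ≤-refl 0≤1) (off 0ℚ (inj₁ refl))
        ih₁ = round L ω₁ (in01 1ℚ 0≤1 ≤-refl) (off 1ℚ (inj₂ refl))
        0≤m₀ : 0ℚ ≤ 𝔼 E ω₀
        0≤m₀ = 0≤𝔼 E (λ u → proj₁ (in01 0ℚ ≤-refl 0≤1 u))
        m₀≤m₁ : 𝔼 E ω₀ ≤ 𝔼 E ω₁
        m₀≤m₁ = 𝔼-mono E le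
          where le : ∀ u → ω₀ u ≤ ω₁ u
                le u with v FinP.≟ u
                ... | yes refl = subst₂ _≤_ (sym (upd-same ω v 0ℚ)) (sym (upd-same ω v 1ℚ)) 0≤1
                ... | no ne = ≡⇒≤ (trans (upd-other ω 0ℚ ne) (sym (upd-other ω 1ℚ ne)))
        mean : 𝔼 E ω ≡ (1ℚ - t) * 𝔼 E ω₀ + t * 𝔼 E ω₁
        mean = trans (𝔼-cong E pt) (trans (𝔼-+ E _ _) (cong₂ _+_ (𝔼-* E (1ℚ - t) ω₀) (𝔼-* E t ω₁)))
          where pt : ∀ u → ω u ≡ (1ℚ - t) * ω₀ u + t * ω₁ u
                pt u with v FinP.≟ u
                ... | yes refl = trans (mix-01 t) (cong₂ (λ x y → (1ℚ - t) * x + t * y) (sym (upd-same ω v 0ℚ)) (sym (upd-same ω v 1ℚ)))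
                ... | no ne = trans (mix-same t (ω u)) (cong₂ (λ x y → (1ℚ - t) * x + t * y) (sym (upd-other ω 0ℚ ne)) (sym (upd-other ω 1ℚ ne)))
        counts : count ω ≡ (1ℚ - t) * count ω₀ + t * count ω₁
        counts = trans (𝔼-cong E (λ a → trans (𝔼-cong E (λ b → trans (𝔼-cong E (λ c → pt a b c)) (lin (T ω₀ a b) (T ω₁ a b))))
            (lin (λ b → 𝔼 E (T ω₀ a b)) (λ b → 𝔼 E (T ω₁ a b))))) (lin (λ a → 𝔼 E (λ b → 𝔼 E (T ω₀ a b))) (λ a → 𝔼 E (λ b → 𝔼 E (T ω₁ a b))))
          where
          lin : ∀ f g → 𝔼 E (λ x → (1ℚ - t) * f x + t * g x) ≡ (1ℚ - t) * 𝔼 E f + t * 𝔼 E g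
          lin f g = trans (𝔼-+ E _ _) (cong₂ _+_ (𝔼-* E (1ℚ - t) f) (𝔼-* E t g))
          same : ∀ {u} x → v ≢ u → upd ω v x u ≡ ω u
          same x ne = upd-other ω x ne
          T : (V → ℚ) → V → V → V → ℚ
          T ω a b c = 𝟙 (edgeᵇ H a b c) * (ω a * (ω b * ω c))
          core : ∀ h {a b c} → (h ≡ true → a ≢ b × b ≢ c × a ≢ c) → Dec (v ≡ a) → Dec (v ≡ b) → Dec (v ≡ c) →
            𝟙 h * (ω a * (ω b * ω c)) ≡ (1ℚ - t) * (𝟙 h * (ω₀ a * (ω₀ b * ω₀ c))) + t * (𝟙 h * (ω₁ a * (ω₁ b * ω₁ c)))
          core false _ _ _ _ = trans (mix0 t _ 0ℚ) (cong₂ (λ x y → (1ℚ - t) * x + t * y) (trans (*-zeroˡ _) (sym (*-zeroˡ _))) (trans (*-zeroˡ _) (sym (*-zeroˡ _))))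
          core true ne (yes refl) (yes refl) _ = ⊥-elim (proj₁ (ne refl) refl)
          core true ne (yes refl) (no _) (yes refl) = ⊥-elim (proj₂ (proj₂ (ne refl)) refl)
          core true ne (no _) (yes refl) (yes refl) = ⊥-elim (proj₁ (proj₂ (ne refl)) refl)
          core true {a} {b} {c} _ (yes refl) (no nb) (no nc) = trans (mixA 1ℚ t (ω b) (ω c)) (cong₂ (λ x y → (1ℚ - t) * x + t * y)
                    (cong₂ (λ x y → 1ℚ * (x * y)) (sym (upd-same ω v 0ℚ)) (cong₂ _*_ (sym (same 0ℚ nb)) (sym (same 0ℚ nc))))
                    (cong₂ (λ x y → 1ℚ * (x * y)) (sym (upd-same ω v 1ℚ)) (cong₂ _*_ (sym (same 1ℚ nb)) (sym (same 1ℚ nc)))))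
          core true {a} {b} {c} _ (no na) (yes refl) (no nc) = trans (mixB 1ℚ t (ω a) (ω c)) (cong₂ (λ x y → (1ℚ - t) * x + t * y)
                    (cong₂ (λ x y → 1ℚ * (x * y)) (sym (same 0ℚ na)) (cong₂ _*_ (sym (upd-same ω v 0ℚ)) (sym (same 0ℚ nc))))
                    (cong₂ (λ x y → 1ℚ * (x * y)) (sym (same 1ℚ na)) (cong₂ _*_ (sym (upd-same ω v 1ℚ)) (sym (same 1ℚ nc)))))
          core true {a} {b} {c} _ (no na) (no nb) (yes refl) = trans (mixC 1ℚ t (ω a) (ω b)) (cong₂ (λ x y → (1ℚ - t) * x + t * y)
                    (cong₂ (λ x y → 1ℚ * (x * y)) (sym (same 0ℚ na)) (cong₂ _*_ (sym (same 0ℚ nb)) (sym (upd-same ω v 0ℚ))))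
                    (cong₂ (λ x y → 1ℚ * (x * y)) (sym (same 1ℚ na)) (cong₂ _*_ (sym (same 1ℚ nb)) (sym (upd-same ω v 1ℚ)))))
          core true {a} {b} {c} _ (no na) (no nb) (no nc) = trans (mix-same t _) (cong₂ (λ x y → (1ℚ - t) * x + t * y)
                    (cong₂ (λ x y → 1ℚ * (x * y)) (sym (same 0ℚ na)) (cong₂ _*_ (sym (same 0ℚ nb)) (sym (same 0ℚ nc))))
                    (cong₂ (λ x y → 1ℚ * (x * y)) (sym (same 1ℚ na)) (cong₂ _*_ (sym (same 1ℚ nb)) (sym (same 1ℚ nc)))))
          pt : ∀ a b c → T ω a b c ≡ (1ℚ - t) * T ω₀ a b c + t * T ω₁ a b c
          pt a b c = core (edgeᵇ H a b c) (λ e → IsEdge-distinct H (edgeᵇ-sound H a b c e)) (v FinP.≟ a) (v FinP.≟ b) (v FinP.≟ c)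

  module Weighted {n' : ℕ} (H : Graph3 (suc n')) (d μ : ℚ) (0≤d : 0ℚ ≤ d) (d≤1 : d ≤ 1ℚ) (dense : Dense d μ H) where

    private
      n = suc n'
      V = Fin n
      E = uniform n'
      N = fromℕ n
      ι = inv N (0<fromℕ n')
      0≤ι : 0ℚ ≤ ι
      0≤ι = <⇒≤ (inv-pos N (0<fromℕ n'))

    error : ℚ
    error = fromℕ 6 * μ + fromℕ 3 * ι

    𝔼³ : (V → V → V → ℚ) → ℚ
    𝔼³ f = 𝔼 E (λ a → 𝔼 E (λ b → 𝔼 E (λ c → f a b c)))

    open Rounding E H d 0≤d error public

    𝔼³-∑³ : ∀ f → 𝔼³ f ≡ ι * (ι * (ι * ∑³ f))
    𝔼³-∑³ f = trans (trans (𝔼-cong E (λ a → trans (𝔼-cong E (λ b → 𝔼-uniform n' _)) (trans (𝔼-* E ι _) (cong (ι *_) (𝔼-uniform n' _)))))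
        (trans (𝔼-* E ι _) (cong (ι *_) (trans (𝔼-* E ι _) (cong (ι *_) (𝔼-uniform n' _)))))) refl

    dense-sets : ∀ (U : V → Bool) → d * cube (𝔼 E (λ v → 𝟙 (U v))) ≤ count (λ v → 𝟙 (U v)) + error
    dense-sets U = subst₂ _≤_ (trans (cube-scale ι d S) (cong (λ z → d * cube z) (trans (cong (ι *_) (size-∑ H U)) (sym (𝔼-uniform n' _)))))
        (trans (scale ι X (fromℕ 6) μ N (fromℕ 3)) (trans (cong (λ z → ι * (ι * (ι * X)) + fromℕ 6 * (μ * (z * (z * z))) + fromℕ 3 * (ι * (z * z))) (inv-r N (0<fromℕ n')))
          (trans (ones _ (fromℕ 6) μ (fromℕ 3) ι) (cong (_+ error) (sym (𝔼³-∑³ _))))))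
        (*-monoˡ 0≤ι (*-monoˡ 0≤ι (*-monoˡ 0≤ι raw)))
      where
      S = fromℕ (size U)
      C₃ = fromℕ (size U C 3)
      e = fromℕ (edgesIn H U)
      X = ∑³ (λ a b c → 𝟙 (edgeᵇ H a b c) * (𝟙 (U a) * (𝟙 (U b) * 𝟙 (U c))))
      N³ = N * (N * (N * 1ℚ))
      S≤N : S ≤ N
      S≤N = ≤-trans (≡⇒≤ (size-∑ H U)) (≤-trans (∑-mono (λ v → 𝟙≤1 (U v))) (≡⇒≤ (trans (∑-const n 1ℚ) (*-identityʳ N))))
      n³ : fromℕ (n ℕ.^ 3) ≡ N³
      n³ = trans (fromℕ-* n (n ℕ.* (n ℕ.* 1))) (cong (N *_) (trans (fromℕ-* n (n ℕ.* 1)) (cong (N *_) (trans (fromℕ-* n 1) (cong (N *_) (+-identityʳ 1ℚ))))))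
      D : d * C₃ - μ * N³ ≤ e
      D = subst₂ (λ x y → d * x - μ * y ≤ e) (toℚ-fromℕ (size U C 3)) (trans (toℚ-fromℕ (n ℕ.^ 3)) n³)
            (subst (d * toℚ (size U C 3) - μ * toℚ (n ℕ.^ 3) ≤_) (toℚ-fromℕ (edgesIn H U)) (dense-at dense U))
      cubes : S * (S * S) ≤ fromℕ 6 * C₃ + fromℕ 3 * (S * S)
      cubes = subst₂ _≤_ (trans (fromℕ-* s (s ℕ.* s)) (cong (S *_) (fromℕ-* s s)))
          (trans (fromℕ-+ (6 ℕ.* (s C 3)) _) (cong₂ _+_ (fromℕ-* 6 (s C 3)) (trans (fromℕ-* 3 (s ℕ.* s)) (cong (fromℕ 3 *_) (fromℕ-* s s)))))
          (fromℕ-mono (choose₃ s))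
        where s = size U
      0≤S : 0ℚ ≤ S
      0≤S = 0≤fromℕ (size U)
      raw : d * (S * (S * S)) ≤ X + fromℕ 6 * (μ * N³) + fromℕ 3 * (N * N)
      raw = ≤-trans (*-monoˡ 0≤d cubes) (≤-trans (≡⇒≤ (chain₁ d _ _)) (+-mono-≤
          (0≤-⇒≤ (≤-trans (subst (0ℚ ≤_) (six-factor (fromℕ 6) d C₃ μ N³ e) (0≤* (0≤fromℕ 6) (≤⇒0≤- D)))
            (+-monoˡ-≤ _ (+-monoˡ-≤ _ (six-edges H U)))))
          (≤-trans (*-monoʳ (0≤* (0≤fromℕ 3) (0≤* 0≤S 0≤S)) d≤1) (≤-trans (≡⇒≤ (*-identityˡ _)) (*-monoˡ (0≤fromℕ 3) (*-mono-≤ 0≤S S≤N 0≤S S≤N))))))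

    dense-weighted : ∀ ω → In01 ω → d * cube (𝔼 E ω) ≤ count ω + error
    dense-weighted = dense-weights dense-sets

module VertexTypes where

  open Conditioning
  open EdgeWeights
  open IndependentColours
  open import Data.Vec using (lookup)

  private opaque
    unfolding -_
    one-minus : ∀ w ψ → (1ℚ - w) * ψ ≡ ψ - w * ψ
    one-minus = solve-∀ ℚ-ring
    from-complement : ∀ p w x e → (p - w + e) - (p - x) ≡ (x + e) - w
    from-complement = solve-∀ ℚ-ring
    collect : ∀ D W ψ ε → (D - W - ε) * ψ ≡ D * ψ - W * ψ - ε * ψ
    collect = solve-∀ ℚ-ring
    swap-ε : ∀ d w e → d - e - w ≡ d - w - e
    swap-ε = solve-∀ ℚ-ring
    fin-chain : ∀ D W P x y → (D - W - P) + ((W + x) + y - D) ≡ (y + x) - P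
    fin-chain = solve-∀ ℚ-ring

  module TypeStructure {n K k : ℕ} (E : Ex (Fin n)) (x₀ : Fin n) (faithful : Faithful E)
    (h : Fin n → Fin n → Fin n → Bool) (c : Fin n → Fin n → Fin K) (dd : Fin n → Fin k) where

    private V = Fin n

    module EL₃ = Edge-level E x₀ faithful h
    module CL₂ = Colour-level E x₀ faithful c

    W : Fin K → Fin K → Fin K → ℚ
    W = EL₃.W c

    W01 : ∀ a b r → 0ℚ ≤ W a b r × W a b r ≤ 1ℚ
    W01 = EL₃.W-01 c

    p : Fin k → Fin k → Ex (Fin K)
    p = CL₂.p dd

    𝔼³ : (V → V → V → ℚ) → ℚ
    𝔼³ f = 𝔼 E (λ a → 𝔼 E (λ b → 𝔼 E (λ e → f a b e)))

    W̄ : Fin k → Fin k → Fin k → ℚ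
    W̄ δ₁ δ₂ δ₃ = 𝔼 (p δ₁ δ₂) (λ a → 𝔼 (p δ₂ δ₃) (λ b → 𝔼 (p δ₁ δ₃) (λ r → W a b r)))

    T₃ : V × V × V → Fin (k ℕ.* (k ℕ.* k))
    T₃ (a , b , e) = combine (dd a) (combine (dd b) (dd e))

    T₃-injective : ∀ {a b e a' b' e'} → T₃ (a , b , e) ≡ T₃ (a' , b' , e') → dd a ≡ dd a' × dd b ≡ dd b' × dd e ≡ dd e'
    T₃-injective q with FinP.combine-injective _ _ _ _ q
    ... | q₁ , q₂ with FinP.combine-injective _ _ _ _ q₂
    ... | q₃ , q₄ = q₁ , q₃ , q₄

    D : Fin k → Fin k → Fin k → ℚ
    D δ₁ δ₂ δ₃ = cexp EL₃.E₃ (x₀ , x₀ , x₀) EL₃.faithful₃ T₃ EL₃.hℚ (combine δ₁ (combine δ₂ δ₃))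

    bad : ℚ → Fin k → Fin k → Fin k → Bool
    bad ε δ₁ δ₂ δ₃ = not (leqᵇ (D δ₁ δ₂ δ₃ - ε) (W̄ δ₁ δ₂ δ₃))

    c̃ : V → V → Fin (K ℕ.* (k ℕ.* k))
    c̃ a b = combine (c a b) (combine (dd a) (dd b))

    c̃-sound : ∀ {a b a' b'} → c̃ a b ≡ c̃ a' b' → c a b ≡ c a' b' × dd a ≡ dd a' × dd b ≡ dd b'
    c̃-sound q with FinP.combine-injective _ _ _ _ q
    ... | q₁ , q₂ with FinP.combine-injective _ _ _ _ q₂
    ... | q₃ , q₄ = q₁ , q₃ , q₄

    I₃ : Set
    I₃ = Fin 3 × Fin 3
    _≟₃_ : DecidableEquality I₃
    _≟₃_ = ≡-dec FinP._≟_ FinP._≟_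
    i₀ i₁ i₂ : Fin 3
    i₀ = zero
    i₁ = suc zero
    i₂ = suc (suc zero)

    module _ (ε : ℚ) where

      ψ : (δ₁ δ₂ δ₃ : Fin k) → ℚ
      ψ δ₁ δ₂ δ₃ = 𝟙 (bad ε δ₁ δ₂ δ₃)

      Ψ₃ : (I₃ → Fin K) → (Fin 3 → Fin k) → ℚ
      Ψ₃ g δ = (1ℚ - W (g (i₀ , i₁)) (g (i₁ , i₂)) (g (i₀ , i₂))) * ψ (δ i₀) (δ i₁) (δ i₂)

      Ψ₃01 : ∀ g δ → 0ℚ ≤ Ψ₃ g δ × Ψ₃ g δ ≤ 1ℚ
      Ψ₃01 g δ = 0≤* 0≤1-W (0≤𝟙 _) , ≤-trans (*-mono-≤ 0≤1-W 1-W≤1 (0≤𝟙 _) (𝟙≤1 _)) (≡⇒≤ (*-identityˡ 1ℚ))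
        where
        w = W01 (g (i₀ , i₁)) (g (i₁ , i₂)) (g (i₀ , i₂))
        0≤1-W = ≤⇒0≤- (proj₂ w)
        1-W≤1 : 1ℚ - W (g (i₀ , i₁)) (g (i₁ , i₂)) (g (i₀ , i₂)) ≤ 1ℚ
        1-W≤1 = ≤-cert _ (proj₁ w) (minus-minus _)
          where opaque
                  unfolding -_
                  minus-minus : ∀ w → 1ℚ - (1ℚ - w) ≡ w
                  minus-minus = solve-∀ ℚ-ring

      Ψ₃-cong : ∀ {g g' δ δ'} → (∀ i j → i Fin.< j → g (i , j) ≡ g' (i , j)) → (∀ v → δ v ≡ δ' v) → Ψ₃ g δ ≡ Ψ₃ g' δ'
      Ψ₃-cong {g} {g'} {δ} {δ'} e e'
        rewrite e i₀ i₁ (ℕ.s≤s ℕ.z≤n) | e i₁ i₂ (ℕ.s≤s (ℕ.s≤s ℕ.z≤n)) | e i₀ i₂ (ℕ.s≤s ℕ.z≤n) | e' i₀ | e' i₁ | e' i₂ = refl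

      module R₃ = CL₂.Resampling 3 dd _≟₃_ proj₁ proj₂ _,_ (λ _ _ → refl) (λ _ _ → refl) Ψ₃ Ψ₃01 Ψ₃-cong

      pairs₃ : List I₃
      pairs₃ = (i₀ , i₁) ∷ (i₁ , i₂) ∷ (i₀ , i₂) ∷ []

      resampled : ∀ f g → R₃.Φ pairs₃ g f ≡ ψ (dd (f i₀)) (dd (f i₁)) (dd (f i₂)) - W̄ (dd (f i₀)) (dd (f i₁)) (dd (f i₂)) * ψ (dd (f i₀)) (dd (f i₁)) (dd (f i₂))
      resampled f g = trans (𝔼-cong p₀₁ (λ γ₁ → trans (𝔼-cong p₁₂ (λ γ₂ → trans (𝔼-cong p₀₂ (λ γ₃ → entry γ₁ γ₂ γ₃)) (lin p₀₂ (λ γ₃ → W γ₁ γ₂ γ₃))))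
          (lin p₁₂ (λ γ₂ → 𝔼 p₀₂ (λ γ₃ → W γ₁ γ₂ γ₃))))) (lin p₀₁ (λ γ₁ → 𝔼 p₁₂ (λ γ₂ → 𝔼 p₀₂ (λ γ₃ → W γ₁ γ₂ γ₃))))
        where
        p₀₁ = p (dd (f i₀)) (dd (f i₁))
        p₁₂ = p (dd (f i₁)) (dd (f i₂))
        p₀₂ = p (dd (f i₀)) (dd (f i₂))
        z = ψ (dd (f i₀)) (dd (f i₁)) (dd (f i₂))
        lin : ∀ (P : Ex (Fin K)) (w : Fin K → ℚ) → 𝔼 P (λ x → z - w x * z) ≡ z - 𝔼 P w * z
        lin P w = trans (𝔼-- P _ _) (cong₂ _-_ (𝔼-const P z) (𝔼-*ʳ P z w))
        entry : ∀ γ₁ γ₂ γ₃ → Ψ₃ (set _≟₃_ (set _≟₃_ (set _≟₃_ g (i₀ , i₁) γ₁) (i₁ , i₂) γ₂) (i₀ , i₂) γ₃) (λ v → dd (f v)) ≡ z - W γ₁ γ₂ γ₃ * z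
        entry γ₁ γ₂ γ₃ = trans (cong (λ w → (1ℚ - w) * z) (cong₃ W
            (trans (set-other _≟₃_ _ γ₃ (λ ())) (trans (set-other _≟₃_ _ γ₂ (λ ())) (set-same _≟₃_ g _ γ₁)))
            (trans (set-other _≟₃_ _ γ₃ (λ ())) (set-same _≟₃_ _ _ γ₂)) (set-same _≟₃_ _ _ γ₃))) (one-minus _ z)
          where cong₃ : ∀ {A B : Set} (f : A → A → A → B) {x x' y y' z z'} → x ≡ x' → y ≡ y' → z ≡ z' → f x y z ≡ f x' y' z'
                cong₃ f refl refl refl = refl

      module _ (α κ : ℚ) (0<α : 0ℚ < α) (0≤κ : 0ℚ ≤ κ) (κK : κ * fromℕ K ≡ 1ℚ)
        (regular₂ : ∀ (d' : V → Fin R₃.k⁺) → (∀ a b → d' a ≡ d' b → dd a ≡ dd b) → CL₂.NoGain (α * α * κ) dd d')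
        (regular₃ : EL₃.NoGain α c c̃) where

        private
          ψV : V → V → V → ℚ
          ψV a b e = ψ (dd a) (dd b) (dd e)
          ψ01 : ∀ a b e → 0ℚ ≤ ψV a b e × ψV a b e ≤ 1ℚ
          ψ01 a b e = 0≤𝟙 _ , 𝟙≤1 _
          X = 𝔼³ (λ a b e → W̄ (dd a) (dd b) (dd e) * ψV a b e)
          Y = 𝔼³ (λ a b e → W (c a b) (c b e) (c a e) * ψV a b e)
          Z = 𝔼³ (λ a b e → D (dd a) (dd b) (dd e) * ψV a b e)
          Pψ = 𝔼³ ψV
          lin³ : ∀ f g → 𝔼³ (λ a b e → f a b e - g a b e) ≡ 𝔼³ f - 𝔼³ g
          lin³ f g = trans (𝔼-cong E (λ a → trans (𝔼-cong E (λ b → 𝔼-- E (f a b) (g a b))) (𝔼-- E _ _))) (𝔼-- E _ _)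

        Y≤X : Y ≤ X + fromℕ 3 * α
        Y≤X = 0≤-⇒≤ (subst (0ℚ ≤_) (from-complement Pψ Y X (fromℕ 3 * α)) (≤⇒0≤- (subst₂ (λ y z → y ≤ z + fromℕ 3 * α)
          (trans (𝔼-cong E (λ a → 𝔼-cong E (λ b → 𝔼-cong E (λ e → resampled (lookup (a ∷ b ∷ e ∷ [])) _)))) (lin³ ψV _))
          (trans (𝔼-cong E (λ a → 𝔼-cong E (λ b → 𝔼-cong E (λ e → one-minus _ (ψV a b e))))) (lin³ ψV _))
          (R₃.decorrelate α κ 0<α 0≤κ κK regular₂ pairs₃))))

        Z≤Y : Z ≤ Y + α
        Z≤Y = ≤-trans (≡⇒≤ (sym (cexp-test EL₃.E₃ (x₀ , x₀ , x₀) EL₃.faithful₃ T₃ {φ = λ (a , b , e) → ψV a b e} EL₃.h01 (λ _ → 0≤𝟙 _ , 𝟙≤1 _)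
                (λ _ _ q → let (q₁ , q₂ , q₃) = T₃-injective q in ψ-cong q₁ q₂ q₃))))
            (EL₃.Test.upper c c̃ (λ a b a' b' q → proj₁ (c̃-sound q)) α 0<α regular₃ ψV ψ01
              (λ a b e a' b' e' q₁ q₂ q₃ → ψ-cong (proj₁ (proj₂ (c̃-sound q₁))) (proj₂ (proj₂ (c̃-sound q₁))) (proj₂ (proj₂ (c̃-sound q₂)))))
          where ψ-cong : ∀ {δ₁ δ₂ δ₃ δ₁' δ₂' δ₃'} → δ₁ ≡ δ₁' → δ₂ ≡ δ₂' → δ₃ ≡ δ₃' → ψ δ₁ δ₂ δ₃ ≡ ψ δ₁' δ₂' δ₃'
                ψ-cong refl refl refl = refl

        bad-rare : ε * Pψ ≤ α + fromℕ 3 * α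
        bad-rare = 0≤-⇒≤ (subst (0ℚ ≤_) (fin-chain Z X (ε * Pψ) (fromℕ 3 * α) α)
            (0≤+ gain (≤⇒0≤- (≤-trans Z≤Y (+-monoˡ-≤ α Y≤X)))))
          where
          pt : ∀ δ₁ δ₂ δ₃ → 0ℚ ≤ (D δ₁ δ₂ δ₃ - W̄ δ₁ δ₂ δ₃ - ε) * ψ δ₁ δ₂ δ₃
          pt δ₁ δ₂ δ₃ with leqᵇ (D δ₁ δ₂ δ₃ - ε) (W̄ δ₁ δ₂ δ₃) in eq
          ... | true = ≡⇒≤ (sym (*-zeroʳ _))
          ... | false = 0≤* (subst (0ℚ ≤_) (swap-ε _ _ ε) (≤⇒0≤- (<⇒≤ (leqᵇ-false eq)))) 0≤1
          gain : 0ℚ ≤ Z - X - ε * Pψ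
          gain = subst (0ℚ ≤_) (trans (𝔼-cong E (λ a → 𝔼-cong E (λ b → 𝔼-cong E (λ e → collect _ _ (ψV a b e) ε))))
              (trans (lin³ (λ a b e → D (dd a) (dd b) (dd e) * ψV a b e - W̄ (dd a) (dd b) (dd e) * ψV a b e) (λ a b e → ε * ψV a b e))
                (cong₂ _-_ (lin³ (λ a b e → D (dd a) (dd b) (dd e) * ψV a b e) (λ a b e → W̄ (dd a) (dd b) (dd e) * ψV a b e))
                  (trans (𝔼-cong E (λ a → trans (𝔼-cong E (λ b → 𝔼-* E ε _)) (𝔼-* E ε _))) (𝔼-* E ε _)))))
            (0≤𝔼 E (λ a → 0≤𝔼 E (λ b → 0≤𝔼 E (λ e → pt (dd a) (dd b) (dd e)))))

    volume : Fin k → ℚ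
    volume δ = 𝔼 E (λ v → 𝟙 (eqᵇ (dd v) δ))

    small : ℚ → Fin k → Bool
    small κ δ = not (leqᵇ κ (volume δ))

    small-rare : ∀ κ → 0ℚ ≤ κ → 𝔼 E (λ v → 𝟙 (small κ (dd v))) ≤ fromℕ k * κ
    small-rare κ 0≤κ = ≤-trans (≡⇒≤ (trans (𝔼-cong E (λ v → sym (∑-δ (λ δ → 𝟙 (small κ δ)) (dd v)))) (𝔼-∑ E (λ δ v → 𝟙 (small κ δ) * 𝟙 (eqᵇ (dd v) δ)))))
        (≤-trans (∑-mono (λ δ → ≤-trans (≡⇒≤ (𝔼-* E (𝟙 (small κ δ)) _)) (each δ))) (≡⇒≤ (∑-const k κ)))
      where
      each : ∀ δ → 𝟙 (small κ δ) * volume δ ≤ κ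
      each δ with leqᵇ κ (volume δ) in eq
      ... | true = ≤-trans (≡⇒≤ (*-zeroˡ _)) 0≤κ
      ... | false = ≤-trans (≡⇒≤ (*-identityˡ _)) (<⇒≤ (leqᵇ-false eq))

    N : Fin k → Fin k → Fin k → ℚ
    N δ₁ δ₂ δ₃ = 𝔼³ (λ a b e → 𝟙 (h a b e) * (𝟙 (eqᵇ (dd a) δ₁) * (𝟙 (eqᵇ (dd b) δ₂) * 𝟙 (eqᵇ (dd e) δ₃))))

    N-D : ∀ δ₁ δ₂ δ₃ → N δ₁ δ₂ δ₃ ≡ volume δ₁ * (volume δ₂ * volume δ₃) * D δ₁ δ₂ δ₃
    N-D δ₁ δ₂ δ₃ = trans (𝔼-cong E (λ a → 𝔼-cong E (λ b → 𝔼-cong E (λ e → trans (*-comm _ _) (cong (_* 𝟙 (h a b e)) (split-eq a b e))))))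
        (trans (cexp-mul EL₃.E₃ (x₀ , x₀ , x₀) EL₃.faithful₃ T₃ EL₃.h01 (combine δ₁ (combine δ₂ δ₃))) (cong (_* D δ₁ δ₂ δ₃) sizes))
      where
      split-eq : ∀ a b e → 𝟙 (eqᵇ (dd a) δ₁) * (𝟙 (eqᵇ (dd b) δ₂) * 𝟙 (eqᵇ (dd e) δ₃)) ≡ 𝟙 (eqᵇ (T₃ (a , b , e)) (combine δ₁ (combine δ₂ δ₃)))
      split-eq a b e with dd a FinP.≟ δ₁ | dd b FinP.≟ δ₂ | dd e FinP.≟ δ₃
      ... | yes refl | yes refl | yes refl = trans (trans (*-identityˡ _) (*-identityˡ _)) (cong 𝟙 (sym (eqᵇ-refl (T₃ (a , b , e)))))
      ... | no ne | _ | _ = trans (*-zeroˡ _) (cong 𝟙 (sym (eqᵇ-≢ (λ q → ne (FinP.combine-injectiveˡ _ _ _ _ q)))))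
      ... | yes _ | no ne | _ = trans (cong (1ℚ *_) (*-zeroˡ _)) (trans (*-zeroʳ 1ℚ) (cong 𝟙 (sym (eqᵇ-≢ (λ q → ne (FinP.combine-injectiveˡ _ _ _ _ (FinP.combine-injectiveʳ (dd a) _ δ₁ _ q)))))))
      ... | yes _ | yes _ | no ne = trans (cong (1ℚ *_) (*-zeroʳ 1ℚ)) (trans (*-zeroʳ 1ℚ) (cong 𝟙 (sym (eqᵇ-≢ (λ q → ne (FinP.combine-injectiveʳ (dd b) _ δ₂ _ (FinP.combine-injectiveʳ (dd a) _ δ₁ _ q)))))))
      sizes : mass EL₃.E₃ (x₀ , x₀ , x₀) EL₃.faithful₃ T₃ (combine δ₁ (combine δ₂ δ₃)) ≡ volume δ₁ * (volume δ₂ * volume δ₃)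
      sizes = trans (𝔼-cong E (λ a → 𝔼-cong E (λ b → 𝔼-cong E (λ e → sym (split-eq a b e)))))
        (trans (𝔼-cong E (λ a → trans (𝔼-cong E (λ b → trans (𝔼-* E (𝟙 (eqᵇ (dd a) δ₁)) _) (cong (𝟙 (eqᵇ (dd a) δ₁) *_) (𝔼-* E (𝟙 (eqᵇ (dd b) δ₂)) _))))
           (trans (𝔼-* E (𝟙 (eqᵇ (dd a) δ₁)) _) (cong (𝟙 (eqᵇ (dd a) δ₁) *_) (𝔼-*ʳ E (volume δ₃) _)))))
          (𝔼-*ʳ E (volume δ₂ * volume δ₃) _))

module SparseTypes where

  open Conditioning
  open VertexTypes
  open WeightedDensity using (cube)
  open Selection using (lsum; 𝔼-lsum)

  lsum-mono : ∀ {X : Set} {f g : X → ℚ} xs → (∀ {x} → x ∈ xs → f x ≤ g x) → lsum f xs ≤ lsum g xs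
  lsum-mono [] p = ≤-refl
  lsum-mono (x ∷ xs) p = +-mono-≤ (p (here refl)) (lsum-mono xs (λ i → p (there i)))

  lsum-cong : ∀ {X : Set} {f g : X → ℚ} xs → (∀ x → f x ≡ g x) → lsum f xs ≡ lsum g xs
  lsum-cong [] p = refl
  lsum-cong (x ∷ xs) p = cong₂ _+_ (p x) (lsum-cong xs p)

  private opaque
    unfolding -_
    inter : ∀ a b c d → (a + b) + (c + d) ≡ (a + c) + (b + d)
    inter = solve-∀ ℚ-ring
    one-more : ∀ l c → c + l * c ≡ (1ℚ + l) * c
    one-more = solve-∀ ℚ-ring
    regroup³ : ∀ h a b c x y z → h * ((a * x) * ((b * y) * (c * z))) ≡ (a * (b * c)) * (h * (x * (y * z)))
    regroup³ = solve-∀ ℚ-ring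
    masses : ∀ a b c x y z d → (a * (b * c)) * (x * (y * z) * d) ≡ ((a * x) * ((b * y) * (c * z))) * d
    masses = solve-∀ ℚ-ring
    prod-swap₁ : ∀ h x y z → h * (x * (y * z)) ≡ h * (y * (x * z))
    prod-swap₁ = solve-∀ ℚ-ring
    prod-swap₂ : ∀ h x y z → h * (x * (y * z)) ≡ h * (x * (z * y))
    prod-swap₂ = solve-∀ ℚ-ring
    final-total : ∀ s κ σ w → s * (s * (s * (((κ * σ) * ((κ * σ) * (κ * σ))) * w)) ) + (((κ * σ) * ((κ * σ) * (κ * σ))) * (s * s + (s * s + s * s)))
       ≡ (κ * (κ * κ)) * ((σ * s) * ((σ * s) * (σ * s)) * w + σ * ((σ * s) * (σ * s) + ((σ * s) * (σ * s) + (σ * s) * (σ * s))))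
    final-total = solve-∀ ℚ-ring
    with-ones : ∀ k σ w → k * (1ℚ * (1ℚ * 1ℚ) * w + σ * (1ℚ * 1ℚ + (1ℚ * 1ℚ + 1ℚ * 1ℚ))) ≡ k * (w + (σ + (σ + σ)))
    with-ones = solve-∀ ℚ-ring
    split₄ : ∀ r w e f g → r * (w + (e + (f + g))) ≡ r * (w + e) + (r * f + r * g)
    split₄ = solve-∀ ℚ-ring
    middle-sum : ∀ s r w → s * (s * (r * w)) + (s * r + s * (r + r)) ≡ s * (s * (r * w)) + r * (s + (s + s))
    middle-sum = solve-∀ ℚ-ring
    outer-sum : ∀ s r w → s * (s * (s * (r * w)) + r * (s + (s + s))) ≡ s * (s * (s * (r * w))) + r * (s * s + (s * s + s * s))
    outer-sum = solve-∀ ℚ-ring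
    inner-const : ∀ s r w e → s * (r * (w + e)) ≡ s * (r * w) + (s * r) * e
    inner-const = solve-∀ ℚ-ring
    ρm : ∀ κ σ i m → κ * σ * i * m ≡ κ * σ * (m * i)
    ρm = solve-∀ ℚ-ring
    κσi : ∀ κ σ i → κ * σ * i ≡ σ * (κ * i)
    κσi = solve-∀ ℚ-ring
    sρ : ∀ s κ σ → s * (κ * σ) ≡ κ * (σ * s)
    sρ = solve-∀ ℚ-ring

  lsum-+ : ∀ {X : Set} (f g : X → ℚ) xs → lsum (λ x → f x + g x) xs ≡ lsum f xs + lsum g xs
  lsum-+ f g [] = sym (+-identityˡ 0ℚ)
  lsum-+ f g (x ∷ xs) = trans (cong₂ _+_ refl (lsum-+ f g xs)) (inter _ _ _ _)

  lsum-*ˡ : ∀ {X : Set} c (f : X → ℚ) xs → lsum (λ x → c * f x) xs ≡ c * lsum f xs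
  lsum-*ˡ c f [] = sym (*-zeroʳ c)
  lsum-*ˡ c f (x ∷ xs) = trans (cong₂ _+_ refl (lsum-*ˡ c f xs)) (sym (*-distribˡ-+ c _ _))

  lsum-*ʳ : ∀ {X : Set} c (f : X → ℚ) xs → lsum (λ x → f x * c) xs ≡ lsum f xs * c
  lsum-*ʳ c f xs = trans (lsum-cong xs (λ x → *-comm (f x) c)) (trans (lsum-*ˡ c f xs) (*-comm c _))

  lsum-const : ∀ {X : Set} c (xs : List X) → lsum (λ _ → c) xs ≡ fromℕ (length xs) * c
  lsum-const c [] = sym (*-zeroˡ c)
  lsum-const c (x ∷ xs) = trans (cong₂ _+_ refl (lsum-const c xs)) (one-more _ c)

  lsum-upper : ∀ {X : Set} {f : X → ℚ} c xs → (∀ {x} → x ∈ xs → f x ≤ c) → lsum f xs ≤ fromℕ (length xs) * c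
  lsum-upper c xs p = ≤-trans (lsum-mono xs p) (≡⇒≤ (lsum-const c xs))

  lsum-δ≤ : ∀ {M} i (xs : List (Fin M)) → AllPairs Fin._<_ xs → lsum (λ j → 𝟙 (eqᵇ i j)) xs ≤ 1ℚ
  lsum-δ≤ i [] _ = 0≤1
  lsum-δ≤ i (x ∷ xs) (a ∷ p) with i FinP.≟ x
  ... | no ne = ≤-trans (≡⇒≤ (+-identityˡ _)) (lsum-δ≤ i xs p)
  ... | yes refl = ≡⇒≤ (trans (cong₂ _+_ refl (none xs a)) (+-identityʳ 1ℚ))
    where none : ∀ xs → All (i Fin.<_) xs → lsum (λ j → 𝟙 (eqᵇ i j)) xs ≡ 0ℚ
          none [] [] = refl
          none (x ∷ xs) (l ∷ ls) = trans (cong₂ (λ b z → 𝟙 b + z) (eqᵇ-≢ {i = i} {x} (λ { refl → ℕP.<-irrefl refl l })) (none xs ls)) (+-identityˡ 0ℚ)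

  lsum-product : ∀ {X : Set} (f g h : X → ℚ) xs →
    lsum f xs * (lsum g xs * lsum h xs) ≡ lsum (λ i → lsum (λ j → lsum (λ l → f i * (g j * h l)) xs) xs) xs
  lsum-product f g h xs = sym (trans (lsum-cong xs (λ i → trans (lsum-cong xs (λ j → trans (lsum-*ˡ (f i) (λ l → g j * h l) xs) (cong (f i *_) (lsum-*ˡ (g j) h xs))))
      (trans (lsum-*ˡ (f i) (λ j → g j * lsum h xs) xs) (cong (f i *_) (lsum-*ʳ (lsum h xs) g xs))))) (lsum-*ʳ (lsum g xs * lsum h xs) f xs))

  module SparseList {n K k : ℕ} (E : Ex (Fin n)) (x₀ : Fin n) (faithful : Faithful E)
    (h : Fin n → Fin n → Fin n → Bool) (h-swap₁ : ∀ a b e → h a b e ≡ h b a e) (h-swap₂ : ∀ a b e → h a b e ≡ h a e b)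
    (c : Fin n → Fin n → Fin K) (dd : Fin n → Fin k)
    (d error : ℚ) (dense : ∀ ω → In01 ω → d * cube (𝔼 E ω) ≤ 𝔼 E (λ a → 𝔼 E (λ b → 𝔼 E (λ e → 𝟙 (h a b e) * (ω a * (ω b * ω e))))) + error) where

    open TypeStructure E x₀ faithful h c dd using (volume; N; N-D; D; 𝔼³; module EL₃; T₃)

    module _ {M : ℕ} (δ : Fin M → Fin k) (κ : ℚ) (0<κ : 0ℚ < κ) (big : ∀ i → κ ≤ volume (δ i))
      (Qs : List (Fin M)) (σ : ℚ) (0≤σ : 0ℚ ≤ σ) (σs : σ * fromℕ (length Qs) ≡ 1ℚ) (inc : AllPairs Fin._<_ Qs)
      (w : ℚ) (0≤w : 0ℚ ≤ w) (sparse : ∀ {i j l} → i ∈ Qs → j ∈ Qs → l ∈ Qs → i Fin.< j → j Fin.< l → D (δ i) (δ j) (δ l) ≤ w) where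

      private
        0<volume : ∀ i → 0ℚ < volume (δ i)
        0<volume i = <-≤-trans 0<κ (big i)
        λ' : Fin M → ℚ
        λ' i = κ * σ * inv (volume (δ i)) (0<volume i)
        ρ = κ * σ
        ρ³ = ρ * (ρ * ρ)
        s = fromℕ (length Qs)
        0≤κ = <⇒≤ 0<κ
        0≤ρ : 0ℚ ≤ ρ
        0≤ρ = 0≤* 0≤κ 0≤σ
        0≤ρ³ : 0ℚ ≤ ρ³
        0≤ρ³ = 0≤* 0≤ρ (0≤* 0≤ρ 0≤ρ)
        0≤λ : ∀ i → 0ℚ ≤ λ' i
        0≤λ i = 0≤* 0≤ρ (<⇒≤ (inv-pos _ (0<volume i)))
        λ-volume : ∀ i → λ' i * volume (δ i) ≡ ρ
        λ-volume i = trans (ρm κ σ _ (volume (δ i))) (trans (cong (ρ *_) (inv-r _ (0<volume i))) (*-identityʳ ρ))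
        λ≤σ : ∀ i → λ' i ≤ σ
        λ≤σ i = ≤-trans (≡⇒≤ (κσi κ σ _)) (≤-trans (*-monoˡ 0≤σ (≤-trans (*-monoʳ (<⇒≤ (inv-pos _ (0<volume i))) (big i)) (≡⇒≤ (inv-r _ (0<volume i))))) (≡⇒≤ (*-identityʳ σ)))
        term : Fin M → Fin n → ℚ
        term i v = λ' i * 𝟙 (eqᵇ (dd v) (δ i))
        ω : Fin n → ℚ
        ω v = lsum (λ i → term i v) Qs
        0≤term : ∀ i v → 0ℚ ≤ term i v
        0≤term i v = 0≤* (0≤λ i) (0≤𝟙 _)
        ω01 : In01 ω
        ω01 v = ≤-trans (≡⇒≤ (sym (trans (lsum-const 0ℚ Qs) (*-zeroʳ s)))) (lsum-mono Qs (λ {i} _ → 0≤term i v)) ,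
          ≤-trans (lsum-upper σ Qs (λ {i} _ → ≤-trans (*-monoˡ (0≤λ i) (𝟙≤1 _)) (≤-trans (≡⇒≤ (*-identityʳ _)) (λ≤σ i)))) (≡⇒≤ (trans (*-comm s σ) σs))
        mean : 𝔼 E ω ≡ κ
        mean = trans (𝔼-lsum E term Qs) (trans (lsum-cong Qs (λ i → trans (𝔼-* E (λ' i) _) (λ-volume i)))
          (trans (lsum-const ρ Qs) (trans (sρ s κ σ) (trans (cong (κ *_) σs) (*-identityʳ κ)))))
        T : Fin M → Fin M → Fin M → ℚ
        T i j l = 𝔼³ (λ a b e → 𝟙 (h a b e) * (term i a * (term j b * term l e)))
        count-T : 𝔼³ (λ a b e → 𝟙 (h a b e) * (ω a * (ω b * ω e))) ≡ lsum (λ i → lsum (λ j → lsum (T i j) Qs) Qs) Qs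
        count-T = trans (𝔼-cong E (λ a → trans (𝔼-cong E (λ b → trans (𝔼-cong E (λ e → expand a b e)) (pull E _))) (pull E _))) (pull E _)
          where
          expand : ∀ a b e → 𝟙 (h a b e) * (ω a * (ω b * ω e)) ≡ lsum (λ i → lsum (λ j → lsum (λ l → 𝟙 (h a b e) * (term i a * (term j b * term l e))) Qs) Qs) Qs
          expand a b e = trans (cong (𝟙 (h a b e) *_) (lsum-product (λ i → term i a) (λ j → term j b) (λ l → term l e) Qs))
            (trans (sym (lsum-*ˡ _ _ Qs)) (lsum-cong Qs (λ i → trans (sym (lsum-*ˡ _ _ Qs)) (lsum-cong Qs (λ j → sym (lsum-*ˡ _ _ Qs))))))
          pull : ∀ (E : Ex (Fin n)) (F : Fin n → Fin M → Fin M → Fin M → ℚ) →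
            𝔼 E (λ x → lsum (λ i → lsum (λ j → lsum (F x i j) Qs) Qs) Qs) ≡ lsum (λ i → lsum (λ j → lsum (λ l → 𝔼 E (λ x → F x i j l)) Qs) Qs) Qs
          pull E F = trans (𝔼-lsum E (λ i x → lsum (λ j → lsum (F x i j) Qs) Qs) Qs) (lsum-cong Qs (λ i →
            trans (𝔼-lsum E (λ j x → lsum (F x i j) Qs) Qs) (lsum-cong Qs (λ j → 𝔼-lsum E (λ l x → F x i j l) Qs))))
        T-D : ∀ i j l → T i j l ≡ ρ³ * D (δ i) (δ j) (δ l)
        T-D i j l = trans (𝔼-cong E (λ a → trans (𝔼-cong E (λ b → trans (𝔼-cong E (λ e → regroup³ _ _ _ _ _ _ _)) (𝔼-* E _ _))) (𝔼-* E _ _)))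
          (trans (𝔼-* E _ _) (trans (cong (λ' i * (λ' j * λ' l) *_) (N-D (δ i) (δ j) (δ l)))
            (trans (masses _ _ _ _ _ _ _) (cong (_* D (δ i) (δ j) (δ l)) (cong₂ _*_ (λ-volume i) (cong₂ _*_ (λ-volume j) (λ-volume l)))))))
        T-swap₁ : ∀ i j l → T i j l ≡ T j i l
        T-swap₁ i j l = trans (𝔼-swap E E (λ b a → 𝔼 E (λ e → 𝟙 (h a b e) * (term i a * (term j b * term l e)))))
          (𝔼-cong E (λ b → 𝔼-cong E (λ a → 𝔼-cong E (λ e → trans (prod-swap₁ _ (term i a) (term j b) (term l e)) (cong (λ z → 𝟙 z * (term j b * (term i a * term l e))) (h-swap₁ a b e))))))
        T-swap₂ : ∀ i j l → T i j l ≡ T i l j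
        T-swap₂ i j l = 𝔼-cong E (λ a → trans (𝔼-swap E E (λ e b → 𝟙 (h a b e) * (term i a * (term j b * term l e))))
          (𝔼-cong E (λ e → 𝔼-cong E (λ b → trans (prod-swap₂ _ (term i a) (term j b) (term l e)) (cong (λ z → 𝟙 z * (term i a * (term l e * term j b))) (h-swap₂ a b e))))))
        sorted : ∀ {i j l} → i ∈ Qs → j ∈ Qs → l ∈ Qs → i Fin.< j → j Fin.< l → T i j l ≤ ρ³ * w
        sorted {i} {j} {l} p q r l< lt' = ≤-trans (≡⇒≤ (T-D i j l)) (*-monoˡ 0≤ρ³ (sparse p q r l< lt'))
        any-order : ∀ {i j l} → i ∈ Qs → j ∈ Qs → l ∈ Qs → i ≢ j → j ≢ l → i ≢ l → T i j l ≤ ρ³ * w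
        any-order {i} {j} {l} p q r ij jl il with FinP.<-cmp i j | FinP.<-cmp j l | FinP.<-cmp i l
        ... | tri≈ _ e _ | _ | _ = ⊥-elim (ij e)
        ... | _ | tri≈ _ e _ | _ = ⊥-elim (jl e)
        ... | _ | _ | tri≈ _ e _ = ⊥-elim (il e)
        ... | tri< x _ _ | tri< y _ _ | _ = sorted p q r x y
        ... | tri< x _ _ | tri> _ _ y | tri< z _ _ = ≤-trans (≡⇒≤ (T-swap₂ i j l)) (sorted p r q z y)
        ... | tri< x _ _ | tri> _ _ y | tri> _ _ z = ≤-trans (≡⇒≤ (trans (T-swap₂ i j l) (T-swap₁ i l j))) (sorted r p q z x)
        ... | tri> _ _ x | tri< y _ _ | tri< z _ _ = ≤-trans (≡⇒≤ (T-swap₁ i j l)) (sorted q p r x z)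
        ... | tri> _ _ x | tri< y _ _ | tri> _ _ z = ≤-trans (≡⇒≤ (trans (T-swap₁ i j l) (T-swap₂ j i l))) (sorted q r p y z)
        ... | tri> _ _ x | tri> _ _ y | _ = ≤-trans (≡⇒≤ (trans (T-swap₁ i j l) (trans (T-swap₂ j i l) (T-swap₁ j l i)))) (sorted r q p y x)
        T-bound : ∀ {i j l} → i ∈ Qs → j ∈ Qs → l ∈ Qs → T i j l ≤ ρ³ * (w + (𝟙 (eqᵇ i j) + (𝟙 (eqᵇ j l) + 𝟙 (eqᵇ i l))))
        T-bound {i} {j} {l} p q r = go (i FinP.≟ j) (j FinP.≟ l) (i FinP.≟ l)
          where
          le : ∀ {x} → 1ℚ ≤ x → T i j l ≤ ρ³ * (w + x)
          le 1≤x = ≤-trans (≡⇒≤ (T-D i j l)) (*-monoˡ 0≤ρ³ (≤-trans (proj₂ (cexp-01 EL₃.E₃ (x₀ , x₀ , x₀) EL₃.faithful₃ T₃ EL₃.h01 _))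
            (≤-trans 1≤x (≤-trans (≡⇒≤ (sym (+-identityˡ _))) (+-monoˡ-≤ _ 0≤w)))))
          1≤ : ∀ {i' j' : Fin M} → i' ≡ j' → 1ℚ ≤ 𝟙 (eqᵇ i' j')
          1≤ {i'} refl = ≡⇒≤ (sym (cong 𝟙 (eqᵇ-refl i')))
          a₁ : ∀ {x y} → 1ℚ ≤ x → 0ℚ ≤ y → 1ℚ ≤ x + y
          a₁ {x} {y} u v = subst (_≤ x + y) (+-identityʳ 1ℚ) (+-mono-≤ u v)
          a₂ : ∀ {x y} → 0ℚ ≤ x → 1ℚ ≤ y → 1ℚ ≤ x + y
          a₂ {x} {y} u v = subst (_≤ x + y) (+-identityˡ 1ℚ) (+-mono-≤ u v)
          go : Dec (i ≡ j) → Dec (j ≡ l) → Dec (i ≡ l) → T i j l ≤ ρ³ * (w + (𝟙 (eqᵇ i j) + (𝟙 (eqᵇ j l) + 𝟙 (eqᵇ i l))))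
          go (yes e) _ _ = le (a₁ (1≤ e) (0≤+ (0≤𝟙 _) (0≤𝟙 _)))
          go (no _) (yes e) _ = le (a₂ (0≤𝟙 _) (a₁ (1≤ e) (0≤𝟙 _)))
          go (no _) (no _) (yes e) = le (a₂ (0≤𝟙 _) (a₂ (0≤𝟙 _) (1≤ e)))
          go (no ij) (no jl) (no il) = ≤-trans (any-order p q r ij jl il) (*-monoˡ 0≤ρ³ (≤-trans (≡⇒≤ (sym (+-identityʳ w))) (+-monoʳ-≤ w (0≤+ (0≤𝟙 _) (0≤+ (0≤𝟙 _) (0≤𝟙 _))))))
        inner : ∀ {i j} → i ∈ Qs → j ∈ Qs → lsum (T i j) Qs ≤ s * (ρ³ * w) + (s * ρ³ * 𝟙 (eqᵇ i j) + (ρ³ + ρ³))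
        inner {i} {j} p q = ≤-trans (lsum-mono Qs (λ r → T-bound p q r)) (≤-trans (≡⇒≤ (trans (lsum-cong Qs (λ l → split₄ ρ³ w (𝟙 (eqᵇ i j)) (𝟙 (eqᵇ j l)) (𝟙 (eqᵇ i l))))
            (trans (lsum-+ _ _ Qs) (cong₂ _+_ (trans (lsum-const _ Qs) (inner-const s ρ³ w _)) (trans (lsum-+ _ _ Qs) (cong₂ _+_ (lsum-*ˡ ρ³ _ Qs) (lsum-*ˡ ρ³ _ Qs)))))))
          (≤-trans (+-monoʳ-≤ _ (+-mono-≤ (one j) (one i))) (≡⇒≤ (+-assoc _ _ _))))
          where one : ∀ j → ρ³ * lsum (λ l → 𝟙 (eqᵇ j l)) Qs ≤ ρ³
                one j = ≤-trans (*-monoˡ 0≤ρ³ (lsum-δ≤ j Qs inc)) (≡⇒≤ (*-identityʳ ρ³))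
        middle : ∀ {i} → i ∈ Qs → lsum (λ j → lsum (T i j) Qs) Qs ≤ s * (s * (ρ³ * w)) + ρ³ * (s + (s + s))
        middle {i} p = ≤-trans (lsum-mono Qs (λ q → inner p q)) (≤-trans (≡⇒≤ (trans (lsum-+ _ _ Qs) (cong₂ _+_ (lsum-const _ Qs)
            (trans (lsum-+ _ _ Qs) (cong₂ _+_ (lsum-*ˡ (s * ρ³) _ Qs) (lsum-const _ Qs))))))
          (≤-trans (+-monoʳ-≤ _ (+-monoˡ-≤ _ (≤-trans (*-monoˡ (0≤* (0≤fromℕ (length Qs)) 0≤ρ³) (lsum-δ≤ i Qs inc)) (≡⇒≤ (*-identityʳ _)))))
            (≡⇒≤ (middle-sum s ρ³ w))))
        outer : lsum (λ i → lsum (λ j → lsum (T i j) Qs) Qs) Qs ≤ cube κ * (w + (σ + (σ + σ)))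
        outer = ≤-trans (lsum-upper _ Qs middle) (≡⇒≤ (trans (outer-sum s ρ³ w) (trans (final-total s κ σ w)
            (trans (cong (λ z → cube κ * (z * (z * z) * w + σ * (z * z + (z * z + z * z)))) σs) (with-ones (cube κ) σ w)))))

      -- Spreading weight evenly over the types of a sparse list exhibits a set of vertices of density about w.
      sparse-bound : d * cube κ ≤ cube κ * (w + (σ + (σ + σ))) + error
      sparse-bound = ≤-trans (≡⇒≤ (cong (λ z → d * cube z) (sym mean))) (≤-trans (dense ω ω01) (+-monoˡ-≤ error (≤-trans (≡⇒≤ count-T) outer)))

module Patterns where

  open Conditioning using (Faithful)
  open Tuples
  open EdgeWeights
  open ReducedStructures using (Role; rβ; rν; rρ; rκ; rγ; Index)
  open WeightedDensity using (edgeᵇ; edgeᵇ-sound; edgeᵇ-complete; IsEdge-swap₁; IsEdge-swap₂; IsEdge-distinct)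
  open import Data.Vec using (lookup)

  ∧-split : ∀ {a b} → a ∧ b ≡ true → a ≡ true × b ≡ true
  ∧-split {true} {true} _ = refl , refl

  sorted-suffices : ∀ {f n m} (F : Graph3 f) (H : Graph3 n) (v : Fin m → Fin f) (y : Fin m → Fin n) →
    (∀ {i j k} → i Fin.< j → j Fin.< k → IsEdge F (v i) (v j) (v k) → IsEdge H (y i) (y j) (y k)) →
    ∀ i j k → IsEdge F (v i) (v j) (v k) → IsEdge H (y i) (y j) (y k)
  sorted-suffices F H v y S i j k e with IsEdge-distinct F e | FinP.<-cmp i j | FinP.<-cmp j k | FinP.<-cmp i k
  ... | (p , _ , _) | tri≈ _ refl _ | _ | _ = ⊥-elim (p refl)
  ... | (_ , p , _) | _ | tri≈ _ refl _ | _ = ⊥-elim (p refl)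
  ... | (_ , _ , p) | _ | _ | tri≈ _ refl _ = ⊥-elim (p refl)
  ... | _ | tri< x _ _ | tri< z _ _ | _ = S x z e
  ... | _ | tri< x _ _ | tri> _ _ z | tri< w _ _ = IsEdge-swap₂ H (S w z (IsEdge-swap₂ F e))
  ... | _ | tri< x _ _ | tri> _ _ z | tri> _ _ w = IsEdge-swap₂ H (IsEdge-swap₁ H (S w x (IsEdge-swap₁ F (IsEdge-swap₂ F e))))
  ... | _ | tri> _ _ x | tri< z _ _ | tri< w _ _ = IsEdge-swap₁ H (S x w (IsEdge-swap₁ F e))
  ... | _ | tri> _ _ x | tri< z _ _ | tri> _ _ w = IsEdge-swap₁ H (IsEdge-swap₂ H (S z w (IsEdge-swap₂ F (IsEdge-swap₁ F e))))
  ... | _ | tri> _ _ x | tri> _ _ z | _ = IsEdge-swap₁ H (IsEdge-swap₂ H (IsEdge-swap₁ H (S z x (IsEdge-swap₁ F (IsEdge-swap₂ F (IsEdge-swap₁ F e))))))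

  RolePattern : Role → Role → Role → Set
  RolePattern r₁ r₂ r₃ = (r₁ ≡ rβ × r₂ ≡ rν × r₃ ≡ rρ) ⊎ (r₁ ≡ rγ × r₂ ≡ rκ × r₃ ≡ rβ)

  -- indices are read upwards or, when the flag is set, downwards
  Below : ∀ {M} → Bool → Fin M → Fin M → Set
  Below false a b = a Fin.< b
  Below true a b = b Fin.< a

  turn : ∀ {A : Set} → Bool → (Fin 2 → A) → A × A
  turn false z = z zero , z (suc zero)
  turn true z = z (suc zero) , z zero

  src tgt : ∀ {M} → Bool → Index M → Fin M
  src false (_ , a , b) = a
  src true (_ , a , b) = b
  tgt false (_ , a , b) = b
  tgt true (_ , a , b) = a

  module _ {f : ℕ} (F : Graph3 f) (ord : Permutation′ f) (ψ : Fin f → Fin f → Role)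
    (coloured : ∀ i j k → i Fin.< j → j Fin.< k → IsEdge F (ord ⟨$⟩ʳ i) (ord ⟨$⟩ʳ j) (ord ⟨$⟩ʳ k) → RolePattern (ψ i j) (ψ j k) (ψ i k))
    {M : ℕ} (down : Bool) (q : Fin f → Fin M) (mono : ∀ {i j} → i Fin.< j → Below down (q i) (q j)) where

    private
      v : Fin f → Fin f
      v i = ord ⟨$⟩ʳ i

    q-injective : ∀ {i j} → q i ≡ q j → i ≡ j
    q-injective {i} {j} e with FinP.<-cmp i j
    ... | tri≈ _ p _ = p
    ... | tri< l _ _ = ⊥-elim (irr down (subst (Below down (q i)) (sym e) (mono l)))
      where irr : ∀ d {a : Fin M} → Below d a a → ⊥
            irr false = ℕP.<-irrefl refl
            irr true = ℕP.<-irrefl refl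
    ... | tri> _ _ l = ⊥-elim (irr down (subst (λ z → Below down z (q i)) (sym e) (mono l)))
      where irr : ∀ d {a : Fin M} → Below d a a → ⊥
            irr false = ℕP.<-irrefl refl
            irr true = ℕP.<-irrefl refl

    opaque
      slot : Fin M → Maybe (Fin f)
      slot a with FinP.any? (λ i → q i FinP.≟ a)
      ... | yes (i , _) = just i
      ... | no _ = nothing

      slot-sound : ∀ {a i} → slot a ≡ just i → q i ≡ a
      slot-sound {a} e with FinP.any? (λ i → q i FinP.≟ a)
      slot-sound refl | yes (i , p) = p

      slot-q : ∀ i → slot (q i) ≡ just i
      slot-q i with FinP.any? (λ j → q j FinP.≟ q i)
      ... | yes (j , p) = cong just (q-injective p)
      ... | no n = ⊥-elim (n (i , refl))

    position-edge : Maybe (Fin f) → Maybe (Fin f) → Maybe (Fin f) → Bool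
    position-edge (just i) (just j) (just k) = does (i FinP.<? j) ∧ (does (j FinP.<? k) ∧ edgeᵇ F (v i) (v j) (v k))
    position-edge _ _ _ = false

    position-edge-sound : ∀ x y z → position-edge x y z ≡ true → Σ (Fin f) λ i → Σ (Fin f) λ j → Σ (Fin f) λ k →
      x ≡ just i × y ≡ just j × z ≡ just k × i Fin.< j × j Fin.< k × IsEdge F (v i) (v j) (v k)
    position-edge-sound (just i) (just j) (just k) e with ∧-split {does (i FinP.<? j)} e
    ... | e₁ , e₂ with ∧-split {does (j FinP.<? k)} e₂
    ... | e₃ , e₄ = i , j , k , refl , refl , refl , does-true (i FinP.<? j) e₁ , does-true (j FinP.<? k) e₃ , edgeᵇ-sound F _ _ _ e₄

    active : Fin M → Fin M → Fin M → Bool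
    active a b e = if down then position-edge (slot e) (slot b) (slot a) else position-edge (slot a) (slot b) (slot e)

    role : Maybe (Fin f) → Maybe (Fin f) → Role
    role (just i) (just j) = ψ i j
    role _ _ = rβ

    sel : Fin M → Fin M → Index M
    sel a b = if down then (role (slot b) (slot a) , b , a) else (role (slot a) (slot b) , a , b)

    src-sel : ∀ a b → src down (sel a b) ≡ a
    src-sel a b = go down
      where go : ∀ d → src d (if d then (role (slot b) (slot a) , b , a) else (role (slot a) (slot b) , a , b)) ≡ a
            go false = refl
            go true = refl

    tgt-sel : ∀ a b → tgt down (sel a b) ≡ b
    tgt-sel a b = go down
      where go : ∀ d → tgt d (if d then (role (slot b) (slot a) , b , a) else (role (slot a) (slot b) , a , b)) ≡ b
            go false = refl
            go true = refl

    N = #triples M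

    s : Fin N → Factor
    s t = if active (tri₁ t) (tri₂ t) (tri₃ t) then edge else one

    active-increasing : ∀ a b e → active a b e ≡ true → a Fin.< b × b Fin.< e
    active-increasing a b e p = go down mono p
      where
      go : ∀ d → (∀ {i j} → i Fin.< j → Below d (q i) (q j)) →
        (if d then position-edge (slot e) (slot b) (slot a) else position-edge (slot a) (slot b) (slot e)) ≡ true → a Fin.< b × b Fin.< e
      go false mono p with position-edge-sound _ _ _ p
      ... | i , j , k , ea , eb , ee , ij , jk , _ = subst₂ Fin._<_ (slot-sound ea) (slot-sound eb) (mono ij) , subst₂ Fin._<_ (slot-sound eb) (slot-sound ee) (mono jk)
      go true mono p with position-edge-sound _ _ _ p
      ... | i , j , k , ee , eb , ea , ij , jk , _ = subst₂ Fin._<_ (slot-sound ea) (slot-sound eb) (mono jk) , subst₂ Fin._<_ (slot-sound eb) (slot-sound ee) (mono ij)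

    s-increasing : ∀ t → s t ≢ one → tri₁ t Fin.< tri₂ t × tri₂ t Fin.< tri₃ t
    s-increasing t ne with active (tri₁ t) (tri₂ t) (tri₃ t) in eq
    ... | true = active-increasing _ _ _ eq
    ... | false = ⊥-elim (ne refl)

    module Weights {K : ℕ} (W : Fin K → Fin K → Fin K → ℚ) (W01 : ∀ a b r → 0ℚ ≤ W a b r × W a b r ≤ 1ℚ) where

      Wᵈ : Fin K → Fin K → Fin K → ℚ
      Wᵈ x y z = if down then W y x z else W x y z

      val : Factor → ℚ → ℚ
      val one w = 1ℚ
      val edge w = w
      val weight w = w

      Ψ : (Index M → Fin K) → ℚ
      Ψ g = ∏ (λ t → val (s t) (W (g (sel (tri₁ t) (tri₂ t))) (g (sel (tri₂ t) (tri₃ t))) (g (sel (tri₁ t) (tri₃ t)))))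

      val-01 : ∀ F w → 0ℚ ≤ w × w ≤ 1ℚ → 0ℚ ≤ val F w × val F w ≤ 1ℚ
      val-01 one w _ = 0≤1 , ≤-refl
      val-01 edge w p = p
      val-01 weight w p = p

      Ψ-01 : ∀ g → 0ℚ ≤ Ψ g × Ψ g ≤ 1ℚ
      Ψ-01 g = ∏-01 (λ t → val-01 (s t) _ (W01 _ _ _))

      Ψ-cong : ∀ {g g'} → (∀ i j → i Fin.< j → g (sel i j) ≡ g' (sel i j)) → Ψ g ≡ Ψ g'
      Ψ-cong {g} {g'} e = ∏-cong (λ t → go t (s t) refl)
        where
        go : ∀ t F → s t ≡ F → val F (W (g (sel (tri₁ t) (tri₂ t))) (g (sel (tri₂ t) (tri₃ t))) (g (sel (tri₁ t) (tri₃ t))))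
          ≡ val F (W (g' (sel (tri₁ t) (tri₂ t))) (g' (sel (tri₂ t) (tri₃ t))) (g' (sel (tri₁ t) (tri₃ t))))
        same : ∀ t → s t ≢ one → W (g (sel (tri₁ t) (tri₂ t))) (g (sel (tri₂ t) (tri₃ t))) (g (sel (tri₁ t) (tri₃ t)))
          ≡ W (g' (sel (tri₁ t) (tri₂ t))) (g' (sel (tri₂ t) (tri₃ t))) (g' (sel (tri₁ t) (tri₃ t)))
        same t ne with s-increasing t ne
        ... | l , l' rewrite e _ _ l | e _ _ l' | e _ _ (ℕP.<-trans l l') = refl
        go t one _ = refl
        go t edge p = same t (λ q → case-absurd (trans (sym p) q))
          where case-absurd : edge ≡ one → ⊥
                case-absurd ()
        go t weight p = same t (λ q → case-absurd (trans (sym p) q))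
          where case-absurd : weight ≡ one → ⊥
                case-absurd ()

      Ψ-lower : ∀ η → 0ℚ ≤ η → η ≤ 1ℚ → ∀ g →
        (∀ {i j k} → i Fin.< j → j Fin.< k →
          η ≤ Wᵈ (g (rβ , q i , q j)) (g (rν , q j , q k)) (g (rρ , q i , q k))
          × η ≤ Wᵈ (g (rγ , q i , q j)) (g (rκ , q j , q k)) (g (rβ , q i , q k))) →
        pw η N ≤ Ψ g
      Ψ-lower η 0≤η η≤1 g H = ∏-lower 0≤η factor
        where
        by-pattern : ∀ {i j k} → i Fin.< j → j Fin.< k → IsEdge F (v i) (v j) (v k) →
          η ≤ Wᵈ (g (ψ i j , q i , q j)) (g (ψ j k , q j , q k)) (g (ψ i k , q i , q k))
        by-pattern {i} {j} {k} ij jk e with coloured i j k ij jk e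
        ... | inj₁ (p₁ , p₂ , p₃) rewrite p₁ | p₂ | p₃ = proj₁ (H ij jk)
        ... | inj₂ (p₁ , p₂ , p₃) rewrite p₁ | p₂ | p₃ = proj₂ (H ij jk)
        at : ∀ d a b e →
          (∀ {i j k} → i Fin.< j → j Fin.< k → IsEdge F (v i) (v j) (v k) →
            η ≤ (if d then W (g (ψ j k , q j , q k)) (g (ψ i j , q i , q j)) (g (ψ i k , q i , q k)) else W (g (ψ i j , q i , q j)) (g (ψ j k , q j , q k)) (g (ψ i k , q i , q k)))) →
          (if d then position-edge (slot e) (slot b) (slot a) else position-edge (slot a) (slot b) (slot e)) ≡ true →
          let sel' = λ a b → if d then (role (slot b) (slot a) , b , a) else (role (slot a) (slot b) , a , b) in
          η ≤ W (g (sel' a b)) (g (sel' b e)) (g (sel' a e))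
        at false a b e B p with position-edge-sound _ _ _ p
        ... | i , j , k , ea , eb , ee , ij , jk , ed with slot-sound ea | slot-sound eb | slot-sound ee
        ... | refl | refl | refl rewrite ea | eb | ee = B ij jk ed
        at true a b e B p with position-edge-sound _ _ _ p
        ... | i , j , k , ee , eb , ea , ij , jk , ed with slot-sound ea | slot-sound eb | slot-sound ee
        ... | refl | refl | refl rewrite ea | eb | ee = B ij jk ed
        factor : ∀ t → η ≤ val (s t) (W (g (sel (tri₁ t) (tri₂ t))) (g (sel (tri₂ t) (tri₃ t))) (g (sel (tri₁ t) (tri₃ t))))
        factor t with active (tri₁ t) (tri₂ t) (tri₃ t) in eq
        ... | false = η≤1
        ... | true = at down (tri₁ t) (tri₂ t) (tri₃ t) by-pattern eq

    module Count {n : ℕ} (E : Ex (Fin n)) (x₀ : Fin n) (faithful : Faithful E) (H : Graph3 n) (free : FFree F H)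
      {K : ℕ} (c : Fin n → Fin n → Fin K) where

      open Edge-level E x₀ faithful (edgeᵇ H)
      open Replacement M K c hiding (N)
      open Weights (W c) (W-01 c)

      weights-Ψ : ∀ x → P (λ t → to-weight (s t)) x ≡ Ψ (λ ι → c (x (src down ι)) (x (tgt down ι)))
      weights-Ψ x = ∏-cong (λ t → go (s t) (tri₁ t) (tri₂ t) (tri₃ t))
        where
        go : ∀ F a b e → value (to-weight F) x a b e ≡ val F (W c (c (x (src down (sel a b))) (x (tgt down (sel a b))))
          (c (x (src down (sel b e))) (x (tgt down (sel b e)))) (c (x (src down (sel a e))) (x (tgt down (sel a e)))))
        go F a b e rewrite src-sel a b | tgt-sel a b | src-sel b e | tgt-sel b e | src-sel a e | tgt-sel a e with F
        ... | one = refl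
        ... | edge = refl
        ... | weight = refl

      clash : (Fin M → Fin n) → Fin M → Fin M → Bool
      clash x a b = not (eqᵇ a b) ∧ eqᵇ (x a) (x b)

      active-q : ∀ d i j k → i Fin.< j → j Fin.< k → IsEdge F (v i) (v j) (v k) →
        let (a , e) = turn d (λ { zero → q i ; (suc _) → q k }) in
        (if d then position-edge (slot e) (slot (q j)) (slot a) else position-edge (slot a) (slot (q j)) (slot e)) ≡ true
      active-q false i j k ij jk e rewrite slot-q i | slot-q j | slot-q k = cong₂ _∧_ (dec-true' (i FinP.<? j) ij) (cong₂ _∧_ (dec-true' (j FinP.<? k) jk) (edgeᵇ-complete F _ _ _ e))
        where dec-true' : ∀ {P : Set} (d : Dec P) → P → does d ≡ true
              dec-true' (yes _) _ = refl
              dec-true' (no n) p = ⊥-elim (n p)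
      active-q true i j k ij jk e rewrite slot-q i | slot-q j | slot-q k = cong₂ _∧_ (dec-true' (i FinP.<? j) ij) (cong₂ _∧_ (dec-true' (j FinP.<? k) jk) (edgeᵇ-complete F _ _ _ e))
        where dec-true' : ∀ {P : Set} (d : Dec P) → P → does d ≡ true
              dec-true' (yes _) _ = refl
              dec-true' (no n) p = ⊥-elim (n p)

      all-edges⇒⊥ : ∀ (x : Fin M → Fin n) → (∀ a b → a ≢ b → x a ≢ x b) → (∀ t → s t ≡ edge → edgeᵇ H (x (tri₁ t)) (x (tri₂ t)) (x (tri₃ t)) ≡ true) → ⊥
      all-edges⇒⊥ x inj h = free (φ , φ-inj , φ-edges)
        where
        φ : Fin f → Fin n
        φ a = x (q (ord ⟨$⟩ˡ a))
        φ-inj : Injective _≡_ _≡_ φ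
        φ-inj {a} {b} e with q (ord ⟨$⟩ˡ a) FinP.≟ q (ord ⟨$⟩ˡ b)
        ... | yes p = trans (sym (inverseʳ ord)) (trans (cong (ord ⟨$⟩ʳ_) (q-injective p)) (inverseʳ ord))
        ... | no ne = ⊥-elim (inj _ _ ne e)
        edge-at : ∀ a b e → active a b e ≡ true → IsEdge H (x a) (x b) (x e)
        edge-at a b e p = edgeᵇ-sound H _ _ _ (subst₂ (λ y z → edgeᵇ H (x y) (x z) (x e) ≡ true) (tri₁-index a b e) (tri₂-index a b e)
            (subst (λ y → edgeᵇ H (x (tri₁ t)) (x (tri₂ t)) (x y) ≡ true) (tri₃-index a b e) (h t st)))
          where
          t = tri-index a b e
          st : s t ≡ edge
          st rewrite tri₁-index a b e | tri₂-index a b e | tri₃-index a b e | p = refl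
        rev : ∀ {x y z} → IsEdge H x y z → IsEdge H z y x
        rev e = IsEdge-swap₁ H (IsEdge-swap₂ H (IsEdge-swap₁ H e))
        step : ∀ d → d ≡ down → ∀ {i j k} → i Fin.< j → j Fin.< k → IsEdge F (v i) (v j) (v k) → IsEdge H (x (q i)) (x (q j)) (x (q k))
        step false refl {i} {j} {k} ij jk e = edge-at (q i) (q j) (q k) (active-q false i j k ij jk e)
        step true refl {i} {j} {k} ij jk e = rev (edge-at (q k) (q j) (q i) (active-q true i j k ij jk e))
        φ-edges : ∀ a b e → IsEdge F a b e → IsEdge H (φ a) (φ b) (φ e)
        φ-edges a b e p = sorted-suffices F H v (λ i → x (q i)) (step down refl) _ _ _
          (subst₂ (λ y z → IsEdge F y z _) (sym (inverseʳ ord)) (sym (inverseʳ ord)) (subst (IsEdge F a b) (sym (inverseʳ ord)) p))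

      count-clash : ∀ x → P s x ≤ ∑ (λ a → ∑ (λ b → 𝟙 (clash x a b)))
      count-clash x = go (FinP.any? (λ a → FinP.any? (λ b → clash x a b BoolP.≟ true))) (FinP.any? (λ t → missing-edge t BoolP.≟ true))
        where
        missing-edge : Fin N → Bool
        missing-edge t = active (tri₁ t) (tri₂ t) (tri₃ t) ∧ not (edgeᵇ H (x (tri₁ t)) (x (tri₂ t)) (x (tri₃ t)))
        0≤∑∑ : 0ℚ ≤ ∑ (λ a → ∑ (λ b → 𝟙 (clash x a b)))
        0≤∑∑ = 0≤∑ (λ a → 0≤∑ (λ b → 0≤𝟙 _))
        go : Dec (Σ (Fin M) λ a → Σ (Fin M) λ b → clash x a b ≡ true) → Dec (Σ (Fin N) λ t → missing-edge t ≡ true) →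
          P s x ≤ ∑ (λ a → ∑ (λ b → 𝟙 (clash x a b)))
        go (yes (a , b , e)) _ = ≤-trans (proj₂ (P-01 s x)) (≤-trans (≡⇒≤ (cong 𝟙 (sym e)))
          (≤-trans (∑-term (λ b → 0≤𝟙 (clash x a b)) b) (∑-term (λ a → 0≤∑ (λ b → 0≤𝟙 (clash x a b))) a)))
        go (no _) (yes (t , e)) = ≤-trans (∏≤ (λ t → value-01 (s t) x _ _ _) t) (≤-trans (≡⇒≤ zero-factor) 0≤∑∑)
          where
          zero-factor : value (s t) x (tri₁ t) (tri₂ t) (tri₃ t) ≡ 0ℚ
          zero-factor with ∧-split {active (tri₁ t) (tri₂ t) (tri₃ t)} e
          ... | p , p' rewrite p = cong 𝟙 (BoolP.not-injective p')
        go (no nc) (no nm) = ⊥-elim (all-edges⇒⊥ x inj edges)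
          where
          inj : ∀ a b → a ≢ b → x a ≢ x b
          inj a b ne e = nc (a , b , cong₂ _∧_ (cong not (eqᵇ-≢ ne)) (trans (cong (λ z → eqᵇ z (x b)) e) (eqᵇ-refl (x b))))
          edges : ∀ t → s t ≡ edge → edgeᵇ H (x (tri₁ t)) (x (tri₂ t)) (x (tri₃ t)) ≡ true
          edges t st with edgeᵇ H (x (tri₁ t)) (x (tri₂ t)) (x (tri₃ t)) in eq
          ... | true = refl
          ... | false = ⊥-elim (nm (t , cong₂ _∧_ (act t st) (cong not eq)))
            where act : ∀ t → s t ≡ edge → active (tri₁ t) (tri₂ t) (tri₃ t) ≡ true
                  act t st with active (tri₁ t) (tri₂ t) (tri₃ t)
                  ... | true = refl

      -- Copies of F do not exist, so only tuples with a repeated vertex contribute.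
      count-bound : ∀ ι → 0ℚ ≤ ι → (∀ u → 𝔼 E (λ w → 𝟙 (eqᵇ u w)) ≤ ι) → 𝔼 (pow E M) (λ x → P s (lookup x)) ≤ fromℕ M * (fromℕ M * ι)
      count-bound ι 0≤ι rare = ≤-trans (𝔼-mono (pow E M) (λ x → count-clash (lookup x)))
          (≤-trans (≡⇒≤ (trans (𝔼-∑ (pow E M) (λ a x → ∑ (λ b → 𝟙 (clash (lookup x) a b)))) (∑-cong (λ a → 𝔼-∑ (pow E M) (λ b x → 𝟙 (clash (lookup x) a b))))))
            (≤-trans (∑-mono (λ a → ∑-mono (λ b → each a b))) (≡⇒≤ (trans (∑-cong {M} (λ a → ∑-const M ι)) (∑-const M _)))))
        where
        each : ∀ a b → 𝔼 (pow E M) (λ x → 𝟙 (clash (lookup x) a b)) ≤ ι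
        each a b = go (a FinP.≟ b)
          where
          go : Dec (a ≡ b) → 𝔼 (pow E M) (λ x → 𝟙 (clash (lookup x) a b)) ≤ ι
          go (yes refl) = ≤-trans (≡⇒≤ (trans (𝔼-cong (pow E M) (λ x → cong (λ z → 𝟙 (not z ∧ eqᵇ (lookup x a) (lookup x a))) (eqᵇ-refl a))) (𝔼-const (pow E M) 0ℚ))) 0≤ι
          go (no ne) = ≤-trans (≡⇒≤ (resample₂ E (λ x → 𝟙 (clash x a b)) (λ e → cong₂ (λ y z → 𝟙 (not (eqᵇ a b) ∧ eqᵇ y z)) (e a) (e b)) a b))
            (𝔼≤ (pow E M) (λ x → 𝔼≤ E (λ u → ≤-trans (≡⇒≤ (𝔼-cong E (λ w → same (lookup x) u w))) (rare u))))
            where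
            same : ∀ (y : Fin M → Fin n) u w → 𝟙 (clash (upd (upd y a u) b w) a b) ≡ 𝟙 (eqᵇ u w)
            same y u w = cong 𝟙 (cong₂ _∧_ (cong not (eqᵇ-≢ ne)) (cong₂ eqᵇ
              (trans (upd-other (upd y a u) w (λ e → ne (sym e))) (upd-same y a u)) (upd-same (upd y a u) b w)))

module Alternatives where

  open Tuples using (pw; pw-pos; #triples)
  open IndependentColours using (EL)
  open RamseyTheory
  open Selection
  open ReducedStructures
  open PoorStructures
  open Patterns
  open import Data.List using (lookup)
  open import Data.List.Relation.Binary.Sublist.Propositional using (_⊆_)

  On₃ : ∀ {A : Set} → (A → A → A → Set) → List A → Set
  On₃ R (i ∷ j ∷ k ∷ []) = R i j k
  On₃ R _ = ⊤

  On₄ : ∀ {A : Set} → (A → A → A → A → Set) → List A → Set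
  On₄ R (i ∷ j ∷ k ∷ l ∷ []) = R i j k l
  On₄ R _ = ⊤

  on₃? : ∀ {A : Set} {R : A → A → A → Set} → (∀ i j k → Dec (R i j k)) → ∀ xs → Dec (On₃ R xs)
  on₃? R? [] = yes tt
  on₃? R? (i ∷ []) = yes tt
  on₃? R? (i ∷ j ∷ []) = yes tt
  on₃? R? (i ∷ j ∷ k ∷ []) = R? i j k
  on₃? R? (i ∷ j ∷ k ∷ _ ∷ _) = yes tt

  on₄? : ∀ {A : Set} {R : A → A → A → A → Set} → (∀ i j k l → Dec (R i j k l)) → ∀ xs → Dec (On₄ R xs)
  on₄? R? [] = yes tt
  on₄? R? (i ∷ []) = yes tt
  on₄? R? (i ∷ j ∷ []) = yes tt
  on₄? R? (i ∷ j ∷ k ∷ []) = yes tt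
  on₄? R? (i ∷ j ∷ k ∷ l ∷ []) = R? i j k l
  on₄? R? (i ∷ j ∷ k ∷ l ∷ _ ∷ _) = yes tt

  module _ {M : ℕ} where

    Up : List (Fin M) → Set
    Up = AllPairs Fin._<_

    up-irr : ∀ {x : Fin M} → ¬ (x Fin.< x)
    up-irr = ℕP.<-irrefl refl

    up-tr : ∀ {x y z : Fin M} → x Fin.< y → y Fin.< z → x Fin.< z
    up-tr = ℕP.<-trans

    triple-⊆ : ∀ {ys} → Up ys → ∀ {i j k} → i ∈ ys → j ∈ ys → k ∈ ys → i Fin.< j → j Fin.< k → i ∷ j ∷ k ∷ [] ⊆ ys
    triple-⊆ up a b c p q = increasing-⊆ (λ {x} → up-irr {x}) (λ {x} {y} {z} → up-tr {x} {y} {z})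
      ((p ∷ ℕP.<-trans p q ∷ []) ∷ (q ∷ []) ∷ [] ∷ []) up (a ∷ b ∷ c ∷ [])

    quad-⊆ : ∀ {ys} → Up ys → ∀ {i j k l} → i ∈ ys → j ∈ ys → k ∈ ys → l ∈ ys → i Fin.< j → j Fin.< k → k Fin.< l → i ∷ j ∷ k ∷ l ∷ [] ⊆ ys
    quad-⊆ up a b c d p q r = increasing-⊆ (λ {x} → up-irr {x}) (λ {x} {y} {z} → up-tr {x} {y} {z})
      ((p ∷ ℕP.<-trans p q ∷ ℕP.<-trans p (ℕP.<-trans q r) ∷ []) ∷ (q ∷ ℕP.<-trans q r ∷ []) ∷ (r ∷ []) ∷ [] ∷ []) up (a ∷ b ∷ c ∷ d ∷ [])

    nth-total : Fin M → List (Fin M) → ℕ → Fin M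
    nth-total d [] _ = d
    nth-total d (x ∷ xs) zero = x
    nth-total d (x ∷ xs) (suc i) = nth-total d xs i

    nth-total-∈ : ∀ d xs {i} → i ℕ.< length xs → nth-total d xs i ∈ xs
    nth-total-∈ d (x ∷ xs) {zero} _ = here refl
    nth-total-∈ d (x ∷ xs) {suc i} (ℕ.s≤s p) = there (nth-total-∈ d xs p)

    nth-total-< : ∀ d xs → Up xs → ∀ {i j} → i ℕ.< j → j ℕ.< length xs → nth-total d xs i Fin.< nth-total d xs j
    nth-total-< d (x ∷ xs) (a ∷ p) {zero} {suc j} _ (ℕ.s≤s q) = All.lookup a (nth-total-∈ d xs q)
    nth-total-< d (x ∷ xs) (a ∷ p) {suc i} {suc j} (ℕ.s≤s l) (ℕ.s≤s q) = nth-total-< d xs p l q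

  allFin-up : ∀ M → AllPairs Fin._<_ (allFin M)
  allFin-up M = AllPairsP.tabulate⁺-< (λ l → l)

  reverse-pairs : ∀ {A : Set} {R : A → A → Set} xs → AllPairs R xs → AllPairs (λ a b → R b a) (reverse xs)
  reverse-pairs [] _ = []
  reverse-pairs {R = R} (x ∷ xs) (a ∷ p) = subst (AllPairs (λ a b → R b a)) (sym (unfold-reverse x xs))
    (AllPairsP.++⁺ (reverse-pairs xs p) ([] ∷ []) (All.tabulate (λ i → All.lookup a (reverse-∈ xs i) ∷ [])))
    where
    reverse-∈ : ∀ xs {y} → y ∈ reverse xs → y ∈ xs
    reverse-∈ (x ∷ xs) i with ∈-++⁻ (reverse xs) (subst (_ ∈_) (unfold-reverse x xs) i)
    ... | inj₁ j = there (reverse-∈ xs j)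
    ... | inj₂ (here refl) = here refl

  ∈-reverse : ∀ {A : Set} (xs : List A) {y} → y ∈ reverse xs → y ∈ xs
  ∈-reverse (x ∷ xs) i with ∈-++⁻ (reverse xs) (subst (_ ∈_) (unfold-reverse x xs) i)
  ... | inj₁ j = there (∈-reverse xs j)
  ... | inj₂ (here refl) = here refl

  module Sizes (f : ℕ) (s₀ : ℕ) where
    opaque
      L₁ : ℕ
      L₁ = Chain.C₁.bound 0 f τ₀ δ₀ 0<τ₀ 0<δ₀

      L₁-def : ∀ M → L₁ ≡ Chain.C₁.bound M f τ₀ δ₀ 0<τ₀ 0<δ₀
      L₁-def M = refl

    opaque
      L₂ L₃ L₄ M : ℕ
      L₂ = L₁ ⊔ 129
      L₃ = L₁ ⊔ ramsey-bound 4 L₂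
      L₄ = s₀ ⊔ ramsey-bound 4 L₃
      M = ramsey-bound 3 L₄

      L₁≤L₂ : L₁ ℕ.≤ L₂
      L₁≤L₂ = ℕP.m≤m⊔n L₁ 129
      129≤L₂ : 129 ℕ.≤ L₂
      129≤L₂ = ℕP.m≤n⊔m L₁ 129
      L₁≤L₃ : L₁ ℕ.≤ L₃
      L₁≤L₃ = ℕP.m≤m⊔n L₁ _
      R₂≤L₃ : ramsey-bound 4 L₂ ℕ.≤ L₃
      R₂≤L₃ = ℕP.m≤n⊔m L₁ _
      s₀≤L₄ : s₀ ℕ.≤ L₄
      s₀≤L₄ = ℕP.m≤m⊔n s₀ _
      R₃≤L₄ : ramsey-bound 4 L₃ ℕ.≤ L₄
      R₃≤L₄ = ℕP.m≤n⊔m s₀ _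
      R₄≤M : ramsey-bound 3 L₄ ℕ.≤ M
      R₄≤M = ℕP.≤-refl

  module Dichotomy (f s₀ : ℕ) where

    open Sizes f s₀

    module _ {K : ℕ} (P : Fin M → Fin M → Ex (Fin K)) (W : Fin K → Fin K → Fin K → ℚ)
      (W01 : ∀ a b r → 0ℚ ≤ W a b r × W a b r ≤ 1ℚ)
      (not-sparse : ∀ Qs → Up Qs → length Qs ≡ s₀ → (∀ {i j l} → i ∈ Qs → j ∈ Qs → l ∈ Qs → i Fin.< j → j Fin.< l → Degrees.density P W i j l < w₀) → ⊥) where

      open Degrees P W

      AllRich AllRichRev : List (Fin M) → Set
      AllRich xs = ∀ {i m j l} → i ∈ xs → m ∈ xs → j ∈ xs → l ∈ xs → i Fin.< m → m Fin.< j → j Fin.< l → Rich τ₀ Δ i m j l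
      AllRichRev xs = ∀ {h i m j} → h ∈ xs → i ∈ xs → m ∈ xs → j ∈ xs → h Fin.< i → i Fin.< m → m Fin.< j → RichRev P W W01 τ₀ Δ h i m j

      -- Ramsey's theorem: sparse and poor index sets are excluded, so one of the two kinds of richness prevails.
      dichotomy : Σ (List (Fin M)) λ xs → Up xs × L₁ ℕ.≤ length xs × (AllRich xs ⊎ AllRichRev xs)
      dichotomy
        with ramsey-property 3 L₄ (On₃ (λ i j k → w₀ ≤ density i j k)) (on₃? (λ i j k → w₀ ≤? density i j k))
               (allFin M) (ℕP.≤-trans R₄≤M (ℕP.≤-reflexive (sym (length-tabulate {n = M} (λ i → i)))))
      ... | ys , s , l , inj₂ sparse with shorten s₀ ys (ℕP.≤-trans s₀≤L₄ (ℕP.≤-reflexive (sym l)))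
      ...   | Qs , s' , l' = ⊥-elim (not-sparse Qs up l' (λ a b c p q → ≰⇒> (sparse (⊆-trans (triple-⊆ up a b c p q) s') refl)))
        where up = AllPairs-⊆ (⊆-trans s' s) (allFin-up M)
      dichotomy | ys , s , l , inj₁ dense
        with ramsey-property 4 L₃ (On₄ (Rich τ₀ Δ)) (on₄? (λ i m j l → τ₀ ≤? _)) ys (ℕP.≤-trans R₃≤L₄ (ℕP.≤-reflexive (sym l)))
      ... | zs , t , l' , inj₁ rich = zs , up , ℕP.≤-trans L₁≤L₃ (ℕP.≤-reflexive (sym l')) ,
              inj₁ (λ a b c d p q r → rich (quad-⊆ up a b c d p q r) refl)
        where up = AllPairs-⊆ (⊆-trans t s) (allFin-up M)
      ... | zs , t , l' , inj₂ poor
        with ramsey-property 4 L₂ (On₄ (RichRev P W W01 τ₀ Δ)) (on₄? (λ h i m j → τ₀ ≤? _)) zs (ℕP.≤-trans R₂≤L₃ (ℕP.≤-reflexive (sym l')))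
      ...   | ws , u , l'' , inj₁ rich = ws , up , ℕP.≤-trans L₁≤L₂ (ℕP.≤-reflexive (sym l'')) ,
                inj₂ (λ a b c d p q r → rich (quad-⊆ up a b c d p q r) refl)
        where up = AllPairs-⊆ (⊆-trans u (⊆-trans t s)) (allFin-up M)
      ...   | ws , u , l'' , inj₂ poor' = ⊥-elim (no-poor ws (ℕP.≤-trans 129≤L₂ (ℕP.≤-reflexive (sym l''))) up
                (λ a b c p q → dense (⊆-trans (triple-⊆ up a b c p q) (⊆-trans u t)) refl)
                (λ a b c d p q r → poor (⊆-trans (quad-⊆ up a b c d p q r) u) refl)
                (λ a b c d p q r → poor' (quad-⊆ up a b c d p q r) refl))
        where
        up = AllPairs-⊆ (⊆-trans u (⊆-trans t s)) (allFin-up M)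
        no-poor : ∀ ws → 129 ℕ.≤ length ws → Up ws →
          (∀ {i j k} → i ∈ ws → j ∈ ws → k ∈ ws → i Fin.< j → j Fin.< k → w₀ ≤ density i j k) →
          (∀ {i m j l} → i ∈ ws → m ∈ ws → j ∈ ws → l ∈ ws → i Fin.< m → m Fin.< j → j Fin.< l → ¬ Rich τ₀ Δ i m j l) →
          (∀ {h i m j} → h ∈ ws → i ∈ ws → m ∈ ws → j ∈ ws → h Fin.< i → i Fin.< m → m Fin.< j → ¬ RichRev P W W01 τ₀ Δ h i m j) → ⊥
        no-poor (w ∷ ws) long up dn po po' = poor-contradiction P W W01 (length (w ∷ ws)) long q
          (λ ij jk kL → dn (∈q (ℕP.<-trans ij (ℕP.<-trans jk kL))) (∈q (ℕP.<-trans jk kL)) (∈q kL) (<q ij (ℕP.<-trans jk kL)) (<q jk kL))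
          (λ im mj jl lL → po (∈q (ℕP.<-trans im (ℕP.<-trans mj (ℕP.<-trans jl lL)))) (∈q (ℕP.<-trans mj (ℕP.<-trans jl lL))) (∈q (ℕP.<-trans jl lL)) (∈q lL)
            (<q im (ℕP.<-trans mj (ℕP.<-trans jl lL))) (<q mj (ℕP.<-trans jl lL)) (<q jl lL))
          (λ im mj jl lL → po' (∈q (ℕP.<-trans im (ℕP.<-trans mj (ℕP.<-trans jl lL)))) (∈q (ℕP.<-trans mj (ℕP.<-trans jl lL))) (∈q (ℕP.<-trans jl lL)) (∈q lL)
            (<q im (ℕP.<-trans mj (ℕP.<-trans jl lL))) (<q mj (ℕP.<-trans jl lL)) (<q jl lL))
          where
          q = nth-total w (w ∷ ws)
          ∈q : ∀ {i} → i ℕ.< length (w ∷ ws) → q i ∈ (w ∷ ws)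
          ∈q = nth-total-∈ w (w ∷ ws)
          <q : ∀ {i j} → i ℕ.< j → j ℕ.< length (w ∷ ws) → q i Fin.< q j
          <q = nth-total-< w (w ∷ ws) up

  subs-complete : ∀ {T : Set} m (ts : List T) {zs} → zs ⊆ ts → length zs ≡ m → Σ (Sub m ts) λ z → z ∈ subs m ts × proj₁ z ≡ zs
  subs-complete zero ts {[]} s l = _ , here refl , refl
  subs-complete (suc m) (t ∷ ts) (.t ∷ʳ s) l with subs-complete (suc m) ts s l
  ... | z , i , e = skip t z , ∈-++⁺ʳ _ (∈-map⁺ (skip t) i) , e
  subs-complete (suc m) (t ∷ ts) (refl ∷ s) l with subs-complete m ts s (ℕP.suc-injective l)
  ... | z , i , e = add t z , ∈-++⁺ˡ (∈-map⁺ (add t) i) , cong (t ∷_) e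

  lsum-term : ∀ {X : Set} {f : X → ℚ} → (∀ x → 0ℚ ≤ f x) → ∀ {x xs} → x ∈ xs → f x ≤ lsum f xs
  lsum-term {f = f} p {x} {y ∷ xs} (here refl) = ≤-trans (≡⇒≤ (sym (+-identityʳ _))) (+-monoʳ-≤ _ (0≤lsum p xs))
  lsum-term {f = f} p {x} {y ∷ xs} (there i) = ≤-trans (lsum-term p i) (≤-trans (≡⇒≤ (sym (+-identityˡ _))) (+-monoˡ-≤ _ (p y)))

  lookup-pairs : ∀ {A : Set} {R : A → A → Set} (xs : List A) → AllPairs R xs → ∀ {i j} → i Fin.< j → R (lookup xs i) (lookup xs j)
  lookup-pairs (x ∷ xs) (a ∷ p) {zero} {suc j} _ = All.lookup a (∈-lookup j)
  lookup-pairs (x ∷ xs) (a ∷ p) {suc i} {suc j} (ℕ.s≤s l) = lookup-pairs xs p l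

  base : ∀ {M} → Bool → List (Fin M)
  base {M} false = allFin M
  base {M} true = reverse (allFin M)

  base-pairs : ∀ {M} d → AllPairs (Below d) (base {M} d)
  base-pairs false = allFin-up _
  base-pairs true = reverse-pairs _ (allFin-up _)

  sub-index : ∀ {M f d} → Sub f (base {M} d) → Fin f → Fin M
  sub-index (zs , s , l) i = lookup zs (cast (sym l) i)

  sub-index-mono : ∀ {M f} d (z : Sub f (base {M} d)) {i j} → i Fin.< j → Below d (sub-index {d = d} z i) (sub-index {d = d} z j)
  sub-index-mono d (zs , s , l) {i} {j} l< = lookup-pairs zs (AllPairs-⊆ s (base-pairs d))
    (subst₂ ℕ._<_ (sym (FinP.toℕ-cast (sym l) i)) (sym (FinP.toℕ-cast (sym l) j)) l<)

  module Payoff {f : ℕ} (F : Graph3 f) (ord : Permutation′ f) (ψ : Fin f → Fin f → Role)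
    (coloured : ∀ i j k → i Fin.< j → j Fin.< k → IsEdge F (ord ⟨$⟩ʳ i) (ord ⟨$⟩ʳ j) (ord ⟨$⟩ʳ k) → RolePattern (ψ i j) (ψ j k) (ψ i k))
    (s₀ : ℕ) where

    open Sizes f s₀

    tests : ∀ d → List (Sub f (base {M} d))
    tests d = subs f (base d)

    η : ℚ
    η = pw δ₀ (#triples M)

    0<η : 0ℚ < η
    0<η = pw-pos (#triples M) 0<δ₀

    gain : ℚ
    gain = Chain.c₁ M f τ₀ δ₀ 0<τ₀ 0<δ₀ η

    0<gain : 0ℚ < gain
    0<gain = Chain.0<c₁ M f τ₀ δ₀ 0<τ₀ 0<δ₀ 0<η

    module Test (d : Bool) (z : Sub f (base {M} d)) {K : ℕ} (W : Fin K → Fin K → Fin K → ℚ)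
      (W01 : ∀ a b r → 0ℚ ≤ W a b r × W a b r ≤ 1ℚ) where
      open Weights F ord ψ coloured d (sub-index {d = d} z) (sub-index-mono d z) W W01 public

    module _ {K : ℕ} (P : Fin M → Fin M → Ex (Fin K)) (W : Fin K → Fin K → Fin K → ℚ)
      (W01 : ∀ a b r → 0ℚ ≤ W a b r × W a b r ≤ 1ℚ) where

      total : ∀ d → (Index M → Fin K) → ℚ
      total d g = lsum (λ z → Test.Ψ d z W W01 g) (tests d)

      0≤total : ∀ d g → 0ℚ ≤ total d g
      0≤total d g = 0≤lsum (λ z → proj₁ (Test.Ψ-01 d z W W01 g)) (tests d)

      law : Bool → Index M → Ex (Fin K)
      law d ι = P (src d ι) (tgt d ι)

      Wd : Bool → Fin K → Fin K → Fin K → ℚ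
      Wd d x y z = if d then W y x z else W x y z

      win : ∀ d ys g → ys ⊆ base d → length ys ≡ f →
        (∀ {p b q} → p ∈ ys → b ∈ ys → q ∈ ys → Below d p b → Below d b q → δ₀ ≤ Wd d (g (rβ , p , b)) (g (rν , b , q)) (g (rρ , p , q))) →
        (∀ {p q c} → p ∈ ys → q ∈ ys → c ∈ ys → Below d p q → Below d q c → δ₀ ≤ Wd d (g (rγ , p , q)) (g (rκ , q , c)) (g (rβ , p , c))) →
        η ≤ total d g
      win d ys g s l S₃ S₅ with subs-complete f (base d) s l
      ... | z@(.ys , _ , l') , i , refl = ≤-trans (Test.Ψ-lower d z W W01 δ₀ (<⇒≤ 0<δ₀) δ₀≤1 g
            (λ {i} {j} {k} ij jk → S₃ (∈q i) (∈q j) (∈q k) (sub-index-mono d z ij) (sub-index-mono d z jk)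
                                 , S₅ (∈q i) (∈q j) (∈q k) (sub-index-mono d z ij) (sub-index-mono d z jk)))
          (lsum-term (λ z → proj₁ (Test.Ψ-01 d z W W01 g)) i)
        where
        ∈q : ∀ i → lookup ys (cast (sym l') i) ∈ ys
        ∈q i = ∈-lookup (cast (sym l') i)

      module Forward = Reduced M Fin._<_ (ℕP.<-irrefl refl) ℕP.<-trans FinP._<?_ P W W01
      module Backward = Reduced M (λ a b → b Fin.< a) (ℕP.<-irrefl refl) (λ p q → ℕP.<-trans q p) (λ a b → b FinP.<? a)
        (λ a b → P b a) (λ x y z → W y x z) (λ x y z → W01 y x z)

      gain-forward : ∀ xs → Up xs → L₁ ℕ.≤ length xs →
        (∀ {i m j l} → i ∈ xs → m ∈ xs → j ∈ xs → l ∈ xs → i Fin.< m → m Fin.< j → j Fin.< l → Degrees.Rich P W τ₀ Δ i m j l) →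
        ∀ g → gain ≤ EL _≟ᴵ_ (law false) (all-items M) (total false) g
      gain-forward xs up le rich = Forward.Embedding.embed f τ₀ δ₀ 0<τ₀ 0<δ₀ xs (total false) (0≤total false) η 0<η
        (λ ys g s l (S₃ , S₅) → win false ys g (⊆-trans s xs⊆) l S₃ S₅)
        up (subst (ℕ._≤ length xs) (L₁-def M) le)
        (λ {i} {m} {j} {l} a b c e p q r → subst (λ D → Degrees.Rich P W τ₀ D i m j l) Δ-def (rich a b c e p q r))
        where
        xs⊆ : xs ⊆ allFin M
        xs⊆ = increasing-⊆ (λ {x} → up-irr {x = x}) (λ {x} {y} {z} → up-tr {x = x} {y} {z}) up (allFin-up M) (All.tabulate (λ {x} _ → ∈-allFin x))

      gain-backward : ∀ xs → Up xs → L₁ ℕ.≤ length xs →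
        (∀ {h i m j} → h ∈ xs → i ∈ xs → m ∈ xs → j ∈ xs → h Fin.< i → i Fin.< m → m Fin.< j → RichRev P W W01 τ₀ Δ h i m j) →
        ∀ g → gain ≤ EL _≟ᴵ_ (law true) (all-items M) (total true) g
      gain-backward xs up le rich = Backward.Embedding.embed f τ₀ δ₀ 0<τ₀ 0<δ₀ (reverse xs) (total true) (0≤total true) η 0<η
        (λ ys g s l (S₃ , S₅) → win true ys g (⊆-trans s (reverse⁺ xs⊆)) l S₃ S₅)
        (reverse-pairs xs up) (subst₂ ℕ._≤_ (L₁-def M) (sym (length-reverse xs)) le)
        (λ {i} {m} {j} {l} a b c e p q r → subst (λ D → Degrees.Rich (λ a b → P b a) (λ x y z → W y x z) τ₀ D i m j l) Δ-def
          (≤-trans (rich (∈-reverse xs e) (∈-reverse xs c) (∈-reverse xs b) (∈-reverse xs a) r q p)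
            (≡⇒≤ (𝔼-cong (P j i) (λ x → cong (λ y → 𝟙 (leqᵇ Δ y ∧ leqᵇ Δ (Degrees.deg-mid P W j i l x)))
              (𝔼-swap (P j m) (P m i) (λ k g → W k g x)))))))
        where
        xs⊆ : xs ⊆ allFin M
        xs⊆ = increasing-⊆ (λ {x} → up-irr {x = x}) (λ {x} {y} {z} → up-tr {x = x} {y} {z}) up (allFin-up M) (All.tabulate (λ {x} _ → ∈-allFin x))

      payoff : (∀ Qs → Up Qs → length Qs ≡ s₀ → (∀ {i j l} → i ∈ Qs → j ∈ Qs → l ∈ Qs → i Fin.< j → j Fin.< l → Degrees.density P W i j l < w₀) → ⊥) →
        ∀ g g' → gain ≤ EL _≟ᴵ_ (law false) (all-items M) (total false) g + EL _≟ᴵ_ (law true) (all-items M) (total true) g'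
      payoff ns g g' with Dichotomy.dichotomy f s₀ P W W01 ns
      ... | xs , up , le , inj₁ rich = ≤-trans (≡⇒≤ (sym (+-identityʳ _))) (+-mono-≤ (gain-forward xs up le rich g) (0≤EL _≟ᴵ_ (law true) (all-items M) (total true) (0≤total true) g'))
      ... | xs , up , le , inj₂ rich = ≤-trans (≡⇒≤ (sym (+-identityˡ _))) (+-mono-≤ (0≤EL _≟ᴵ_ (law false) (all-items M) (total false) (0≤total false) g) (gain-backward xs up le rich g'))

module StationaryEnergies where

  open Conditioning
  open Tuples
  open EdgeWeights
  open IndependentColours
  open Selection using (lsum; 𝔼-lsum)
  open ReducedStructures
  open PoorStructures
  open WeightedDensity using (edgeᵇ; edgeᵇ-swap₁; edgeᵇ-swap₂; cube)
  open VertexTypes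
  open SparseTypes
  open Patterns
  open Alternatives
  open import Data.Vec using (lookup)

  EL-lsum : ∀ {I Γ Z : Set} (_≟I_ : DecidableEquality I) (p : I → Ex Γ) is (Φ : Z → (I → Γ) → ℚ) zs g →
    EL _≟I_ p is (λ g → lsum (λ z → Φ z g) zs) g ≡ lsum (λ z → EL _≟I_ p is (Φ z) g) zs
  EL-lsum _≟I_ p [] Φ zs g = refl
  EL-lsum _≟I_ p (ι ∷ is) Φ zs g = trans (𝔼-cong (p ι) (λ γ → EL-lsum _≟I_ p is Φ zs (set _≟I_ g ι γ)))
    (𝔼-lsum (p ι) (λ z γ → EL _≟I_ p is (Φ z) (set _≟I_ g ι γ)) zs)

  private opaque
    unfolding -_
    distrib-len : ∀ l a b → l * a + b * a ≡ (l + b) * a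
    distrib-len = solve-∀ ℚ-ring
    neg-part : ∀ g s → 0ℚ - g * (1ℚ - s) ≡ g * (s - 1ℚ)
    neg-part = solve-∀ ℚ-ring
    part : ∀ g s → g - g * (1ℚ - s) ≡ g * s
    part = solve-∀ ℚ-ring
    move : ∀ a e w → (w + e) - a ≡ w - (a - e)
    move = solve-∀ ℚ-ring
    mono-diff : ∀ g s t → g * (1ℚ - s) - g * (1ℚ - t) ≡ g * (t - s)
    mono-diff = solve-∀ ℚ-ring

  module Core {f : ℕ} (F : Graph3 f) (ord : Permutation′ f) (ψ : Fin f → Fin f → Role)
    (coloured : ∀ i j k → i Fin.< j → j Fin.< k → IsEdge F (ord ⟨$⟩ʳ i) (ord ⟨$⟩ʳ j) (ord ⟨$⟩ʳ k) → RolePattern (ψ i j) (ψ j k) (ψ i k))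
    (s₀ : ℕ) where

    open Sizes f s₀
    open Payoff F ord ψ coloured s₀

    #t = #triples M
    #i = length (all-items M)
    #tests = fromℕ (length (tests false)) + fromℕ (length (tests true))

    module _ {n K k : ℕ} (E : Ex (Fin n)) (x₀ : Fin n) (faithful : Faithful E) (H : Graph3 n) (free : FFree F H)
      (c : Fin n → Fin n → Fin K) (dd : Fin n → Fin k) where

      open TypeStructure E x₀ faithful (edgeᵇ H) c dd
        using (W; W01; p; W̄; D; bad; bad-rare; volume; small; small-rare; c̃; module R₃; module EL₃; module CL₂)

      module _ (α : ℚ) (0<α : 0ℚ < α) (ξ : ℚ) (0≤ξ : 0ℚ ≤ ξ) (ξK : ξ * fromℕ K ≡ 1ℚ)
        (ι : ℚ) (0≤ι : 0ℚ ≤ ι) (rare : ∀ u → 𝔼 E (λ w → 𝟙 (eqᵇ u w)) ≤ ι)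
        (regular-c : ∀ (c' : Fin n → Fin n → Fin (EL₃.Replacement.K⁺ M K c)) → Ref₂ c' c → EL₃.NoGain α c c')
        (regular-d : ∀ (d' : Fin n → Fin (k ℕ.* (K ℕ.^ #t ℕ.* K ℕ.^ #t))) → (∀ a b → d' a ≡ d' b → dd a ≡ dd b) → CL₂.NoGain (α * α * ξ) dd d') where

        B : ℚ
        B = fromℕ M * (fromℕ M * ι) + fromℕ #t * α + fromℕ #i * α

        lawᵈ : Bool → (Fin M → Fin n) → Index M → Ex (Fin K)
        lawᵈ d x ι = p (dd (x (src d ι))) (dd (x (tgt d ι)))

        colours : Bool → (Fin M → Fin n) → Index M → Fin K
        colours d x ι = c (x (src d ι)) (x (tgt d ι))

        test-bound : ∀ d z → 𝔼 (pow E M) (λ x → EL _≟ᴵ_ (lawᵈ d (lookup x)) (all-items M) (Test.Ψ d z W W01) (colours d (lookup x))) ≤ B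
        test-bound d z = ≤-trans (R.decorrelate α ξ 0<α 0≤ξ ξK regular-d (all-items M)) (+-monoˡ-≤ (fromℕ #i * α)
            (≤-trans (≡⇒≤ (𝔼-cong (pow E M) (λ x → sym (Cnt.weights-Ψ (lookup x)))))
            (≤-trans (Rep.edges-to-weights α 0<α regular-c (s F ord ψ coloured d q m) (s-increasing F ord ψ coloured d q m))
              (+-monoˡ-≤ (fromℕ #t * α) (Cnt.count-bound ι 0≤ι rare)))))
          where
          q = sub-index {d = d} z
          m = sub-index-mono d z
          module Rep = EL₃.Replacement M K c
          module Cnt = Count F ord ψ coloured d q m E x₀ faithful H free c
          module R = CL₂.Resampling M dd _≟ᴵ_ (src d) (tgt d) (sel F ord ψ coloured d q m) (src-sel F ord ψ coloured d q m) (tgt-sel F ord ψ coloured d q m)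
            (λ g δ → Test.Ψ d z W W01 g) (λ g δ → Test.Ψ-01 d z W W01 g) (λ {g} {g'} e _ → Test.Ψ-cong d z W W01 {g} {g'} e)

        model : (Fin M → Fin n) → Fin M → Fin M → Ex (Fin K)
        model x a b = p (dd (x a)) (dd (x b))

        value : Bool → (Fin M → Fin n) → ℚ
        value d x = EL _≟ᴵ_ (lawᵈ d x) (all-items M) (total (model x) W W01 d) (colours d x)

        value-bound : ∀ d → 𝔼 (pow E M) (λ x → value d (lookup x)) ≤ fromℕ (length (tests d)) * B
        value-bound d = ≤-trans (≡⇒≤ (trans
            (𝔼-cong (pow E M) (λ x → EL-lsum _≟ᴵ_ (lawᵈ d (lookup x)) (all-items M) (λ z → Test.Ψ d z W W01) (tests d) (colours d (lookup x))))
            (𝔼-lsum (pow E M) (λ z x → EL _≟ᴵ_ (lawᵈ d (lookup x)) (all-items M) (Test.Ψ d z W W01) (colours d (lookup x))) (tests d))))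
          (lsum-upper B (tests d) (λ {z} _ → test-bound d z))

        values-bound : 𝔼 (pow E M) (λ x → value false (lookup x) + value true (lookup x)) ≤ #tests * B
        values-bound = ≤-trans (≡⇒≤ (𝔼-+ (pow E M) _ _)) (≤-trans (+-mono-≤ (value-bound false) (value-bound true)) (≡⇒≤ (distrib-len _ B _)))

        module _ (dᵣ error : ℚ) (dense : ∀ ω → In01 ω → dᵣ * cube (𝔼 E ω) ≤ 𝔼 E (λ a → 𝔼 E (λ b → 𝔼 E (λ e → 𝟙 (edgeᵇ H a b e) * (ω a * (ω b * ω e))))) + error)
          (ϑ : ℚ) (0<ϑ : 0ℚ < ϑ) (σ : ℚ) (0≤σ : 0ℚ ≤ σ) (σs₀ : σ * fromℕ s₀ ≡ 1ℚ)
          (strict : cube ϑ * ((w₀ + ε₀) + (σ + (σ + σ))) + error < dᵣ * cube ϑ) where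

          small-at : (Fin M → Fin n) → Fin M → Bool
          small-at x i = small ϑ (dd (x i))

          bad-at : (Fin M → Fin n) → Fin #t → Bool
          bad-at x t = does (tri₁ t FinP.<? tri₂ t) ∧ (does (tri₂ t FinP.<? tri₃ t) ∧ bad ε₀ (dd (x (tri₁ t))) (dd (x (tri₂ t))) (dd (x (tri₃ t))))

          smalls bads : (Fin M → Fin n) → ℚ
          smalls x = ∑ (λ i → 𝟙 (small-at x i))
          bads x = ∑ (λ t → 𝟙 (bad-at x t))

          0≤smalls : ∀ x → 0ℚ ≤ smalls x
          0≤smalls x = 0≤∑ (λ i → 0≤𝟙 _)
          0≤bads : ∀ x → 0ℚ ≤ bads x
          0≤bads x = 0≤∑ (λ t → 0≤𝟙 _)

          0≤value : ∀ d x → 0ℚ ≤ value d x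
          0≤value d x = 0≤EL _≟ᴵ_ (lawᵈ d x) (all-items M) (total (model x) W W01 d) (0≤total (model x) W W01 d) (colours d x)

          no-defects : ∀ x → (∀ i → small-at x i ≡ false) → (∀ t → bad-at x t ≡ false) → gain ≤ value false x + value true x
          no-defects x ns nb = payoff (model x) W W01 not-sparse (colours false x) (colours true x)
            where
            big : ∀ i → ϑ ≤ volume (dd (x i))
            big i = leqᵇ-sound (BoolP.not-injective (ns i))
            not-bad : ∀ {i j l} → i Fin.< j → j Fin.< l → D (dd (x i)) (dd (x j)) (dd (x l)) - ε₀ ≤ W̄ (dd (x i)) (dd (x j)) (dd (x l))
            not-bad {i} {j} {l} ij jl = leqᵇ-sound (BoolP.not-injective (trans (sym read) (nb (tri-index i j l))))
              where
              yes-true : ∀ {P : Set} (d : Dec P) → P → does d ≡ true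
              yes-true (yes _) _ = refl
              yes-true (no n) p = ⊥-elim (n p)
              read : bad-at x (tri-index i j l) ≡ bad ε₀ (dd (x i)) (dd (x j)) (dd (x l))
              read rewrite tri₁-index i j l | tri₂-index i j l | tri₃-index i j l | yes-true (i FinP.<? j) ij | yes-true (j FinP.<? l) jl = refl
            not-sparse : ∀ Qs → Up Qs → length Qs ≡ s₀ →
              (∀ {i j l} → i ∈ Qs → j ∈ Qs → l ∈ Qs → i Fin.< j → j Fin.< l → Degrees.density (model x) W i j l < w₀) → ⊥
            not-sparse Qs up len sparse = <-irrefl refl (<-≤-trans strict (SL.sparse-bound (λ i → dd (x i)) ϑ 0<ϑ big Qs σ 0≤σ
                (trans (cong (λ z → σ * fromℕ z) len) σs₀) up (w₀ + ε₀) (0≤+ (<⇒≤ 0<w₀) (<⇒≤ 0<ε₀))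
                (λ {i} {j} {l} a b e p q → 0≤-⇒≤ (subst (0ℚ ≤_) (sym (move _ ε₀ w₀))
                  (≤⇒0≤- (≤-trans (not-bad p q) (<⇒≤ (sparse a b e p q))))))))
              where module SL = SparseList E x₀ faithful (edgeᵇ H) (edgeᵇ-swap₁ H) (edgeᵇ-swap₂ H) c dd dᵣ error dense

          -- Either a defect makes the left-hand side nonpositive, or the reduced structure pays off.
          payoff-or-defect : ∀ x → gain * (1ℚ - (smalls x + bads x)) ≤ value false x + value true x
          payoff-or-defect x = go (FinP.any? (λ i → small-at x i BoolP.≟ true)) (FinP.any? (λ t → bad-at x t BoolP.≟ true))
            where
            vacuous : 1ℚ ≤ smalls x + bads x → gain * (1ℚ - (smalls x + bads x)) ≤ value false x + value true x
            vacuous p = ≤-trans (≤-cert _ (0≤* (<⇒≤ 0<gain) (≤⇒0≤- p)) (neg-part gain _)) (0≤+ (0≤value false x) (0≤value true x))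
            flip : ∀ b → ¬ b ≡ true → b ≡ false
            flip false _ = refl
            flip true n = ⊥-elim (n refl)
            go : Dec (Σ (Fin M) λ i → small-at x i ≡ true) → Dec (Σ (Fin #t) λ t → bad-at x t ≡ true) → gain * (1ℚ - (smalls x + bads x)) ≤ value false x + value true x
            go (yes (i , e)) _ = vacuous (subst (_≤ smalls x + bads x) (+-identityʳ 1ℚ)
              (+-mono-≤ (≤-trans (≡⇒≤ (cong 𝟙 (sym e))) (∑-term (λ i → 0≤𝟙 (small-at x i)) i)) (0≤bads x)))
            go (no _) (yes (t , e)) = vacuous (subst (_≤ smalls x + bads x) (+-identityˡ 1ℚ)
              (+-mono-≤ (0≤smalls x) (≤-trans (≡⇒≤ (cong 𝟙 (sym e))) (∑-term (λ t → 0≤𝟙 (bad-at x t)) t))))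
            go (no ns) (no nb) = ≤-trans (≤-cert _ (0≤* (<⇒≤ 0<gain) (0≤+ (0≤smalls x) (0≤bads x))) (part gain _))
              (no-defects x (λ i → flip _ (λ e → ns (i , e))) (λ t → flip _ (λ e → nb (t , e))))

          smalls-rare : 𝔼 (pow E M) (λ x → smalls (lookup x)) ≤ fromℕ M * (fromℕ k * ϑ)
          smalls-rare = ≤-trans (≡⇒≤ (𝔼-∑ (pow E M) (λ i x → 𝟙 (small-at (lookup x) i)))) (≤-trans (∑-mono each) (≡⇒≤ (∑-const M _)))
            where
            each : ∀ i → 𝔼 (pow E M) (λ x → 𝟙 (small-at (lookup x) i)) ≤ fromℕ k * ϑ
            each i = ≤-trans (≡⇒≤ (resample E i (λ x → 𝟙 (small-at (lookup x) i)))) (𝔼≤ (pow E M) (λ x → ≤-trans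
              (≡⇒≤ (𝔼-cong E (λ a → cong (λ v → 𝟙 (small ϑ (dd v))) (lookup∘update i x a)))) (small-rare ϑ (<⇒≤ 0<ϑ))))

          bads-rare : (∀ (d' : Fin n → Fin (R₃.k⁺ ε₀)) → (∀ a b → d' a ≡ d' b → dd a ≡ dd b) → CL₂.NoGain (α * α * ξ) dd d') →
            EL₃.NoGain α c c̃ → ε₀ * 𝔼 (pow E M) (λ x → bads (lookup x)) ≤ fromℕ #t * (α + fromℕ 3 * α)
          bads-rare regular₂ regular₃ = ≤-trans (≡⇒≤ (trans (cong (ε₀ *_) (𝔼-∑ (pow E M) (λ t x → 𝟙 (bad-at (lookup x) t)))) (sym (∑-* ε₀ _))))
              (≤-trans (∑-mono each) (≡⇒≤ (∑-const #t _)))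
            where
            0≤4α : 0ℚ ≤ α + fromℕ 3 * α
            0≤4α = 0≤+ (<⇒≤ 0<α) (0≤* (0≤fromℕ 3) (<⇒≤ 0<α))
            each : ∀ t → ε₀ * 𝔼 (pow E M) (λ x → 𝟙 (bad-at (lookup x) t)) ≤ α + fromℕ 3 * α
            each t = go (tri₁ t FinP.<? tri₂ t) (tri₂ t FinP.<? tri₃ t)
              where
              ev : Bool → Bool → (Fin M → Fin n) → ℚ
              ev b b' x = 𝟙 (b ∧ (b' ∧ bad ε₀ (dd (x (tri₁ t))) (dd (x (tri₂ t))) (dd (x (tri₃ t)))))
              zero-case : ∀ b b' → (∀ x → ev b b' x ≡ 0ℚ) → ε₀ * 𝔼 (pow E M) (λ x → ev b b' (lookup x)) ≤ α + fromℕ 3 * α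
              zero-case b b' z = ≤-trans (≡⇒≤ (trans (cong (ε₀ *_) (trans (𝔼-cong (pow E M) (λ x → z (lookup x))) (𝔼-const (pow E M) 0ℚ))) (*-zeroʳ ε₀))) 0≤4α
              go : (u : Dec (tri₁ t Fin.< tri₂ t)) (v : Dec (tri₂ t Fin.< tri₃ t)) → ε₀ * 𝔼 (pow E M) (λ x → ev (does u) (does v) (lookup x)) ≤ α + fromℕ 3 * α
              go (no _) v = zero-case false (does v) (λ _ → refl)
              go (yes _) (no _) = zero-case true false (λ _ → refl)
              go (yes ij) (yes jk) = ≤-trans (*-monoˡ (<⇒≤ 0<ε₀) (≤-trans (≡⇒≤ (resample₃ E (ev true true) ev-resp (tri₁ t) (tri₂ t) (tri₃ t)))
                  (𝔼≤ (pow E M) (λ x → ≡⇒≤ (𝔼-cong E (λ a → 𝔼-cong E (λ b → 𝔼-cong E (λ e → at (lookup x) a b e))))))))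
                  (bad-rare ε₀ α ξ 0<α 0≤ξ ξK regular₂ regular₃)
                where
                i = tri₁ t
                j = tri₂ t
                l = tri₃ t
                ev-resp : Respects (ev true true)
                ev-resp {g} {g'} e rewrite e i | e j | e l = refl
                i≢j : i ≢ j
                i≢j e = FinP.<-irrefl e ij
                j≢l : j ≢ l
                j≢l e = FinP.<-irrefl e jk
                i≢l : i ≢ l
                i≢l e = FinP.<-irrefl e (FinP.<-trans ij jk)
                at : ∀ g a b e → ev true true (upd (upd (upd g i a) j b) l e) ≡ 𝟙 (bad ε₀ (dd a) (dd b) (dd e))
                at g a b e = cong 𝟙 (bad-cong
                    (trans (upd-other _ e (λ q → i≢l (sym q))) (trans (upd-other _ b (λ q → i≢j (sym q))) (upd-same g i a)))
                    (trans (upd-other _ e (λ q → j≢l (sym q))) (upd-same _ j b)) (upd-same _ l e))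
                  where
                  bad-cong : ∀ {a a' b b' e e'} → a ≡ a' → b ≡ b' → e ≡ e' → bad ε₀ (dd a) (dd b) (dd e) ≡ bad ε₀ (dd a') (dd b') (dd e')
                  bad-cong refl refl refl = refl

          absurd : (∀ (d' : Fin n → Fin (R₃.k⁺ ε₀)) → (∀ a b → d' a ≡ d' b → dd a ≡ dd b) → CL₂.NoGain (α * α * ξ) dd d') →
            EL₃.NoGain α c c̃ → ∀ q → fromℕ M * (fromℕ k * ϑ) ≤ q → fromℕ #t * (α + fromℕ 3 * α) ≤ ε₀ * q →
            #tests * B < gain * (1ℚ - (q + q)) → ⊥
          absurd regular₂ regular₃ q S≤ T≤ total< = <-irrefl refl (<-≤-trans total< (≤-trans
              (≤-trans (≤-cert _ (0≤* (<⇒≤ 0<gain) (≤⇒0≤- (+-mono-≤ (≤-trans smalls-rare S≤) (*-cancel 0<ε₀ (≤-trans (bads-rare regular₂ regular₃) T≤)))))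
                 (mono-diff gain _ _)) (≡⇒≤ (sym expected)))
              (≤-trans (𝔼-mono (pow E M) (λ x → payoff-or-defect (lookup x))) values-bound)))
            where
            expected : 𝔼 (pow E M) (λ x → gain * (1ℚ - (smalls (lookup x) + bads (lookup x))))
              ≡ gain * (1ℚ - (𝔼 (pow E M) (λ x → smalls (lookup x)) + 𝔼 (pow E M) (λ x → bads (lookup x))))
            expected = trans (𝔼-* (pow E M) gain _) (cong (gain *_) (trans (𝔼-- (pow E M) (λ _ → 1ℚ) (λ x → smalls (lookup x) + bads (lookup x)))
              (cong₂ _-_ (𝔼-1 (pow E M)) (𝔼-+ (pow E M) (λ x → smalls (lookup x)) (λ x → bads (lookup x))))))

module EnergyIncrement where

  open Conditioning
  open Tuples using (#triples)
  open Archimedean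
  open EdgeWeights
  open IndependentColours
  open ReducedStructures
  open PoorStructures
  open WeightedDensity using (edgeᵇ; cube)
  open VertexTypes
  open Patterns
  open Alternatives hiding (base)
  open StationaryEnergies

  private opaque
    unfolding -_
    more : ∀ t a → (1ℚ + t) * a ≡ t * a + a
    more = solve-∀ ℚ-ring
    over : ∀ c b i → c * (b * i) ≡ b * ((1ℚ + c) * i) - b * i
    over = solve-∀ ℚ-ring
    thrice : ∀ σ → fromℕ 3 * σ ≡ σ + (σ + σ)
    thrice = solve-∀ ℚ-ring
    swap-right : ∀ r s i → r * s * i ≡ (r * i) * s
    swap-right = solve-∀ ℚ-ring
    test-total : ∀ T m t l ι α → T * (m * (m * ι) + t * α + l * α) ≡ (T * (m * m)) * ι + (T * (t + l)) * α
    test-total = solve-∀ ℚ-ring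
    four : ∀ t α → t * (α + fromℕ 3 * α) ≡ (t * fromℕ 4) * α
    four = solve-∀ ℚ-ring
    budget : ∀ θ w s → θ * (w + s) + θ * s ≡ θ * (w + (s + s))
    budget = solve-∀ ℚ-ring
    assoc³ : ∀ a b c → a * (b * c) ≡ (a * b) * c
    assoc³ = solve-∀ ℚ-ring

  opaque
    unfolding -_
    quarter : ℚ
    quarter = ½ * ½
    0<quarter : 0ℚ < quarter
    0<quarter = from-yes (0ℚ Q.<? quarter)
    quarter<1 : quarter < 1ℚ
    quarter<1 = from-yes (quarter Q.<? 1ℚ)
    quarters : 1ℚ - (quarter + quarter) ≡ quarter + quarter
    quarters = refl

  half-pos : ∀ {b} → 0ℚ < b → 0ℚ < b * quarter × b * quarter < b
  half-pos {b} p = 0<* p 0<quarter , l<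
    where opaque
            unfolding -_
            l< : b * quarter < b
            l< = subst (b * quarter <_) (*-identityʳ b) (QP.*-monoʳ-<-pos b {{Q.positive p}} quarter<1)

  min-pos : ∀ {a b} → 0ℚ < a → 0ℚ < b → Σ ℚ λ m → 0ℚ < m × m ≤ a × m ≤ b
  min-pos {a} {b} p q with ≤-total a b
  ... | inj₁ l = a , p , ≤-refl , l
  ... | inj₂ l = b , q , l , ≤-refl

  small-factor : ∀ {c b} → 0ℚ ≤ c → 0ℚ < b → Σ ℚ λ a → 0ℚ < a × c * a ≤ b
  small-factor {c} {b} 0≤c 0<b = b * i , 0<* 0<b 0<i ,
      ≤-trans (≡⇒≤ (trans (over c b i) (cong (λ z → b * z - b * i) (inv-r (1ℚ + c) 0<1+c))))
        (≤-cert (b * i) (<⇒≤ (0<* 0<b 0<i)) (drop b (b * i)))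
    where
    0<1+c : 0ℚ < 1ℚ + c
    0<1+c = <-≤-trans 0<1 (≤-trans (≡⇒≤ (sym (+-identityʳ 1ℚ))) (+-monoʳ-≤ 1ℚ 0≤c))
    i = inv (1ℚ + c) 0<1+c
    0<i = inv-pos (1ℚ + c) 0<1+c
    opaque
      unfolding -_
      drop : ∀ b x → b - (b * 1ℚ - x) ≡ x
      drop = solve-∀ ℚ-ring

  shrink : ∀ {c a a'} → 0ℚ ≤ c → a' ≤ a → ∀ {b} → c * a ≤ b → c * a' ≤ b
  shrink 0≤c l p = ≤-trans (*-monoˡ 0≤c l) p

  module _ {X : Set} (E : Ex X) (x₀ : X) (faithful : Faithful E) where

    energy₁-01 : ∀ {k} (C : X → Fin k) {h} → In01 h → 0ℚ ≤ energy₁ E x₀ faithful C h × energy₁ E x₀ faithful C h ≤ 1ℚ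
    energy₁-01 C {h} p = 0≤𝔼 E (λ x → 0≤² _) , 𝔼≤ E (λ x → let (l , u) = cexp-01 E x₀ faithful C p (C x) in
      ≤-trans (*-mono-≤ l u l u) (≡⇒≤ (*-identityˡ 1ℚ)))

  module Loop {f : ℕ} (F : Graph3 f) (ord : Permutation′ f) (ψ : Fin f → Fin f → Role)
    (coloured : ∀ i j k → i Fin.< j → j Fin.< k → IsEdge F (ord ⟨$⟩ʳ i) (ord ⟨$⟩ʳ j) (ord ⟨$⟩ʳ k) → RolePattern (ψ i j) (ψ j k) (ψ i k))
    (dᵣ : ℚ) (1/5≤d : fifth ≤ dᵣ) where

    R₀ : ℕ
    R₀ = proj₁ (archimedean (fromℕ 3) 0<slack)

    opaque
      s₀ : ℕ
      s₀ = suc R₀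

      0<s₀ : 0ℚ < fromℕ s₀
      0<s₀ = 0<fromℕ R₀

      R₀≤s₀ : fromℕ R₀ ≤ fromℕ s₀
      R₀≤s₀ = fromℕ-mono (ℕP.n≤1+n R₀)

    σ : ℚ
    σ = inv (fromℕ s₀) 0<s₀

    0≤σ : 0ℚ ≤ σ
    0≤σ = <⇒≤ (inv-pos (fromℕ s₀) 0<s₀)

    σs₀ : σ * fromℕ s₀ ≡ 1ℚ
    σs₀ = trans (*-comm σ _) (inv-r (fromℕ s₀) 0<s₀)

    3σ≤slack : σ + (σ + σ) ≤ slack
    3σ≤slack = ≤-trans (≡⇒≤ (sym (thrice σ))) (≤-trans (*-monoʳ 0≤σ (≤-trans (proj₂ (archimedean (fromℕ 3) 0<slack)) (*-monoʳ (<⇒≤ 0<slack) R₀≤s₀)))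
      (≡⇒≤ (trans (swap-right (fromℕ s₀) slack σ) (trans (cong (_* slack) (inv-r (fromℕ s₀) 0<s₀)) (*-identityˡ slack)))))

    open Core F ord ψ coloured s₀
    open Sizes f s₀
    open Payoff F ord ψ coloured s₀ using (gain; 0<gain; tests)

    0≤#tests : 0ℚ ≤ #tests
    0≤#tests = 0≤+ (0≤fromℕ (length (tests false))) (0≤fromℕ (length (tests true)))

    choose-α : Σ ℚ λ α → 0ℚ < α × fromℕ #t * (α + fromℕ 3 * α) ≤ ε₀ * quarter × #tests * (fromℕ #t + fromℕ #i) * α ≤ gain * quarter
    choose-α = common (small-factor 0≤t (0<* 0<ε₀ 0<quarter)) (small-factor 0≤T (0<* 0<gain 0<quarter))
      where
      0≤t : 0ℚ ≤ fromℕ #t * fromℕ 4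
      0≤t = 0≤* (0≤fromℕ #t) (0≤fromℕ 4)
      0≤T : 0ℚ ≤ #tests * (fromℕ #t + fromℕ #i)
      0≤T = 0≤* 0≤#tests (0≤+ (0≤fromℕ #t) (0≤fromℕ #i))
      common : ∀ {b b'} → (Σ ℚ λ α → 0ℚ < α × (fromℕ #t * fromℕ 4) * α ≤ b) → (Σ ℚ λ α → 0ℚ < α × #tests * (fromℕ #t + fromℕ #i) * α ≤ b') →
        Σ ℚ λ α → 0ℚ < α × fromℕ #t * (α + fromℕ 3 * α) ≤ b × #tests * (fromℕ #t + fromℕ #i) * α ≤ b'
      common (α₁ , p₁ , q₁) (α₂ , p₂ , q₂) = let (α , p , l₁ , l₂) = min-pos p₁ p₂ in
        α , p , ≤-trans (≡⇒≤ (four _ α)) (shrink 0≤t l₁ q₁) , shrink 0≤T l₂ q₂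

    opaque
      α : ℚ
      α = proj₁ choose-α
      0<α : 0ℚ < α
      0<α = proj₁ (proj₂ choose-α)
      α-bads : fromℕ #t * (α + fromℕ 3 * α) ≤ ε₀ * quarter
      α-bads = proj₁ (proj₂ (proj₂ choose-α))
      α-tests : #tests * (fromℕ #t + fromℕ #i) * α ≤ gain * quarter
      α-tests = proj₂ (proj₂ (proj₂ choose-α))

    ι : ℕ → ℚ
    ι n' = inv (fromℕ (suc n')) (0<fromℕ n')

    record Regime (e : ℚ) {n' : ℕ} (H : Graph3 (suc n')) : Set where
      field
        free : FFree F H
        large : ι n' ≤ e
        dense : ∀ ω → In01 ω → dᵣ * cube (𝔼 (uniform n') ω)
          ≤ 𝔼 (uniform n') (λ a → 𝔼 (uniform n') (λ b → 𝔼 (uniform n') (λ e → 𝟙 (edgeᵇ H a b e) * (ω a * (ω b * ω e))))) + fromℕ 9 * e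

    open Regime

    weaken : ∀ {e e'} → e ≤ e' → ∀ {n'} {H : Graph3 (suc n')} → Regime e H → Regime e' H
    weaken l r = record { free = free r ; large = ≤-trans (large r) l
      ; dense = λ ω p → ≤-trans (dense r ω p) (+-monoʳ-≤ _ (*-monoˡ (0≤fromℕ 9) l)) }

    edge-energy : ∀ {n' K} (H : Graph3 (suc n')) → (Fin (suc n') → Fin (suc n') → Fin K) → ℚ
    edge-energy {n'} H c = Edge-level.energy (uniform n') zero (Faithful-uniform n') (edgeᵇ H) c

    colour-energy : ∀ {n' K k} → (Fin (suc n') → Fin (suc n') → Fin K) → (Fin (suc n') → Fin k) → ℚ
    colour-energy {n'} c dd = Colour-level.energy (uniform n') zero (Faithful-uniform n') c dd

    EdgeBound : ℕ → ℕ → ℚ → Set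
    EdgeBound t K e = ∀ {n'} (H : Graph3 (suc n')) → Regime e H → ∀ (c : Fin (suc n') → Fin (suc n') → Fin K) →
      fromℕ t * (α * α) ≤ edge-energy H c → ⊥

    ColourBound : ℕ → ℕ → ℚ → ℕ → ℕ → ℚ → Set
    ColourBound t K ξ u k e = ∀ {n'} (H : Graph3 (suc n')) → Regime e H → ∀ (c : Fin (suc n') → Fin (suc n') → Fin K) →
      fromℕ t * (α * α) ≤ edge-energy H c → ∀ (dd : Fin (suc n') → Fin k) →
      fromℕ u * (α * α * ξ) ≤ colour-energy c dd → ⊥

    Eventually : (ℚ → Set) → Set
    Eventually P = Σ ℚ λ e → 0ℚ < e × P e

    0<α² : 0ℚ < α * α
    0<α² = 0<* 0<α 0<α

    edge-weaken : ∀ t K {e e'} → e' ≤ e → EdgeBound t K e → EdgeBound t K e'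
    edge-weaken t K l b H r = b H (weaken l r)

    colour-weaken : ∀ t K ξ u k {e e'} → e' ≤ e → ColourBound t K ξ u k e → ColourBound t K ξ u k e'
    colour-weaken t K ξ u k l b H r = b H (weaken l r)

    K⁺ : ℕ → ℕ
    K⁺ K = (2 ℕ.* K) ℕ.^ #t ℕ.* ((2 ℕ.* K) ℕ.^ #t ℕ.* (2 ℕ.* K) ℕ.^ #t)

    k⁺ : ℕ → ℕ → ℕ → ℕ
    k⁺ T K k = k ℕ.* (K ℕ.^ T ℕ.* K ℕ.^ T)

    -- A class size ϑ and an error e that suffice once both energies are stationary.
    Parameters : ℕ → ℚ → Set
    Parameters k e = Σ ℚ λ ϑ → 0ℚ < ϑ × fromℕ M * (fromℕ k * ϑ) ≤ quarter
        × fromℕ 9 * e ≤ cube ϑ * slack * quarter × #tests * (fromℕ M * fromℕ M) * e ≤ gain * quarter * quarter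

    parameters : ∀ k → Eventually (Parameters k)
    parameters k = choose (small-factor (0≤* (0≤fromℕ M) (0≤fromℕ k)) 0<quarter)
      where
      0≤T : 0ℚ ≤ #tests * (fromℕ M * fromℕ M)
      0≤T = 0≤* 0≤#tests (0≤* (0≤fromℕ M) (0≤fromℕ M))
      choose : (Σ ℚ λ ϑ → 0ℚ < ϑ × (fromℕ M * fromℕ k) * ϑ ≤ quarter) → Eventually (Parameters k)
      choose (ϑ , 0<ϑ , p) = common (small-factor (0≤fromℕ 9) (0<* (0<* (0<* 0<ϑ (0<* 0<ϑ 0<ϑ)) 0<slack) 0<quarter)) (small-factor 0≤T (0<* (0<* 0<gain 0<quarter) 0<quarter))
        where
        common : (Σ ℚ λ e → 0ℚ < e × fromℕ 9 * e ≤ cube ϑ * slack * quarter) → (Σ ℚ λ e → 0ℚ < e × #tests * (fromℕ M * fromℕ M) * e ≤ gain * quarter * quarter) → Eventually (Parameters k)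
        common (e₁ , p₁ , q₁) (e₂ , p₂ , q₂) = let (e , pe , l₁ , l₂) = min-pos p₁ p₂ in
          e , pe , ϑ , 0<ϑ , ≤-trans (≡⇒≤ (assoc³ _ _ ϑ)) p , shrink (0≤fromℕ 9) l₁ q₁ , shrink 0≤T l₂ q₂

    rare-vertex : ∀ n' (u : Fin (suc n')) → 𝔼 (uniform n') (λ w → 𝟙 (eqᵇ u w)) ≤ ι n'
    rare-vertex n' u = ≤-trans (≡⇒≤ (trans (𝔼-uniform n' _) (cong (ι n' *_)
      (trans (∑-cong (λ w → sym (*-identityˡ _))) (∑-δ (λ _ → 1ℚ) u))))) (≡⇒≤ (*-identityʳ _))

    no-increment : ∀ t {a} x y → fromℕ t * a ≤ x → (fromℕ (suc t) * a ≤ y → ⊥) → y ≤ x + a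
    no-increment t {a} x y p h = go (y ≤? x + a)
      where
      go : Dec (y ≤ x + a) → y ≤ x + a
      go (yes q) = q
      go (no n) = ⊥-elim (h (≤-trans (≡⇒≤ (more (fromℕ t) a)) (≤-trans (+-monoˡ-≤ a p) (<⇒≤ (≰⇒> n)))))

    stationary : ∀ K ξ → 0ℚ < ξ → ξ * fromℕ K ≡ 1ℚ → ∀ t u k e → Parameters k e →
      EdgeBound (suc t) (K⁺ K) e → EdgeBound (suc t) (K ℕ.* (k ℕ.* k)) e →
      ColourBound t K ξ (suc u) (k⁺ #t K k) e → ColourBound t K ξ (suc u) (k⁺ (#triples 3) K k) e → ColourBound t K ξ u k e
    stationary K ξ 0<ξ ξK t u k e (ϑ , 0<ϑ , small , err , cnt) b₁ b₂ b₃ b₄ {n'} H r c en dd en' =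
        absurd (uniform n') zero (Faithful-uniform n') H (free r) c dd α 0<α ξ (<⇒≤ 0<ξ) ξK (ι n') (<⇒≤ (inv-pos _ (0<fromℕ n'))) (rare-vertex n')
          (λ c' ref → no-increment t (edge-energy H c) (edge-energy H c') en (b₁ H r c'))
          (λ d' ref → no-increment u (colour-energy c dd) (colour-energy c d') en' (b₃ H r c en d'))
          dᵣ (fromℕ 9 * e) (dense r) ϑ 0<ϑ σ 0≤σ σs₀ strict
          (λ d' ref → no-increment u (colour-energy c dd) (colour-energy c d') en' (b₄ H r c en d'))
          (no-increment t (edge-energy H c) (edge-energy H pairs) en (b₂ H r pairs))
          quarter small α-bads few
      where
      pairs = TypeStructure.c̃ (uniform n') zero (Faithful-uniform n') (edgeᵇ H) c dd
      0<ϑ³ : 0ℚ < cube ϑ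
      0<ϑ³ = 0<* 0<ϑ (0<* 0<ϑ 0<ϑ)
      strict : cube ϑ * ((w₀ + ε₀) + (σ + (σ + σ))) + fromℕ 9 * e < dᵣ * cube ϑ
      strict = <-≤-trans (+-mono-≤-< (*-monoˡ (<⇒≤ 0<ϑ³) (+-monoʳ-≤ (w₀ + ε₀) 3σ≤slack))
          (≤-<-trans err (proj₂ (half-pos (0<* 0<ϑ³ 0<slack)))))
        (≤-trans (≡⇒≤ (trans (budget (cube ϑ) (w₀ + ε₀) slack) (trans (cong (cube ϑ *_) (sym fifth-splits)) (*-comm _ fifth)))) (*-monoʳ (<⇒≤ 0<ϑ³) 1/5≤d))
      few : #tests * (fromℕ M * (fromℕ M * ι n') + fromℕ #t * α + fromℕ #i * α) < gain * (1ℚ - (quarter + quarter))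
      few = subst₂ _<_ (sym (test-total #tests (fromℕ M) (fromℕ #t) (fromℕ #i) (ι n') α))
        (trans (sym (*-distribˡ-+ gain quarter quarter)) (cong (gain *_) (sym quarters)))
        (+-mono-<-≤ (≤-<-trans (shrink (0≤* 0≤#tests (0≤* (0≤fromℕ M) (0≤fromℕ M))) (large r) cnt) (proj₂ (half-pos (0<* 0<gain 0<quarter)))) α-tests)

    edge-energy-01 : ∀ {n' K} (H : Graph3 (suc n')) (c : Fin (suc n') → Fin (suc n') → Fin K) → 0ℚ ≤ edge-energy H c × edge-energy H c ≤ 1ℚ
    edge-energy-01 {n'} H c = energy₁-01 E₃ (zero , zero , zero) faithful₃ (C₃ c) h01
      where open Edge-level (uniform n') zero (Faithful-uniform n') (edgeᵇ H)

    0≤colour-energy : ∀ {n' K k} (c : Fin (suc n') → Fin (suc n') → Fin K) (dd : Fin (suc n') → Fin k) → 0ℚ ≤ colour-energy c dd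
    0≤colour-energy {n'} c dd = 0≤∑ (λ γ → proj₁ (energy₁-01 E₂ (zero , zero) faithful₂ (C₂ dd) (colour-01 γ)))
      where open Colour-level (uniform n') zero (Faithful-uniform n') c

    colour-energy≤ : ∀ {n' K k} (c : Fin (suc n') → Fin (suc n') → Fin K) (dd : Fin (suc n') → Fin k) → colour-energy c dd ≤ fromℕ K
    colour-energy≤ {n'} {K} c dd = ≤-trans (∑-mono (λ γ → proj₂ (energy₁-01 E₂ (zero , zero) faithful₂ (C₂ dd) (colour-01 γ))))
        (≡⇒≤ (trans (∑-const K 1ℚ) (*-identityʳ (fromℕ K))))
      where open Colour-level (uniform n') zero (Faithful-uniform n') c

    beyond : ∀ {a b x} → a + 1ℚ ≤ b → b ≤ x → x ≤ a → ⊥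
    beyond {a} p q r = <-irrefl refl (<-≤-trans (subst (_< a + 1ℚ) (+-identityʳ a) (+-mono-≤-< ≤-refl 0<1)) (≤-trans p (≤-trans q r)))

    descend : ∀ {P : ℕ → Set} → (∀ u → P (suc u) → P u) → ∀ u → P u → P 0
    descend f zero p = p
    descend f (suc u) p = descend f u (f u p)

    both : ∀ {P Q : ℚ → Set} → (∀ {e e'} → e' ≤ e → P e → P e') → (∀ {e e'} → e' ≤ e → Q e → Q e') →
      Eventually P → Eventually Q → Eventually (λ e → P e × Q e)
    both f g (e₁ , p₁ , b₁) (e₂ , p₂ , b₂) = let (e , p , l₁ , l₂) = min-pos p₁ p₂ in e , p , f l₁ b₁ , g l₂ b₂

    parameters-weaken : ∀ k {e e'} → e' ≤ e → Parameters k e → Parameters k e'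
    parameters-weaken k l (ϑ , p , q , r , s) = ϑ , p , q , shrink (0≤fromℕ 9) l r , shrink (0≤* 0≤#tests (0≤* (0≤fromℕ M) (0≤fromℕ M))) l s

    colour-loop : ∀ K ξ → 0ℚ < ξ → ξ * fromℕ K ≡ 1ℚ → ∀ t → (∀ K → Eventually (EdgeBound (suc t) K)) → ∀ k → Eventually (ColourBound t K ξ 0 k)
    colour-loop K ξ 0<ξ ξK t outer = descend {λ u → ∀ k → Eventually (ColourBound t K ξ u k)} step (proj₁ enough) base
      where
      enough : Σ ℕ λ u → fromℕ K + 1ℚ ≤ fromℕ u * (α * α * ξ)
      enough = archimedean (fromℕ K + 1ℚ) (0<* 0<α² 0<ξ)
      base : ∀ k → Eventually (ColourBound t K ξ (proj₁ enough) k)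
      base k = 1ℚ , 0<1 , λ H r c en dd en' → beyond (proj₂ enough) en' (colour-energy≤ c dd)
      step : ∀ u → (∀ k → Eventually (ColourBound t K ξ (suc u) k)) → ∀ k → Eventually (ColourBound t K ξ u k)
      step u rec k = conclude (both {P} {Q} (parameters-weaken k) (λ l (b , b') → weaken₁ l b , weaken₂ l b')
          (parameters k)
          (both {Q₁} {Q₂} weaken₁ weaken₂
            (both {EdgeBound (suc t) (K⁺ K)} {EdgeBound (suc t) (K ℕ.* (k ℕ.* k))} (edge-weaken (suc t) (K⁺ K)) (edge-weaken (suc t) (K ℕ.* (k ℕ.* k))) (outer (K⁺ K)) (outer (K ℕ.* (k ℕ.* k))))
            (both {ColourBound t K ξ (suc u) (k⁺ #t K k)} {ColourBound t K ξ (suc u) (k⁺ (#triples 3) K k)} (colour-weaken t K ξ (suc u) (k⁺ #t K k)) (colour-weaken t K ξ (suc u) (k⁺ (#triples 3) K k)) (rec (k⁺ #t K k)) (rec (k⁺ (#triples 3) K k)))))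
        where
        P Q₁ Q₂ Q : ℚ → Set
        P = Parameters k
        Q₁ e = EdgeBound (suc t) (K⁺ K) e × EdgeBound (suc t) (K ℕ.* (k ℕ.* k)) e
        Q₂ e = ColourBound t K ξ (suc u) (k⁺ #t K k) e × ColourBound t K ξ (suc u) (k⁺ (#triples 3) K k) e
        Q e = Q₁ e × Q₂ e
        weaken₁ : ∀ {e e'} → e' ≤ e → Q₁ e → Q₁ e'
        weaken₁ l (b₁ , b₂) = edge-weaken (suc t) (K⁺ K) l b₁ , edge-weaken (suc t) (K ℕ.* (k ℕ.* k)) l b₂
        weaken₂ : ∀ {e e'} → e' ≤ e → Q₂ e → Q₂ e'
        weaken₂ l (b₃ , b₄) = colour-weaken t K ξ (suc u) (k⁺ #t K k) l b₃ , colour-weaken t K ξ (suc u) (k⁺ (#triples 3) K k) l b₄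
        conclude : Eventually (λ e → P e × Q e) → Eventually (ColourBound t K ξ u k)
        conclude (e , pe , ps , (b₁ , b₂) , (b₃ , b₄)) = e , pe , stationary K ξ 0<ξ ξK t u k e ps b₁ b₂ b₃ b₄

    edge-loop : ∀ K → Eventually (EdgeBound 0 K)
    edge-loop = descend {λ t → ∀ K → Eventually (EdgeBound t K)} step (proj₁ enough) base
      where
      enough : Σ ℕ λ t → 1ℚ + 1ℚ ≤ fromℕ t * (α * α)
      enough = archimedean (1ℚ + 1ℚ) 0<α²
      base : ∀ K → Eventually (EdgeBound (proj₁ enough) K)
      base K = 1ℚ , 0<1 , λ H r c en → beyond (proj₂ enough) en (proj₂ (edge-energy-01 H c))
      no-colours : Fin 0 → ⊥
      no-colours ()
      step : ∀ t → (∀ K → Eventually (EdgeBound (suc t) K)) → ∀ K → Eventually (EdgeBound t K)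
      step t outer zero = 1ℚ , 0<1 , λ H r c en → no-colours (c zero zero)
      step t outer (suc K) = trivial-types (colour-loop (suc K) ξ (inv-pos _ (0<fromℕ K)) (trans (*-comm ξ _) (inv-r _ (0<fromℕ K))) t outer 1)
        where
        ξ = inv (fromℕ (suc K)) (0<fromℕ K)
        trivial-types : Eventually (ColourBound t (suc K) ξ 0 1) → Eventually (EdgeBound t (suc K))
        trivial-types (e , p , b) = e , p , λ {n'} H r c en → b H r c en (λ _ → zero)
          (≤-trans (≡⇒≤ (*-zeroˡ (α * α * ξ))) (0≤colour-energy {n'} {suc K} {1} c (λ _ → zero)))

    no-regime : Eventually (λ e → ∀ {n'} (H : Graph3 (suc n')) → Regime e H → ⊥)
    no-regime = conclude (edge-loop 1)
      where
      conclude : Eventually (EdgeBound 0 1) → Eventually (λ e → ∀ {n'} (H : Graph3 (suc n')) → Regime e H → ⊥)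
      conclude (e , p , b) = e , p , λ {n'} H r → b H r (λ _ _ → zero) (≤-trans (≡⇒≤ (*-zeroˡ (α * α))) (proj₁ (edge-energy-01 {n'} {1} H (λ _ _ → zero))))

open Archimedean
open ReducedStructures using (Role; rβ; rν; rρ; rκ; rγ)
open PoorStructures using (fifth)
open WeightedDensity
open Patterns using (RolePattern)
open EnergyIncrement
open import Data.Integer using (+_)

private opaque
  unfolding -_
  nine : ∀ e → fromℕ 6 * e + fromℕ 3 * e ≡ fromℕ 9 * e
  nine = solve-∀ ℚ-ring

opaque
  unfolding fifth

  -- For d ≤ 1/5 one has (2 - d)³ ≥ 5.832 > 5.4 ≥ 27 d.
  fifth≤ : ∀ d → AboveDStar d → fifth ≤ d
  fifth≤ d above = ≮⇒≥ (λ d<fifth → <-irrefl refl (<-≤-trans above (below (<⇒≤ d<fifth))))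
    where
    b : ℚ
    b = toℚ 2 - fifth
    0≤b : 0ℚ ≤ b
    0≤b = from-yes (0ℚ ≤? b)
    below : d ≤ fifth → toℚ 27 * d ≤ (toℚ 2 - d) * (toℚ 2 - d) * (toℚ 2 - d)
    below d≤ = ≤-trans (*-monoˡ (from-yes (0ℚ ≤? toℚ 27)) d≤) (≤-trans (from-yes (toℚ 27 * fifth ≤? b * b * b))
        (*-mono-≤ (0≤* 0≤b 0≤b) (*-mono-≤ 0≤b b≤ 0≤b b≤) 0≤b b≤))
      where b≤ : b ≤ toℚ 2 - d
            b≤ = +-monoʳ-≤ (toℚ 2) (neg-antimono-≤ d≤)

module _ {f : ℕ} (F : Graph3 f) (ord : Permutation′ f) (ψ : Fin f → Fin f → Role)
  (coloured : ∀ i j k → i Fin.< j → j Fin.< k → IsEdge F (ord ⟨$⟩ʳ i) (ord ⟨$⟩ʳ j) (ord ⟨$⟩ʳ k) → RolePattern (ψ i j) (ψ j k) (ψ i k)) where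

  coloured⇒¬admissible : ∀ d → 0ℚ ≤ d → d ≤ 1ℚ → fifth ≤ d → ¬ Admissible F d
  coloured⇒¬admissible d 0≤d d≤1 1/5≤d adm = refute (L.no-regime)
    where
    module L = Loop F ord ψ coloured d 1/5≤d
    refute : L.Eventually (λ e → ∀ {n'} (H : Graph3 (suc n')) → L.Regime e H → ⊥) → ⊥
    refute (e , 0<e , none) = found (adm e 0<e (suc (proj₁ enough)))
      where
      enough : Σ ℕ λ R → 1ℚ ≤ fromℕ R * e
      enough = archimedean 1ℚ 0<e
      found : (Σ ℕ λ n → suc (proj₁ enough) ℕ.≤ n × Σ (Graph3 n) λ H → FFree F H × Dense d e H) → ⊥
      found (suc n' , ℕ.s≤s big , H , free , dense) = none H (record { free = free ; large = large
          ; dense = λ ω p → ≤-trans (Weighted.dense-weighted H d e 0≤d d≤1 dense ω p) (+-monoʳ-≤ _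
              (≤-trans (+-monoʳ-≤ (fromℕ 6 * e) (*-monoˡ (0≤fromℕ 3) large)) (≡⇒≤ (nine e)))) })
        where
        large : inv (fromℕ (suc n')) (0<fromℕ n') ≤ e
        large = *-cancel (0<fromℕ n') (≤-trans (≡⇒≤ (inv-r (fromℕ (suc n')) (0<fromℕ n')))
          (≤-trans (proj₂ enough) (*-monoʳ (<⇒≤ 0<e) (fromℕ-mono (ℕP.m≤n⇒m≤1+n big)))))

-- The roles of the colours when the edges of one of the three classes are missing.
role : Fin 3 → Colour → Role
role zero green = rβ
role zero cyan = rν
role zero black = rν
role zero _ = rρ
role (suc zero) blue = rβ
role (suc zero) green = rβ
role (suc zero) violet = rν
role (suc zero) black = rν
role (suc zero) _ = rρ
role (suc (suc zero)) blue = rβ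
role (suc (suc zero)) violet = rν
role (suc (suc zero)) green = rγ
role (suc (suc zero)) cyan = rκ
role (suc (suc zero)) _ = rρ

module _ {f : ℕ} (F : Graph3 f) (ord : Permutation′ f) (istar : ℕ) (χ : Fin f → Fin f → Colour)
  (spade : ∀ (i j k : Fin f) → i Fin.< j → j Fin.< k → IsEdge F (ord ⟨$⟩ʳ i) (ord ⟨$⟩ʳ j) (ord ⟨$⟩ʳ k) →
    ExactlyOne (CondA ord istar χ i j k) (CondB ord istar χ i j k) (CondC ord istar χ i j k)) where

  Placed : Fin f → Fin f → Fin f → Set
  Placed i j k = i Fin.< j × j Fin.< k × IsEdge F (ord ⟨$⟩ʳ i) (ord ⟨$⟩ʳ j) (ord ⟨$⟩ʳ k)

  placed? : ∀ i j k → Dec (Placed i j k)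
  placed? i j k = (i FinP.<? j) ×-dec ((j FinP.<? k) ×-dec isEdge? F _ _ _)

  class-of : ∀ {i j k} → Placed i j k → Σ (Fin 3) λ t → Cond ord istar χ t i j k
  class-of {i} {j} {k} (ij , jk , e) with spade i j k ij jk e
  ... | inj₁ (a , _) = zero , a
  ... | inj₂ (inj₁ (_ , b , _)) = suc zero , b
  ... | inj₂ (inj₂ (_ , _ , c)) = suc (suc zero) , c

  class : Fin f → Fin f → Fin f → Fin 3
  class i j k with placed? i j k
  ... | yes p = proj₁ (class-of p)
  ... | no _ = zero

  class-sound : ∀ i j k → Placed i j k → Cond ord istar χ (class i j k) i j k
  class-sound i j k p with placed? i j k
  ... | yes q = proj₂ (class-of q)
  ... | no n = ⊥-elim (n p)

  Inhabited : Fin 3 → Set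
  Inhabited t = Σ (Fin f) λ i → Σ (Fin f) λ j → Σ (Fin f) λ k → Placed i j k × class i j k ≡ t

  inhabited? : ∀ t → Dec (Inhabited t)
  inhabited? t = FinP.any? (λ i → FinP.any? (λ j → FinP.any? (λ k → placed? i j k ×-dec (class i j k FinP.≟ t))))

  roles-of-missing : ∀ t → ¬ Inhabited t → ∀ i j k → i Fin.< j → j Fin.< k → IsEdge F (ord ⟨$⟩ʳ i) (ord ⟨$⟩ʳ j) (ord ⟨$⟩ʳ k) →
    RolePattern (role t (χ (ord ⟨$⟩ʳ i) (ord ⟨$⟩ʳ j))) (role t (χ (ord ⟨$⟩ʳ j) (ord ⟨$⟩ʳ k))) (role t (χ (ord ⟨$⟩ʳ i) (ord ⟨$⟩ʳ k)))
  roles-of-missing t missing i j k ij jk e = go t (class i j k) (λ eq → missing (i , j , k , (ij , jk , e) , eq)) (class-sound i j k (ij , jk , e))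
    where
    go : ∀ t u → u ≢ t → Cond ord istar χ u i j k →
      RolePattern (role t (χ (ord ⟨$⟩ʳ i) (ord ⟨$⟩ʳ j))) (role t (χ (ord ⟨$⟩ʳ j) (ord ⟨$⟩ʳ k))) (role t (χ (ord ⟨$⟩ʳ i) (ord ⟨$⟩ʳ k)))
    go zero zero ne _ = ⊥-elim (ne refl)
    go (suc zero) zero ne (p , q , r) rewrite p | q | r = inj₁ (refl , refl , refl)
    go (suc (suc zero)) zero ne (p , q , r) rewrite p | q | r = inj₁ (refl , refl , refl)
    go zero (suc zero) ne ((p , q , r) , _) rewrite p | q | r = inj₁ (refl , refl , refl)
    go (suc zero) (suc zero) ne _ = ⊥-elim (ne refl)
    go (suc (suc zero)) (suc zero) ne ((p , q , r) , _) rewrite p | q | r = inj₂ (refl , refl , refl)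
    go zero (suc (suc zero)) ne ((p , q , r) , _) rewrite p | q | r = inj₁ (refl , refl , refl)
    go (suc zero) (suc (suc zero)) ne ((p , q , r) , _) rewrite p | q | r = inj₁ (refl , refl , refl)
    go (suc (suc zero)) (suc (suc zero)) ne _ = ⊥-elim (ne refl)

  missing-class : 1 ℕ.≤ istar → istar ℕ.≤ f → ¬ SpadeStar F → Σ (Fin 3) λ t → ¬ Inhabited t
  missing-class l u ¬star = FinP.¬∀⟶∃¬ 3 Inhabited inhabited? (λ all → ¬star
    (ord , istar , l , u , χ , class , (λ i j k ij jk e → class-sound i j k (ij , jk , e)) ,
      (λ t → let (i , j , k , (ij , jk , e) , eq) = all t in i , j , k , ij , jk , e , eq)))

theorem6p2 : ∀ (f : ℕ) (F : Graph3 f) → Spade F → ¬ SpadeStar F →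
    ∀ (d : ℚ) → 0ℚ ≤ d → d ≤ 1ℚ → AboveDStar d → ¬ Admissible F d
theorem6p2 f F (ord , istar , l , u , χ , spade) ¬star d 0≤d d≤1 above = go (missing-class F ord istar χ spade l u ¬star)
  where
  go : (Σ (Fin 3) λ t → ¬ Inhabited F ord istar χ spade t) → ¬ Admissible F d
  go (t , missing) = coloured⇒¬admissible F ord (λ i j → role t (χ (ord ⟨$⟩ʳ i) (ord ⟨$⟩ʳ j)))
    (roles-of-missing F ord istar χ spade t missing) d 0≤d d≤1 (fifth≤ d above)
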